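{- Let $q$ be an odd prime power and $g\in\mathbb{F}_q[u]$ a monic irreducible polynomial of degree $2m$. Let $h(t)\in\mathbb{F}_q[t]$ be the monic polynomial that is a scalar multiple of $(t+1)^{2m}g\left(\frac{2t}{t+1}\right)$. Define $\tilde h\in\mathbb{F}_q[s]$ by $\tilde h(t^2)=h(t)$ if $h\in\mathbb{F}_q[t^2]$, and by $\tilde h(t^2)=h(t)h(-t)$ otherwise. Let $\delta_k=\gamma_k^2$ and $\Gamma'=\langle\delta_1,\dots,\delta_{q+1}\rangle\le\Gamma$. Then the Cayley graph $Y_g=\mathrm{Cay}(\Gamma'/(\Gamma'\cap\Gamma(g)),\{\delta_1,\dots,\delta_{q+1}\})$ is isomorphic to the Morgenstern graph $X_{\tilde h}$ (with the variable $s$ renamed $u$). In particular, the subgroup $\Gamma'/(\Gamma'\cap\Gamma(g))\le\Gamma/\Gamma(g)$ is isomorphic to either $\operatorname{PSL}_2(\mathbb{F}_{q^{\deg\tilde h}})$ or $\operatorname{PGL}_2(\mathbb{F}_{q^{\deg\tilde h}})$.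
   Context: Fix a non-square $\epsilon\in\mathbb{F}_q$. Let $A$ be the quaternion algebra over $\mathbb{F}_q(u)$ with basis $1,i,j,ij$, $i^2=\epsilon$, $j^2=u-1$, $ij=-ji$. Let $(c_k,d_k)$, $k=1,\dots,q+1$, be the solutions in $\mathbb{F}_q^2$ of $\epsilon d^2-c^2=1$, $\gamma_k$ the image of $1+c_kj+d_kij$ in $A^\times/\mathbb{F}_q(u)^\times$, and $\Gamma=\langle\gamma_1,\dots,\gamma_{q+1}\rangle$. For irreducible $g\in\mathbb{F}_q[u]$, $\Gamma(g)$ is the set of elements of $\Gamma$ with a representative $a+bi+cj+dij$, $a,b,c,d\in\mathbb{F}_q[u]$, $g\nmid a$, $g\mid b,c,d$, and the Morgenstern graph is $X_g=\mathrm{Cay}(\Gamma/\Gamma(g),\{\gamma_1,\dots,\gamma_{q+1}\})$. -}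

module Defs where

open import Level using (0ℓ)
open import Data.Nat as ℕ using (ℕ; zero; suc; _∸_)
open import Data.Bool using (Bool; true; false; if_then_else_)
open import Data.Fin using (Fin)
open import Data.List using (List; []; _∷_; _++_; map; foldr; reverse)
open import Data.List.Relation.Unary.All using (All; all?)
open import Data.Product using (Σ; ∃; _×_; _,_; proj₁; proj₂)
open import Data.Sum using (_⊎_)
open import Relation.Nullary using (¬_; yes; no; Dec)
open import Relation.Binary.PropositionalEquality using (_≡_)
open import Relation.Binary.Definitions using (DecidableEquality)
open import Algebra.Structures using (IsCommutativeRing)
open import Function.Bundles using (_↔_; _⇔_)

record FiniteField : Set₁ where
  infixl 6 _+_
  infixl 7 _*_
  field
    F      : Set
    _+_ _*_ : F → F → F
    -_     : F → F
    0# 1#  : F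
    isCommutativeRing : IsCommutativeRing _≡_ _+_ _*_ -_ 0# 1#
    0≢1    : ¬ (0# ≡ 1#)
    inverse : ∀ x → ¬ (x ≡ 0#) → ∃ λ y → x * y ≡ 1#
    _≟_    : DecidableEquality F
    size   : ℕ
    enum   : Fin size ↔ F

module _ (𝔽 : FiniteField) where
  open FiniteField 𝔽

  NonSquare : F → Set
  NonSquare e = ∀ x → ¬ (x * x ≡ e)

  -- Polynomials in one variable: coefficient lists, lowest degree first
  -- (trailing zeros allowed; equality is ≈ₚ below).
  Poly : Set
  Poly = List F

  _+ₚ_ : Poly → Poly → Poly
  []       +ₚ q        = q
  (a ∷ p)  +ₚ []       = a ∷ p
  (a ∷ p)  +ₚ (b ∷ q)  = (a + b) ∷ (p +ₚ q)

  scaleₚ : F → Poly → Poly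
  scaleₚ c p = map (c *_) p

  negₚ : Poly → Poly
  negₚ p = map -_ p

  _*ₚ_ : Poly → Poly → Poly
  []      *ₚ q = []
  (a ∷ p) *ₚ q = scaleₚ a q +ₚ (0# ∷ (p *ₚ q))

  constₚ : F → Poly
  constₚ c = c ∷ []

  oneₚ : Poly
  oneₚ = constₚ 1#

  X : Poly
  X = 0# ∷ 1# ∷ []

  powₚ : Poly → ℕ → Poly
  powₚ p zero    = oneₚ
  powₚ p (suc n) = p *ₚ powₚ p n

  IsZeroₚ : Poly → Set
  IsZeroₚ p = All (_≡ 0#) p

  isZero? : (p : Poly) → Dec (IsZeroₚ p)
  isZero? p = all? (λ x → x ≟ 0#) p

  _≈ₚ_ : Poly → Poly → Set
  p ≈ₚ q = IsZeroₚ (p +ₚ negₚ q)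

  -- degree (deg 0 = 0 by convention) and leading coefficient
  deg : Poly → ℕ
  deg []      = 0
  deg (a ∷ p) with isZero? p
  ... | yes _ = 0
  ... | no  _ = suc (deg p)

  lead : Poly → F
  lead []      = 0#
  lead (a ∷ p) with isZero? p
  ... | yes _ = a
  ... | no  _ = lead p

  Monic : Poly → Set
  Monic p = lead p ≡ 1#

  _∣ₚ_ : Poly → Poly → Set
  g ∣ₚ a = ∃ λ b → a ≈ₚ (g *ₚ b)

  Irreducible : Poly → Set
  Irreducible g = (1 ℕ.≤ deg g) × (∀ a b → g ≈ₚ (a *ₚ b) → deg a ≡ 0 ⊎ deg b ≡ 0)

  ScalarMultiple : Poly → Poly → Set
  ScalarMultiple h H = ∃ λ c → ¬ (c ≡ 0#) × h ≈ₚ scaleₚ c H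

  two : F
  two = 1# + 1#

  -- H(t) = (t+1)^{2m} g(2t/(t+1)) = Σ_i g_i (2t)^i (t+1)^{2m-i}
  Hpoly : Poly → ℕ → Poly
  Hpoly g m = go 0 g
    where
      N = 2 ℕ.* m
      go : ℕ → Poly → Poly
      go i []       = []
      go i (c ∷ cs) = scaleₚ c (powₚ (scaleₚ two X) i *ₚ powₚ (1# ∷ 1# ∷ []) (N ∸ i))
                        +ₚ go (suc i) cs

  oddCoeffs evenCoeffs : Poly → Poly
  evenCoeffs []      = []
  evenCoeffs (a ∷ p) = a ∷ oddCoeffs p
  oddCoeffs  []      = []
  oddCoeffs  (a ∷ p) = evenCoeffs p

  negVar : Poly → Poly
  negVar p = go true p
    where
      go : Bool → Poly → Poly
      go b []      = []
      go b (a ∷ q) = (if b then a else (- a)) ∷ go (if b then false else true) q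

  -- h̃ with h̃(t²) = h(t) if h ∈ F[t²], and h̃(t²) = h(t)h(-t) otherwise
  tilde : Poly → Poly
  tilde h with isZero? (oddCoeffs h)
  ... | yes _ = evenCoeffs h
  ... | no  _ = evenCoeffs (h *ₚ negVar h)

-- The quaternion algebra A = (ε, u-1) over F_q(u); we work with
-- elements having coefficients in F_q[u] (every element of Γ has such
-- a representative).

module _ (𝔽 : FiniteField) (ε : FiniteField.F 𝔽) where
  open FiniteField 𝔽

  record Quat : Set where
    constructor quat
    field
      qa qb qc qd : Poly 𝔽
  open Quat public

  private
    _⊕_ = _+ₚ_ 𝔽
    _⊗_ = _*ₚ_ 𝔽
    Eₚ  = constₚ 𝔽 ε
    Jₚ  = (- 1#) ∷ 1# ∷ []
    ⊖_ : Poly 𝔽 → Poly 𝔽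
    ⊖ p = negₚ 𝔽 p

  -- i² = ε, j² = u-1, ij = -ji  (k = ij)
  _·Q_ : Quat → Quat → Quat
  quat a₁ b₁ c₁ d₁ ·Q quat a₂ b₂ c₂ d₂ = quat
    ((a₁ ⊗ a₂) ⊕ ((Eₚ ⊗ (b₁ ⊗ b₂)) ⊕ ((Jₚ ⊗ (c₁ ⊗ c₂)) ⊕ (⊖ ((Eₚ ⊗ Jₚ) ⊗ (d₁ ⊗ d₂))))))
    ((a₁ ⊗ b₂) ⊕ ((b₁ ⊗ a₂) ⊕ ((⊖ (Jₚ ⊗ (c₁ ⊗ d₂))) ⊕ (Jₚ ⊗ (d₁ ⊗ c₂)))))
    ((a₁ ⊗ c₂) ⊕ ((c₁ ⊗ a₂) ⊕ ((Eₚ ⊗ (b₁ ⊗ d₂)) ⊕ (⊖ (Eₚ ⊗ (d₁ ⊗ b₂))))))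
    ((a₁ ⊗ d₂) ⊕ ((d₁ ⊗ a₂) ⊕ ((b₁ ⊗ c₂) ⊕ (⊖ (c₁ ⊗ b₂)))))

  oneQ : Quat
  oneQ = quat (oneₚ 𝔽) [] [] []

  -- conjugate; x · conj x is the (nonzero, central) reduced norm, so
  -- conj x represents x⁻¹ in A^× / F_q(u)^×
  conj : Quat → Quat
  conj (quat a b c d) = quat a (⊖ b) (⊖ c) (⊖ d)

  scaleQ : Poly 𝔽 → Quat → Quat
  scaleQ λ' (quat a b c d) = quat (λ' ⊗ a) (λ' ⊗ b) (λ' ⊗ c) (λ' ⊗ d)

  _≈Q_ : Quat → Quat → Set
  quat a b c d ≈Q quat a' b' c' d' =
    _≈ₚ_ 𝔽 a a' × _≈ₚ_ 𝔽 b b' × _≈ₚ_ 𝔽 c c' × _≈ₚ_ 𝔽 d d'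

  -- equality in A^× / F_q(u)^× (denominators cleared)
  _∼_ : Quat → Quat → Set
  x ∼ y = ∃ λ λ' → ∃ λ μ → ¬ IsZeroₚ 𝔽 λ' × ¬ IsZeroₚ 𝔽 μ × (scaleQ λ' x ≈Q scaleQ μ y)

  -- the q+1 solutions of ε d² - c² = 1
  Sol : Set
  Sol = Σ (F × F) λ cd → ε * (proj₂ cd * proj₂ cd) + (- (proj₁ cd * proj₁ cd)) ≡ 1#

  γ : Sol → Quat
  γ ((c , d) , _) = quat (oneₚ 𝔽) [] (constₚ 𝔽 c) (constₚ 𝔽 d)

  δ : Sol → Quat
  δ s = γ s ·Q γ s

  -- words in the generators and their inverses (true = inverse letter)
  Letter : Set
  Letter = Bool × Sol

  Word : Set
  Word = List Letter

  evalWord : (Sol → Quat) → Word → Quat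
  evalWord e = foldr (λ l acc → letter l ·Q acc) oneQ
    where
      letter : Letter → Quat
      letter (false , s) = e s
      letter (true  , s) = conj (e s)

  invWord : Word → Word
  invWord w = reverse (map (λ { (b , s) → (if b then false else true) , s }) w)

  InΓ[_] : Poly 𝔽 → Quat → Set
  InΓ[ g ] x = ∃ λ r → (r ∼ x) × ¬ (_∣ₚ_ 𝔽 g (qa r))
                 × _∣ₚ_ 𝔽 g (qb r) × _∣ₚ_ 𝔽 g (qc r) × _∣ₚ_ 𝔽 g (qd r)

  -- cosets: w₁ ≡ w₂ in ⟨e⟩/(⟨e⟩ ∩ Γ(g)) iff w₁⁻¹ w₂ ∈ Γ(g)
  CosetEq : (Sol → Quat) → Poly 𝔽 → Word → Word → Set
  CosetEq e g w₁ w₂ = InΓ[ g ] (evalWord e (invWord w₁ ++ w₂))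

record Graph : Set₁ where
  field
    V   : Set
    _≈V_ : V → V → Set
    Adj : V → V → Set

record GraphIso (G H : Graph) : Set where
  private
    module G = Graph G
    module H = Graph H
  field
    f        : G.V → H.V
    f-≈      : ∀ x y → G._≈V_ x y ⇔ H._≈V_ (f x) (f y)
    f-surj   : ∀ y → ∃ λ x → H._≈V_ (f x) y
    f-adj    : ∀ x y → G.Adj x y ⇔ H.Adj (f x) (f y)

Cayley : (𝔽 : FiniteField) (ε : FiniteField.F 𝔽) → (Sol 𝔽 ε → Quat 𝔽 ε) → Poly 𝔽 → Graph
Cayley 𝔽 ε e g = record
  { V    = Word 𝔽 ε
  ; _≈V_ = CosetEq 𝔽 ε e g
  ; Adj  = λ x y → ∃ λ s → CosetEq 𝔽 ε e g y (x ++ ((false , s) ∷ []))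
  }

Xgraph : (𝔽 : FiniteField) (ε : FiniteField.F 𝔽) → Poly 𝔽 → Graph
Xgraph 𝔽 ε = Cayley 𝔽 ε (γ 𝔽 ε)

Ygraph : (𝔽 : FiniteField) (ε : FiniteField.F 𝔽) → Poly 𝔽 → Graph
Ygraph 𝔽 ε = Cayley 𝔽 ε (δ 𝔽 ε)

-- Groups given by a carrier, a setoid equality and the graph of the
-- multiplication (Mul x y z  means  z = x·y); the group axioms are not
-- recorded, these are only used as source/target of isomorphisms.

record GroupData : Set₁ where
  field
    G    : Set
    _≈G_ : G → G → Set
    Mul  : G → G → G → Set

record GroupIso (A B : GroupData) : Set where
  private
    module A = GroupData A
    module B = GroupData B
  field
    φ      : A.G → B.G
    φ-≈    : ∀ x y → A._≈G_ x y ⇔ B._≈G_ (φ x) (φ y)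
    φ-surj : ∀ y → ∃ λ x → B._≈G_ (φ x) y
    φ-hom  : ∀ x y z → A.Mul x y z → B.Mul (φ x) (φ y) (φ z)

YGroup : (𝔽 : FiniteField) (ε : FiniteField.F 𝔽) → Poly 𝔽 → GroupData
YGroup 𝔽 ε g = record
  { G    = Word 𝔽 ε
  ; _≈G_ = CosetEq 𝔽 ε (δ 𝔽 ε) g
  ; Mul  = λ x y z → CosetEq 𝔽 ε (δ 𝔽 ε) g z (x ++ y)
  }

module _ (K : FiniteField) where
  open FiniteField K

  record Mat2 : Set where
    constructor mat
    field m₁₁ m₁₂ m₂₁ m₂₂ : F

  _·M_ : Mat2 → Mat2 → Mat2
  mat a b c d ·M mat a' b' c' d' =
    mat (a * a' + b * c') (a * b' + b * d') (c * a' + d * c') (c * b' + d * d')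

  det : Mat2 → F
  det (mat a b c d) = a * d + (- (b * c))

  scaleM : F → Mat2 → Mat2
  scaleM x (mat a b c d) = mat (x * a) (x * b) (x * c) (x * d)

  PGL2 : GroupData
  PGL2 = record
    { G    = Σ Mat2 (λ M → ¬ (det M ≡ 0#))
    ; _≈G_ = λ M N → ∃ λ x → ¬ (x ≡ 0#) × proj₁ N ≡ scaleM x (proj₁ M)
    ; Mul  = λ M N P → ∃ λ x → ¬ (x ≡ 0#) × proj₁ P ≡ scaleM x (proj₁ M ·M proj₁ N)
    }

  PSL2 : GroupData
  PSL2 = record
    { G    = Σ Mat2 (λ M → det M ≡ 1#)
    ; _≈G_ = λ M N → proj₁ N ≡ proj₁ M ⊎ proj₁ N ≡ scaleM (- 1#) (proj₁ M)
    ; Mul  = λ M N P → proj₁ P ≡ (proj₁ M ·M proj₁ N)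
                        ⊎ proj₁ P ≡ scaleM (- 1#) (proj₁ M ·M proj₁ N)
    }

{-# OPTIONS --safe #-}
module Submission where

-- Let u be a root of g, t = u / (2 − u) and s = t².  Rescaling j by t + 1 turns
-- δ_k at u into a scalar multiple of γ_k at s, so the identity on words is the
-- graph isomorphism once h̃ is the minimal polynomial of s.  If h is not even,
-- this holds because separating the even and odd parts of h(t) = 0 writes t as an
-- element of 𝔽(s), so that s has the same degree as t.
--
-- For the group, K ≅ 𝔽[s]/(h̃) splits the quaternion algebra, words become
-- matrices of determinant a power of s, and one has to reach all of SL₂(K).  A
-- Pell sequence gives a + b z of norm uⁿ, z = cj + dij, with b divisible by any
-- given polynomial.  If h̃ᵉ (e ≥ 1) divides b exactly, replacing z by h̃⁻ᵉ m z m̄ for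
-- some m of norm h̃ᵉ up to scalars (a product of factors found by pigeonhole)
-- leaves a nontrivial unipotent modulo h̃, and conjugation by lifts of matrices,
-- whose norms were included in b as well, yields all elementary matrices.  Every
-- quaternion of norm uⁿ whose i-coordinate vanishes at u = 1 is a scalar multiple
-- of a word: some γ_k can be split off on the left by reduction modulo u.

-- Every coset question becomes one of realness: a word has as norm a power of the variable, which
-- is a unit at the root in question, so the word lies in the congruence subgroup exactly when its
-- value there is a scalar. Nothing has to be cancelled from the scalars allowed in `_∼_`. The Pell
-- construction stands in for strong approximation. Its obstacle is that the coefficient b is
-- reachable only through divisibility: b can be made a multiple of a given polynomial, but the
-- exact power of h̃ in it is out of control, and any positive power makes a + b z a scalar modulo
-- h̃. So the power is measured afterwards and moved into z, whose norm absorbs its square; the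
-- total norm, and with it the membership in the group, stays the same. The condition at u = 1
-- separates words from the rest: splitting off generators ends at norm 1, and the constants a + bi
-- of norm 1 form a nontrivial group. At u = 1 the algebra has j² = 0, so the i-coordinate is
-- undisturbed by generators and detects that constant. Finally K is known only by its size, so a
-- map from the residue field into it must be built, which is the purpose of the tower of subfields.

open import Defs
open import Level using (0ℓ; _⊔_)
open import Algebra.Bundles using (CommutativeRing; RawRing)
open import Algebra.Structures using (IsCommutativeRing)
open import Algebra.Morphism.Structures using (IsRingMonomorphism)
import Algebra.Morphism.RingMonomorphism as RingMonomorphism
import Algebra.Solver.Ring as Solver
open import Algebra.Solver.Ring.AlmostCommutativeRing using (fromCommutativeRing; _-Raw-AlmostCommutative⟶_; Induced-equivalence)
open import Data.Bool.Base using (Bool; true; false; if_then_else_)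
open import Data.Empty using (⊥; ⊥-elim)
open import Data.Fin.Base as Fin using (Fin; zero; suc; toℕ; fromℕ<; punchIn; punchOut)
import Data.Fin.Properties as Fin
open import Data.Fin.Permutation using (Permutation; permutation)
open import Data.Integer.Base as ℤ using (ℤ)
import Data.Integer.Properties as ℤ
open import Data.List.Base using (List; []; _∷_; [_]; _++_; _∷ʳ_; map; reverse; length; allFin; cartesianProduct; cartesianProductWith)
import Data.List.Properties as List
open import Data.List.Membership.Propositional using (_∈_)
open import Data.List.Membership.Propositional.Properties using (∈-map⁺; ∈-allFin; ∈-cartesianProduct⁺; ∈-cartesianProductWith⁺)
open import Data.List.Relation.Unary.All using ([]; _∷_)
open import Data.List.Relation.Unary.Any using (here; there)
open import Data.Maybe.Base using (just; nothing)
open import Data.Nat.Base as ℕ using (ℕ; zero; suc; z≤n; s≤s; _∸_; NonZero)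
import Data.Nat.Properties as ℕ
import Data.Nat.Divisibility as ℕ
open import Data.Nat.DivMod using (_%_; _/_; m%n<n; m≡m%n+[m/n]*n)
open import Data.Nat.Induction using (<-wellFounded)
open import Data.Nat.Solver using (module +-*-Solver)
open import Data.Product using (Σ; ∃; ∃₂; _×_; _,_; proj₁; proj₂)
open import Data.Product.Function.NonDependent.Propositional using (_×-↔_)
open import Data.Sum as Sum using (_⊎_; inj₁; inj₂; [_,_]′)
open import Data.Sum.Function.Propositional using (_⊎-↔_)
open import Data.Unit.Base using (⊤; tt)
open import Data.Vec.Base as Vec using (Vec; []; _∷_; toList)
import Data.Vec.Properties as Vec
open import Data.Vec.Functional using (replicate; removeAt)
open import Function.Base using (_∘_; id)
open import Function.Bundles using (_↔_; Inverse; mk↔ₛ′; _⇔_; mk⇔; Equivalence)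
open import Function.Construct.Composition using (_↔-∘_)
open import Function.Construct.Identity using (↔-id)
open import Function.Properties.Equivalence using () renaming (trans to ⇔-trans)
open import Induction.WellFounded using (Acc; acc)
open import Relation.Binary.Definitions using (WeaklyDecidable; tri<; tri≈; tri>)
open import Relation.Binary.PropositionalEquality as ≡ using (_≡_; _≢_; refl; cong; cong₂; sym; trans; subst; module ≡-Reasoning)
open import Relation.Nullary using (¬_; Dec; yes; no; does; contradiction)
open import Relation.Nullary.Decidable using (map′; ¬?; _×-dec_; decidable-stable; dec-true; dec-false)
open import Relation.Unary using (Decidable)

-- The standard solver needs a coefficient ring in which cancellation computes;
-- ℤ acts on every commutative ring.
module IntegerCoefficients {c ℓ} (R : CommutativeRing c ℓ) where
  private
    module R = CommutativeRing R
    open R using (_≈_; _+_; _*_; -_; 0#; 1#)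
    open import Algebra.Properties.Semiring.Mult.TCOptimised R.semiring using (×1-homo-*; ×-homo-+; 1+×) renaming (_×_ to _·_)
    open import Algebra.Properties.Ring R.ring using (-0#≈0#; -‿distribˡ-*; -‿distribʳ-*; -‿involutive)
    open import Algebra.Properties.AbelianGroup R.+-abelianGroup using (⁻¹-∙-comm)
    open import Relation.Binary.Reasoning.Setoid R.setoid

    ⟦_⟧ : ℤ → R.Carrier
    ⟦ ℤ.+ n ⟧ = n · 1#
    ⟦ ℤ.-[1+ n ] ⟧ = - (suc n · 1#)

    cancel : ∀ a x y → (a + x) + - (a + y) ≈ x + - y
    cancel a x y = begin
      (a + x) + - (a + y)        ≈⟨ R.+-congˡ (R.sym (⁻¹-∙-comm a y)) ⟩
      (a + x) + (- a + - y)      ≈⟨ R.+-congʳ (R.+-comm a x) ⟩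
      (x + a) + (- a + - y)      ≈⟨ R.+-assoc x a _ ⟩
      x + (a + (- a + - y))      ≈⟨ R.+-congˡ (R.sym (R.+-assoc a (- a) (- y))) ⟩
      x + ((a + - a) + - y)      ≈⟨ R.+-congˡ (R.+-congʳ (R.-‿inverseʳ a)) ⟩
      x + (0# + - y)             ≈⟨ R.+-congˡ (R.+-identityˡ _) ⟩
      x + - y                    ∎

    ⊖-homo : ∀ m n → ⟦ m ℤ.⊖ n ⟧ ≈ m · 1# + - (n · 1#)
    ⊖-homo zero zero = R.sym (R.-‿inverseʳ 0#)
    ⊖-homo zero (suc n) = R.sym (R.+-identityˡ _)
    ⊖-homo (suc m) zero = R.sym (R.trans (R.+-congˡ -0#≈0#) (R.+-identityʳ _))
    ⊖-homo (suc m) (suc n) = begin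
      ⟦ suc m ℤ.⊖ suc n ⟧              ≡⟨ cong ⟦_⟧ (ℤ.[1+m]⊖[1+n]≡m⊖n m n) ⟩
      ⟦ m ℤ.⊖ n ⟧                      ≈⟨ ⊖-homo m n ⟩
      m · 1# + - (n · 1#)              ≈⟨ cancel 1# _ _ ⟨
      (1# + m · 1#) + - (1# + n · 1#)  ≈⟨ R.+-cong (1+× m 1#) (R.-‿cong (1+× n 1#)) ⟨
      suc m · 1# + - (suc n · 1#)      ∎

    +-homo : ∀ i j → ⟦ i ℤ.+ j ⟧ ≈ ⟦ i ⟧ + ⟦ j ⟧
    +-homo (ℤ.+ m) (ℤ.+ n) = ×-homo-+ 1# m n
    +-homo (ℤ.+ m) ℤ.-[1+ n ] = ⊖-homo m (suc n)
    +-homo ℤ.-[1+ m ] (ℤ.+ n) = R.trans (⊖-homo n (suc m)) (R.+-comm _ _)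
    +-homo ℤ.-[1+ m ] ℤ.-[1+ n ] = begin
      - (suc (suc (m ℕ.+ n)) · 1#)           ≡⟨ cong (λ k → - (suc k · 1#)) (ℕ.+-suc m n) ⟨
      - ((suc m ℕ.+ suc n) · 1#)             ≈⟨ R.-‿cong (×-homo-+ 1# (suc m) (suc n)) ⟩
      - (suc m · 1# + suc n · 1#)            ≈⟨ ⁻¹-∙-comm _ _ ⟨
      - (suc m · 1#) + - (suc n · 1#)        ∎

    -‿homo : ∀ i → ⟦ ℤ.- i ⟧ ≈ - ⟦ i ⟧
    -‿homo (ℤ.+ zero) = R.sym -0#≈0#
    -‿homo (ℤ.+ suc n) = R.refl
    -‿homo ℤ.-[1+ n ] = R.sym (-‿involutive _)

    *-homo : ∀ i j → ⟦ i ℤ.* j ⟧ ≈ ⟦ i ⟧ * ⟦ j ⟧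
    *-homo (ℤ.+ m) (ℤ.+ n) = begin
      ⟦ (ℤ.+ m) ℤ.* (ℤ.+ n) ⟧   ≡⟨ cong ⟦_⟧ (ℤ.pos-* m n) ⟨
      (m ℕ.* n) · 1#        ≈⟨ ×1-homo-* m n ⟩
      m · 1# * n · 1#       ∎
    *-homo (ℤ.+ m) ℤ.-[1+ n ] = begin
      ⟦ (ℤ.+ m) ℤ.* ℤ.-[1+ n ] ⟧          ≡⟨ cong ⟦_⟧ (ℤ.neg-distribʳ-* (ℤ.+ m) (ℤ.+ suc n)) ⟨
      ⟦ ℤ.- ((ℤ.+ m) ℤ.* (ℤ.+ suc n)) ⟧   ≈⟨ -‿homo ((ℤ.+ m) ℤ.* (ℤ.+ suc n)) ⟩
      - ⟦ (ℤ.+ m) ℤ.* (ℤ.+ suc n) ⟧       ≈⟨ R.-‿cong (*-homo (ℤ.+ m) (ℤ.+ suc n)) ⟩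
      - (m · 1# * suc n · 1#)         ≈⟨ -‿distribʳ-* _ _ ⟩
      m · 1# * - (suc n · 1#)         ∎
    *-homo ℤ.-[1+ m ] (ℤ.+ n) = begin
      ⟦ ℤ.-[1+ m ] ℤ.* (ℤ.+ n) ⟧          ≡⟨ cong ⟦_⟧ (ℤ.neg-distribˡ-* (ℤ.+ suc m) (ℤ.+ n)) ⟨
      ⟦ ℤ.- ((ℤ.+ suc m) ℤ.* (ℤ.+ n)) ⟧   ≈⟨ -‿homo ((ℤ.+ suc m) ℤ.* (ℤ.+ n)) ⟩
      - ⟦ (ℤ.+ suc m) ℤ.* (ℤ.+ n) ⟧       ≈⟨ R.-‿cong (*-homo (ℤ.+ suc m) (ℤ.+ n)) ⟩
      - (suc m · 1# * n · 1#)         ≈⟨ -‿distribˡ-* _ _ ⟩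
      - (suc m · 1#) * n · 1#         ∎
    *-homo ℤ.-[1+ m ] ℤ.-[1+ n ] = begin
      ⟦ ℤ.-[1+ m ] ℤ.* ℤ.-[1+ n ] ⟧       ≈⟨ ×1-homo-* (suc m) (suc n) ⟩
      suc m · 1# * suc n · 1#         ≈⟨ -‿involutive _ ⟨
      - - (suc m · 1# * suc n · 1#)   ≈⟨ R.-‿cong (-‿distribˡ-* _ _) ⟩
      - (- (suc m · 1#) * suc n · 1#) ≈⟨ -‿distribʳ-* _ _ ⟩
      - (suc m · 1#) * - (suc n · 1#) ∎

    coefficients : RawRing _ _
    coefficients = record { _≈_ = _≡_ ; _+_ = ℤ._+_ ; _*_ = ℤ._*_ ; -_ = ℤ.-_ ; 0# = ℤ.0ℤ ; 1# = ℤ.1ℤ }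

    morphism : coefficients -Raw-AlmostCommutative⟶ fromCommutativeRing R
    morphism = record
      { ⟦_⟧ = ⟦_⟧ ; +-homo = +-homo ; *-homo = *-homo ; -‿homo = -‿homo ; 0-homo = R.refl ; 1-homo = R.refl }

    _≟′_ : WeaklyDecidable (Induced-equivalence morphism)
    i ≟′ j with i ℤ.≟ j
    ... | yes refl = just R.refl
    ... | no _ = nothing

  open Solver coefficients (fromCommutativeRing R) morphism _≟′_ public
    using (Polynomial; solve; _:=_; _:+_; _:*_; _:-_; :-_; con)

-- Divisibility and principal quotients of a commutative ring

module PrincipalQuotient {c ℓ} (R : CommutativeRing c ℓ) where
  private module R = CommutativeRing R
  open R using (Carrier; _≈_; _+_; _*_; -_; _-_)
  open IntegerCoefficients R
  open import Relation.Binary.Reasoning.Setoid R.setoid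

  infix 4 _∣_
  record _∣_ (f x : Carrier) : Set (c ⊔ ℓ) where
    constructor multiple
    field
      quotient : Carrier
      equality : x ≈ f * quotient

  ∣-resp : ∀ {f x y} → x ≈ y → f ∣ x → f ∣ y
  ∣-resp x≈y (multiple q e) = multiple q (R.trans (R.sym x≈y) e)

  ∣-refl : ∀ {f} → f ∣ f
  ∣-refl = multiple R.1# (R.sym (R.*-identityʳ _))

  ∣-* : ∀ {f x} y → f ∣ x → f ∣ y * x
  ∣-* {f} {x} y (multiple q e) = multiple (y * q) (begin
    y * x          ≈⟨ R.*-congˡ e ⟩
    y * (f * q)    ≈⟨ solve 3 (λ f y q → y :* (f :* q) := f :* (y :* q)) R.refl f y q ⟩
    f * (y * q)    ∎)

  ∣-+ : ∀ {f x y} → f ∣ x → f ∣ y → f ∣ x + y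
  ∣-+ {f} {x} {y} (multiple q e) (multiple r e′) = multiple (q + r) (R.trans (R.+-cong e e′) (R.sym (R.distribˡ f q r)))

  ∣-neg : ∀ {f x} → f ∣ x → f ∣ - x
  ∣-neg {f} {x} (multiple q e) = multiple (- q) (R.trans (R.-‿cong e) (solve 2 (λ f q → :- (f :* q) := f :* (:- q)) R.refl f q))

  ∣-+-cancelˡ : ∀ {f x y} → f ∣ x → f ∣ x + y → f ∣ y
  ∣-+-cancelˡ {f} {x} {y} f∣x f∣x+y =
    ∣-resp (solve 2 (λ x y → (x :+ y) :- x := y) R.refl x y) (∣-+ f∣x+y (∣-neg f∣x))

  module Modulo (f : Carrier) where
    infix 4 _~_
    record _~_ (x y : Carrier) : Set (c ⊔ ℓ) where
      constructor congruent
      field divides : f ∣ x - y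
    open _~_ public

    ≈⇒~ : ∀ {x y} → x ≈ y → x ~ y
    ≈⇒~ {x} {y} e = congruent (multiple R.0# (begin
      x - y      ≈⟨ R.+-congʳ e ⟩
      y - y      ≈⟨ R.-‿inverseʳ y ⟩
      R.0#       ≈⟨ R.zeroʳ f ⟨
      f * R.0#   ∎))

    ~-sym : ∀ {x y} → x ~ y → y ~ x
    ~-sym {x} {y} (congruent d) = congruent (∣-resp (solve 2 (λ x y → :- (x :- y) := y :- x) R.refl x y) (∣-neg d))

    ~-trans : ∀ {x y z} → x ~ y → y ~ z → x ~ z
    ~-trans {x} {y} {z} (congruent d) (congruent d′) =
      congruent (∣-resp (solve 3 (λ x y z → (x :- y) :+ (y :- z) := x :- z) R.refl x y z) (∣-+ d d′))

    ~-+ : ∀ {x x′ y y′} → x ~ x′ → y ~ y′ → x + y ~ x′ + y′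
    ~-+ {x} {x′} {y} {y′} (congruent d) (congruent d′) = congruent (∣-resp
      (solve 4 (λ x x′ y y′ → (x :- x′) :+ (y :- y′) := (x :+ y) :- (x′ :+ y′)) R.refl x x′ y y′) (∣-+ d d′))

    ~-* : ∀ {x x′ y y′} → x ~ x′ → y ~ y′ → x * y ~ x′ * y′
    ~-* {x} {x′} {y} {y′} (congruent d) (congruent d′) = congruent (∣-resp
      (solve 4 (λ x x′ y y′ → y :* (x :- x′) :+ x′ :* (y :- y′) := x :* y :- x′ :* y′) R.refl x x′ y y′) (∣-+ (∣-* y d) (∣-* x′ d′)))

    ~-neg : ∀ {x y} → x ~ y → - x ~ - y
    ~-neg {x} {y} (congruent d) = congruent (∣-resp (solve 2 (λ x y → :- (x :- y) := :- x :- (:- y)) R.refl x y) (∣-neg d))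

    xy~xz⇒∣ : ∀ x y z → x * y ~ x * z → f ∣ x * (y - z)
    xy~xz⇒∣ x y z (congruent d) = ∣-resp (solve 3 (λ x y z → x :* y :- x :* z := x :* (y :- z)) R.refl x y z) d

    ∣⇒~0 : ∀ {x} → f ∣ x → x ~ R.0#
    ∣⇒~0 {x} d = congruent (∣-resp (solve 1 (λ x → x := x :- con ℤ.0ℤ) R.refl x) d)

    ~0⇒∣ : ∀ {x} → x ~ R.0# → f ∣ x
    ~0⇒∣ {x} (congruent d) = ∣-resp (solve 1 (λ x → x :- con ℤ.0ℤ := x) R.refl x) d

    quotientRing : CommutativeRing c (c ⊔ ℓ)
    quotientRing = record
      { Carrier = Carrier ; _≈_ = _~_ ; _+_ = _+_ ; _*_ = _*_ ; -_ = -_ ; 0# = R.0# ; 1# = R.1#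
      ; isCommutativeRing = record
        { isRing = record
          { +-isAbelianGroup = record
            { isGroup = record
              { isMonoid = record
                { isSemigroup = record
                  { isMagma = record
                    { isEquivalence = record { refl = ≈⇒~ R.refl ; sym = ~-sym ; trans = ~-trans }
                    ; ∙-cong = ~-+ }
                  ; assoc = λ x y z → ≈⇒~ (R.+-assoc x y z) }
                ; identity = (λ x → ≈⇒~ (R.+-identityˡ x)) , (λ x → ≈⇒~ (R.+-identityʳ x)) }
              ; inverse = (λ x → ≈⇒~ (R.-‿inverseˡ x)) , (λ x → ≈⇒~ (R.-‿inverseʳ x))
              ; ⁻¹-cong = ~-neg }
            ; comm = λ x y → ≈⇒~ (R.+-comm x y) }
          ; *-cong = ~-*
          ; *-assoc = λ x y z → ≈⇒~ (R.*-assoc x y z)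
          ; *-identity = (λ x → ≈⇒~ (R.*-identityˡ x)) , (λ x → ≈⇒~ (R.*-identityʳ x))
          ; distrib = (λ x y z → ≈⇒~ (R.distribˡ x y z)) , (λ x y z → ≈⇒~ (R.distribʳ x y z)) }
        ; *-comm = λ x y → ≈⇒~ (R.*-comm x y) } }

open ≡-Reasoning

-- Finite sets and finite fields

module _ {A : Set} {m : ℕ} (A↔ : Fin m ↔ A) where
  private module A = Inverse A↔

  from-injective : ∀ {x y} → A.from x ≡ A.from y → x ≡ y
  from-injective {x} {y} eq = trans (sym (A.strictlyInverseˡ x)) (trans (cong A.to eq) (A.strictlyInverseˡ y))

  to-injective : ∀ {i j} → A.to i ≡ A.to j → i ≡ j
  to-injective {i} {j} eq = trans (sym (A.strictlyInverseʳ i)) (trans (cong A.from eq) (A.strictlyInverseʳ j))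

  search : {P : A → Set} → Decidable P → Dec (∃ P)
  search {P} P? = map′ (λ (i , p) → A.to i , p) (λ (x , p) → A.from x , subst P (sym (A.strictlyInverseˡ x)) p)
                       (Fin.any? (P? ∘ A.to))

  -- If `y` were missed, punching it out would leave an injection of a finite set into one with an
  -- element fewer.
  injective⇒surjective : (f : A → A) → (∀ {x y} → f x ≡ f y → x ≡ y) → ∀ y → ∃ λ x → f x ≡ y
  injective⇒surjective f f-inj y = go m A↔ refl
    where
    -- The size is generalised so that it can be matched against `suc k`, the form that `punchOut`
    -- requires.
    go : ∀ k (e : Fin k ↔ A) → k ≡ m → ∃ λ x → f x ≡ y
    go zero e _ = contradiction (Inverse.from e y) Fin.¬Fin0
    go (suc k) e refl with Fin.any? (λ i → A.from (f (A.to i)) Fin.≟ A.from y)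
    ... | yes (i , eq) = A.to i , from-injective eq
    ... | no ∄ = ⊥-elim (ℕ.1+n≰n (Fin.injective⇒≤ {f = λ i → punchOut (λ eq → ∄ (i , sym eq))}
                   (λ eq → to-injective (f-inj (from-injective (Fin.punchOut-injective (λ e → ∄ (_ , sym e)) (λ e → ∄ (_ , sym e)) eq))))))

module _ {A B : Set} {m n : ℕ} (A↔ : Fin m ↔ A) (B↔ : Fin n ↔ B) where
  private
    module A = Inverse A↔
    module B = Inverse B↔

  injective⇒size≤ : (f : A → B) → (∀ {x y} → f x ≡ f y → x ≡ y) → m ℕ.≤ n
  injective⇒size≤ f f-inj = Fin.injective⇒≤ {f = B.from ∘ f ∘ A.to}
    (λ eq → to-injective A↔ (f-inj (from-injective B↔ eq)))

  collision : n ℕ.< m → (f : A → B) → ∃₂ λ x y → x ≢ y × f x ≡ f y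
  collision n<m f with Fin.pigeonhole n<m (B.from ∘ f ∘ A.to)
  ... | i , j , i<j , eq = A.to i , A.to j , (λ e → Fin.<⇒≢ i<j (to-injective A↔ e)) , from-injective B↔ eq

  injective⇒bijective : m ≡ n → (f : A → B) → (∀ {x y} → f x ≡ f y → x ≡ y) → ∀ y → ∃ λ x → f x ≡ y
  injective⇒bijective refl f f-inj y
    with injective⇒surjective A↔ (A.to ∘ B.from ∘ f) (λ eq → f-inj (from-injective B↔ (to-injective A↔ eq))) (A.to (B.from y))
  ... | x , eq = x , from-injective B↔ (to-injective A↔ eq)

Vec↔ : ∀ {A : Set} {m} → Fin m ↔ A → ∀ k → Fin (m ℕ.^ k) ↔ Vec A k
Vec↔ e zero = mk↔ₛ′ (λ _ → []) (λ _ → zero) (λ { [] → refl }) (λ { zero → refl })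
Vec↔ {A} e (suc k) = cons ↔-∘ ((e ×-↔ Vec↔ e k) ↔-∘ Fin.*↔×)
  where
  cons : (A × Vec A k) ↔ Vec A (suc k)
  cons = mk↔ₛ′ (λ p → proj₁ p ∷ proj₂ p) (λ v → Vec.head v , Vec.tail v) (λ { (_ ∷ _) → refl }) (λ _ → refl)

Char≢2 : FiniteField → Set
Char≢2 K = 1# + 1# ≢ 0#
  where open FiniteField K

module FieldTheory (K : FiniteField) where
  open FiniteField K public

  commutativeRing : CommutativeRing 0ℓ 0ℓ
  commutativeRing = record { isCommutativeRing = isCommutativeRing }

  open CommutativeRing commutativeRing public
    using (+-identityˡ; +-identityʳ; *-identityˡ; *-identityʳ; +-assoc; *-assoc; +-comm; *-comm; zeroˡ; zeroʳ;
           distribˡ; distribʳ; -‿inverseˡ; -‿inverseʳ; *-commutativeMonoid; +-commutativeMonoid; semiring; commutativeSemiring; rawRing)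
  open import Algebra.Properties.Ring (CommutativeRing.ring commutativeRing) public
    using (-0#≈0#; -‿involutive; -‿distribˡ-*; -‿distribʳ-*)
  open import Algebra.Properties.Semiring.Exp semiring public using (_^_; ^-homo-*; ^-congˡ)
  open IntegerCoefficients commutativeRing public

  x-y≡0⇒x≡y : ∀ {x y} → x + - y ≡ 0# → x ≡ y
  x-y≡0⇒x≡y {x} {y} eq = begin
    x              ≡⟨ solve 2 (λ x y → x := (x :- y) :+ y) refl x y ⟩
    (x + - y) + y  ≡⟨ cong (_+ y) eq ⟩
    0# + y         ≡⟨ +-identityˡ y ⟩
    y              ∎

  x≡y⇒x-y≡0 : ∀ {x y} → x ≡ y → x + - y ≡ 0#
  x≡y⇒x-y≡0 {x} refl = -‿inverseʳ x

  inv : ∀ x → x ≢ 0# → F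
  inv x x≢0 = proj₁ (inverse x x≢0)

  inv-inverseʳ : ∀ x (x≢0 : x ≢ 0#) → x * inv x x≢0 ≡ 1#
  inv-inverseʳ x x≢0 = proj₂ (inverse x x≢0)

  inv-inverseˡ : ∀ x (x≢0 : x ≢ 0#) → inv x x≢0 * x ≡ 1#
  inv-inverseˡ x x≢0 = trans (*-comm _ x) (inv-inverseʳ x x≢0)

  *-cancelˡ : ∀ {x y z} → x ≢ 0# → x * y ≡ x * z → y ≡ z
  *-cancelˡ {x} {y} {z} x≢0 eq = begin
    y                      ≡⟨ lemma y ⟩
    inv x x≢0 * (x * y)    ≡⟨ cong (inv x x≢0 *_) eq ⟩
    inv x x≢0 * (x * z)    ≡⟨ lemma z ⟨
    z                      ∎
    where
    lemma : ∀ w → w ≡ inv x x≢0 * (x * w)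
    lemma w = begin
      w                      ≡⟨ *-identityˡ w ⟨
      1# * w                 ≡⟨ cong (_* w) (inv-inverseˡ x x≢0) ⟨
      (inv x x≢0 * x) * w    ≡⟨ *-assoc _ x w ⟩
      inv x x≢0 * (x * w)    ∎

  x*y≡0⇒y≡0 : ∀ {x y} → x ≢ 0# → x * y ≡ 0# → y ≡ 0#
  x*y≡0⇒y≡0 {x} x≢0 eq = *-cancelˡ x≢0 (trans eq (sym (zeroʳ x)))

  x*y≢0 : ∀ {x y} → x ≢ 0# → y ≢ 0# → x * y ≢ 0#
  x*y≢0 x≢0 y≢0 eq = y≢0 (x*y≡0⇒y≡0 x≢0 eq)

  x*y≢0⇒y≢0 : ∀ {x y} → x * y ≢ 0# → y ≢ 0#
  x*y≢0⇒y≢0 {x} xy≢0 refl = xy≢0 (zeroʳ x)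

  x*y≡0⇒x≡0⊎y≡0 : ∀ {x y} → x * y ≡ 0# → x ≡ 0# ⊎ y ≡ 0#
  x*y≡0⇒x≡0⊎y≡0 {x} eq with x ≟ 0#
  ... | yes x≡0 = inj₁ x≡0
  ... | no x≢0 = inj₂ (x*y≡0⇒y≡0 x≢0 eq)

  x²≡0⇒x≡0 : ∀ {x} → x * x ≡ 0# → x ≡ 0#
  x²≡0⇒x≡0 eq with x*y≡0⇒x≡0⊎y≡0 eq
  ... | inj₁ e = e
  ... | inj₂ e = e

  1≢0 : 1# ≢ 0#
  1≢0 = 0≢1 ∘ sym

  inv≢0 : ∀ x (x≢0 : x ≢ 0#) → inv x x≢0 ≢ 0#
  inv≢0 x x≢0 = x*y≢0⇒y≢0 (λ eq → 1≢0 (trans (sym (inv-inverseʳ x x≢0)) eq))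

  x^n≢0 : ∀ {x} n → x ≢ 0# → x ^ n ≢ 0#
  x^n≢0 zero x≢0 = 1≢0
  x^n≢0 (suc n) x≢0 = x*y≢0 x≢0 (x^n≢0 n x≢0)

  x≡-x⇒x≡0 : 1# + 1# ≢ 0# → ∀ {x} → x ≡ - x → x ≡ 0#
  x≡-x⇒x≡0 2≢0 {x} eq = x*y≡0⇒y≡0 2≢0 (begin
    (1# + 1#) * x   ≡⟨ solve 1 (λ x → (con (ℤ.+ 2)) :* x := x :+ x) refl x ⟩
    x + x           ≡⟨ cong (x +_) eq ⟩
    x + - x         ≡⟨ -‿inverseʳ x ⟩
    0#              ∎)

  x²≡y²⇒x≡±y : ∀ {x y} → x * x ≡ y * y → x ≡ y ⊎ x ≡ - y
  x²≡y²⇒x≡±y {x} {y} eq with x*y≡0⇒x≡0⊎y≡0 {x + - y} {x + y} (begin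
    (x + - y) * (x + y)   ≡⟨ solve 2 (λ x y → (x :- y) :* (x :+ y) := x :* x :- y :* y) refl x y ⟩
    x * x + - (y * y)     ≡⟨ x≡y⇒x-y≡0 eq ⟩
    0#                    ∎)
  ... | inj₁ e = inj₁ (x-y≡0⇒x≡y e)
  ... | inj₂ e = inj₂ (x-y≡0⇒x≡y (trans (cong (x +_) (-‿involutive y)) e))

record Hom (E K : FiniteField) : Set where
  private
    module E = FieldTheory E
    module K = FieldTheory K
  field
    ⟦_⟧    : E.F → K.F
    +-homo : ∀ x y → ⟦ x E.+ y ⟧ ≡ ⟦ x ⟧ K.+ ⟦ y ⟧
    *-homo : ∀ x y → ⟦ x E.* y ⟧ ≡ ⟦ x ⟧ K.* ⟦ y ⟧
    1-homo : ⟦ E.1# ⟧ ≡ K.1#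

  0-homo : ⟦ E.0# ⟧ ≡ K.0#
  0-homo = begin
    ⟦ E.0# ⟧                                     ≡⟨ K.solve 1 (λ x → x K.:= (x K.:+ x) K.:- x) refl _ ⟩
    (⟦ E.0# ⟧ K.+ ⟦ E.0# ⟧) K.+ K.- ⟦ E.0# ⟧     ≡⟨ cong (K._+ K.- ⟦ E.0# ⟧) (+-homo E.0# E.0#) ⟨
    ⟦ E.0# E.+ E.0# ⟧ K.+ K.- ⟦ E.0# ⟧           ≡⟨ cong (λ z → ⟦ z ⟧ K.+ K.- ⟦ E.0# ⟧) (E.+-identityˡ E.0#) ⟩
    ⟦ E.0# ⟧ K.+ K.- ⟦ E.0# ⟧                    ≡⟨ K.-‿inverseʳ _ ⟩
    K.0#                                         ∎

  -‿homo : ∀ x → ⟦ E.- x ⟧ ≡ K.- ⟦ x ⟧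
  -‿homo x = K.x-y≡0⇒x≡y (begin
    ⟦ E.- x ⟧ K.+ K.- (K.- ⟦ x ⟧)   ≡⟨ cong (⟦ E.- x ⟧ K.+_) (K.-‿involutive _) ⟩
    ⟦ E.- x ⟧ K.+ ⟦ x ⟧             ≡⟨ +-homo _ _ ⟨
    ⟦ E.- x E.+ x ⟧                 ≡⟨ cong ⟦_⟧ (E.-‿inverseˡ x) ⟩
    ⟦ E.0# ⟧                        ≡⟨ 0-homo ⟩
    K.0#                            ∎)

  ≢0-homo : ∀ {x} → x ≢ E.0# → ⟦ x ⟧ ≢ K.0#
  ≢0-homo {x} x≢0 eq = K.1≢0 (begin
    K.1#                        ≡⟨ 1-homo ⟨
    ⟦ E.1# ⟧                    ≡⟨ cong ⟦_⟧ (E.inv-inverseʳ x x≢0) ⟨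
    ⟦ x E.* E.inv x x≢0 ⟧       ≡⟨ *-homo _ _ ⟩
    ⟦ x ⟧ K.* ⟦ E.inv x x≢0 ⟧   ≡⟨ cong (K._* ⟦ E.inv x x≢0 ⟧) eq ⟩
    K.0# K.* _                  ≡⟨ K.zeroˡ _ ⟩
    K.0#                        ∎)

  injective : ∀ {x y} → ⟦ x ⟧ ≡ ⟦ y ⟧ → x ≡ y
  injective {x} {y} eq with (x E.+ E.- y) E.≟ E.0#
  ... | yes x-y≡0 = E.x-y≡0⇒x≡y x-y≡0
  ... | no x-y≢0 = ⊥-elim (≢0-homo x-y≢0 (begin
    ⟦ x E.+ E.- y ⟧           ≡⟨ +-homo _ _ ⟩
    ⟦ x ⟧ K.+ ⟦ E.- y ⟧       ≡⟨ cong₂ K._+_ eq (-‿homo y) ⟩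
    ⟦ y ⟧ K.+ K.- ⟦ y ⟧       ≡⟨ K.-‿inverseʳ _ ⟩
    K.0#                      ∎))

idHom : ∀ K → Hom K K
idHom K = record { ⟦_⟧ = id ; +-homo = λ _ _ → refl ; *-homo = λ _ _ → refl ; 1-homo = refl }

infixr 9 _∘ₕ_
_∘ₕ_ : ∀ {D E K} → Hom E K → Hom D E → Hom D K
g ∘ₕ f = record
  { ⟦_⟧    = G.⟦_⟧ ∘ F.⟦_⟧
  ; +-homo = λ x y → trans (cong G.⟦_⟧ (F.+-homo x y)) (G.+-homo _ _)
  ; *-homo = λ x y → trans (cong G.⟦_⟧ (F.*-homo x y)) (G.*-homo _ _)
  ; 1-homo = trans (cong G.⟦_⟧ F.1-homo) G.1-homo }
  where module F = Hom f
        module G = Hom g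

-- Polynomials

module PolyTheory (𝔽 : FiniteField) where
  private module 𝔽 = FieldTheory 𝔽
  open 𝔽 using (F; 0#; 1#)

  infixl 6 _⊕_
  infixl 7 _⊗_
  infix 4 _≋_

  _⊕_ _⊗_ : Poly 𝔽 → Poly 𝔽 → Poly 𝔽
  _⊕_ = _+ₚ_ 𝔽
  _⊗_ = _*ₚ_ 𝔽

  ⊖_ : Poly 𝔽 → Poly 𝔽
  ⊖_ = negₚ 𝔽

  scale : F → Poly 𝔽 → Poly 𝔽
  scale = scaleₚ 𝔽

  coef : Poly 𝔽 → ℕ → F
  coef [] _ = 0#
  coef (a ∷ p) zero = a
  coef (a ∷ p) (suc n) = coef p n

  -- _≈ₚ_ unfolds, so its arguments cannot be inferred; this record is its inferable form.
  record _≋_ (p q : Poly 𝔽) : Set where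
    constructor pointwise
    field at : ∀ n → coef p n ≡ coef q n
  open _≋_ public

  ≋-refl : ∀ {p} → p ≋ p
  ≋-refl = pointwise λ _ → refl

  ≋-sym : ∀ {p q} → p ≋ q → q ≋ p
  ≋-sym e = pointwise λ n → sym (at e n)

  ≋-trans : ∀ {p q r} → p ≋ q → q ≋ r → p ≋ r
  ≋-trans e e′ = pointwise λ n → trans (at e n) (at e′ n)

  coef-⊕ : ∀ p q n → coef (p ⊕ q) n ≡ coef p n 𝔽.+ coef q n
  coef-⊕ [] q n = sym (𝔽.+-identityˡ _)
  coef-⊕ (a ∷ p) [] n = sym (𝔽.+-identityʳ _)
  coef-⊕ (a ∷ p) (b ∷ q) zero = refl
  coef-⊕ (a ∷ p) (b ∷ q) (suc n) = coef-⊕ p q n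

  coef-⊖ : ∀ p n → coef (⊖ p) n ≡ 𝔽.- coef p n
  coef-⊖ [] n = sym 𝔽.-0#≈0#
  coef-⊖ (a ∷ p) zero = refl
  coef-⊖ (a ∷ p) (suc n) = coef-⊖ p n

  coef-scale : ∀ c p n → coef (scale c p) n ≡ c 𝔽.* coef p n
  coef-scale c [] n = sym (𝔽.zeroʳ c)
  coef-scale c (a ∷ p) zero = refl
  coef-scale c (a ∷ p) (suc n) = coef-scale c p n

  coef-∷⊗ : ∀ a p q n → coef ((a ∷ p) ⊗ q) n ≡ a 𝔽.* coef q n 𝔽.+ coef (0# ∷ p ⊗ q) n
  coef-∷⊗ a p q n = trans (coef-⊕ (scale a q) (0# ∷ p ⊗ q) n) (cong (𝔽._+ _) (coef-scale a q n))

  IsZero⇒≋[] : ∀ {p} → IsZeroₚ 𝔽 p → p ≋ []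
  IsZero⇒≋[] z = pointwise (go z)
    where
    go : ∀ {p} → IsZeroₚ 𝔽 p → ∀ n → coef p n ≡ 0#
    go [] n = refl
    go (a≡0 ∷ z) zero = a≡0
    go (a≡0 ∷ z) (suc n) = go z n

  ≋[]⇒IsZero : ∀ p → p ≋ [] → IsZeroₚ 𝔽 p
  ≋[]⇒IsZero [] e = []
  ≋[]⇒IsZero (a ∷ p) e = at e 0 ∷ ≋[]⇒IsZero p (pointwise (at e ∘ suc))

  ≈⇒≋ : ∀ {p q} → _≈ₚ_ 𝔽 p q → p ≋ q
  ≈⇒≋ {p} {q} z = pointwise λ n → 𝔽.x-y≡0⇒x≡y (begin
    coef p n 𝔽.+ 𝔽.- coef q n    ≡⟨ cong (coef p n 𝔽.+_) (coef-⊖ q n) ⟨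
    coef p n 𝔽.+ coef (⊖ q) n    ≡⟨ coef-⊕ p (⊖ q) n ⟨
    coef (p ⊕ ⊖ q) n             ≡⟨ at (IsZero⇒≋[] z) n ⟩
    0#                           ∎)

  ≋⇒≈ : ∀ {p q} → p ≋ q → _≈ₚ_ 𝔽 p q
  ≋⇒≈ {p} {q} e = ≋[]⇒IsZero _ (pointwise λ n → begin
    coef (p ⊕ ⊖ q) n             ≡⟨ coef-⊕ p (⊖ q) n ⟩
    coef p n 𝔽.+ coef (⊖ q) n    ≡⟨ cong₂ 𝔽._+_ (at e n) (coef-⊖ q n) ⟩
    coef q n 𝔽.+ 𝔽.- coef q n    ≡⟨ 𝔽.-‿inverseʳ _ ⟩
    0#                           ∎)

  ∷-cong : ∀ {a b p q} → a ≡ b → p ≋ q → a ∷ p ≋ b ∷ q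
  ∷-cong refl e = pointwise λ { zero → refl ; (suc n) → at e n }

  ⊕-cong : ∀ {p p′ q q′} → p ≋ p′ → q ≋ q′ → p ⊕ q ≋ p′ ⊕ q′
  ⊕-cong {p} {p′} {q} {q′} e e′ = pointwise λ n →
    trans (coef-⊕ p q n) (trans (cong₂ 𝔽._+_ (at e n) (at e′ n)) (sym (coef-⊕ p′ q′ n)))

  ⊖-cong : ∀ {p q} → p ≋ q → ⊖ p ≋ ⊖ q
  ⊖-cong {p} {q} e = pointwise λ n → trans (coef-⊖ p n) (trans (cong 𝔽.-_ (at e n)) (sym (coef-⊖ q n)))

  ⊕-assoc : ∀ p q r → (p ⊕ q) ⊕ r ≋ p ⊕ (q ⊕ r)
  ⊕-assoc p q r = pointwise λ n → begin
    coef ((p ⊕ q) ⊕ r) n                       ≡⟨ coef-⊕ (p ⊕ q) r n ⟩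
    coef (p ⊕ q) n 𝔽.+ coef r n                ≡⟨ cong (𝔽._+ _) (coef-⊕ p q n) ⟩
    coef p n 𝔽.+ coef q n 𝔽.+ coef r n         ≡⟨ 𝔽.+-assoc _ _ _ ⟩
    coef p n 𝔽.+ (coef q n 𝔽.+ coef r n)       ≡⟨ cong (_ 𝔽.+_) (coef-⊕ q r n) ⟨
    coef p n 𝔽.+ coef (q ⊕ r) n                ≡⟨ coef-⊕ p (q ⊕ r) n ⟨
    coef (p ⊕ (q ⊕ r)) n                       ∎

  ⊕-comm : ∀ p q → p ⊕ q ≋ q ⊕ p
  ⊕-comm p q = pointwise λ n → trans (coef-⊕ p q n) (trans (𝔽.+-comm _ _) (sym (coef-⊕ q p n)))

  ⊕-identityʳ : ∀ p → p ⊕ [] ≋ p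
  ⊕-identityʳ p = ⊕-comm p []

  ⊖-inverseʳ : ∀ p → p ⊕ ⊖ p ≋ []
  ⊖-inverseʳ p = IsZero⇒≋[] (≋⇒≈ {p} {p} ≋-refl)

  ⊗-congˡ : ∀ p {q q′} → q ≋ q′ → p ⊗ q ≋ p ⊗ q′
  ⊗-congˡ [] e = ≋-refl
  ⊗-congˡ (a ∷ p) {q} {q′} e = pointwise λ n →
    trans (coef-∷⊗ a p q n) (trans (cong₂ 𝔽._+_ (cong (a 𝔽.*_) (at e n)) (at (∷-cong refl (⊗-congˡ p e)) n)) (sym (coef-∷⊗ a p q′ n)))

  ⊗-∷ : ∀ p b q → p ⊗ (b ∷ q) ≋ scale b p ⊕ (0# ∷ p ⊗ q)
  ⊗-∷ [] b q = pointwise λ { zero → refl ; (suc n) → refl }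
  ⊗-∷ (a ∷ p) b q = pointwise λ
    { zero → cong (𝔽._+ 0#) (𝔽.*-comm a b)
    ; (suc n) → begin
        coef ((a ∷ p) ⊗ (b ∷ q)) (suc n)                                   ≡⟨ coef-∷⊗ a p (b ∷ q) (suc n) ⟩
        a 𝔽.* coef q n 𝔽.+ coef (p ⊗ (b ∷ q)) n                            ≡⟨ cong (_ 𝔽.+_) (at (⊗-∷ p b q) n) ⟩
        a 𝔽.* coef q n 𝔽.+ coef (scale b p ⊕ (0# ∷ p ⊗ q)) n               ≡⟨ cong (_ 𝔽.+_) (coef-⊕ (scale b p) _ n) ⟩
        a 𝔽.* coef q n 𝔽.+ (coef (scale b p) n 𝔽.+ coef (0# ∷ p ⊗ q) n)    ≡⟨ 𝔽.solve 3 (λ x y z → x 𝔽.:+ (y 𝔽.:+ z) 𝔽.:= y 𝔽.:+ (x 𝔽.:+ z)) refl _ _ _ ⟩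
        coef (scale b p) n 𝔽.+ (a 𝔽.* coef q n 𝔽.+ coef (0# ∷ p ⊗ q) n)    ≡⟨ cong (_ 𝔽.+_) (coef-∷⊗ a p q n) ⟨
        coef (scale b p) n 𝔽.+ coef ((a ∷ p) ⊗ q) n                        ≡⟨ coef-⊕ (scale b p) ((a ∷ p) ⊗ q) n ⟨
        coef (scale b (a ∷ p) ⊕ (0# ∷ (a ∷ p) ⊗ q)) (suc n)                ∎ }

  ⊗-comm : ∀ p q → p ⊗ q ≋ q ⊗ p
  ⊗-comm [] q = ≋-sym (go q)
    where
    go : ∀ q → q ⊗ [] ≋ []
    go [] = ≋-refl
    go (b ∷ q) = pointwise λ { zero → refl ; (suc n) → at (go q) n }
  ⊗-comm (a ∷ p) q = ≋-trans (⊕-cong (≋-refl {scale a q}) (∷-cong refl (⊗-comm p q))) (≋-sym (⊗-∷ q a p))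

  ⊗-cong : ∀ {p p′ q q′} → p ≋ p′ → q ≋ q′ → p ⊗ q ≋ p′ ⊗ q′
  ⊗-cong {p} {p′} {q} {q′} e e′ =
    ≋-trans (⊗-congˡ p e′) (≋-trans (⊗-comm p q′) (≋-trans (⊗-congˡ q′ e) (⊗-comm q′ p′)))

  ⊗-distribʳ : ∀ r p q → (p ⊕ q) ⊗ r ≋ p ⊗ r ⊕ q ⊗ r
  ⊗-distribʳ r [] q = ≋-refl
  ⊗-distribʳ r (a ∷ p) [] = ≋-sym (⊕-identityʳ _)
  ⊗-distribʳ r (a ∷ p) (b ∷ q) = pointwise λ n → begin
    coef ((a 𝔽.+ b ∷ p ⊕ q) ⊗ r) n                                       ≡⟨ coef-∷⊗ (a 𝔽.+ b) (p ⊕ q) r n ⟩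
    (a 𝔽.+ b) 𝔽.* coef r n 𝔽.+ coef (0# ∷ (p ⊕ q) ⊗ r) n                 ≡⟨ cong (_ 𝔽.+_) (shift n) ⟩
    (a 𝔽.+ b) 𝔽.* coef r n 𝔽.+ (coef (0# ∷ p ⊗ r) n 𝔽.+ coef (0# ∷ q ⊗ r) n)
      ≡⟨ 𝔽.solve 5 (λ a b c x y → (a 𝔽.:+ b) 𝔽.:* c 𝔽.:+ (x 𝔽.:+ y) 𝔽.:= (a 𝔽.:* c 𝔽.:+ x) 𝔽.:+ (b 𝔽.:* c 𝔽.:+ y)) refl a b _ _ _ ⟩
    (a 𝔽.* coef r n 𝔽.+ coef (0# ∷ p ⊗ r) n) 𝔽.+ (b 𝔽.* coef r n 𝔽.+ coef (0# ∷ q ⊗ r) n)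
      ≡⟨ cong₂ 𝔽._+_ (coef-∷⊗ a p r n) (coef-∷⊗ b q r n) ⟨
    coef ((a ∷ p) ⊗ r) n 𝔽.+ coef ((b ∷ q) ⊗ r) n                        ≡⟨ coef-⊕ ((a ∷ p) ⊗ r) ((b ∷ q) ⊗ r) n ⟨
    coef ((a ∷ p) ⊗ r ⊕ (b ∷ q) ⊗ r) n                                   ∎
    where
    shift : ∀ n → coef (0# ∷ (p ⊕ q) ⊗ r) n ≡ coef (0# ∷ p ⊗ r) n 𝔽.+ coef (0# ∷ q ⊗ r) n
    shift zero = sym (𝔽.+-identityʳ 0#)
    shift (suc n) = trans (at (⊗-distribʳ r p q) n) (coef-⊕ (p ⊗ r) (q ⊗ r) n)

  scale-⊗ : ∀ c p q → scale c p ⊗ q ≋ scale c (p ⊗ q)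
  scale-⊗ c [] q = ≋-refl
  scale-⊗ c (a ∷ p) q = pointwise λ n → begin
    coef ((c 𝔽.* a ∷ scale c p) ⊗ q) n                           ≡⟨ coef-∷⊗ (c 𝔽.* a) (scale c p) q n ⟩
    (c 𝔽.* a) 𝔽.* coef q n 𝔽.+ coef (0# ∷ scale c p ⊗ q) n       ≡⟨ cong (_ 𝔽.+_) (shift n) ⟩
    (c 𝔽.* a) 𝔽.* coef q n 𝔽.+ c 𝔽.* coef (0# ∷ p ⊗ q) n
      ≡⟨ 𝔽.solve 4 (λ c a x y → (c 𝔽.:* a) 𝔽.:* x 𝔽.:+ c 𝔽.:* y 𝔽.:= c 𝔽.:* (a 𝔽.:* x 𝔽.:+ y)) refl c a _ _ ⟩
    c 𝔽.* (a 𝔽.* coef q n 𝔽.+ coef (0# ∷ p ⊗ q) n)               ≡⟨ cong (c 𝔽.*_) (coef-∷⊗ a p q n) ⟨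
    c 𝔽.* coef ((a ∷ p) ⊗ q) n                                   ≡⟨ coef-scale c ((a ∷ p) ⊗ q) n ⟨
    coef (scale c ((a ∷ p) ⊗ q)) n                               ∎
    where
    shift : ∀ n → coef (0# ∷ scale c p ⊗ q) n ≡ c 𝔽.* coef (0# ∷ p ⊗ q) n
    shift zero = sym (𝔽.zeroʳ c)
    shift (suc n) = trans (at (scale-⊗ c p q) n) (coef-scale c (p ⊗ q) n)

  0∷-⊗ : ∀ p q → (0# ∷ p) ⊗ q ≋ 0# ∷ p ⊗ q
  0∷-⊗ p q = pointwise λ n → trans (coef-∷⊗ 0# p q n) (trans (cong (𝔽._+ coef (0# ∷ p ⊗ q) n) (𝔽.zeroˡ _)) (𝔽.+-identityˡ _))

  ⊗-assoc : ∀ p q r → (p ⊗ q) ⊗ r ≋ p ⊗ (q ⊗ r)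
  ⊗-assoc [] q r = ≋-refl
  ⊗-assoc (a ∷ p) q r = ≋-trans (⊗-distribʳ r (scale a q) (0# ∷ p ⊗ q))
    (⊕-cong (scale-⊗ a q r) (≋-trans (0∷-⊗ (p ⊗ q) r) (∷-cong refl (⊗-assoc p q r))))

  const-⊗ : ∀ c p → constₚ 𝔽 c ⊗ p ≋ scale c p
  const-⊗ c p = ≋-trans (⊕-cong (≋-refl {scale c p}) (pointwise λ { zero → refl ; (suc n) → refl })) (⊕-identityʳ _)

  ⊗-identityˡ : ∀ p → oneₚ 𝔽 ⊗ p ≋ p
  ⊗-identityˡ p = ≋-trans (const-⊗ 1# p) (pointwise λ n → trans (coef-scale 1# p n) (𝔽.*-identityˡ _))

  ⊗-identityʳ : ∀ p → p ⊗ oneₚ 𝔽 ≋ p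
  ⊗-identityʳ p = ≋-trans (⊗-comm p (oneₚ 𝔽)) (⊗-identityˡ p)

  polyRing : CommutativeRing 0ℓ 0ℓ
  polyRing = record
    { Carrier = Poly 𝔽 ; _≈_ = _≋_ ; _+_ = _⊕_ ; _*_ = _⊗_ ; -_ = ⊖_ ; 0# = [] ; 1# = oneₚ 𝔽
    ; isCommutativeRing = record
      { isRing = record
        { +-isAbelianGroup = record
          { isGroup = record
            { isMonoid = record
              { isSemigroup = record
                { isMagma = record
                  { isEquivalence = record { refl = ≋-refl ; sym = ≋-sym ; trans = ≋-trans }
                  ; ∙-cong = ⊕-cong }
                ; assoc = ⊕-assoc }
              ; identity = (λ _ → ≋-refl) , ⊕-identityʳ }
            ; inverse = (λ p → ≋-trans (⊕-comm (⊖ p) p) (⊖-inverseʳ p)) , ⊖-inverseʳ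
            ; ⁻¹-cong = ⊖-cong }
          ; comm = ⊕-comm }
        ; *-cong = ⊗-cong
        ; *-assoc = ⊗-assoc
        ; *-identity = ⊗-identityˡ , ⊗-identityʳ
        ; distrib = (λ p q r → ≋-trans (⊗-comm p (q ⊕ r)) (≋-trans (⊗-distribʳ p q r) (⊕-cong (⊗-comm q p) (⊗-comm r p)))) , ⊗-distribʳ }
      ; *-comm = ⊗-comm } }

  module ℙ where
    open CommutativeRing polyRing public using (+-congˡ; +-congʳ; *-congˡ; *-congʳ; setoid; zeroʳ; zeroˡ)
    open IntegerCoefficients polyRing public
    open import Relation.Binary.Reasoning.Setoid (CommutativeRing.setoid polyRing) public

  open PrincipalQuotient polyRing public using (_∣_; multiple; ∣-resp; ∣-refl; ∣-*; ∣-+; ∣-neg; ∣-+-cancelˡ)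

  ∣ₚ⇒∣ : ∀ {f p} → _∣ₚ_ 𝔽 f p → f ∣ p
  ∣ₚ⇒∣ (q , e) = multiple q (≈⇒≋ e)

  ∣⇒∣ₚ : ∀ {f p} → f ∣ p → _∣ₚ_ 𝔽 f p
  ∣⇒∣ₚ (multiple q e) = q , ≋⇒≈ e

  -- Degree p n: the degree is exactly n (no polynomial ≋ [] has one); p <deg n: it is below n.
  _<deg_ : Poly 𝔽 → ℕ → Set
  p <deg n = ∀ m → n ℕ.≤ m → coef p m ≡ 0#

  record Degree (p : Poly 𝔽) (n : ℕ) : Set where
    constructor degree
    field
      leading≢0 : coef p n ≢ 0#
      bounded   : p <deg suc n
  open Degree public

  Degree-resp-≋ : ∀ {p q n} → p ≋ q → Degree p n → Degree q n
  Degree-resp-≋ e (degree l b) = degree (l ∘ trans (at e _)) (λ m n<m → trans (sym (at e m)) (b m n<m))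

  Degree⇒≢[] : ∀ {p n} → Degree p n → ¬ p ≋ []
  Degree⇒≢[] D e = leading≢0 D (at e _)

  degree⊎zero : ∀ p → ∃ (Degree p) ⊎ p ≋ []
  degree⊎zero [] = inj₂ ≋-refl
  degree⊎zero (a ∷ p) with degree⊎zero p
  ... | inj₁ (n , degree l b) = inj₁ (suc n , degree l λ { (suc m) (s≤s n<m) → b m n<m })
  ... | inj₂ e with a 𝔽.≟ 0#
  ...   | yes a≡0 = inj₂ (pointwise λ { zero → a≡0 ; (suc n) → at e n })
  ...   | no a≢0 = inj₁ (0 , degree a≢0 λ { (suc m) _ → at e m })

  degree-of : ∀ {p} → ¬ p ≋ [] → ∃ (Degree p)
  degree-of {p} p≢0 with degree⊎zero p
  ... | inj₁ D = D
  ... | inj₂ e = contradiction e p≢0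

  _≋[]? : ∀ p → Dec (p ≋ [])
  p ≋[]? with degree⊎zero p
  ... | inj₁ (_ , D) = no (Degree⇒≢[] D)
  ... | inj₂ e = yes e

  -- Mere bounds are assumed rather than exact degrees: the quadratic forms of `Anisotropy` need the
  -- top coefficient of squares whose own leading coefficient may vanish.
  ⊗-top : ∀ p q m n → p <deg suc m → q <deg suc n →
          coef (p ⊗ q) (m ℕ.+ n) ≡ coef p m 𝔽.* coef q n × (p ⊗ q) <deg suc (m ℕ.+ n)
  ⊗-top [] q m n _ _ = sym (𝔽.zeroˡ _) , λ _ _ → refl
  ⊗-top (a ∷ p) q zero n bp bq = product n , λ k n<k → trans (product k) (trans (cong (a 𝔽.*_) (bq k n<k)) (𝔽.zeroʳ a))
    where
    p≋[] : p ≋ []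
    p≋[] = pointwise λ k → bp (suc k) (s≤s z≤n)
    product : ∀ k → coef ((a ∷ p) ⊗ q) k ≡ a 𝔽.* coef q k
    product k = trans (coef-∷⊗ a p q k) (trans (cong (_ 𝔽.+_) (lem k)) (𝔽.+-identityʳ _))
      where
      lem : ∀ k → coef (0# ∷ p ⊗ q) k ≡ 0#
      lem zero = refl
      lem (suc k) = at (⊗-cong {q = q} p≋[] ≋-refl) k
  ⊗-top (a ∷ p) q (suc m) n bp bq with ⊗-top p q m n (λ k m<k → bp (suc k) (s≤s m<k)) bq
  ... | top , bnd = trans (lem (m ℕ.+ n) (s≤s (ℕ.m≤n+m n m))) top
                  , λ { (suc k) (s≤s lt) → trans (lem k (s≤s (ℕ.≤-trans (ℕ.m≤n+m n m) (ℕ.<⇒≤ lt)))) (bnd k lt) }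
    where
    lem : ∀ k → n ℕ.< suc k → coef ((a ∷ p) ⊗ q) (suc k) ≡ coef (p ⊗ q) k
    lem k n<k = begin
      coef ((a ∷ p) ⊗ q) (suc k)                   ≡⟨ coef-∷⊗ a p q (suc k) ⟩
      a 𝔽.* coef q (suc k) 𝔽.+ coef (p ⊗ q) k      ≡⟨ cong (λ z → a 𝔽.* z 𝔽.+ coef (p ⊗ q) k) (bq (suc k) n<k) ⟩
      a 𝔽.* 0# 𝔽.+ coef (p ⊗ q) k                  ≡⟨ cong (𝔽._+ coef (p ⊗ q) k) (𝔽.zeroʳ a) ⟩
      0# 𝔽.+ coef (p ⊗ q) k                        ≡⟨ 𝔽.+-identityˡ _ ⟩
      coef (p ⊗ q) k                               ∎

  Degree-⊗ : ∀ {p q m n} → Degree p m → Degree q n → Degree (p ⊗ q) (m ℕ.+ n)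
  Degree-⊗ {p} {q} {m} {n} (degree lp bp) (degree lq bq) with ⊗-top p q m n bp bq
  ... | top , bnd = degree (λ e → 𝔽.x*y≢0 lp lq (trans (sym top) e)) bnd

  ⊗≢[] : ∀ {p q} → ¬ p ≋ [] → ¬ q ≋ [] → ¬ p ⊗ q ≋ []
  ⊗≢[] p≢0 q≢0 = Degree⇒≢[] (Degree-⊗ (proj₂ (degree-of p≢0)) (proj₂ (degree-of q≢0)))

  ⊗-cancelˡ : ∀ p {q r} → ¬ p ≋ [] → p ⊗ q ≋ p ⊗ r → q ≋ r
  ⊗-cancelˡ p {q} {r} p≢0 e with (q ⊕ ⊖ r) ≋[]?
  ... | yes z = ≈⇒≋ (≋[]⇒IsZero _ z)
  ... | no nz = ⊥-elim (⊗≢[] p≢0 nz (ℙ.begin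
    p ⊗ (q ⊕ ⊖ r)          ℙ.≈⟨ ℙ.solve 3 (λ p q r → p ℙ.:* (q ℙ.:- r) ℙ.:= p ℙ.:* q ℙ.:- p ℙ.:* r) ≋-refl p q r ⟩
    p ⊗ q ⊕ ⊖ (p ⊗ r)      ℙ.≈⟨ ℙ.+-congʳ e ⟩
    p ⊗ r ⊕ ⊖ (p ⊗ r)      ℙ.≈⟨ ⊖-inverseʳ (p ⊗ r) ⟩
    []                     ℙ.∎))

  Degree-unique : ∀ {p m n} → Degree p m → Degree p n → m ≡ n
  Degree-unique {p} {m} {n} D D′ with ℕ.<-cmp m n
  ... | tri< m<n _ _ = ⊥-elim (leading≢0 D′ (bounded D n m<n))
  ... | tri≈ _ m≡n _ = m≡n
  ... | tri> _ _ n<m = ⊥-elim (leading≢0 D (bounded D′ m n<m))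

  Degree⇒deg : ∀ {p n} → Degree p n → deg 𝔽 p ≡ n
  Degree⇒deg {[]} D = ⊥-elim (leading≢0 D refl)
  Degree⇒deg {a ∷ p} {n} D with isZero? 𝔽 p
  Degree⇒deg {a ∷ p} {zero} D | yes _ = refl
  Degree⇒deg {a ∷ p} {suc n} D | yes z = ⊥-elim (leading≢0 D (at (IsZero⇒≋[] z) n))
  Degree⇒deg {a ∷ p} {zero} D | no nz = ⊥-elim (nz (≋[]⇒IsZero p (pointwise λ k → bounded D (suc k) (s≤s z≤n))))
  Degree⇒deg {a ∷ p} {suc n} D | no _ = cong suc (Degree⇒deg {p} (degree (leading≢0 D) (λ m lt → bounded D (suc m) (s≤s lt))))

  Degree-deg : ∀ {p} → ¬ p ≋ [] → Degree p (deg 𝔽 p)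
  Degree-deg {p} p≢0 with degree-of p≢0
  ... | n , D = subst (Degree p) (sym (Degree⇒deg D)) D

  1≤deg⇒≢[] : ∀ {p} → 1 ℕ.≤ deg 𝔽 p → ¬ p ≋ []
  1≤deg⇒≢[] {a ∷ p} 1≤ e with isZero? 𝔽 p
  ... | no nz = nz (≋[]⇒IsZero p (pointwise (at e ∘ suc)))

  <deg⇒Degree< : ∀ {p m n} → p <deg m → Degree p n → n ℕ.< m
  <deg⇒Degree< {p} {m} {n} b D with n ℕ.<? m
  ... | yes n<m = n<m
  ... | no n≮m = ⊥-elim (leading≢0 D (b n (ℕ.≮⇒≥ n≮m)))

  Monic⇒≢[] : ∀ {p} → Monic 𝔽 p → ¬ p ≋ []
  Monic⇒≢[] {[]} 0≡1 e = 𝔽.0≢1 0≡1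
  Monic⇒≢[] {a ∷ p} mon e with isZero? 𝔽 p
  ... | yes _ = 𝔽.0≢1 (trans (sym (at e 0)) mon)
  ... | no nz = nz (≋[]⇒IsZero p (pointwise (at e ∘ suc)))

  -- Recursion from the top coefficient down: the remainder of `p` is shifted by one place with `x`
  -- put in front, and the only coefficient that may overflow is cancelled by `c` times `f`.
  divide : ∀ {f d} → Degree f d → ∀ p → ∃₂ λ k r → p ≋ f ⊗ k ⊕ r × r <deg d
  divide {f} D [] = [] , [] , ≋-sym (≋-trans (⊕-identityʳ _) (⊗-comm f [])) , λ _ _ → refl
  divide {f} {d} D (x ∷ p) with divide D p
  ... | k , r , e , br = c ∷ k , (x ∷ r) ⊕ ⊖ scale c f , eq , bnd
    where
    l⁻¹ = 𝔽.inv (coef f d) (leading≢0 D)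
    c = coef (x ∷ r) d 𝔽.* l⁻¹
    eq : x ∷ p ≋ f ⊗ (c ∷ k) ⊕ ((x ∷ r) ⊕ ⊖ scale c f)
    eq = ℙ.begin
      x ∷ p                                                      ℙ.≈⟨ ∷-cong (sym (𝔽.+-identityˡ x)) e ⟩
      (0# ∷ f ⊗ k) ⊕ (x ∷ r)
        ℙ.≈⟨ ℙ.solve 3 (λ a b c → a ℙ.:+ b ℙ.:= (c ℙ.:+ a) ℙ.:+ (b ℙ.:- c)) ≋-refl (0# ∷ f ⊗ k) (x ∷ r) (scale c f) ⟩
      (scale c f ⊕ (0# ∷ f ⊗ k)) ⊕ ((x ∷ r) ⊕ ⊖ scale c f)       ℙ.≈⟨ ℙ.+-congʳ (⊗-∷ f c k) ⟨
      f ⊗ (c ∷ k) ⊕ ((x ∷ r) ⊕ ⊖ scale c f)                      ℙ.∎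
    value : ∀ m → coef ((x ∷ r) ⊕ ⊖ scale c f) m ≡ coef (x ∷ r) m 𝔽.+ 𝔽.- (c 𝔽.* coef f m)
    value m = trans (coef-⊕ (x ∷ r) (⊖ scale c f) m) (cong (_ 𝔽.+_) (trans (coef-⊖ (scale c f) m) (cong 𝔽.-_ (coef-scale c f m))))
    bnd : ((x ∷ r) ⊕ ⊖ scale c f) <deg d
    bnd m d≤m with ℕ.m≤n⇒m<n∨m≡n d≤m
    bnd (suc m) _ | inj₁ (s≤s d≤m) = begin
      coef ((x ∷ r) ⊕ ⊖ scale c f) (suc m)                   ≡⟨ value (suc m) ⟩
      coef r m 𝔽.+ 𝔽.- (c 𝔽.* coef f (suc m))                ≡⟨ cong₂ (λ y z → y 𝔽.+ 𝔽.- (c 𝔽.* z)) (br m d≤m) (bounded D (suc m) (s≤s d≤m)) ⟩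
      0# 𝔽.+ 𝔽.- (c 𝔽.* 0#)                                  ≡⟨ 𝔽.solve 1 (λ c → 𝔽.con (ℤ.+ 0) 𝔽.:- c 𝔽.:* 𝔽.con (ℤ.+ 0) 𝔽.:= 𝔽.con (ℤ.+ 0)) refl c ⟩
      0#                                                     ∎
    bnd m _ | inj₂ refl = begin
      coef ((x ∷ r) ⊕ ⊖ scale c f) d                         ≡⟨ value d ⟩
      t 𝔽.+ 𝔽.- (t 𝔽.* l⁻¹ 𝔽.* coef f d)                     ≡⟨ cong (λ z → t 𝔽.+ 𝔽.- z) (𝔽.*-assoc t l⁻¹ _) ⟩
      t 𝔽.+ 𝔽.- (t 𝔽.* (l⁻¹ 𝔽.* coef f d))                   ≡⟨ cong (λ z → t 𝔽.+ 𝔽.- (t 𝔽.* z)) (𝔽.inv-inverseˡ _ (leading≢0 D)) ⟩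
      t 𝔽.+ 𝔽.- (t 𝔽.* 1#)                                   ≡⟨ cong (λ z → t 𝔽.+ 𝔽.- z) (𝔽.*-identityʳ t) ⟩
      t 𝔽.+ 𝔽.- t                                            ≡⟨ 𝔽.-‿inverseʳ t ⟩
      0#                                                     ∎
      where t = coef (x ∷ r) d

  ∣-small⇒≋[] : ∀ {f d p} → Degree f d → p <deg d → f ∣ p → p ≋ []
  ∣-small⇒≋[] {f} {d} {p} D bp (multiple k e) with degree⊎zero k
  ... | inj₂ k≋[] = ≋-trans e (≋-trans (⊗-congˡ f k≋[]) (⊗-comm f []))
  ... | inj₁ (n , Dk) = ⊥-elim (leading≢0 (Degree-resp-≋ (≋-sym e) (Degree-⊗ D Dk)) (bp _ (ℕ.m≤m+n d n)))

module Evaluation {E K : FiniteField} (φ : Hom E K) (α : FiniteField.F K) where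
  private
    module E = FieldTheory E
    module K = FieldTheory K
    module φ = Hom φ
  open PolyTheory E

  ev : Poly E → K.F
  ev [] = K.0#
  ev (a ∷ p) = φ.⟦ a ⟧ K.+ α K.* ev p

  ev-⊕ : ∀ p q → ev (p ⊕ q) ≡ ev p K.+ ev q
  ev-⊕ [] q = sym (K.+-identityˡ _)
  ev-⊕ (a ∷ p) [] = sym (K.+-identityʳ _)
  ev-⊕ (a ∷ p) (b ∷ q) = begin
    φ.⟦ a E.+ b ⟧ K.+ α K.* ev (p ⊕ q)                      ≡⟨ cong₂ (λ x y → x K.+ α K.* y) (φ.+-homo a b) (ev-⊕ p q) ⟩
    (φ.⟦ a ⟧ K.+ φ.⟦ b ⟧) K.+ α K.* (ev p K.+ ev q)
      ≡⟨ K.solve 5 (λ a b α p q → (a K.:+ b) K.:+ α K.:* (p K.:+ q) K.:= (a K.:+ α K.:* p) K.:+ (b K.:+ α K.:* q)) refl _ _ α _ _ ⟩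
    (φ.⟦ a ⟧ K.+ α K.* ev p) K.+ (φ.⟦ b ⟧ K.+ α K.* ev q)   ∎

  ev-scale : ∀ c p → ev (scale c p) ≡ φ.⟦ c ⟧ K.* ev p
  ev-scale c [] = sym (K.zeroʳ _)
  ev-scale c (a ∷ p) = begin
    φ.⟦ c E.* a ⟧ K.+ α K.* ev (scale c p)                ≡⟨ cong₂ (λ x y → x K.+ α K.* y) (φ.*-homo c a) (ev-scale c p) ⟩
    φ.⟦ c ⟧ K.* φ.⟦ a ⟧ K.+ α K.* (φ.⟦ c ⟧ K.* ev p)
      ≡⟨ K.solve 4 (λ c a α p → c K.:* a K.:+ α K.:* (c K.:* p) K.:= c K.:* (a K.:+ α K.:* p)) refl _ _ α _ ⟩
    φ.⟦ c ⟧ K.* (φ.⟦ a ⟧ K.+ α K.* ev p)                  ∎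

  ev-⊖ : ∀ p → ev (⊖ p) ≡ K.- ev p
  ev-⊖ [] = sym K.-0#≈0#
  ev-⊖ (a ∷ p) = begin
    φ.⟦ E.- a ⟧ K.+ α K.* ev (⊖ p)    ≡⟨ cong₂ (λ x y → x K.+ α K.* y) (φ.-‿homo a) (ev-⊖ p) ⟩
    K.- φ.⟦ a ⟧ K.+ α K.* K.- ev p    ≡⟨ K.solve 3 (λ a α p → K.:- a K.:+ α K.:* (K.:- p) K.:= K.:- (a K.:+ α K.:* p)) refl _ α _ ⟩
    K.- (φ.⟦ a ⟧ K.+ α K.* ev p)      ∎

  ev-⊗ : ∀ p q → ev (p ⊗ q) ≡ ev p K.* ev q
  ev-⊗ [] q = sym (K.zeroˡ _)
  ev-⊗ (a ∷ p) q = begin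
    ev (scale a q ⊕ (E.0# ∷ p ⊗ q))                            ≡⟨ ev-⊕ (scale a q) _ ⟩
    ev (scale a q) K.+ (φ.⟦ E.0# ⟧ K.+ α K.* ev (p ⊗ q))       ≡⟨ cong₂ K._+_ (ev-scale a q) (cong₂ (λ x y → x K.+ α K.* y) φ.0-homo (ev-⊗ p q)) ⟩
    φ.⟦ a ⟧ K.* ev q K.+ (K.0# K.+ α K.* (ev p K.* ev q))
      ≡⟨ K.solve 4 (λ a q α p → a K.:* q K.:+ (K.con (ℤ.+ 0) K.:+ α K.:* (p K.:* q)) K.:= (a K.:+ α K.:* p) K.:* q) refl _ _ α _ ⟩
    (φ.⟦ a ⟧ K.+ α K.* ev p) K.* ev q                          ∎

  ev-cong : ∀ {p q} → p ≋ q → ev p ≡ ev q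
  ev-cong {p} {q} e = K.x-y≡0⇒x≡y (begin
    ev p K.+ K.- ev q    ≡⟨ cong (_ K.+_) (ev-⊖ q) ⟨
    ev p K.+ ev (⊖ q)    ≡⟨ ev-⊕ p (⊖ q) ⟨
    ev (p ⊕ ⊖ q)         ≡⟨ ev-zero (p ⊕ ⊖ q) (≋⇒≈ e) ⟩
    K.0#                 ∎)
    where
    ev-zero : ∀ p → IsZeroₚ E p → ev p ≡ K.0#
    ev-zero [] [] = refl
    ev-zero (_ ∷ p) (refl ∷ z) = trans (cong₂ (λ x y → x K.+ α K.* y) φ.0-homo (ev-zero p z)) (trans (K.+-identityˡ _) (K.zeroʳ α))

  ev-const : ∀ c → ev (constₚ E c) ≡ φ.⟦ c ⟧
  ev-const c = trans (cong (_ K.+_) (K.zeroʳ α)) (K.+-identityʳ _)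

  ev-one : ev (oneₚ E) ≡ K.1#
  ev-one = trans (ev-const E.1#) φ.1-homo

  ev-X : ev (X E) ≡ α
  ev-X = begin
    φ.⟦ E.0# ⟧ K.+ α K.* ev (oneₚ E)    ≡⟨ cong₂ (λ x y → x K.+ α K.* y) φ.0-homo ev-one ⟩
    K.0# K.+ α K.* K.1#                 ≡⟨ K.+-identityˡ _ ⟩
    α K.* K.1#                          ≡⟨ K.*-identityʳ α ⟩
    α                                   ∎

  ev-pow : ∀ p n → ev (powₚ E p n) ≡ ev p K.^ n
  ev-pow p zero = ev-one
  ev-pow p (suc n) = trans (ev-⊗ p (powₚ E p n)) (cong (ev p K.*_) (ev-pow p n))

  ∣⇒ev≡0 : ∀ {f p} → ev f ≡ K.0# → f ∣ p → ev p ≡ K.0#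
  ∣⇒ev≡0 {f} {p} f≡0 (multiple q e) = trans (ev-cong e) (trans (ev-⊗ f q) (trans (cong (K._* ev q) f≡0) (K.zeroˡ _)))

-- Residue fields

module Truncation (𝔽 : FiniteField) where
  private module 𝔽 = FieldTheory 𝔽
  open PolyTheory 𝔽

  truncate : ∀ n → Poly 𝔽 → Vec 𝔽.F n
  truncate zero p = []
  truncate (suc n) [] = 𝔽.0# ∷ truncate n []
  truncate (suc n) (a ∷ p) = a ∷ truncate n p

  coef-truncate : ∀ n p → p <deg n → toList (truncate n p) ≋ p
  coef-truncate zero p b = pointwise λ k → sym (b k z≤n)
  coef-truncate (suc n) [] b = pointwise λ { zero → refl ; (suc k) → at (coef-truncate n [] (λ _ _ → refl)) k }
  coef-truncate (suc n) (a ∷ p) b = ∷-cong refl (coef-truncate n p (λ m n≤m → b (suc m) (s≤s n≤m)))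

  toList-<deg : ∀ {n} (v : Vec 𝔽.F n) → toList v <deg n
  toList-<deg [] m _ = refl
  toList-<deg (x ∷ v) (suc m) (s≤s n≤m) = toList-<deg v m n≤m

  toList-injective-≋ : ∀ {n} {v w : Vec 𝔽.F n} → toList v ≋ toList w → v ≡ w
  toList-injective-≋ {v = []} {[]} e = refl
  toList-injective-≋ {v = x ∷ v} {y ∷ w} e = cong₂ _∷_ (at e 0) (toList-injective-≋ (pointwise (at e ∘ suc)))

  ⊖-<deg : ∀ {p q n} → p <deg n → q <deg n → (p ⊕ ⊖ q) <deg n
  ⊖-<deg {p} {q} bp bq m n≤m = begin
    coef (p ⊕ ⊖ q) m               ≡⟨ coef-⊕ p (⊖ q) m ⟩
    coef p m 𝔽.+ coef (⊖ q) m      ≡⟨ cong₂ 𝔽._+_ (bp m n≤m) (coef-⊖ q m) ⟩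
    𝔽.0# 𝔽.+ 𝔽.- coef q m          ≡⟨ cong (λ z → 𝔽.0# 𝔽.+ 𝔽.- z) (bq m n≤m) ⟩
    𝔽.0# 𝔽.+ 𝔽.- 𝔽.0#              ≡⟨ 𝔽.-‿inverseʳ 𝔽.0# ⟩
    𝔽.0#                           ∎

PrimePoly : (𝔽 : FiniteField) → Poly 𝔽 → Set
PrimePoly 𝔽 f = ∀ p q → f ∣ p ⊗ q → f ∣ p ⊎ f ∣ q
  where open PolyTheory 𝔽

module Residue (𝔽 : FiniteField) {f : Poly 𝔽} {d : ℕ} (D : PolyTheory.Degree 𝔽 f d) (1≤d : 1 ℕ.≤ d)
               (prime : PrimePoly 𝔽 f) where
  private module 𝔽 = FieldTheory 𝔽
  open PolyTheory 𝔽
  open Truncation 𝔽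
  private
    open PrincipalQuotient.Modulo polyRing f

    C : Set
    C = Vec 𝔽.F d

  abstract
    -- Residue classes are represented by their remainders, vectors of length `d`, since a
    -- `FiniteField` demands propositional equality. The division is kept abstract so that goals do
    -- not unfold it; `reduce~` is all that is used about it.
    reduce : Poly 𝔽 → Vec 𝔽.F d
    reduce p = truncate d (proj₁ (proj₂ (divide D p)))

    private
      reduce~ : ∀ p → toList (reduce p) ~ p
      reduce~ p with divide D p
      ... | k , r , e , br = ~-trans (≈⇒~ (coef-truncate d r br)) (~-sym (~-trans (≈⇒~ e) (~-+ (∣⇒~0 (multiple k ≋-refl)) (≈⇒~ (≋-refl {r})))))

  private
    ~⇒≡ : ∀ {v w : C} → toList v ~ toList w → v ≡ w
    ~⇒≡ {v} {w} (congruent div) = toList-injective-≋ (≈⇒≋ (≋[]⇒IsZero _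
      (∣-small⇒≋[] D (⊖-<deg {toList v} {toList w} (toList-<deg v) (toList-<deg w)) div)))

    reduce-resp : ∀ {p q} → p ~ q → reduce p ≡ reduce q
    reduce-resp {p} {q} e = ~⇒≡ (~-trans (reduce~ p) (~-trans e (~-sym (reduce~ q))))

    rawC : RawRing 0ℓ 0ℓ
    rawC = record
      { Carrier = C ; _≈_ = _≡_
      ; _+_ = λ v w → reduce (toList v ⊕ toList w)
      ; _*_ = λ v w → reduce (toList v ⊗ toList w)
      ; -_ = λ v → reduce (⊖ toList v)
      ; 0# = reduce [] ; 1# = reduce (oneₚ 𝔽) }

    module C = RawRing rawC

    -- The ring axioms are pulled back along this injection into the quotient of the polynomial ring
    -- by `f`.
    toList-mono : IsRingMonomorphism rawC (CommutativeRing.rawRing quotientRing) toList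
    toList-mono = record
      { isRingHomomorphism = record
        { isSemiringHomomorphism = record
          { isNearSemiringHomomorphism = record
            { +-isMonoidHomomorphism = record
              { isMagmaHomomorphism = record
                { isRelHomomorphism = record { cong = λ { refl → ≈⇒~ ≋-refl } }
                ; homo = λ v w → reduce~ (toList v ⊕ toList w) }
              ; ε-homo = reduce~ [] }
            ; *-homo = λ v w → reduce~ (toList v ⊗ toList w) }
          ; 1#-homo = reduce~ (oneₚ 𝔽) }
        ; -‿homo = λ v → reduce~ (⊖ toList v) }
      ; injective = ~⇒≡ }

    C-isCommutativeRing : IsCommutativeRing _≡_ C._+_ C._*_ C.-_ C.0# C.1#
    C-isCommutativeRing = RingMonomorphism.isCommutativeRing toList-mono (CommutativeRing.isCommutativeRing quotientRing)

    ≡0⇒∣ : ∀ {v : C} → v ≡ C.0# → f ∣ toList v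
    ≡0⇒∣ refl = ~0⇒∣ (reduce~ [])

    *-cancel : ∀ {v w x : C} → v ≢ C.0# → v C.* w ≡ v C.* x → w ≡ x
    *-cancel {v} {w} {x} v≢0 eq = [ (λ f∣v → ⊥-elim (v≢0 (∣⇒≡0 f∣v))) , (λ f∣w-x → ~⇒≡ (congruent f∣w-x)) ]′ (prime (toList v) (toList w ⊕ ⊖ toList x) f∣)
      where
      ∣⇒≡0 : f ∣ toList v → v ≡ C.0#
      ∣⇒≡0 f∣v = ~⇒≡ {v} {reduce []} (~-trans {toList v} {[]} {toList (reduce [])} (∣⇒~0 f∣v) (~-sym (reduce~ [])))
      vw~vx : toList v ⊗ toList w ~ toList v ⊗ toList x
      vw~vx = ~-trans (~-sym (reduce~ (toList v ⊗ toList w)))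
             (subst (λ u → toList u ~ toList v ⊗ toList x) (sym eq) (reduce~ (toList v ⊗ toList x)))
      f∣ : f ∣ toList v ⊗ (toList w ⊕ ⊖ toList x)
      f∣ = xy~xz⇒∣ (toList v) (toList w) (toList x) vw~vx

  residueField : FiniteField
  residueField = record
    { F = C ; _+_ = C._+_ ; _*_ = C._*_ ; -_ = C.-_ ; 0# = C.0# ; 1# = C.1#
    ; isCommutativeRing = C-isCommutativeRing
    ; 0≢1 = λ eq → 1≢0 (trans (sym (reduce-top 𝔽.1#)) (trans (cong (λ v → coef (toList v) 0) (sym eq)) (at (∣-small⇒≋[] D (toList-<deg C.0#) (≡0⇒∣ refl)) 0)))
    -- Primality makes multiplication by a nonzero element injective; on a finite set it then hits
    -- 1.
    ; inverse = λ v v≢0 → injective⇒surjective (Vec↔ 𝔽.enum d) (v C.*_) (*-cancel v≢0) C.1#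
    ; _≟_ = Vec.≡-dec 𝔽._≟_
    ; size = 𝔽.size ℕ.^ d
    ; enum = Vec↔ 𝔽.enum d }
    where
    open 𝔽 using (1≢0)
    const-<deg : ∀ c → constₚ 𝔽 c <deg d
    const-<deg c zero d≤0 = contradiction (ℕ.≤-trans 1≤d d≤0) λ ()
    const-<deg c (suc m) _ = refl
    reduce-top : ∀ c → coef (toList (reduce (constₚ 𝔽 c))) 0 ≡ c
    reduce-top c = at (≈⇒≋ {toList (reduce (constₚ 𝔽 c))} {constₚ 𝔽 c} (≋[]⇒IsZero _
      (∣-small⇒≋[] D (⊖-<deg {toList (reduce (constₚ 𝔽 c))} {constₚ 𝔽 c} (toList-<deg (reduce (constₚ 𝔽 c))) (const-<deg c)) (divides (reduce~ (constₚ 𝔽 c)))))) 0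

  private module L = FieldTheory residueField

  reduce-⊕ : ∀ p q → reduce (p ⊕ q) ≡ reduce p L.+ reduce q
  reduce-⊕ p q = reduce-resp (~-sym (~-+ (reduce~ p) (reduce~ q)))

  reduce-⊗ : ∀ p q → reduce (p ⊗ q) ≡ reduce p L.* reduce q
  reduce-⊗ p q = reduce-resp (~-sym (~-* (reduce~ p) (reduce~ q)))

  reduce≡0⇒∣ : ∀ {p} → reduce p ≡ L.0# → f ∣ p
  reduce≡0⇒∣ {p} eq = ~0⇒∣ (~-trans (~-sym (reduce~ p)) (~-trans (subst (λ v → toList (reduce p) ~ toList v) eq (≈⇒~ ≋-refl)) (reduce~ [])))

  reduce-toList : ∀ (v : Vec 𝔽.F d) → reduce (toList v) ≡ v
  reduce-toList v = ~⇒≡ (reduce~ (toList v))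

  base : Hom 𝔽 residueField
  base = record
    { ⟦_⟧ = λ c → reduce (constₚ 𝔽 c)
    ; +-homo = λ x y → reduce-⊕ (constₚ 𝔽 x) (constₚ 𝔽 y)
    ; *-homo = λ x y → trans (reduce-resp {constₚ 𝔽 (x 𝔽.* y)} {constₚ 𝔽 x ⊗ constₚ 𝔽 y} (≈⇒~ (pointwise λ { zero → sym (𝔽.+-identityʳ _) ; (suc n) → refl })))
                             (reduce-⊗ (constₚ 𝔽 x) (constₚ 𝔽 y))
    ; 1-homo = refl }

  root : FiniteField.F residueField
  root = reduce (X 𝔽)

  open Evaluation base root

  ev-root : ∀ p → ev p ≡ reduce p
  ev-root [] = refl
  ev-root (a ∷ p) = begin
    reduce (constₚ 𝔽 a) L.+ root L.* ev p                ≡⟨ cong (λ z → reduce (constₚ 𝔽 a) L.+ root L.* z) (ev-root p) ⟩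
    reduce (constₚ 𝔽 a) L.+ root L.* reduce p            ≡⟨ cong (reduce (constₚ 𝔽 a) L.+_) (reduce-⊗ (X 𝔽) p) ⟨
    reduce (constₚ 𝔽 a) L.+ reduce (X 𝔽 ⊗ p)             ≡⟨ reduce-⊕ (constₚ 𝔽 a) (X 𝔽 ⊗ p) ⟨
    reduce (constₚ 𝔽 a ⊕ X 𝔽 ⊗ p)                        ≡⟨ reduce-resp (≈⇒~ eq) ⟩
    reduce (a ∷ p)                                       ∎
    where
    eq : constₚ 𝔽 a ⊕ X 𝔽 ⊗ p ≋ a ∷ p
    eq = ℙ.begin
      constₚ 𝔽 a ⊕ X 𝔽 ⊗ p           ℙ.≈⟨ ℙ.+-congˡ {constₚ 𝔽 a} (0∷-⊗ (oneₚ 𝔽) p) ⟩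
      constₚ 𝔽 a ⊕ (𝔽.0# ∷ oneₚ 𝔽 ⊗ p)   ℙ.≈⟨ ℙ.+-congˡ {constₚ 𝔽 a} {𝔽.0# ∷ oneₚ 𝔽 ⊗ p} {𝔽.0# ∷ p} (∷-cong refl (⊗-identityˡ p)) ⟩
      constₚ 𝔽 a ⊕ (𝔽.0# ∷ p)        ℙ.≈⟨ ∷-cong (𝔽.+-identityʳ a) ≋-refl ⟩
      a ∷ p                          ℙ.∎

  -- Horner evaluation at the class of `X` is reduction itself. From here on divisibility by `f` is
  -- handled as vanishing at a point.
  ev-root≡0⇔∣ : ∀ p → (ev p ≡ L.0# → f ∣ p) × (f ∣ p → ev p ≡ L.0#)
  ev-root≡0⇔∣ p = (λ eq → reduce≡0⇒∣ (trans (sym (ev-root p)) eq)) , (λ f∣p → trans (ev-root p) (reduce-resp (∣⇒~0 f∣p)))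

  module _ {K : FiniteField} (φ : Hom 𝔽 K) (κ : FiniteField.F K)
           (fκ≡0 : Evaluation.ev φ κ f ≡ FiniteField.0# K) where
    private
      module K = FieldTheory K
      module φκ = Evaluation φ κ

      ev-reduce : ∀ p → φκ.ev (toList (reduce p)) ≡ φκ.ev p
      ev-reduce p = K.x-y≡0⇒x≡y (begin
        φκ.ev (toList (reduce p)) K.+ K.- φκ.ev p     ≡⟨ cong (φκ.ev (toList (reduce p)) K.+_) (φκ.ev-⊖ p) ⟨
        φκ.ev (toList (reduce p)) K.+ φκ.ev (⊖ p)     ≡⟨ φκ.ev-⊕ (toList (reduce p)) (⊖ p) ⟨
        φκ.ev (toList (reduce p) ⊕ ⊖ p)               ≡⟨ φκ.∣⇒ev≡0 {f} fκ≡0 (divides (reduce~ p)) ⟩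
        K.0#                                          ∎)

    -- The universal property of the quotient: `root` may be sent to any root of `f` in an
    -- extension.
    extend : Hom residueField K
    extend = record
      { ⟦_⟧ = φκ.ev ∘ toList
      ; +-homo = λ v w → trans (ev-reduce (toList v ⊕ toList w)) (φκ.ev-⊕ (toList v) (toList w))
      ; *-homo = λ v w → trans (ev-reduce (toList v ⊗ toList w)) (φκ.ev-⊗ (toList v) (toList w))
      ; 1-homo = trans (ev-reduce (oneₚ 𝔽)) φκ.ev-one }

module _ {𝔽 : FiniteField} where
  open PolyTheory 𝔽
  open import Algebra.Properties.CommutativeSemigroup (CommutativeRing.*-commutativeSemigroup polyRing) using (xy∙z≈xz∙y)
  private module 𝔽 = FieldTheory 𝔽

  const∣ : ∀ {p} q → Degree p 0 → p ∣ q
  const∣ {p} q D = multiple (scale c⁻¹ q) (ℙ.begin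
    q                                       ℙ.≈⟨ ⊗-identityˡ q ⟨
    oneₚ 𝔽 ⊗ q                              ℙ.≈⟨ ⊗-cong {constₚ 𝔽 (coef p 0 𝔽.* c⁻¹)} {oneₚ 𝔽} {q} (∷-cong (𝔽.inv-inverseʳ (coef p 0) _) ≋-refl) ≋-refl ⟨
    constₚ 𝔽 (coef p 0 𝔽.* c⁻¹) ⊗ q         ℙ.≈⟨ ⊗-cong {constₚ 𝔽 (coef p 0 𝔽.* c⁻¹)} {constₚ 𝔽 (coef p 0) ⊗ constₚ 𝔽 c⁻¹} {q} (pointwise λ { zero → sym (𝔽.+-identityʳ _) ; (suc _) → refl }) ≋-refl ⟩
    (constₚ 𝔽 (coef p 0) ⊗ constₚ 𝔽 c⁻¹) ⊗ q   ℙ.≈⟨ ⊗-assoc (constₚ 𝔽 (coef p 0)) (constₚ 𝔽 c⁻¹) q ⟩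
    constₚ 𝔽 (coef p 0) ⊗ (constₚ 𝔽 c⁻¹ ⊗ q)   ℙ.≈⟨ ⊗-cong (pointwise {constₚ 𝔽 _} {p} λ { zero → refl ; (suc n) → sym (bounded D (suc n) (s≤s z≤n)) }) (const-⊗ c⁻¹ q) ⟩
    p ⊗ scale c⁻¹ q                         ℙ.∎)
    where c⁻¹ = 𝔽.inv (coef p 0) (leading≢0 D)

  -- Euclid's descent: if `p` is smaller than `g`, the remainder of `g` on division by `p` again
  -- satisfies `g ∣ r ⊗ q`. The descent stops when the remainder is zero, where `g` factors through
  -- `p` and irreducibility makes `p` a unit.
  irreducible⇒prime : ∀ {g} → Irreducible 𝔽 g → PrimePoly 𝔽 g
  irreducible⇒prime {g} (1≤deg , irr) p q (multiple l pq≋gl) = go (divide D p)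
    where
    g≢0 = 1≤deg⇒≢[] {g} 1≤deg
    D = Degree-deg g≢0

    unit : ∀ p → Degree p 0 → g ∣ p ⊗ q → g ∣ q
    unit p Dp (multiple l e) = from-inverse (const∣ (oneₚ 𝔽) Dp)
      where
      from-inverse : p ∣ oneₚ 𝔽 → g ∣ q
      from-inverse (multiple c 1≋pc) = multiple (l ⊗ c) (ℙ.begin
        q             ℙ.≈⟨ ⊗-identityˡ q ⟨
        oneₚ 𝔽 ⊗ q    ℙ.≈⟨ ⊗-cong 1≋pc ≋-refl ⟩
        (p ⊗ c) ⊗ q   ℙ.≈⟨ xy∙z≈xz∙y p c q ⟩
        (p ⊗ q) ⊗ c   ℙ.≈⟨ ⊗-cong e ≋-refl ⟩
        (g ⊗ l) ⊗ c   ℙ.≈⟨ ⊗-assoc g l c ⟩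
        g ⊗ (l ⊗ c)   ℙ.∎)

    small : ∀ {n} → Acc ℕ._<_ n → ∀ p → Degree p n → n ℕ.< deg 𝔽 g → g ∣ p ⊗ q → g ∣ q
    small {n} (acc rec) p Dp n< g∣pq = step (divide Dp g)
      where
      exact : ∀ k → g ≋ p ⊗ k → g ∣ q
      exact k g≋pk = [ (λ deg-p≡0 → unit p (subst (Degree p) (trans (sym (Degree⇒deg Dp)) deg-p≡0) Dp) g∣pq)
                     , (λ deg-k≡0 → ⊥-elim (absurd deg-k≡0 (degree⊎zero k))) ]′ (irr p k (≋⇒≈ g≋pk))
        where
        absurd : deg 𝔽 k ≡ 0 → (∃ λ m → Degree k m) ⊎ k ≋ [] → ⊥
        -- `deg` is 0 for the zero polynomial as well as for constants, so both have to be excluded.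
        absurd _ (inj₂ k≋[]) = g≢0 (≋-trans g≋pk (≋-trans (⊗-congˡ p k≋[]) (⊗-comm p [])))
        absurd deg-k≡0 (inj₁ (m , Dk)) = ℕ.<-irrefl refl (subst (n ℕ.<_) deg-g≡n n<)
          where
          deg-g≡n : deg 𝔽 g ≡ n
          deg-g≡n = begin
            deg 𝔽 g     ≡⟨ Degree⇒deg (Degree-resp-≋ (≋-sym g≋pk) (Degree-⊗ Dp Dk)) ⟩
            n ℕ.+ m     ≡⟨ cong (n ℕ.+_) (trans (sym (Degree⇒deg Dk)) deg-k≡0) ⟩
            n ℕ.+ 0     ≡⟨ ℕ.+-identityʳ n ⟩
            n           ∎

      step : (∃₂ λ k r → g ≋ p ⊗ k ⊕ r × r <deg n) → g ∣ q
      step (k , r , g≋pk+r , br) = [ smaller , (λ r≋[] → exact k (≋-trans g≋pk+r (≋-trans (ℙ.+-congˡ r≋[]) (⊕-identityʳ _)))) ]′ (degree⊎zero r)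
        where
        smaller : (∃ λ m → Degree r m) → g ∣ q
        smaller (m , Dr) = small (rec m<n) r Dr (ℕ.<-trans m<n n<) (∣-+-cancelˡ
          (∣-resp (≋-trans (≋-sym (⊗-assoc k p q)) (⊗-cong (⊗-comm k p) ≋-refl)) (∣-* k g∣pq))
          (∣-resp (≋-trans (⊗-cong g≋pk+r ≋-refl) (⊗-distribʳ q (p ⊗ k) r)) (multiple {g} q ≋-refl)))
          where
          m<n : m ℕ.< n
          m<n = <deg⇒Degree< br Dr

    go : (∃₂ λ k r → p ≋ g ⊗ k ⊕ r × r <deg deg 𝔽 g) → g ∣ p ⊎ g ∣ q
    go (k , r , e , br) with degree⊎zero r
    ... | inj₂ r≋[] = inj₁ (multiple k (≋-trans e (≋-trans (ℙ.+-congˡ r≋[]) (⊕-identityʳ _))))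
    ... | inj₁ (m , Dr) = inj₂ (small (<-wellFounded m) r Dr (<deg⇒Degree< br Dr) (∣-+-cancelˡ
      (multiple {g} (k ⊗ q) (⊗-assoc g k q))
      (∣-resp (≋-trans (⊗-cong e ≋-refl) (⊗-distribʳ q (g ⊗ k) r)) (multiple {g} l pq≋gl))))

module _ {𝔽 K : FiniteField} (φ : Hom 𝔽 K) (α : FiniteField.F K) where
  open PolyTheory 𝔽
  open Evaluation φ α
  private module K = FieldTheory K

  minimal⇒prime : ∀ {f} → ev f ≡ K.0# → (∀ p → ev p ≡ K.0# → f ∣ p) → PrimePoly 𝔽 f
  minimal⇒prime {f} f≡0 min p q f∣pq with K.x*y≡0⇒x≡0⊎y≡0 (trans (sym (ev-⊗ p q)) (∣⇒ev≡0 {f} {p ⊗ q} f≡0 f∣pq))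
  ... | inj₁ p≡0 = inj₁ (min p p≡0)
  ... | inj₂ q≡0 = inj₂ (min q q≡0)

-- Fermat's theorem, roots and minimal polynomials

module Counting (K : FiniteField) where
  open FieldTheory K
  private module e = Inverse enum
  open import Algebra.Properties.CommutativeMonoid.Sum +-commutativeMonoid
    using (sum; sum-permute; ∑-distrib-+; sum-cong-≗; sum-replicate)
  open import Algebra.Properties.CommutativeMonoid.Sum *-commutativeMonoid using ()
    renaming (sum to product; sum-permute to product-permute; ∑-distrib-+ to product-distrib-*; sum-cong-≗ to product-cong
             ; sum-replicate to product-replicate; sum-remove to product-remove)
  open import Algebra.Properties.Semiring.Mult semiring public using (×-homo-+; ×1-homo-*) renaming (_×_ to _·_)

  2≤size : 2 ℕ.≤ size
  2≤size = Fin.injective⇒≤ {f = λ { zero → e.from 0# ; (suc zero) → e.from 1# }} λ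
    { {zero} {zero} _ → refl
    ; {zero} {suc zero} eq → ⊥-elim (0≢1 (from-injective enum eq))
    ; {suc zero} {zero} eq → ⊥-elim (1≢0 (from-injective enum eq))
    ; {suc zero} {suc zero} _ → refl }

  private
    transport : (f g : F → F) → (∀ x → f (g x) ≡ x) → (∀ x → g (f x) ≡ x) → Permutation size size
    transport f g fg gf = permutation (e.from ∘ f ∘ e.to) (e.from ∘ g ∘ e.to) (cancel f g fg) (cancel g f gf)
      where
      cancel : ∀ f g → (∀ x → f (g x) ≡ x) → ∀ i → e.from (f (e.to (e.from (g (e.to i))))) ≡ i
      cancel f g fg i = trans (cong (e.from ∘ f) (e.strictlyInverseˡ _)) (trans (cong e.from (fg _)) (e.strictlyInverseʳ i))

  -- The sum of all elements is unchanged when every element is increased by 1, because that only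
  -- permutes them.
  size·1≡0 : size · 1# ≡ 0#
  size·1≡0 = begin
    size · 1#                               ≡⟨ solve 2 (λ n s → n := (s :+ n) :- s) refl (size · 1#) S ⟩
    (S + size · 1#) + - S                   ≡⟨ cong (λ z → (S + z) + - S) (sum-replicate size) ⟨
    (S + sum (replicate size 1#)) + - S     ≡⟨ cong (_+ - S) (∑-distrib-+ e.to (replicate size 1#)) ⟨
    sum (λ i → e.to i + 1#) + - S           ≡⟨ cong (_+ - S) (sum-cong-≗ (λ i → e.strictlyInverseˡ (e.to i + 1#))) ⟨
    sum (λ i → e.to (e.from (e.to i + 1#))) + - S
      ≡⟨ cong (_+ - S) (sum-permute e.to (transport (_+ 1#) (_+ - 1#)
           (solve 1 (λ x → (x :- con ℤ.1ℤ) :+ con ℤ.1ℤ := x) refl) (solve 1 (λ x → (x :+ con ℤ.1ℤ) :- con ℤ.1ℤ := x) refl))) ⟨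
    S + - S                                 ≡⟨ -‿inverseʳ S ⟩
    0#                                      ∎
    where S = sum e.to

  private
    product≢0 : ∀ {n} (t : Fin n → F) → (∀ i → t i ≢ 0#) → product t ≢ 0#
    product≢0 {zero} t _ = 1≢0
    product≢0 {suc n} t t≢0 = x*y≢0 (t≢0 zero) (product≢0 (t ∘ suc) (t≢0 ∘ suc))

    product≡1 : ∀ {n} (t : Fin n → F) → (∀ i → t i ≡ 1#) → product t ≡ 1#
    product≡1 {zero} t _ = refl
    product≡1 {suc n} t t≡1 = trans (cong₂ _*_ (t≡1 zero) (product≡1 (t ∘ suc) (t≡1 ∘ suc))) (*-identityˡ 1#)

    product-single : ∀ {n} (t : Fin n → F) i → (∀ j → j ≢ i → t j ≡ 1#) → product t ≡ t i
    product-single {suc n} t i t≡1 = begin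
      product t                         ≡⟨ product-remove {i = i} t ⟩
      t i * product (removeAt t i)      ≡⟨ cong (t i *_) (product≡1 (removeAt t i) (λ j → t≡1 _ (Fin.punchInᵢ≢i i j))) ⟩
      t i * 1#                          ≡⟨ *-identityʳ (t i) ⟩
      t i                               ∎

  private module _ (a : F) (a≢0 : a ≢ 0#) where
    -- The product below runs over all elements, so zero is counted as 1. Scaling by `a` then
    -- multiplies every factor by `a` except the one at zero, and `else` records this single defect;
    -- it turns the exponent into `size` instead of `size` minus 1.
    unit else : F → F
    unit x with x ≟ 0#
    ... | yes _ = 1#
    ... | no _ = x
    else x with x ≟ 0#
    ... | yes _ = a
    ... | no _ = 1#

    unit≢0 : ∀ x → unit x ≢ 0#
    unit≢0 x with x ≟ 0#
    ... | yes _ = 1≢0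
    ... | no x≢0 = x≢0

    unit-scale : ∀ x → unit (a * x) * else x ≡ a * unit x
    unit-scale x with x ≟ 0# | (a * x) ≟ 0#
    ... | yes _ | yes _ = *-comm 1# a
    ... | yes refl | no ax≢0 = ⊥-elim (ax≢0 (zeroʳ a))
    ... | no x≢0 | yes ax≡0 = ⊥-elim (x*y≢0 a≢0 x≢0 ax≡0)
    ... | no _ | no _ = *-identityʳ _

    else≡1 : ∀ {x} → x ≢ 0# → else x ≡ 1#
    else≡1 {x} x≢0 with x ≟ 0#
    ... | yes x≡0 = ⊥-elim (x≢0 x≡0)
    ... | no _ = refl

    else-0 : else 0# ≡ a
    else-0 with 0# ≟ 0#
    ... | yes _ = refl
    ... | no 0≢0 = ⊥-elim (0≢0 refl)

    P = product (unit ∘ e.to)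

    P-scale : product (λ i → unit (a * e.to i)) ≡ P
    P-scale = begin
      product (λ i → unit (a * e.to i))                      ≡⟨ product-cong (λ i → cong unit (e.strictlyInverseˡ (a * e.to i))) ⟨
      product (λ i → unit (e.to (e.from (a * e.to i))))      ≡⟨ product-permute (unit ∘ e.to) (transport (a *_) (inv a a≢0 *_)
                                                                  (λ x → trans (sym (*-assoc a _ x)) (trans (cong (_* x) (inv-inverseʳ a a≢0)) (*-identityˡ x)))
                                                                  (λ x → trans (sym (*-assoc _ a x)) (trans (cong (_* x) (inv-inverseˡ a a≢0)) (*-identityˡ x)))) ⟨
      P                                                      ∎

    product-else : product (else ∘ e.to) ≡ a
    product-else = begin
      product (else ∘ e.to)      ≡⟨ product-single (else ∘ e.to) (e.from 0#) (λ j j≢ → else≡1 (λ eq → j≢ (trans (sym (e.strictlyInverseʳ j)) (cong e.from eq)))) ⟩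
      else (e.to (e.from 0#))    ≡⟨ cong else (e.strictlyInverseˡ 0#) ⟩
      else 0#                    ≡⟨ else-0 ⟩
      a                          ∎

    fermat-≢0 : a ^ size ≡ a
    fermat-≢0 = *-cancelˡ (product≢0 (unit ∘ e.to) (unit≢0 ∘ e.to)) (begin
      P * a ^ size                                                       ≡⟨ *-comm P (a ^ size) ⟩
      a ^ size * P                                                       ≡⟨ cong (_* P) (product-replicate size) ⟨
      product (replicate size a) * P                                     ≡⟨ product-distrib-* (replicate size a) (unit ∘ e.to) ⟨
      product (λ i → a * unit (e.to i))                                  ≡⟨ product-cong (unit-scale ∘ e.to) ⟨
      product (λ i → unit (a * e.to i) * else (e.to i))                  ≡⟨ product-distrib-* (λ i → unit (a * e.to i)) (else ∘ e.to) ⟩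
      product (λ i → unit (a * e.to i)) * product (else ∘ e.to)          ≡⟨ cong₂ _*_ P-scale product-else ⟩
      P * a                                                              ∎)

  0^n≡0 : ∀ {n} → 1 ℕ.≤ n → 0# ^ n ≡ 0#
  0^n≡0 {suc n} _ = zeroˡ _

  fermat : ∀ a → a ^ size ≡ a
  fermat a with a ≟ 0#
  ... | yes refl = 0^n≡0 (ℕ.<⇒≤ 2≤size)
  ... | no a≢0 = fermat-≢0 a a≢0

module Roots (K : FiniteField) where
  open FieldTheory K
  open PolyTheory K
  private module At x = Evaluation (idHom K) x
  open At using (ev)

  -- Horner's scheme for the quotient by X - a: its coefficients are the values at `a` of the tails
  -- of the polynomial. The list keeps its length, the last entry being 0.
  synthetic : F → Poly K → Poly K
  synthetic a [] = []
  synthetic a (c ∷ p) = ev a p ∷ synthetic a p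

  synthetic-factor : ∀ a p x → ev x p + - ev a p ≡ (x + - a) * ev x (synthetic a p)
  synthetic-factor a [] x = solve 1 (λ y → con ℤ.0ℤ :- con ℤ.0ℤ := y :* con ℤ.0ℤ) refl (x + - a)
  synthetic-factor a (c ∷ p) x = begin
    (c + x * ev x p) + - (c + a * ev a p)
      ≡⟨ solve 5 (λ c x a P A → (c :+ x :* P) :- (c :+ a :* A) := (x :- a) :* A :+ x :* (P :- A)) refl c x a _ _ ⟩
    (x + - a) * ev a p + x * (ev x p + - ev a p)
      ≡⟨ cong (λ z → (x + - a) * ev a p + x * z) (synthetic-factor a p x) ⟩
    (x + - a) * ev a p + x * ((x + - a) * ev x (synthetic a p))
      ≡⟨ solve 4 (λ y A x Q → y :* A :+ x :* (y :* Q) := y :* (A :+ x :* Q)) refl (x + - a) _ x _ ⟩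
    (x + - a) * (ev a p + x * ev x (synthetic a p))  ∎

  synthetic-<deg : ∀ a p {n} → p <deg n → synthetic a p <deg (n ∸ 1)
  synthetic-<deg a [] b m _ = refl
  synthetic-<deg a (c ∷ p) {n} b zero n∸1≤0 = At.ev-cong a {p} {[]} (pointwise λ k → b (suc k) (ℕ.≤-trans (ℕ.m∸n≡0⇒m≤n (ℕ.n≤0⇒n≡0 n∸1≤0)) (s≤s z≤n)))
  synthetic-<deg a (c ∷ p) {n} b (suc m) n∸1≤1+m = synthetic-<deg a p {n ∸ 1} (λ k n∸1≤k → b (suc k) (ℕ.≤-trans (ℕ.m≤n+m∸n n 1) (s≤s n∸1≤k))) m (ℕ.∸-monoˡ-≤ 1 n∸1≤1+m)

  synthetic≋[]⇒const : ∀ a p → synthetic a p ≋ [] → p ≋ constₚ K (ev a p)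
  synthetic≋[]⇒const a [] _ = pointwise λ { zero → refl ; (suc _) → refl }
  synthetic≋[]⇒const a (c ∷ p) e = ∷-cong (sym (trans (cong (λ z → c + a * z) (at e 0)) (solve 2 (λ c a → c :+ a :* con ℤ.0ℤ := c) refl c a)))
    (≋-trans (synthetic≋[]⇒const a p (pointwise (at e ∘ suc))) (pointwise λ { zero → at e 0 ; (suc _) → refl }))

  vanishing : ∀ n (point : Fin n → F) → (∀ {i j} → point i ≡ point j → i ≡ j) →
              ∀ p → p <deg n → (∀ i → ev (point i) p ≡ 0#) → p ≋ []
  vanishing zero point inj p b _ = pointwise λ k → b k z≤n
  vanishing (suc n) point inj p b roots =
    ≋-trans (synthetic≋[]⇒const a p q≋[]) (pointwise λ { zero → roots zero ; (suc _) → refl })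
    where
    a = point zero
    q≋[] : synthetic a p ≋ []
    q≋[] = vanishing n (point ∘ suc) (Fin.suc-injective ∘ inj) (synthetic a p) (synthetic-<deg a p b)
      (λ i → x*y≡0⇒y≡0 (λ eq → contradiction (inj (x-y≡0⇒x≡y eq)) λ ()) (begin
        (point (suc i) + - a) * ev (point (suc i)) (synthetic a p)   ≡⟨ synthetic-factor a p (point (suc i)) ⟨
        ev (point (suc i)) p + - ev a p                              ≡⟨ cong₂ (λ x y → x + - y) (roots (suc i)) (roots zero) ⟩
        0# + - 0#                                                    ≡⟨ -‿inverseʳ 0# ⟩
        0#                                                           ∎))

  vanishing-everywhere : ∀ p → p <deg size → (∀ x → ev x p ≡ 0#) → p ≋ []
  vanishing-everywhere p b roots = vanishing size (Inverse.to enum) (to-injective enum) p b (roots ∘ Inverse.to enum)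

module _ (E : FiniteField) where
  open PolyTheory E
  private module E = FieldTheory E

  X^_-X : ℕ → Poly E
  X^ n -X = powₚ E (X E) n ⊕ ⊖ X E

  Degree-X^ : ∀ n → Degree (powₚ E (X E) n) n
  Degree-X^ zero = degree E.1≢0 λ { (suc _) _ → refl }
  Degree-X^ (suc n) = Degree-⊗ {X E} (degree E.1≢0 λ { (suc (suc _)) _ → refl ; (suc zero) (s≤s ()) }) (Degree-X^ n)

  Degree-X^-X : ∀ {n} → 2 ℕ.≤ n → Degree (X^ n -X) n
  Degree-X^-X {n} 2≤n = degree (λ eq → leading≢0 (Degree-X^ n) (trans (sym (same n 2≤n)) eq))
    (λ m n<m → trans (same m (ℕ.≤-trans 2≤n (ℕ.<⇒≤ n<m))) (bounded (Degree-X^ n) m n<m))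
    where
    coef-⊖X : ∀ m → 2 ℕ.≤ m → coef (⊖ X E) m ≡ E.0#
    coef-⊖X (suc (suc m)) _ = refl
    coef-⊖X (suc zero) (s≤s ())
    same : ∀ m → 2 ℕ.≤ m → coef (X^ n -X) m ≡ coef (powₚ E (X E) n) m
    same m 2≤m = trans (coef-⊕ (powₚ E (X E) n) (⊖ X E) m) (trans (cong (coef (powₚ E (X E) n) m E.+_) (coef-⊖X m 2≤m)) (E.+-identityʳ _))

module _ {E K : FiniteField} (φ : Hom E K) where
  open PolyTheory E
  private
    module E = FieldTheory E
    module K = FieldTheory K
    module Kₚ = PolyTheory K
    module φ = Hom φ
    module At κ = Evaluation φ κ
  open At using (ev)

  ev-X^-X : ∀ n κ → ev κ (X^_-X E n) ≡ κ K.^ n K.+ K.- κ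
  ev-X^-X n κ = begin
    ev κ (X^_-X E n)                                   ≡⟨ At.ev-⊕ κ (powₚ E (X E) n) (⊖ X E) ⟩
    ev κ (powₚ E (X E) n) K.+ ev κ (⊖ X E)             ≡⟨ cong₂ K._+_ (At.ev-pow κ (X E) n) (At.ev-⊖ κ (X E)) ⟩
    ev κ (X E) K.^ n K.+ K.- ev κ (X E)                ≡⟨ cong (λ x → x K.^ n K.+ K.- x) (At.ev-X κ) ⟩
    κ K.^ n K.+ K.- κ                                  ∎

  ev-X^size-X : ∀ κ → ev κ (X^_-X E K.size) ≡ K.0#
  ev-X^size-X κ = trans (ev-X^-X K.size κ) (K.x≡y⇒x-y≡0 (Counting.fermat K κ))

  private
    coef-map : ∀ p n → Kₚ.coef (map φ.⟦_⟧ p) n ≡ φ.⟦ coef p n ⟧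
    coef-map [] n = sym φ.0-homo
    coef-map (a ∷ p) zero = refl
    coef-map (a ∷ p) (suc n) = coef-map p n

    ev-map : ∀ κ p → Evaluation.ev (idHom K) κ (map φ.⟦_⟧ p) ≡ ev κ p
    ev-map κ [] = refl
    ev-map κ (a ∷ p) = cong (λ z → φ.⟦ a ⟧ K.+ κ K.* z) (ev-map κ p)

  -- A factor without roots would leave a cofactor of degree < |K| vanishing on all of K.
  root-of-factor : ∀ {f d} → Degree f d → 1 ℕ.≤ d → f ∣ X^_-X E K.size → ∃ λ κ → ev κ f ≡ K.0#
  root-of-factor {f} {d} D 1≤d (multiple g e) = decidable-stable (search K.enum (λ κ → ev κ f K.≟ K.0#)) λ ∄ →
    let g-root : ∀ κ → ev κ g ≡ K.0#
        g-root κ = K.x*y≡0⇒y≡0 (λ eq → ∄ (κ , eq)) (trans (sym (At.ev-⊗ κ f g)) (trans (sym (At.ev-cong κ e)) (ev-X^size-X κ)))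
        Dg = degree-of g≢0
        map-g≋[] = Roots.vanishing-everywhere K (map φ.⟦_⟧ g)
          (λ m size≤m → trans (coef-map g m) (trans (cong φ.⟦_⟧ (bounded (proj₂ Dg) m (ℕ.≤-trans (g-small (proj₂ Dg)) size≤m))) φ.0-homo))
          (λ x → trans (ev-map x g) (g-root x))
    in φ.≢0-homo (leading≢0 (proj₂ Dg)) (trans (sym (coef-map g _)) (Kₚ.at map-g≋[] _))
    where
    DX = Degree-X^-X E (Counting.2≤size K)
    g≢0 : ¬ g ≋ []
    g≢0 g≋[] = Degree⇒≢[] DX (≋-trans e (≋-trans (⊗-congˡ f g≋[]) (⊗-comm f [])))
    g-small : ∀ {n} → Degree g n → n ℕ.< K.size
    g-small {n} Dg = subst (n ℕ.<_) (Degree-unique (Degree-⊗ D Dg) (Degree-resp-≋ e DX)) (ℕ.+-monoˡ-≤ n 1≤d)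

module _ {E L : FiniteField} (φ : Hom E L) (θ : FiniteField.F L) where
  open PolyTheory E
  open Truncation E
  open Evaluation φ θ
  private
    module E = FieldTheory E
    module L = FieldTheory L

  record IsMinimalPolynomial (f : Poly E) : Set where
    field
      d       : ℕ
      D       : Degree f d
      1≤d     : 1 ℕ.≤ d
      f[θ]≡0  : ev f ≡ L.0#
      minimal : ∀ p → ev p ≡ L.0# → f ∣ p

  no-smaller⇒minimal : ∀ {f d} → Degree f d → ev f ≡ L.0# → (∀ r → r <deg d → ev r ≡ L.0# → r ≋ []) →
                       ∀ p → ev p ≡ L.0# → f ∣ p
  no-smaller⇒minimal {f} {d} D f≡0 none p p≡0 =
    multiple k (≋-trans e (≋-trans (ℙ.+-congˡ (none r br r≡0)) (⊕-identityʳ _)))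
    where
    qr = divide D p
    k = proj₁ qr
    r = proj₁ (proj₂ qr)
    e = proj₁ (proj₂ (proj₂ qr))
    br = proj₂ (proj₂ (proj₂ qr))
    r≡0 : ev r ≡ L.0#
    r≡0 = begin
      ev r                        ≡⟨ L.+-identityˡ _ ⟨
      L.0# L.+ ev r               ≡⟨ cong (L._+ ev r) (trans (ev-⊗ f k) (trans (cong (L._* ev k) f≡0) (L.zeroˡ _))) ⟨
      ev (f ⊗ k) L.+ ev r         ≡⟨ ev-⊕ (f ⊗ k) r ⟨
      ev (f ⊗ k ⊕ r)              ≡⟨ ev-cong e ⟨
      ev p                        ≡⟨ p≡0 ⟩
      L.0#                        ∎

  Degree0⇒ev≢0 : ∀ {f} → Degree f 0 → ev f ≢ L.0#
  Degree0⇒ev≢0 {f} D f≡0 = Hom.≢0-homo φ (leading≢0 D) (begin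
    Hom.⟦ φ ⟧ (coef f 0)        ≡⟨ ev-const (coef f 0) ⟨
    ev (constₚ E (coef f 0))    ≡⟨ ev-cong {constₚ E (coef f 0)} {f} (pointwise λ { zero → refl ; (suc n) → sym (bounded D (suc n) (s≤s z≤n)) }) ⟩
    ev f                        ≡⟨ f≡0 ⟩
    L.0#                        ∎)

  -- Descent from X^n - X with n the size of `L`, which annihilates everything by Fermat. Since
  -- there are only finitely many coefficient vectors of length `d`, a smaller annihilator is either
  -- found or excluded by search.
  minimalPolynomial : ∃ IsMinimalPolynomial
  minimalPolynomial = go (<-wellFounded L.size) (Degree-X^-X E (Counting.2≤size L)) (ev-X^size-X φ θ)
    where
    1≤ : ∀ {f d} → Degree f d → ev f ≡ L.0# → 1 ℕ.≤ d
    1≤ {d = zero} D f≡0 = ⊥-elim (Degree0⇒ev≢0 D f≡0)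
    1≤ {d = suc _} _ _ = s≤s z≤n
    go : ∀ {f d} → Acc ℕ._<_ d → Degree f d → ev f ≡ L.0# → ∃ IsMinimalPolynomial
    go {f} {d} (acc rec) D f≡0
      with search (Vec↔ E.enum d) (λ v → (ev (toList v) L.≟ L.0#) ×-dec ¬? (toList v ≋[]?))
    ... | yes (v , v≡0 , v≢0) = go (rec (<deg⇒Degree< (toList-<deg v) (proj₂ (degree-of v≢0)))) (proj₂ (degree-of v≢0)) v≡0
    ... | no ∄ = f , record
      { d = d ; D = D ; 1≤d = 1≤ D f≡0 ; f[θ]≡0 = f≡0
      ; minimal = no-smaller⇒minimal D f≡0 λ r br r≡0 → decidable-stable (r ≋[]?) λ r≢0 →
          ∄ (truncate d r , trans (ev-cong (coef-truncate d r br)) r≡0 , λ e → r≢0 (≋-trans (≋-sym (coef-truncate d r br)) e)) }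

-- Prime fields; finite fields of the same size

module Characteristic (K : FiniteField) where
  open FieldTheory K
  open Counting K

  record IsCharacteristic (p : ℕ) : Set where
    field
      p≢0   : NonZero p
      p·1≡0 : p · 1# ≡ 0#
      least : ∀ n → n ℕ.< p → n · 1# ≡ 0# → n ≡ 0

  characteristic : ∃ IsCharacteristic
  characteristic = go (<-wellFounded size) (ℕ.<⇒≤ 2≤size) size·1≡0
    where
    go : ∀ {n} → Acc ℕ._<_ n → 1 ℕ.≤ n → n · 1# ≡ 0# → ∃ IsCharacteristic
    go {n} (acc rec) 1≤n n·1≡0
      with Fin.any? {n = n} (λ i → (¬? (toℕ i ℕ.≟ 0)) ×-dec ((toℕ i · 1#) ≟ 0#))
    ... | yes (i , i≢0 , i·1≡0) = go (rec (Fin.toℕ<n i)) (ℕ.n≢0⇒n>0 i≢0) i·1≡0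
    ... | no ∄ = n , record
      { p≢0 = ℕ.>-nonZero 1≤n ; p·1≡0 = n·1≡0
      ; least = λ m m<n m·1≡0 → decidable-stable (m ℕ.≟ 0) λ m≢0 →
          ∄ (fromℕ< m<n , subst (λ k → k ≢ 0 × k · 1# ≡ 0#) (sym (Fin.toℕ-fromℕ< m<n)) (m≢0 , m·1≡0)) }

  module _ {p : ℕ} .{{_ : NonZero p}} (p·1≡0 : p · 1# ≡ 0#) where
    %-· : ∀ n → (n % p) · 1# ≡ n · 1#
    %-· n = begin
      (n % p) · 1#                                  ≡⟨ +-identityʳ _ ⟨
      (n % p) · 1# + 0#                             ≡⟨ cong ((n % p) · 1# +_) (zeroʳ ((n / p) · 1#)) ⟨
      (n % p) · 1# + (n / p) · 1# * 0#              ≡⟨ cong (λ z → (n % p) · 1# + (n / p) · 1# * z) p·1≡0 ⟨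
      (n % p) · 1# + (n / p) · 1# * p · 1#          ≡⟨ cong ((n % p) · 1# +_) (×1-homo-* (n / p) p) ⟨
      (n % p) · 1# + ((n / p) ℕ.* p) · 1#           ≡⟨ ×-homo-+ 1# (n % p) ((n / p) ℕ.* p) ⟨
      (n % p ℕ.+ (n / p) ℕ.* p) · 1#                ≡⟨ cong (_· 1#) (m≡m%n+[m/n]*n n p) ⟨
      n · 1#                                        ∎

  ·-injective-≤ : ∀ {m n} → m ℕ.≤ n → m · 1# ≡ n · 1# → (n ∸ m) · 1# ≡ 0#
  ·-injective-≤ {m} {n} m≤n eq = begin
    (n ∸ m) · 1#                                ≡⟨ solve 2 (λ x y → y := (x :+ y) :- x) refl (m · 1#) ((n ∸ m) · 1#) ⟩
    (m · 1# + (n ∸ m) · 1#) + - (m · 1#)        ≡⟨ cong (_+ - (m · 1#)) (×-homo-+ 1# m (n ∸ m)) ⟨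
    (m ℕ.+ (n ∸ m)) · 1# + - (m · 1#)           ≡⟨ cong (λ k → k · 1# + - (m · 1#)) (ℕ.m+[n∸m]≡n m≤n) ⟩
    n · 1# + - (m · 1#)                         ≡⟨ cong (λ z → n · 1# + - z) eq ⟩
    n · 1# + - (n · 1#)                         ≡⟨ -‿inverseʳ _ ⟩
    0#                                          ∎

  -- This transfers the characteristic between two fields of the same size before any map between
  -- them exists.
  power-·1≡0 : ∀ p k → (p ℕ.^ k) · 1# ≡ 0# → p · 1# ≡ 0#
  power-·1≡0 p zero eq = ⊥-elim (1≢0 (trans (sym (+-identityʳ 1#)) eq))
  power-·1≡0 p (suc k) eq = [ id , power-·1≡0 p k ]′ (x*y≡0⇒x≡0⊎y≡0 (trans (sym (×1-homo-* p (p ℕ.^ k))) eq))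

module PrimeField (L : FiniteField) {p : ℕ} (char : Characteristic.IsCharacteristic L p) where
  private
    module L = FieldTheory L
    module Lc = Counting L
    open Lc using (_·_)
    open Characteristic.IsCharacteristic char
    instance _ = p≢0

    -- Injective by the minimality of `p`. The ring axioms and the cancellation law on `Fin p` are
    -- all pulled back from `L` along it.
    ι : Fin p → L.F
    ι i = toℕ i · L.1#

    mod : ℕ → Fin p
    mod n = fromℕ< (m%n<n n p)

    toℕ-mod : ∀ n → toℕ (mod n) ≡ n % p
    toℕ-mod n = Fin.toℕ-fromℕ< (m%n<n n p)

    ι-mod : ∀ n → ι (mod n) ≡ n · L.1#
    ι-mod n = trans (cong (_· L.1#) (toℕ-mod n)) (Characteristic.%-· L p·1≡0 n)

    ι-injective : ∀ {i j} → ι i ≡ ι j → i ≡ j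
    ι-injective {i} {j} eq = Fin.toℕ-injective ([ (λ i≤j → lemma i j i≤j eq) , (λ j≤i → sym (lemma j i j≤i (sym eq))) ]′ (ℕ.≤-total (toℕ i) (toℕ j)))
      where
      lemma : ∀ i j → toℕ i ℕ.≤ toℕ j → ι i ≡ ι j → toℕ i ≡ toℕ j
      lemma i j i≤j eq = ℕ.≤-antisym i≤j (ℕ.m∸n≡0⇒m≤n (least _ (ℕ.≤-<-trans (ℕ.m∸n≤m (toℕ j) (toℕ i)) (Fin.toℕ<n j)) (Characteristic.·-injective-≤ L i≤j eq)))

    rawFin : RawRing 0ℓ 0ℓ
    rawFin = record
      { Carrier = Fin p ; _≈_ = _≡_
      ; _+_ = λ i j → mod (toℕ i ℕ.+ toℕ j) ; _*_ = λ i j → mod (toℕ i ℕ.* toℕ j) ; -_ = λ i → mod (p ∸ toℕ i)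
      ; 0# = mod 0 ; 1# = mod 1 }

    module R = RawRing rawFin

    ι-+ : ∀ i j → ι (i R.+ j) ≡ ι i L.+ ι j
    ι-+ i j = trans (ι-mod _) (Lc.×-homo-+ L.1# (toℕ i) (toℕ j))

    ι-* : ∀ i j → ι (i R.* j) ≡ ι i L.* ι j
    ι-* i j = trans (ι-mod _) (Lc.×1-homo-* (toℕ i) (toℕ j))

    ι-neg : ∀ i → ι (R.- i) ≡ L.- ι i
    ι-neg i = L.x-y≡0⇒x≡y (begin
      ι (R.- i) L.+ L.- (L.- ι i)           ≡⟨ cong₂ L._+_ (ι-mod (p ∸ toℕ i)) (L.-‿involutive (ι i)) ⟩
      (p ∸ toℕ i) · L.1# L.+ toℕ i · L.1#   ≡⟨ Lc.×-homo-+ L.1# (p ∸ toℕ i) (toℕ i) ⟨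
      (p ∸ toℕ i ℕ.+ toℕ i) · L.1#          ≡⟨ cong (_· L.1#) (ℕ.m∸n+n≡m (ℕ.<⇒≤ (Fin.toℕ<n i))) ⟩
      p · L.1#                              ≡⟨ p·1≡0 ⟩
      L.0#                                  ∎)

    ι-1 : ι R.1# ≡ L.1#
    ι-1 = trans (ι-mod 1) (L.+-identityʳ L.1#)

    ι-mono : IsRingMonomorphism rawFin L.rawRing ι
    ι-mono = record
      { isRingHomomorphism = record
        { isSemiringHomomorphism = record
          { isNearSemiringHomomorphism = record
            { +-isMonoidHomomorphism = record
              { isMagmaHomomorphism = record { isRelHomomorphism = record { cong = cong ι } ; homo = ι-+ }
              ; ε-homo = ι-mod 0 }
            ; *-homo = ι-* }
          ; 1#-homo = ι-1 }
        ; -‿homo = ι-neg }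
      ; injective = ι-injective }

  primeField : FiniteField
  primeField = record
    { F = Fin p ; _+_ = R._+_ ; _*_ = R._*_ ; -_ = R.-_ ; 0# = R.0# ; 1# = R.1#
    ; isCommutativeRing = RingMonomorphism.isCommutativeRing ι-mono L.isCommutativeRing
    ; 0≢1 = λ eq → L.0≢1 (trans (sym (ι-mod 0)) (trans (cong ι eq) ι-1))
    ; inverse = λ i i≢0 → injective⇒surjective (↔-id _) (i R.*_)
        (λ {j} {k} eq → ι-injective (L.*-cancelˡ (λ e → i≢0 (ι-injective (trans e (sym (ι-mod 0))))) (trans (sym (ι-* i j)) (trans (cong ι eq) (ι-* i k))))) R.1#
    ; _≟_ = Fin._≟_ ; size = p ; enum = ↔-id _ }

  module _ (K : FiniteField) where
    private
      module K = FieldTheory K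
      module Kc = Counting K

    primeHom : p Kc.· K.1# ≡ K.0# → Hom primeField K
    primeHom p·1≡0 = record
      { ⟦_⟧ = λ i → toℕ i Kc.· K.1#
      ; +-homo = λ i j → trans (eval (toℕ i ℕ.+ toℕ j)) (Kc.×-homo-+ K.1# (toℕ i) (toℕ j))
      ; *-homo = λ i j → trans (eval (toℕ i ℕ.* toℕ j)) (Kc.×1-homo-* (toℕ i) (toℕ j))
      ; 1-homo = trans (eval 1) (K.+-identityʳ K.1#) }
      where
      eval : ∀ n → toℕ (mod n) Kc.· K.1# ≡ n Kc.· K.1#
      eval n = trans (cong (Kc._· K.1#) (toℕ-mod n)) (Characteristic.%-· K p·1≡0 n)

module SameSize (L K : FiniteField) (sizes : FiniteField.size L ≡ FiniteField.size K) where
  private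
    module L = FieldTheory L
    module K = FieldTheory K
    open Counting K using (_·_; size·1≡0)
    p = proj₁ (Characteristic.characteristic L)
    char = proj₂ (Characteristic.characteristic L)
    open PrimeField L char

    -- A field inside `L` with a map to `K`. The map is conditional on `K` having characteristic
    -- `p`: this follows only from the size of `L` being a power of `p`, which is known once the
    -- tower has reached the top.
    record Subfield : Set₁ where
      field
        E        : FiniteField
        φ        : Hom E L
        exponent : ℕ
        size≡    : FiniteField.size E ≡ p ℕ.^ exponent
        ψ        : p · K.1# ≡ K.0# → Hom E K

    start : Subfield
    start = record
      { E = primeField ; φ = primeHom L (Characteristic.IsCharacteristic.p·1≡0 char)
      ; exponent = 1 ; size≡ = sym (ℕ.^-identityʳ p) ; ψ = primeHom K }

    module Adjoin (S : Subfield) (θ : L.F) where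
      open Subfield S
      f = proj₁ (minimalPolynomial φ θ)
      open IsMinimalPolynomial (proj₂ (minimalPolynomial φ θ))
      open Residue E D 1≤d (minimal⇒prime φ θ f[θ]≡0 minimal)

      adjoin : Subfield
      adjoin = record
        { E = residueField
        ; φ = extend φ θ f[θ]≡0
        ; exponent = exponent ℕ.* d
        ; size≡ = trans (cong (ℕ._^ d) size≡) (ℕ.^-*-assoc p exponent d)
        -- `f` divides X^n - X for n the size of `L`. The sizes being equal, the same polynomial
        -- vanishes on all of `K`, so its factor `f` has a root there.
        ; ψ = λ p·1≡0 → let κ , fκ≡0 = root-of-factor (ψ p·1≡0) D 1≤d (subst (λ n → PolyTheory._∣_ E f (X^_-X E n)) sizes (minimal _ (ev-X^size-X φ θ)))
                        in extend (ψ p·1≡0) κ fκ≡0 }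

      larger : (∀ x → Hom.⟦ φ ⟧ x ≢ θ) → FiniteField.size E ℕ.< FiniteField.size (Subfield.E adjoin)
      larger θ∉ = subst (ℕ._< E.size ℕ.^ d) (ℕ.^-identityʳ E.size) (ℕ.^-monoʳ-< E.size (Counting.2≤size E) (ℕ.≤∧≢⇒< 1≤d (λ 1≡d → linear (sym 1≡d))))
        where
        module E = FieldTheory E
        module φ = Hom φ
        open PolyTheory E
        open Evaluation φ θ
        linear : d ≢ 1
        linear d≡1 = θ∉ (E.- (f₀ E.* f₁⁻¹)) (L.*-cancelˡ (φ.≢0-homo f₁≢0) (begin
          φ.⟦ f₁ ⟧ L.* φ.⟦ E.- (f₀ E.* f₁⁻¹) ⟧    ≡⟨ φ.*-homo _ _ ⟨
          φ.⟦ f₁ E.* E.- (f₀ E.* f₁⁻¹) ⟧          ≡⟨ cong φ.⟦_⟧ (E.solve 3 (λ a b c → a E.:* (E.:- (b E.:* c)) E.:= E.:- (b E.:* (a E.:* c))) refl f₁ f₀ f₁⁻¹) ⟩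
          φ.⟦ E.- (f₀ E.* (f₁ E.* f₁⁻¹)) ⟧        ≡⟨ cong (λ z → φ.⟦ E.- (f₀ E.* z) ⟧) (E.inv-inverseʳ f₁ f₁≢0) ⟩
          φ.⟦ E.- (f₀ E.* E.1#) ⟧                 ≡⟨ cong (λ z → φ.⟦ E.- z ⟧) (E.*-identityʳ f₀) ⟩
          φ.⟦ E.- f₀ ⟧                            ≡⟨ φ.-‿homo f₀ ⟩
          L.- φ.⟦ f₀ ⟧                            ≡⟨ L.solve 2 (λ a b → L.:- a L.:= b L.:- (a L.:+ b)) refl φ.⟦ f₀ ⟧ (φ.⟦ f₁ ⟧ L.* θ) ⟩
          φ.⟦ f₁ ⟧ L.* θ L.+ L.- (φ.⟦ f₀ ⟧ L.+ φ.⟦ f₁ ⟧ L.* θ)   ≡⟨ cong (λ z → φ.⟦ f₁ ⟧ L.* θ L.+ L.- z) value ⟩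
          φ.⟦ f₁ ⟧ L.* θ L.+ L.- L.0#             ≡⟨ L.solve 1 (λ a → a L.:- L.con ℤ.0ℤ L.:= a) refl (φ.⟦ f₁ ⟧ L.* θ) ⟩
          φ.⟦ f₁ ⟧ L.* θ                          ∎))
          where
          f₀ = coef f 0
          f₁ = coef f 1
          D₁ = subst (Degree f) d≡1 D
          f₁≢0 = leading≢0 D₁
          f₁⁻¹ = E.inv f₁ f₁≢0
          value : φ.⟦ f₀ ⟧ L.+ φ.⟦ f₁ ⟧ L.* θ ≡ L.0#
          value = begin
            φ.⟦ f₀ ⟧ L.+ φ.⟦ f₁ ⟧ L.* θ           ≡⟨ cong (φ.⟦ f₀ ⟧ L.+_) (trans (L.*-comm _ θ) (cong (θ L.*_) (sym (ev-const f₁)))) ⟩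
            ev (f₀ ∷ f₁ ∷ [])                     ≡⟨ ev-cong {f₀ ∷ f₁ ∷ []} {f} (pointwise λ { zero → refl ; (suc zero) → refl ; (suc (suc n)) → sym (bounded D₁ (suc (suc n)) (s≤s (s≤s z≤n))) }) ⟩
            ev f                                  ≡⟨ f[θ]≡0 ⟩
            L.0#                                  ∎

    Surjective : Subfield → Set
    Surjective S = ∀ θ → ∃ λ x → Hom.⟦ Subfield.φ S ⟧ x ≡ θ

    climb : (S : Subfield) → Acc ℕ._<_ (L.size ∸ FiniteField.size (Subfield.E S)) → Σ Subfield Surjective
    climb S (acc rec) = decide (search L.enum (λ θ → ¬? (preimage? θ)))
      where
      open Subfield S
      preimage? : ∀ θ → Dec (∃ λ x → Hom.⟦ φ ⟧ x ≡ θ)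
      preimage? θ = search (FiniteField.enum E) (λ x → Hom.⟦ φ ⟧ x L.≟ θ)
      decide : Dec (∃ λ θ → ¬ ∃ λ x → Hom.⟦ φ ⟧ x ≡ θ) → Σ Subfield Surjective
      decide (no ∄) = S , λ θ → decidable-stable (preimage? θ) (λ θ∉ → ∄ (θ , θ∉))
      decide (yes (θ , θ∉)) = climb adjoin (rec (ℕ.∸-monoʳ-< (larger λ x eq → θ∉ (x , eq))
        (injective⇒size≤ (FiniteField.enum (Subfield.E adjoin)) L.enum (Hom.⟦_⟧ (Subfield.φ adjoin)) (Hom.injective (Subfield.φ adjoin)))))
        where open Adjoin S θ

    S = proj₁ (climb start (<-wellFounded _))
    surj = proj₂ (climb start (<-wellFounded _))
    open Subfield S
    module E = FieldTheory E
    module φ = Hom φ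

    pre : L.F → E.F
    pre = proj₁ ∘ surj

    sec : ∀ θ → φ.⟦ pre θ ⟧ ≡ θ
    sec = proj₂ ∘ surj

    E≡L : E.size ≡ L.size
    E≡L = ℕ.≤-antisym (injective⇒size≤ E.enum L.enum φ.⟦_⟧ φ.injective)
                      (injective⇒size≤ L.enum E.enum pre (λ {x} {y} eq → trans (sym (sec x)) (trans (cong φ.⟦_⟧ eq) (sec y))))

  size≡char^ : ∃ λ k → L.size ≡ proj₁ (Characteristic.characteristic L) ℕ.^ k
  size≡char^ = exponent , trans (sym E≡L) size≡

  private
    p·1≡0 : p · K.1# ≡ K.0#
    p·1≡0 = Characteristic.power-·1≡0 K p exponent (subst (λ n → n · K.1# ≡ K.0#) (trans (sym sizes) (proj₂ size≡char^)) size·1≡0)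
    module ψ₀ = Hom (ψ p·1≡0)

  sameSize⇒hom : Hom L K
  sameSize⇒hom = record
    { ⟦_⟧ = ψ₀.⟦_⟧ ∘ pre
    ; +-homo = λ x y → trans (cong ψ₀.⟦_⟧ (φ.injective (trans (sec _) (trans (cong₂ L._+_ (sym (sec x)) (sym (sec y))) (sym (φ.+-homo _ _)))))) (ψ₀.+-homo _ _)
    ; *-homo = λ x y → trans (cong ψ₀.⟦_⟧ (φ.injective (trans (sec _) (trans (cong₂ L._*_ (sym (sec x)) (sym (sec y))) (sym (φ.*-homo _ _)))))) (ψ₀.*-homo _ _)
    ; 1-homo = trans (cong ψ₀.⟦_⟧ (φ.injective (trans (sec _) (sym φ.1-homo)))) ψ₀.1-homo }

-- If 1 + 1 = 0 the characteristic is 2, and the size, a power of the characteristic that is at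
-- least 2, is even.
odd⇒2≢0 : (K : FiniteField) → 2 ℕ.∤ FiniteField.size K → Char≢2 K
odd⇒2≢0 K 2∤size 1+1≡0 = even k size≡
  where
  open FieldTheory K
  open Counting K
  char = Characteristic.characteristic K
  open Characteristic.IsCharacteristic (proj₂ char)
  k = proj₁ (SameSize.size≡char^ K K refl)
  2·1≡0 : 2 · 1# ≡ 0#
  2·1≡0 = trans (cong (1# +_) (+-identityʳ 1#)) 1+1≡0
  p≡2 : proj₁ char ≡ 2
  p≡2 = go (proj₁ char) p≢0 p·1≡0 least
    where
    go : ∀ p → NonZero p → p · 1# ≡ 0# → (∀ n → n ℕ.< p → n · 1# ≡ 0# → n ≡ 0) → p ≡ 2
    go (suc zero) _ 1·1≡0 _ = ⊥-elim (1≢0 (trans (sym (+-identityʳ 1#)) 1·1≡0))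
    go (suc (suc zero)) _ _ _ = refl
    go (suc (suc (suc p))) _ _ least = contradiction (least 2 (s≤s (s≤s (s≤s z≤n))) 2·1≡0) λ ()
  size≡ : size ≡ 2 ℕ.^ k
  size≡ = trans (proj₂ (SameSize.size≡char^ K K refl)) (cong (ℕ._^ k) p≡2)
  even : ∀ k → size ≡ 2 ℕ.^ k → ⊥
  even zero eq = ℕ.1+n≰n (subst (2 ℕ.≤_) eq 2≤size)
  even (suc k) eq = 2∤size (subst (2 ℕ.∣_) (sym eq) (ℕ.m∣m*n (2 ℕ.^ k)))

-- Squares in a finite field of odd characteristic

module Squares (K : FiniteField) (2≢0 : Char≢2 K) where
  open FieldTheory K
  private
    module e = Inverse enum

    -- Tells x from - x, so that x ↦ (x * x , sign x) is injective.
    sign : F → Bool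
    sign x = does (e.from x Fin.<? e.from (- x))

    sign-0 : sign 0# ≡ false
    sign-0 = dec-false (_ Fin.<? _) (λ lt → Fin.<-irrefl (cong e.from (sym -0#≈0#)) lt)

    sign-neg : ∀ {x} → sign x ≡ sign (- x) → x ≡ 0#
    sign-neg {x} eq with e.from x Fin.<? e.from (- x) | e.from (- x) Fin.<? e.from (- - x)
    ... | yes lt | yes lt′ = ⊥-elim (Fin.<-asym lt (subst (λ z → e.from (- x) Fin.< e.from z) (-‿involutive x) lt′))
    ... | yes lt | no ≮ = contradiction (trans (sym (dec-true (_ Fin.<? _) lt)) (trans eq (dec-false (_ Fin.<? _) ≮))) λ ()
    ... | no ≮ | yes lt = contradiction (trans (sym (dec-true (_ Fin.<? _) lt)) (trans (sym eq) (dec-false (_ Fin.<? _) ≮))) λ ()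
    ... | no ≮ | no ≮′ = x≡-x⇒x≡0 2≢0 (from-injective enum (Fin.≤-antisym
      (ℕ.≮⇒≥ (subst (λ z → ¬ e.from (- x) Fin.< e.from z) (-‿involutive x) ≮′)) (ℕ.≮⇒≥ ≮)))

    signed-square-injective : ∀ {x y} → x * x ≡ y * y → sign x ≡ sign y → x ≡ y
    signed-square-injective {x} {y} x²≡y² s with x²≡y²⇒x≡±y x²≡y²
    ... | inj₁ eq = eq
    ... | inj₂ refl = trans (cong -_ y≡0) (trans -0#≈0# (sym y≡0))
      where y≡0 = sign-neg {y} (sym s)

  -- The squares x² and the values t + e y² each fill more than half of the field and must meet. To
  -- count without dividing by 2 the signs are recorded: if the two sets were disjoint, `f` would
  -- embed 2q + 1 elements into `F × Bool`, which has 2q, for q the size. The additional element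
  -- goes to `(0# , true)`, which no square reaches because `sign 0#` is `false`.
  norm-surjective : ∀ e → e ≢ 0# → ∀ t → ∃₂ λ x y → x * x + - (e * (y * y)) ≡ t
  norm-surjective e e≢0 t =
    let (x , y , p) = decidable-stable (search enum λ x → search enum λ y → (x * x + - (e * (y * y))) ≟ t) impossible
    in x , y , p
    where
    module _ (∄ : ¬ ∃₂ λ x y → x * x + - (e * (y * y)) ≡ t) where
      f : ⊤ ⊎ (F ⊎ F) → F × Bool
      f (inj₁ tt) = 0# , true
      f (inj₂ (inj₁ x)) = x * x , sign x
      f (inj₂ (inj₂ y)) = t + e * (y * y) , sign y

      meet : ∀ {x y} → x * x ≡ t + e * (y * y) → ⊥
      meet {x} {y} eq = ∄ (x , y , trans (cong (_+ - (e * (y * y))) eq) (solve 2 (λ t z → (t :+ z) :- z := t) refl t (e * (y * y))))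

      f-injective : ∀ {a b} → f a ≡ f b → a ≡ b
      f-injective {inj₁ tt} {inj₁ tt} _ = refl
      f-injective {inj₁ tt} {inj₂ (inj₁ x)} eq = zero-vs-square (cong proj₁ eq) (cong proj₂ eq)
        where
        zero-vs-square : ∀ {a : Set} → 0# ≡ x * x → true ≡ sign x → a
        zero-vs-square 0≡x² s = contradiction (trans s (trans (cong sign (x²≡0⇒x≡0 (sym 0≡x²))) sign-0)) λ ()
      f-injective {inj₁ tt} {inj₂ (inj₂ y)} eq = ⊥-elim (meet {0#} {y} (trans (zeroˡ 0#) (cong proj₁ eq)))
      f-injective {inj₂ (inj₁ x)} {inj₁ tt} eq = sym (f-injective {inj₁ tt} {inj₂ (inj₁ x)} (sym eq))
      f-injective {inj₂ (inj₂ y)} {inj₁ tt} eq = sym (f-injective {inj₁ tt} {inj₂ (inj₂ y)} (sym eq))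
      f-injective {inj₂ (inj₁ x)} {inj₂ (inj₁ x′)} eq = cong (inj₂ ∘ inj₁) (signed-square-injective (cong proj₁ eq) (cong proj₂ eq))
      f-injective {inj₂ (inj₁ x)} {inj₂ (inj₂ y)} eq = ⊥-elim (meet {x} {y} (cong proj₁ eq))
      f-injective {inj₂ (inj₂ y)} {inj₂ (inj₁ x)} eq = ⊥-elim (meet {x} {y} (sym (cong proj₁ eq)))
      f-injective {inj₂ (inj₂ y)} {inj₂ (inj₂ y′)} eq = cong (inj₂ ∘ inj₂) (signed-square-injective
        (*-cancelˡ e≢0 (begin
          e * (y * y)                   ≡⟨ solve 2 (λ t z → z := (t :+ z) :- t) refl t (e * (y * y)) ⟩
          (t + e * (y * y)) + - t       ≡⟨ cong (λ z → z + - t) (cong proj₁ eq) ⟩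
          (t + e * (y′ * y′)) + - t     ≡⟨ solve 2 (λ t z → z := (t :+ z) :- t) refl t (e * (y′ * y′)) ⟨
          e * (y′ * y′)                 ∎))
        (cong proj₂ eq))

      impossible : ⊥
      impossible = ℕ.1+n≰n {size ℕ.+ size} (subst (suc (size ℕ.+ size) ℕ.≤_) (trans (ℕ.*-comm size 2) (cong (size ℕ.+_) (ℕ.+-identityʳ size)))
        (injective⇒size≤ ((Fin.1↔⊤ ⊎-↔ ((enum ⊎-↔ enum) ↔-∘ Fin.+↔⊎)) ↔-∘ Fin.+↔⊎) ((enum ×-↔ Fin.2↔Bool) ↔-∘ Fin.*↔×) f (λ {a} {b} → f-injective {a} {b})))

  private
    module TooManyClasses (n : ℕ) (enum′ : Fin (suc n) ↔ F) (class : Fin 3 → F) (class≢0 : ∀ k → class k ≢ 0#)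
      (disjoint : ∀ {k l x y} → x ≢ 0# → y ≢ 0# → class k * (x * x) ≡ class l * (y * y) → k ≡ l) where
      module e′ = Inverse enum′
      z = e′.from 0#

      nonzero : Fin n → F
      nonzero i = e′.to (punchIn z i)

      nonzero≢0 : ∀ i → nonzero i ≢ 0#
      nonzero≢0 i eq = Fin.punchInᵢ≢i z i (trans (sym (e′.strictlyInverseʳ _)) (cong e′.from eq))

      z≢ : ∀ {x} → x ≢ 0# → z ≢ e′.from x
      z≢ x≢0 eq = x≢0 (sym (from-injective enum′ eq))

      value : Fin 3 × Fin n → F
      value (k , i) = class k * (nonzero i * nonzero i)

      value≢0 : ∀ a → value a ≢ 0#
      value≢0 (k , i) = x*y≢0 (class≢0 k) (x*y≢0 (nonzero≢0 i) (nonzero≢0 i))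

      f : Fin 3 × Fin n → Fin n × Bool
      f (k , i) = punchOut (z≢ (value≢0 (k , i))) , sign (nonzero i)

      f-injective : ∀ {a b} → f a ≡ f b → a ≡ b
      f-injective {k , i} {l , j} eq = combine (disjoint (nonzero≢0 i) (nonzero≢0 j) same)
        where
        same : value (k , i) ≡ value (l , j)
        same = from-injective enum′ (Fin.punchOut-injective (z≢ (value≢0 (k , i))) (z≢ (value≢0 (l , j))) (cong proj₁ eq))
        combine : k ≡ l → (k , i) ≡ (l , j)
        combine refl = cong (k ,_) (Fin.punchIn-injective z i j (to-injective enum′
          (signed-square-injective (*-cancelˡ (class≢0 k) same) (cong proj₂ eq))))

      3n≤2n : 3 ℕ.* n ℕ.≤ n ℕ.* 2
      3n≤2n = injective⇒size≤ Fin.*↔× ((↔-id _ ×-↔ Fin.2↔Bool) ↔-∘ Fin.*↔×) f f-injective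

      n≡0 : n ≡ 0
      n≡0 = ℕ.n≤0⇒n≡0 (ℕ.+-cancelʳ-≤ (n ℕ.+ (n ℕ.+ 0)) n 0 (subst (3 ℕ.* n ℕ.≤_) (ℕ.*-comm n 2) 3n≤2n))

  IsSquare : F → Set
  IsSquare x = ∃ λ r → r * r ≡ x

  square? : ∀ x → Dec (IsSquare x)
  square? x = search enum (λ r → (r * r) ≟ x)

  -- Otherwise 1, `s` and `d` would lie in three different classes modulo nonzero squares. Sending a
  -- class and a nonzero x to the class times x², together with the sign of x, would embed 3n pairs
  -- into 2n, n being the number of nonzero elements.
  nonsquare-index-2 : ∀ {s d} → ¬ IsSquare s → d ≢ 0# → IsSquare d ⊎ IsSquare (s * d)
  nonsquare-index-2 {s} {d} ¬□s d≢0 with square? d | square? (s * d)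
  ... | yes □ | _ = inj₁ □
  ... | _ | yes □ = inj₂ □
  ... | no ¬□d | no ¬□sd = ⊥-elim (go size (Counting.2≤size K) enum)
    where
    s≢0 : s ≢ 0#
    s≢0 refl = ¬□s (0# , zeroˡ 0#)
    class : Fin 3 → F
    class zero = 1#
    class (suc zero) = s
    class (suc (suc zero)) = d
    class≢0 : ∀ k → class k ≢ 0#
    class≢0 zero = 1≢0
    class≢0 (suc zero) = s≢0
    class≢0 (suc (suc zero)) = d≢0
    ratio : ∀ {c x y} → y ≢ 0# → 1# * (x * x) ≡ c * (y * y) → IsSquare c
    ratio {c} {x} {y} y≢0 eq = x * inv y y≢0 , (begin
      (x * inv y y≢0) * (x * inv y y≢0)            ≡⟨ solve 2 (λ x i → (x :* i) :* (x :* i) := (con ℤ.1ℤ :* (x :* x)) :* (i :* i)) refl x (inv y y≢0) ⟩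
      (1# * (x * x)) * (inv y y≢0 * inv y y≢0)     ≡⟨ cong (_* (inv y y≢0 * inv y y≢0)) eq ⟩
      (c * (y * y)) * (inv y y≢0 * inv y y≢0)      ≡⟨ solve 3 (λ c y i → (c :* (y :* y)) :* (i :* i) := c :* ((y :* i) :* (y :* i))) refl c y (inv y y≢0) ⟩
      c * ((y * inv y y≢0) * (y * inv y y≢0))      ≡⟨ cong (λ z → c * (z * z)) (inv-inverseʳ y y≢0) ⟩
      c * (1# * 1#)                                ≡⟨ solve 1 (λ c → c :* (con ℤ.1ℤ :* con ℤ.1ℤ) := c) refl c ⟩
      c                                            ∎)
    ratio′ : ∀ {x y} → y ≢ 0# → s * (x * x) ≡ d * (y * y) → IsSquare (s * d)
    ratio′ {x} {y} y≢0 eq = ratio {s * d} {s * x} y≢0 (begin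
      1# * ((s * x) * (s * x))    ≡⟨ solve 2 (λ s x → con ℤ.1ℤ :* ((s :* x) :* (s :* x)) := s :* (s :* (x :* x))) refl s x ⟩
      s * (s * (x * x))           ≡⟨ cong (s *_) eq ⟩
      s * (d * (y * y))           ≡⟨ *-assoc s d _ ⟨
      s * d * (y * y)             ∎)
    disjoint : ∀ {k l x y} → x ≢ 0# → y ≢ 0# → class k * (x * x) ≡ class l * (y * y) → k ≡ l
    disjoint {zero} {zero} _ _ _ = refl
    disjoint {zero} {suc zero} _ y≢0 eq = ⊥-elim (¬□s (ratio y≢0 eq))
    disjoint {zero} {suc (suc zero)} _ y≢0 eq = ⊥-elim (¬□d (ratio y≢0 eq))
    disjoint {suc zero} {zero} x≢0 _ eq = ⊥-elim (¬□s (ratio x≢0 (sym eq)))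
    disjoint {suc zero} {suc zero} _ _ _ = refl
    disjoint {suc zero} {suc (suc zero)} _ y≢0 eq = ⊥-elim (¬□sd (ratio′ y≢0 eq))
    disjoint {suc (suc zero)} {zero} x≢0 _ eq = ⊥-elim (¬□d (ratio x≢0 (sym eq)))
    disjoint {suc (suc zero)} {suc zero} x≢0 _ eq = ⊥-elim (¬□sd (ratio′ x≢0 (sym eq)))
    disjoint {suc (suc zero)} {suc (suc zero)} _ _ _ = refl
    go : ∀ n → 2 ℕ.≤ n → Fin n ↔ F → ⊥
    go (suc (suc n)) _ enum′ = contradiction (TooManyClasses.n≡0 (suc n) enum′ class class≢0 disjoint) λ ()
    go (suc zero) (s≤s ())

-- Quaternion algebras

-- The coordinates of a product in the quaternion algebra (ε, J) over R, spelled as in Defs._·Q_.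
module QuaternionCoordinates {c ℓ} (R : CommutativeRing c ℓ) (ε J : CommutativeRing.Carrier R) where
  private module R = CommutativeRing R
  open R using (Carrier; _≈_; _+_; _*_; -_)
  open IntegerCoefficients R

  -- The same formulas as solver expressions, so that identities between products need not be
  -- expanded by hand.
  module Symbolic {n} (ε J : Polynomial n) where
    N : (a b c d : Polynomial n) → Polynomial n
    N a b c d = (a :* a :- ε :* (b :* b)) :- J :* (c :* c :- ε :* (d :* d))

    module _ (a₁ b₁ c₁ d₁ a₂ b₂ c₂ d₂ : Polynomial n) where
      *a *b *c *d : Polynomial n
      *a = (a₁ :* a₂) :+ ((ε :* (b₁ :* b₂)) :+ ((J :* (c₁ :* c₂)) :- ((ε :* J) :* (d₁ :* d₂))))
      *b = (a₁ :* b₂) :+ ((b₁ :* a₂) :+ ((:- (J :* (c₁ :* d₂))) :+ (J :* (d₁ :* c₂))))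
      *c = (a₁ :* c₂) :+ ((c₁ :* a₂) :+ ((ε :* (b₁ :* d₂)) :- (ε :* (d₁ :* b₂))))
      *d = (a₁ :* d₂) :+ ((d₁ :* a₂) :+ ((b₁ :* c₂) :- (c₁ :* b₂)))

  N : (a b c d : Carrier) → Carrier
  N a b c d = (a * a + - (ε * (b * b))) + - (J * (c * c + - (ε * (d * d))))

  module _ (a₁ b₁ c₁ d₁ a₂ b₂ c₂ d₂ : Carrier) where
    *a *b *c *d : Carrier
    *a = (a₁ * a₂) + ((ε * (b₁ * b₂)) + ((J * (c₁ * c₂)) + (- ((ε * J) * (d₁ * d₂)))))
    *b = (a₁ * b₂) + ((b₁ * a₂) + ((- (J * (c₁ * d₂))) + (J * (d₁ * c₂))))
    *c = (a₁ * c₂) + ((c₁ * a₂) + ((ε * (b₁ * d₂)) + (- (ε * (d₁ * b₂)))))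
    *d = (a₁ * d₂) + ((d₁ * a₂) + ((b₁ * c₂) + (- (c₁ * b₂))))

    N-* : N *a *b *c *d ≈ N a₁ b₁ c₁ d₁ * N a₂ b₂ c₂ d₂
    N-* = solve 10 (λ ε J a₁ b₁ c₁ d₁ a₂ b₂ c₂ d₂ → let module H = Symbolic ε J in
      H.N (H.*a a₁ b₁ c₁ d₁ a₂ b₂ c₂ d₂) (H.*b a₁ b₁ c₁ d₁ a₂ b₂ c₂ d₂) (H.*c a₁ b₁ c₁ d₁ a₂ b₂ c₂ d₂) (H.*d a₁ b₁ c₁ d₁ a₂ b₂ c₂ d₂)
      := H.N a₁ b₁ c₁ d₁ :* H.N a₂ b₂ c₂ d₂) R.refl ε J a₁ b₁ c₁ d₁ a₂ b₂ c₂ d₂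

  N-cong : ∀ {a b c d a′ b′ c′ d′} → a ≈ a′ → b ≈ b′ → c ≈ c′ → d ≈ d′ → N a b c d ≈ N a′ b′ c′ d′
  N-cong a b c d = R.+-cong (R.+-cong (R.*-cong a a) (R.-‿cong (R.*-congˡ (R.*-cong b b))))
    (R.-‿cong (R.*-congˡ (R.+-cong (R.*-cong c c) (R.-‿cong (R.*-congˡ (R.*-cong d d))))))

  N-conj : ∀ a b c d → N a (- b) (- c) (- d) ≈ N a b c d
  N-conj = solve 6 (λ ε J a b c d → let module H = Symbolic ε J in H.N a (:- b) (:- c) (:- d) := H.N a b c d) R.refl ε J

  N-pure : ∀ a k b c d → N a (k * b) (k * c) (k * d) ≈ a * a + (k * k) * N R.0# b c d
  N-pure = solve 7 (λ ε J a k b c d → let module H = Symbolic ε J in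
    H.N a (k :* b) (k :* c) (k :* d) := a :* a :+ (k :* k) :* H.N (con ℤ.0ℤ) b c d) R.refl ε J

  N-1 : ∀ c d → N R.1# R.0# c d ≈ R.1# + J * (ε * (d * d) + - (c * c))
  N-1 = solve 4 (λ ε J c d → let module H = Symbolic ε J in
    H.N (con ℤ.1ℤ) (con ℤ.0ℤ) c d := con ℤ.1ℤ :+ J :* (ε :* (d :* d) :- c :* c)) R.refl ε J

  N-jk : ∀ c d → N R.0# R.0# c d ≈ J * (ε * (d * d) + - (c * c))
  N-jk = solve 4 (λ ε J c d → let module H = Symbolic ε J in
    H.N (con ℤ.0ℤ) (con ℤ.0ℤ) c d := J :* (ε :* (d :* d) :- c :* c)) R.refl ε J

  N-scale : ∀ k a b c d → N (k * a) (k * b) (k * c) (k * d) ≈ k * (k * N a b c d)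
  N-scale = solve 7 (λ ε J k a b c d → let module H = Symbolic ε J in
    H.N (k :* a) (k :* b) (k :* c) (k :* d) := k :* (k :* H.N a b c d)) R.refl ε J

  -- x ↦ m x m̄ multiplies the trace by the norm of m, so trace zero is preserved.
  sandwich-pure : ∀ a₁ b₁ c₁ d₁ b₂ c₂ d₂ →
    *a (*a a₁ b₁ c₁ d₁ R.0# b₂ c₂ d₂) (*b a₁ b₁ c₁ d₁ R.0# b₂ c₂ d₂) (*c a₁ b₁ c₁ d₁ R.0# b₂ c₂ d₂) (*d a₁ b₁ c₁ d₁ R.0# b₂ c₂ d₂)
       a₁ (- b₁) (- c₁) (- d₁) ≈ R.0#
  sandwich-pure = solve 9 (λ ε J a₁ b₁ c₁ d₁ b₂ c₂ d₂ → let module H = Symbolic ε J ; o = con ℤ.0ℤ in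
    H.*a (H.*a a₁ b₁ c₁ d₁ o b₂ c₂ d₂) (H.*b a₁ b₁ c₁ d₁ o b₂ c₂ d₂) (H.*c a₁ b₁ c₁ d₁ o b₂ c₂ d₂) (H.*d a₁ b₁ c₁ d₁ o b₂ c₂ d₂)
         a₁ (:- b₁) (:- c₁) (:- d₁) := o) R.refl ε J

infix 4 _,ᵢ_,ⱼ_,ₖ_
record ℍ (K : FiniteField) : Set where
  constructor _,ᵢ_,ⱼ_,ₖ_
  open FiniteField K using (F)
  field a b c d : F

module QuaternionAlgebra (K : FiniteField) (ε J : FiniteField.F K) where
  open FieldTheory K
  open QuaternionCoordinates commutativeRing ε J

  infixl 7 _•_
  _•_ : ℍ K → ℍ K → ℍ K
  (a₁ ,ᵢ b₁ ,ⱼ c₁ ,ₖ d₁) • (a₂ ,ᵢ b₂ ,ⱼ c₂ ,ₖ d₂) =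
    *a a₁ b₁ c₁ d₁ a₂ b₂ c₂ d₂ ,ᵢ *b a₁ b₁ c₁ d₁ a₂ b₂ c₂ d₂ ,ⱼ *c a₁ b₁ c₁ d₁ a₂ b₂ c₂ d₂ ,ₖ *d a₁ b₁ c₁ d₁ a₂ b₂ c₂ d₂

  real : F → ℍ K
  real x = x ,ᵢ 0# ,ⱼ 0# ,ₖ 0#

  conjugate : ℍ K → ℍ K
  conjugate (a ,ᵢ b ,ⱼ c ,ₖ d) = a ,ᵢ - b ,ⱼ - c ,ₖ - d

  infixr 8 _∙_
  _∙_ : F → ℍ K → ℍ K
  x ∙ (a ,ᵢ b ,ⱼ c ,ₖ d) = (x * a) ,ᵢ (x * b) ,ⱼ (x * c) ,ₖ (x * d)

  norm : ℍ K → F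
  norm (a ,ᵢ b ,ⱼ c ,ₖ d) = N a b c d

  IsReal : ℍ K → Set
  IsReal (a ,ᵢ b ,ⱼ c ,ₖ d) = b ≡ 0# × c ≡ 0# × d ≡ 0#

  ℍ-≡ : {a b c d a′ b′ c′ d′ : F} → a ≡ a′ → b ≡ b′ → c ≡ c′ → d ≡ d′ → _≡_ {A = ℍ K} (a ,ᵢ b ,ⱼ c ,ₖ d) (a′ ,ᵢ b′ ,ⱼ c′ ,ₖ d′)
  ℍ-≡ refl refl refl refl = refl

  norm-• : ∀ x y → norm (x • y) ≡ norm x * norm y
  norm-• (a₁ ,ᵢ b₁ ,ⱼ c₁ ,ₖ d₁) (a₂ ,ᵢ b₂ ,ⱼ c₂ ,ₖ d₂) = N-* a₁ b₁ c₁ d₁ a₂ b₂ c₂ d₂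

  norm-conjugate : ∀ x → norm (conjugate x) ≡ norm x
  norm-conjugate (a ,ᵢ b ,ⱼ c ,ₖ d) = N-conj a b c d

  norm-real : norm (real 1#) ≡ 1#
  norm-real = solve 2 (λ ε J → let module H = Symbolic ε J ; o = con ℤ.0ℤ in H.N (con ℤ.1ℤ) o o o := con ℤ.1ℤ) refl ε J

  •-assoc : ∀ x y z → (x • y) • z ≡ x • (y • z)
  •-assoc (a₁ ,ᵢ b₁ ,ⱼ c₁ ,ₖ d₁) (a₂ ,ᵢ b₂ ,ⱼ c₂ ,ₖ d₂) (a₃ ,ᵢ b₃ ,ⱼ c₃ ,ₖ d₃) = ℍ-≡
    (solve 14 (λ ε J a₁ b₁ c₁ d₁ a₂ b₂ c₂ d₂ a₃ b₃ c₃ d₃ → let module H = Symbolic ε J in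
       H.*a (H.*a a₁ b₁ c₁ d₁ a₂ b₂ c₂ d₂) (H.*b a₁ b₁ c₁ d₁ a₂ b₂ c₂ d₂) (H.*c a₁ b₁ c₁ d₁ a₂ b₂ c₂ d₂) (H.*d a₁ b₁ c₁ d₁ a₂ b₂ c₂ d₂) a₃ b₃ c₃ d₃
       := H.*a a₁ b₁ c₁ d₁ (H.*a a₂ b₂ c₂ d₂ a₃ b₃ c₃ d₃) (H.*b a₂ b₂ c₂ d₂ a₃ b₃ c₃ d₃) (H.*c a₂ b₂ c₂ d₂ a₃ b₃ c₃ d₃) (H.*d a₂ b₂ c₂ d₂ a₃ b₃ c₃ d₃))
       refl ε J a₁ b₁ c₁ d₁ a₂ b₂ c₂ d₂ a₃ b₃ c₃ d₃)
    (solve 14 (λ ε J a₁ b₁ c₁ d₁ a₂ b₂ c₂ d₂ a₃ b₃ c₃ d₃ → let module H = Symbolic ε J in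
       H.*b (H.*a a₁ b₁ c₁ d₁ a₂ b₂ c₂ d₂) (H.*b a₁ b₁ c₁ d₁ a₂ b₂ c₂ d₂) (H.*c a₁ b₁ c₁ d₁ a₂ b₂ c₂ d₂) (H.*d a₁ b₁ c₁ d₁ a₂ b₂ c₂ d₂) a₃ b₃ c₃ d₃
       := H.*b a₁ b₁ c₁ d₁ (H.*a a₂ b₂ c₂ d₂ a₃ b₃ c₃ d₃) (H.*b a₂ b₂ c₂ d₂ a₃ b₃ c₃ d₃) (H.*c a₂ b₂ c₂ d₂ a₃ b₃ c₃ d₃) (H.*d a₂ b₂ c₂ d₂ a₃ b₃ c₃ d₃))
       refl ε J a₁ b₁ c₁ d₁ a₂ b₂ c₂ d₂ a₃ b₃ c₃ d₃)
    (solve 14 (λ ε J a₁ b₁ c₁ d₁ a₂ b₂ c₂ d₂ a₃ b₃ c₃ d₃ → let module H = Symbolic ε J in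
       H.*c (H.*a a₁ b₁ c₁ d₁ a₂ b₂ c₂ d₂) (H.*b a₁ b₁ c₁ d₁ a₂ b₂ c₂ d₂) (H.*c a₁ b₁ c₁ d₁ a₂ b₂ c₂ d₂) (H.*d a₁ b₁ c₁ d₁ a₂ b₂ c₂ d₂) a₃ b₃ c₃ d₃
       := H.*c a₁ b₁ c₁ d₁ (H.*a a₂ b₂ c₂ d₂ a₃ b₃ c₃ d₃) (H.*b a₂ b₂ c₂ d₂ a₃ b₃ c₃ d₃) (H.*c a₂ b₂ c₂ d₂ a₃ b₃ c₃ d₃) (H.*d a₂ b₂ c₂ d₂ a₃ b₃ c₃ d₃))
       refl ε J a₁ b₁ c₁ d₁ a₂ b₂ c₂ d₂ a₃ b₃ c₃ d₃)
    (solve 14 (λ ε J a₁ b₁ c₁ d₁ a₂ b₂ c₂ d₂ a₃ b₃ c₃ d₃ → let module H = Symbolic ε J in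
       H.*d (H.*a a₁ b₁ c₁ d₁ a₂ b₂ c₂ d₂) (H.*b a₁ b₁ c₁ d₁ a₂ b₂ c₂ d₂) (H.*c a₁ b₁ c₁ d₁ a₂ b₂ c₂ d₂) (H.*d a₁ b₁ c₁ d₁ a₂ b₂ c₂ d₂) a₃ b₃ c₃ d₃
       := H.*d a₁ b₁ c₁ d₁ (H.*a a₂ b₂ c₂ d₂ a₃ b₃ c₃ d₃) (H.*b a₂ b₂ c₂ d₂ a₃ b₃ c₃ d₃) (H.*c a₂ b₂ c₂ d₂ a₃ b₃ c₃ d₃) (H.*d a₂ b₂ c₂ d₂ a₃ b₃ c₃ d₃))
       refl ε J a₁ b₁ c₁ d₁ a₂ b₂ c₂ d₂ a₃ b₃ c₃ d₃)

  conjugate-• : ∀ x y → conjugate (x • y) ≡ conjugate y • conjugate x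
  conjugate-• (a₁ ,ᵢ b₁ ,ⱼ c₁ ,ₖ d₁) (a₂ ,ᵢ b₂ ,ⱼ c₂ ,ₖ d₂) = ℍ-≡
    (solve 10 (λ ε J a₁ b₁ c₁ d₁ a₂ b₂ c₂ d₂ → let module H = Symbolic ε J in
       H.*a a₁ b₁ c₁ d₁ a₂ b₂ c₂ d₂ := H.*a a₂ (:- b₂) (:- c₂) (:- d₂) a₁ (:- b₁) (:- c₁) (:- d₁)) refl ε J a₁ b₁ c₁ d₁ a₂ b₂ c₂ d₂)
    (solve 10 (λ ε J a₁ b₁ c₁ d₁ a₂ b₂ c₂ d₂ → let module H = Symbolic ε J in
       :- (H.*b a₁ b₁ c₁ d₁ a₂ b₂ c₂ d₂) := H.*b a₂ (:- b₂) (:- c₂) (:- d₂) a₁ (:- b₁) (:- c₁) (:- d₁)) refl ε J a₁ b₁ c₁ d₁ a₂ b₂ c₂ d₂)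
    (solve 10 (λ ε J a₁ b₁ c₁ d₁ a₂ b₂ c₂ d₂ → let module H = Symbolic ε J in
       :- (H.*c a₁ b₁ c₁ d₁ a₂ b₂ c₂ d₂) := H.*c a₂ (:- b₂) (:- c₂) (:- d₂) a₁ (:- b₁) (:- c₁) (:- d₁)) refl ε J a₁ b₁ c₁ d₁ a₂ b₂ c₂ d₂)
    (solve 10 (λ ε J a₁ b₁ c₁ d₁ a₂ b₂ c₂ d₂ → let module H = Symbolic ε J in
       :- (H.*d a₁ b₁ c₁ d₁ a₂ b₂ c₂ d₂) := H.*d a₂ (:- b₂) (:- c₂) (:- d₂) a₁ (:- b₁) (:- c₁) (:- d₁)) refl ε J a₁ b₁ c₁ d₁ a₂ b₂ c₂ d₂)

  •-conjugate : ∀ x → x • conjugate x ≡ real (norm x)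
  •-conjugate (a ,ᵢ b ,ⱼ c ,ₖ d) = ℍ-≡
    (solve 6 (λ ε J a b c d → let module H = Symbolic ε J in H.*a a b c d a (:- b) (:- c) (:- d) := H.N a b c d) refl ε J a b c d)
    (solve 6 (λ ε J a b c d → let module H = Symbolic ε J in H.*b a b c d a (:- b) (:- c) (:- d) := con ℤ.0ℤ) refl ε J a b c d)
    (solve 6 (λ ε J a b c d → let module H = Symbolic ε J in H.*c a b c d a (:- b) (:- c) (:- d) := con ℤ.0ℤ) refl ε J a b c d)
    (solve 6 (λ ε J a b c d → let module H = Symbolic ε J in H.*d a b c d a (:- b) (:- c) (:- d) := con ℤ.0ℤ) refl ε J a b c d)

  conjugate-involutive : ∀ x → conjugate (conjugate x) ≡ x
  conjugate-involutive (a ,ᵢ b ,ⱼ c ,ₖ d) = ℍ-≡ refl (-‿involutive b) (-‿involutive c) (-‿involutive d)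

  conjugate-∙ : ∀ k x → conjugate (k ∙ x) ≡ k ∙ conjugate x
  conjugate-∙ k (a ,ᵢ b ,ⱼ c ,ₖ d) = ℍ-≡ refl (-‿distribʳ-* k b) (-‿distribʳ-* k c) (-‿distribʳ-* k d)

  conjugate-•-self : ∀ x → conjugate x • x ≡ real (norm x)
  conjugate-•-self x = begin
    conjugate x • x                            ≡⟨ cong (conjugate x •_) (conjugate-involutive x) ⟨
    conjugate x • conjugate (conjugate x)      ≡⟨ •-conjugate (conjugate x) ⟩
    real (norm (conjugate x))                  ≡⟨ cong real (norm-conjugate x) ⟩
    real (norm x)                              ∎

  real-• : ∀ k x → real k • x ≡ k ∙ x
  real-• k (a ,ᵢ b ,ⱼ c ,ₖ d) = ℍ-≡
    (solve 7 (λ ε J k a b c d → let module H = Symbolic ε J ; o = con ℤ.0ℤ in H.*a k o o o a b c d := k :* a) refl ε J k a b c d)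
    (solve 7 (λ ε J k a b c d → let module H = Symbolic ε J ; o = con ℤ.0ℤ in H.*b k o o o a b c d := k :* b) refl ε J k a b c d)
    (solve 7 (λ ε J k a b c d → let module H = Symbolic ε J ; o = con ℤ.0ℤ in H.*c k o o o a b c d := k :* c) refl ε J k a b c d)
    (solve 7 (λ ε J k a b c d → let module H = Symbolic ε J ; o = con ℤ.0ℤ in H.*d k o o o a b c d := k :* d) refl ε J k a b c d)

  •-real : ∀ k x → x • real k ≡ k ∙ x
  •-real k (a ,ᵢ b ,ⱼ c ,ₖ d) = ℍ-≡
    (solve 7 (λ ε J k a b c d → let module H = Symbolic ε J ; o = con ℤ.0ℤ in H.*a a b c d k o o o := k :* a) refl ε J k a b c d)
    (solve 7 (λ ε J k a b c d → let module H = Symbolic ε J ; o = con ℤ.0ℤ in H.*b a b c d k o o o := k :* b) refl ε J k a b c d)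
    (solve 7 (λ ε J k a b c d → let module H = Symbolic ε J ; o = con ℤ.0ℤ in H.*c a b c d k o o o := k :* c) refl ε J k a b c d)
    (solve 7 (λ ε J k a b c d → let module H = Symbolic ε J ; o = con ℤ.0ℤ in H.*d a b c d k o o o := k :* d) refl ε J k a b c d)

  1∙ : ∀ x → 1# ∙ x ≡ x
  1∙ (a ,ᵢ b ,ⱼ c ,ₖ d) = ℍ-≡ (*-identityˡ a) (*-identityˡ b) (*-identityˡ c) (*-identityˡ d)

  ∙-∙ : ∀ k l x → k ∙ l ∙ x ≡ (k * l) ∙ x
  ∙-∙ k l (a ,ᵢ b ,ⱼ c ,ₖ d) = ℍ-≡ (sym (*-assoc k l a)) (sym (*-assoc k l b)) (sym (*-assoc k l c)) (sym (*-assoc k l d))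

  ∙-• : ∀ k x y → (k ∙ x) • y ≡ k ∙ (x • y)
  ∙-• k x y = begin
    (k ∙ x) • y             ≡⟨ cong (_• y) (real-• k x) ⟨
    (real k • x) • y        ≡⟨ •-assoc (real k) x y ⟩
    real k • (x • y)        ≡⟨ real-• k (x • y) ⟩
    k ∙ (x • y)             ∎

  •-∙ : ∀ k x y → x • (k ∙ y) ≡ k ∙ (x • y)
  •-∙ k x y = begin
    x • (k ∙ y)             ≡⟨ cong (x •_) (•-real k y) ⟨
    x • (y • real k)        ≡⟨ •-assoc x y (real k) ⟨
    (x • y) • real k        ≡⟨ •-real k (x • y) ⟩
    k ∙ (x • y)             ∎

  IsReal⇒real : ∀ {x} → IsReal x → x ≡ real (ℍ.a x)
  IsReal⇒real (refl , refl , refl) = refl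

  norm-IsReal : ∀ {x} → IsReal x → norm x ≡ ℍ.a x * ℍ.a x
  norm-IsReal {a ,ᵢ _ ,ⱼ _ ,ₖ _} (refl , refl , refl) =
    solve 3 (λ ε J a → let module H = Symbolic ε J ; o = con ℤ.0ℤ in H.N a o o o := a :* a) refl ε J a

module WordValues (𝔽 : FiniteField) (ε : FiniteField.F 𝔽) (K : FiniteField) (e j : FiniteField.F K) (value : Sol 𝔽 ε → ℍ K) where
  open FieldTheory K
  open QuaternionAlgebra K e j

  letterValue : Letter 𝔽 ε → ℍ K
  letterValue (false , s) = value s
  letterValue (true , s) = conjugate (value s)

  wordValue : Word 𝔽 ε → ℍ K
  wordValue [] = real 1#
  wordValue (l ∷ w) = letterValue l • wordValue w

  wordValue-++ : ∀ v w → wordValue (v ++ w) ≡ wordValue v • wordValue w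
  wordValue-++ [] w = sym (trans (real-• 1# _) (1∙ _))
  wordValue-++ (l ∷ v) w = trans (cong (letterValue l •_) (wordValue-++ v w)) (sym (•-assoc (letterValue l) (wordValue v) (wordValue w)))

  private
    flip : Letter 𝔽 ε → Letter 𝔽 ε
    flip = λ { (b , s) → (if b then false else true) , s }

    letterValue-flip : ∀ l → letterValue (flip l) ≡ conjugate (letterValue l)
    letterValue-flip (false , s) = refl
    letterValue-flip (true , s) = sym (conjugate-involutive (value s))

    wordValue-reverse-flip : ∀ w → wordValue (reverse (map flip w)) ≡ conjugate (wordValue w)
    wordValue-reverse-flip [] = ℍ-≡ refl (sym -0#≈0#) (sym -0#≈0#) (sym -0#≈0#)
    wordValue-reverse-flip (l ∷ w) = begin
      wordValue (reverse (flip l ∷ map flip w))                          ≡⟨ cong wordValue (List.unfold-reverse (flip l) (map flip w)) ⟩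
      wordValue (reverse (map flip w) ∷ʳ flip l)                         ≡⟨ wordValue-++ (reverse (map flip w)) [ flip l ] ⟩
      wordValue (reverse (map flip w)) • (letterValue (flip l) • real 1#)
        ≡⟨ cong₂ _•_ (wordValue-reverse-flip w) (trans (•-real 1# _) (trans (1∙ _) (letterValue-flip l))) ⟩
      conjugate (wordValue w) • conjugate (letterValue l)                ≡⟨ conjugate-• (letterValue l) (wordValue w) ⟨
      conjugate (letterValue l • wordValue w)                            ∎

  wordValue-invWord : ∀ w → wordValue (invWord 𝔽 ε w) ≡ conjugate (wordValue w)
  -- The pattern lambda inside `invWord` and the one in `flip` are distinct functions to the type
  -- checker and agree only after matching on the letter.
  wordValue-invWord w = trans (cong (wordValue ∘ reverse) (List.map-cong (λ { (b , s) → refl }) w)) (wordValue-reverse-flip w)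

  norm-wordValue : ∀ {n} → (∀ s → norm (value s) ≡ n) → ∀ w → norm (wordValue w) ≡ n ^ length w
  norm-wordValue n≡ [] = norm-real
  norm-wordValue {n} n≡ ((b , s) ∷ w) = trans (norm-• (letterValue (b , s)) (wordValue w)) (cong₂ _*_ (letter b) (norm-wordValue n≡ w))
    where
    letter : ∀ b → norm (letterValue (b , s)) ≡ n
    letter false = n≡ s
    letter true = trans (norm-conjugate (value s)) (n≡ s)

module QuatEvaluation (𝔽 : FiniteField) (ε : FiniteField.F 𝔽) {K : FiniteField} (φ : Hom 𝔽 K) (α : FiniteField.F K) where
  private
    module 𝔽 = FieldTheory 𝔽
    module φ = Hom φ
  open FieldTheory K
  open PolyTheory 𝔽 using (_⊕_; _⊗_; ⊖_; _≋_; _∣_; multiple; ≋⇒≈; ≈⇒≋; ≋-refl; ⊗-cancelˡ; ⊗≢[]; ∣ₚ⇒∣; ∣⇒∣ₚ; ≋-trans; ≋-sym; ⊗-cong; ⊗-comm; IsZero⇒≋[]; ≋[]⇒IsZero; polyRing)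
  open Evaluation φ α

  e j : F
  e = φ.⟦ ε ⟧
  j = α + - 1#

  open QuaternionAlgebra K e j

  evℍ : Quat 𝔽 ε → ℍ K
  evℍ (quat a b c d) = ev a ,ᵢ ev b ,ⱼ ev c ,ₖ ev d

  private
    Eₚ Jₚ : Poly 𝔽
    Eₚ = constₚ 𝔽 ε
    Jₚ = (𝔽.- 𝔽.1#) ∷ 𝔽.1# ∷ []

  ev-Jₚ : ev Jₚ ≡ j
  ev-Jₚ = begin
    φ.⟦ 𝔽.- 𝔽.1# ⟧ + α * ev (oneₚ 𝔽)    ≡⟨ cong₂ (λ x y → x + α * y) (trans (φ.-‿homo 𝔽.1#) (cong -_ φ.1-homo)) ev-one ⟩
    - 1# + α * 1#                       ≡⟨ solve 1 (λ α → :- con ℤ.1ℤ :+ α :* con ℤ.1ℤ := α :- con ℤ.1ℤ) refl α ⟩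
    α + - 1#                            ∎

  private
    ev-sum : ∀ p q r s → ev (p ⊕ (q ⊕ (r ⊕ s))) ≡ ev p + (ev q + (ev r + ev s))
    ev-sum p q r s = trans (ev-⊕ p _) (cong (ev p +_) (trans (ev-⊕ q _) (cong (ev q +_) (ev-⊕ r s))))

    ev-E : ∀ p q → ev (Eₚ ⊗ (p ⊗ q)) ≡ e * (ev p * ev q)
    ev-E p q = trans (ev-⊗ Eₚ (p ⊗ q)) (cong₂ _*_ (ev-const ε) (ev-⊗ p q))

    ev-J : ∀ p q → ev (Jₚ ⊗ (p ⊗ q)) ≡ j * (ev p * ev q)
    ev-J p q = trans (ev-⊗ Jₚ (p ⊗ q)) (cong₂ _*_ ev-Jₚ (ev-⊗ p q))

    ev-EJ : ∀ p q → ev ((Eₚ ⊗ Jₚ) ⊗ (p ⊗ q)) ≡ e * j * (ev p * ev q)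
    ev-EJ p q = trans (ev-⊗ (Eₚ ⊗ Jₚ) (p ⊗ q)) (cong₂ _*_ (trans (ev-⊗ Eₚ Jₚ) (cong₂ _*_ (ev-const ε) ev-Jₚ)) (ev-⊗ p q))

    ev-neg : ∀ {p x} → ev p ≡ x → ev (⊖ p) ≡ - x
    ev-neg {p} eq = trans (ev-⊖ p) (cong -_ eq)

    sum-cong : ∀ {w w′ x x′ y y′ z z′} → w ≡ w′ → x ≡ x′ → y ≡ y′ → z ≡ z′ → w + (x + (y + z)) ≡ w′ + (x′ + (y′ + z′))
    sum-cong refl refl refl refl = refl

  evℍ-· : ∀ x y → evℍ (_·Q_ 𝔽 ε x y) ≡ evℍ x • evℍ y
  evℍ-· (quat a₁ b₁ c₁ d₁) (quat a₂ b₂ c₂ d₂) = ℍ-≡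
    (trans (ev-sum (a₁ ⊗ a₂) (Eₚ ⊗ (b₁ ⊗ b₂)) (Jₚ ⊗ (c₁ ⊗ c₂)) (⊖ ((Eₚ ⊗ Jₚ) ⊗ (d₁ ⊗ d₂))))
      (sum-cong (ev-⊗ a₁ a₂) (ev-E b₁ b₂) (ev-J c₁ c₂) (ev-neg {(Eₚ ⊗ Jₚ) ⊗ (d₁ ⊗ d₂)} (ev-EJ d₁ d₂))))
    (trans (ev-sum (a₁ ⊗ b₂) (b₁ ⊗ a₂) (⊖ (Jₚ ⊗ (c₁ ⊗ d₂))) (Jₚ ⊗ (d₁ ⊗ c₂)))
      (sum-cong (ev-⊗ a₁ b₂) (ev-⊗ b₁ a₂) (ev-neg {Jₚ ⊗ (c₁ ⊗ d₂)} (ev-J c₁ d₂)) (ev-J d₁ c₂)))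
    (trans (ev-sum (a₁ ⊗ c₂) (c₁ ⊗ a₂) (Eₚ ⊗ (b₁ ⊗ d₂)) (⊖ (Eₚ ⊗ (d₁ ⊗ b₂))))
      (sum-cong (ev-⊗ a₁ c₂) (ev-⊗ c₁ a₂) (ev-E b₁ d₂) (ev-neg {Eₚ ⊗ (d₁ ⊗ b₂)} (ev-E d₁ b₂))))
    (trans (ev-sum (a₁ ⊗ d₂) (d₁ ⊗ a₂) (b₁ ⊗ c₂) (⊖ (c₁ ⊗ b₂)))
      (sum-cong (ev-⊗ a₁ d₂) (ev-⊗ d₁ a₂) (ev-⊗ b₁ c₂) (ev-neg {c₁ ⊗ b₂} (ev-⊗ c₁ b₂))))

  evℍ-conj : ∀ x → evℍ (conj 𝔽 ε x) ≡ conjugate (evℍ x)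
  evℍ-conj (quat a b c d) = ℍ-≡ refl (ev-⊖ b) (ev-⊖ c) (ev-⊖ d)

  module _ (q : Sol 𝔽 ε → Quat 𝔽 ε) where
    open WordValues 𝔽 ε K e j (evℍ ∘ q)

    evℍ-evalWord : ∀ w → evℍ (evalWord 𝔽 ε q w) ≡ wordValue w
    evℍ-evalWord [] = ℍ-≡ ev-one refl refl refl
    evℍ-evalWord ((false , s) ∷ w) = trans (evℍ-· (q s) (evalWord 𝔽 ε q w)) (cong (evℍ (q s) •_) (evℍ-evalWord w))
    evℍ-evalWord ((true , s) ∷ w) = trans (evℍ-· (conj 𝔽 ε (q s)) (evalWord 𝔽 ε q w)) (cong₂ _•_ (evℍ-conj (q s)) (evℍ-evalWord w))

  γ̂ : Sol 𝔽 ε → ℍ K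
  γ̂ ((c , d) , _) = 1# ,ᵢ 0# ,ⱼ φ.⟦ c ⟧ ,ₖ φ.⟦ d ⟧

  evℍ-γ : ∀ s → evℍ (γ 𝔽 ε s) ≡ γ̂ s
  evℍ-γ ((c , d) , _) = ℍ-≡ ev-one refl (ev-const c) (ev-const d)

  φ-Sol : ∀ {c d} → ε 𝔽.* (d 𝔽.* d) 𝔽.+ (𝔽.- (c 𝔽.* c)) ≡ 𝔽.1# → e * (φ.⟦ d ⟧ * φ.⟦ d ⟧) + - (φ.⟦ c ⟧ * φ.⟦ c ⟧) ≡ 1#
  φ-Sol {c} {d} eq = begin
    e * (φ.⟦ d ⟧ * φ.⟦ d ⟧) + - (φ.⟦ c ⟧ * φ.⟦ c ⟧)    ≡⟨ cong₂ (λ x y → e * x + - y) (φ.*-homo d d) (φ.*-homo c c) ⟨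
    e * φ.⟦ d 𝔽.* d ⟧ + - φ.⟦ c 𝔽.* c ⟧                ≡⟨ cong₂ _+_ (φ.*-homo ε _) (φ.-‿homo _) ⟨
    φ.⟦ ε 𝔽.* (d 𝔽.* d) ⟧ + φ.⟦ 𝔽.- (c 𝔽.* c) ⟧        ≡⟨ φ.+-homo _ _ ⟨
    φ.⟦ ε 𝔽.* (d 𝔽.* d) 𝔽.+ (𝔽.- (c 𝔽.* c)) ⟧          ≡⟨ cong φ.⟦_⟧ eq ⟩
    φ.⟦ 𝔽.1# ⟧                                         ≡⟨ φ.1-homo ⟩
    1#                                                 ∎

  norm-γ̂ : ∀ s → norm (γ̂ s) ≡ α
  norm-γ̂ ((c , d) , eq) = begin
    norm (γ̂ ((c , d) , eq))
      ≡⟨ solve 4 (λ e α c d → (con ℤ.1ℤ :* con ℤ.1ℤ :- e :* (con ℤ.0ℤ :* con ℤ.0ℤ)) :- (α :- con ℤ.1ℤ) :* (c :* c :- e :* (d :* d))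
                              := con ℤ.1ℤ :+ (α :- con ℤ.1ℤ) :* (e :* (d :* d) :- c :* c)) refl e α φ.⟦ c ⟧ φ.⟦ d ⟧ ⟩
    1# + (α + - 1#) * (e * (φ.⟦ d ⟧ * φ.⟦ d ⟧) + - (φ.⟦ c ⟧ * φ.⟦ c ⟧))   ≡⟨ cong (λ z → 1# + (α + - 1#) * z) (φ-Sol eq) ⟩
    1# + (α + - 1#) * 1#        ≡⟨ solve 1 (λ α → con ℤ.1ℤ :+ (α :- con ℤ.1ℤ) :* con ℤ.1ℤ := α) refl α ⟩
    α                           ∎

  module _ {f : Poly 𝔽} (ev≡0⇒∣ : ∀ p → ev p ≡ 0# → f ∣ p) (∣⇒ev≡0′ : ∀ p → f ∣ p → ev p ≡ 0#) where
    open import Algebra.Properties.CommutativeSemigroup (CommutativeRing.*-commutativeSemigroup polyRing) using (interchange)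

    private
      cross : ∀ {l m a a′ b b′} → ¬ IsZeroₚ 𝔽 l → ¬ IsZeroₚ 𝔽 m → _≈ₚ_ 𝔽 (l ⊗ a) (m ⊗ a′) → _≈ₚ_ 𝔽 (l ⊗ b) (m ⊗ b′) → a ⊗ b′ ≋ b ⊗ a′
      cross {l} {m} {a} {a′} {b} {b′} l≢0 m≢0 la≈ma′ lb≈mb′ =
        ⊗-cancelˡ (l ⊗ m) (⊗≢[] (l≢0 ∘ ≋[]⇒IsZero l) (m≢0 ∘ ≋[]⇒IsZero m))
          (≋-trans (interchange l m a b′) (≋-trans (⊗-cong (≈⇒≋ {l ⊗ a} {m ⊗ a′} la≈ma′) (≋-sym (≈⇒≋ {l ⊗ b} {m ⊗ b′} lb≈mb′)))
            (≋-trans (⊗-comm (m ⊗ a′) (l ⊗ b)) (≋-sym (interchange l m b a′)))))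

      vanish : ∀ {ra rb xa xb} → ¬ _∣ₚ_ 𝔽 f ra → _∣ₚ_ 𝔽 f rb → ra ⊗ xb ≋ rb ⊗ xa → ev xb ≡ 0#
      vanish {ra} {rb} {xa} {xb} f∤ra f∣rb e = x*y≡0⇒y≡0 {ev ra} (λ eq → f∤ra (∣⇒∣ₚ (ev≡0⇒∣ ra eq))) (begin
        ev ra * ev xb       ≡⟨ ev-⊗ ra xb ⟨
        ev (ra ⊗ xb)        ≡⟨ ev-cong e ⟩
        ev (rb ⊗ xa)        ≡⟨ ev-⊗ rb xa ⟩
        ev rb * ev xa       ≡⟨ cong (_* ev xa) (∣⇒ev≡0′ rb (∣ₚ⇒∣ f∣rb)) ⟩
        0# * ev xa          ≡⟨ zeroˡ _ ⟩
        0#                  ∎)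

    -- λ r = μ x forces rₐ x_b = r_b xₐ, so f needs not be cancelled from λ and μ.
    InΓ⇔IsReal : ∀ x → norm (evℍ x) ≢ 0# → InΓ[_] 𝔽 ε f x ⇔ IsReal (evℍ x)
    InΓ⇔IsReal x@(quat xa xb xc xd) N≢0 = mk⇔ to from
      where
      to : InΓ[_] 𝔽 ε f x → IsReal (evℍ x)
      to (quat ra rb rc rd , (l , m , l≢0 , m≢0 , ea , eb , ec , ed) , f∤a , f∣b , f∣c , f∣d) =
        vanish {ra} {rb} {xa} {xb} f∤a f∣b (cross {l} {m} l≢0 m≢0 ea eb)
        , vanish {ra} {rc} {xa} {xc} f∤a f∣c (cross {l} {m} l≢0 m≢0 ea ec)
        , vanish {ra} {rd} {xa} {xd} f∤a f∣d (cross {l} {m} l≢0 m≢0 ea ed)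
      1≢0ₚ : ¬ IsZeroₚ 𝔽 (oneₚ 𝔽)
      1≢0ₚ z = 𝔽.1≢0 (PolyTheory.at (IsZero⇒≋[] z) 0)
      from : IsReal (evℍ x) → InΓ[_] 𝔽 ε f x
      from real@(b≡0 , c≡0 , d≡0) = x
        , (oneₚ 𝔽 , oneₚ 𝔽 , 1≢0ₚ , 1≢0ₚ , ≋⇒≈ {oneₚ 𝔽 ⊗ xa} ≋-refl , ≋⇒≈ {oneₚ 𝔽 ⊗ xb} ≋-refl , ≋⇒≈ {oneₚ 𝔽 ⊗ xc} ≋-refl , ≋⇒≈ {oneₚ 𝔽 ⊗ xd} ≋-refl)
        , (λ f∣a → N≢0 (trans (norm-IsReal real) (trans (cong (_* ev xa) (∣⇒ev≡0′ xa (∣ₚ⇒∣ f∣a))) (zeroˡ _))))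
        , ∣⇒∣ₚ (ev≡0⇒∣ xb b≡0) , ∣⇒∣ₚ (ev≡0⇒∣ xc c≡0) , ∣⇒∣ₚ (ev≡0⇒∣ xd d≡0)

-- The roots of g, h and h̃

module LocalDefinitions (𝔽 : FiniteField) where
  open FiniteField 𝔽

  module _ (m : ℕ) where
    term : F → ℕ → Poly 𝔽
    term c i = scaleₚ 𝔽 c (_*ₚ_ 𝔽 (powₚ 𝔽 (scaleₚ 𝔽 (two 𝔽) (X 𝔽)) i) (powₚ 𝔽 (1# ∷ 1# ∷ []) (2 ℕ.* m ∸ i)))

    homogenise : ℕ → Poly 𝔽 → Poly 𝔽
    homogenise i [] = []
    homogenise i (c ∷ cs) = _+ₚ_ 𝔽 (term c i) (homogenise (suc i) cs)

    -- The where-function of Hpoly has no name: local is solved to it by unification in the last clause of Hpoly≡.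
    mutual
      private
        local : Poly 𝔽 → ℕ → Poly 𝔽 → Poly 𝔽
        local = _

      Hpoly≡ : ∀ g → Hpoly 𝔽 g m ≡ homogenise 0 g
      Hpoly≡ [] = refl
      Hpoly≡ (c ∷ cs) with c ∷ cs | 1 | term c 0
      ... | g′ | i | t = cong (_+ₚ_ 𝔽 t) (local≡ g′ i cs)

      private
        local≡ : ∀ g i cs → local g i cs ≡ homogenise i cs
        local≡ g i [] = refl
        local≡ g i (c ∷ cs) = cong (_+ₚ_ 𝔽 (term c i)) (local≡ g (suc i) cs)

  alternate : Bool → Poly 𝔽 → Poly 𝔽
  alternate b [] = []
  alternate b (a ∷ q) = (if b then a else (- a)) ∷ alternate (if b then false else true) q

  mutual
    private
      local′ : Poly 𝔽 → Bool → Poly 𝔽 → Poly 𝔽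
      local′ = _

    negVar≡ : ∀ p → negVar 𝔽 p ≡ alternate true p
    negVar≡ [] = refl
    -- Abstracting the arguments into variables turns the unification problem for `local′` into a
    -- pattern, which has a unique solution.
    negVar≡ (a ∷ q) with a ∷ q | false
    ... | p | b = cong (a ∷_) (local′≡ p b q)

    private
      local′≡ : ∀ p b q → local′ p b q ≡ alternate b q
      local′≡ p b [] = refl
      local′≡ p b (a ∷ q) = cong ((if b then a else (- a)) ∷_) (local′≡ p (if b then false else true) q)

module Parity (𝔽 : FiniteField) where
  private module 𝔽 = FieldTheory 𝔽
  open PolyTheory 𝔽
  open LocalDefinitions 𝔽

  mutual
    coef-even : ∀ p n → coef (evenCoeffs 𝔽 p) n ≡ coef p (n ℕ.+ n)
    coef-even [] n = refl
    coef-even (a ∷ p) zero = refl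
    coef-even (a ∷ p) (suc n) = trans (coef-odd p n) (cong (coef p) (sym (ℕ.+-suc n n)))

    coef-odd : ∀ p n → coef (oddCoeffs 𝔽 p) n ≡ coef p (suc (n ℕ.+ n))
    coef-odd [] n = refl
    coef-odd (a ∷ p) n = coef-even p n

  Degree-even : ∀ {p n} → Degree p (n ℕ.+ n) → Degree (evenCoeffs 𝔽 p) n
  Degree-even {p} {n} D = degree (leading≢0 D ∘ trans (sym (coef-even p n)))
    (λ k n<k → trans (coef-even p k) (bounded D (k ℕ.+ k) (ℕ.+-mono-≤ n<k (ℕ.<⇒≤ n<k))))

  Degree-negVar : ∀ {p n} → Degree p n → Degree (negVar 𝔽 p) n
  Degree-negVar {p} {n} D rewrite negVar≡ p = degree (λ eq → leading≢0 D (coef≡0 true p n eq)) (λ m n<m → ≡0coef true p m (bounded D m n<m))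
    where
    coef≡0 : ∀ b p n → coef (alternate b p) n ≡ 𝔽.0# → coef p n ≡ 𝔽.0#
    coef≡0 b [] n eq = eq
    coef≡0 true (a ∷ p) zero eq = eq
    coef≡0 false (a ∷ p) zero eq = trans (sym (𝔽.-‿involutive a)) (trans (cong 𝔽.-_ eq) 𝔽.-0#≈0#)
    coef≡0 b (a ∷ p) (suc n) eq = coef≡0 _ p n eq
    ≡0coef : ∀ b p n → coef p n ≡ 𝔽.0# → coef (alternate b p) n ≡ 𝔽.0#
    ≡0coef b [] n eq = eq
    ≡0coef true (a ∷ p) zero eq = eq
    ≡0coef false (a ∷ p) zero eq = trans (cong 𝔽.-_ eq) 𝔽.-0#≈0#
    ≡0coef b (a ∷ p) (suc n) eq = ≡0coef _ p n eq

  -- With an explicit motive the case split inside `tilde` is performed only here.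
  tilde-elim : ∀ h (P : Poly 𝔽 → Set) → (IsZeroₚ 𝔽 (oddCoeffs 𝔽 h) → P (evenCoeffs 𝔽 h)) →
               (¬ IsZeroₚ 𝔽 (oddCoeffs 𝔽 h) → P (evenCoeffs 𝔽 (h ⊗ negVar 𝔽 h))) → P (tilde 𝔽 h)
  tilde-elim h P even odd with isZero? 𝔽 (oddCoeffs 𝔽 h)
  ... | yes z = even z
  ... | no nz = odd nz

  -- Substitution of t² for the variable. It makes an annihilator of s = t² into one of t of twice
  -- the degree, which is how the degree of s is bounded from below.
  double : Poly 𝔽 → Poly 𝔽
  double [] = []
  double (a ∷ p) = a ∷ 𝔽.0# ∷ double p

  Degree-double : ∀ {p n} → Degree p n → Degree (double p) (n ℕ.+ n)
  Degree-double {p} {n} (degree l b) = degree (l ∘ trans (sym (even p n))) (λ m n+n<m → big p n m b n+n<m)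
    where
    even : ∀ p n → coef (double p) (n ℕ.+ n) ≡ coef p n
    even [] n = refl
    even (a ∷ p) zero = refl
    even (a ∷ p) (suc n) = trans (cong (coef (𝔽.0# ∷ double p)) (ℕ.+-suc n n)) (even p n)
    zeros : ∀ p → p ≋ [] → double p ≋ []
    zeros [] e = ≋-refl
    zeros (a ∷ p) e = pointwise λ { zero → at e 0 ; (suc zero) → refl ; (suc (suc k)) → at (zeros p (pointwise (at e ∘ suc))) k }
    big : ∀ p n m → p <deg suc n → n ℕ.+ n ℕ.< m → coef (double p) m ≡ 𝔽.0#
    big [] n m b lt = refl
    big (a ∷ p) n (suc zero) b lt = refl
    big (a ∷ p) zero (suc (suc m)) b lt = at (zeros p (pointwise λ k → b (suc k) (s≤s z≤n))) m
    big (a ∷ p) (suc n) (suc (suc m)) b (s≤s lt) = big p n m (λ k n<k → b (suc k) (s≤s n<k)) (ℕ.≤-trans (ℕ.≤-reflexive (sym (ℕ.+-suc n n))) (ℕ.s≤s⁻¹ lt))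

  module _ {K : FiniteField} (φ : Hom 𝔽 K) where
    private
      module K = FieldTheory K
      module φ = Hom φ
      module At x = Evaluation φ x
    open At using (ev)

    ev-parity : ∀ t p → ev t p ≡ ev (t K.* t) (evenCoeffs 𝔽 p) K.+ t K.* ev (t K.* t) (oddCoeffs 𝔽 p)
    ev-parity t [] = K.solve 1 (λ t → K.con ℤ.0ℤ K.:= K.con ℤ.0ℤ K.:+ t K.:* K.con ℤ.0ℤ) refl t
    ev-parity t (a ∷ p) = begin
      φ.⟦ a ⟧ K.+ t K.* ev t p        ≡⟨ cong (λ z → φ.⟦ a ⟧ K.+ t K.* z) (ev-parity t p) ⟩
      φ.⟦ a ⟧ K.+ t K.* (ev (t K.* t) (evenCoeffs 𝔽 p) K.+ t K.* ev (t K.* t) (oddCoeffs 𝔽 p))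
        ≡⟨ K.solve 4 (λ a t E O → a K.:+ t K.:* (E K.:+ t K.:* O) K.:= (a K.:+ (t K.:* t) K.:* O) K.:+ t K.:* E) refl φ.⟦ a ⟧ t _ _ ⟩
      (φ.⟦ a ⟧ K.+ (t K.* t) K.* ev (t K.* t) (oddCoeffs 𝔽 p)) K.+ t K.* ev (t K.* t) (evenCoeffs 𝔽 p) ∎

    ev-double : ∀ t p → ev t (double p) ≡ ev (t K.* t) p
    ev-double t [] = refl
    ev-double t (a ∷ p) = begin
      φ.⟦ a ⟧ K.+ t K.* (φ.⟦ 𝔽.0# ⟧ K.+ t K.* ev t (double p))    ≡⟨ cong₂ (λ x y → φ.⟦ a ⟧ K.+ t K.* (x K.+ t K.* y)) φ.0-homo (ev-double t p) ⟩
      φ.⟦ a ⟧ K.+ t K.* (K.0# K.+ t K.* ev (t K.* t) p)           ≡⟨ K.solve 3 (λ a t p → a K.:+ t K.:* (K.con ℤ.0ℤ K.:+ t K.:* p) K.:= a K.:+ (t K.:* t) K.:* p) refl _ t _ ⟩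
      φ.⟦ a ⟧ K.+ (t K.* t) K.* ev (t K.* t) p                    ∎

    ev-negVar : ∀ t p → ev (K.- t) (negVar 𝔽 p) ≡ ev t p
    ev-negVar t p rewrite negVar≡ p = proj₁ (go p)
      where
      go : ∀ p → ev (K.- t) (alternate true p) ≡ ev t p × ev (K.- t) (alternate false p) ≡ K.- ev t p
      go [] = refl , sym K.-0#≈0#
      go (a ∷ p) with go p
      ... | e₁ , e₂ = trans (cong (λ z → φ.⟦ a ⟧ K.+ K.- t K.* z) e₂) (K.solve 3 (λ a t p → a K.:+ (K.:- t) K.:* (K.:- p) K.:= a K.:+ t K.:* p) refl _ t _)
                    , trans (cong₂ (λ x z → x K.+ K.- t K.* z) (φ.-‿homo a) e₁) (K.solve 3 (λ a t p → K.:- a K.:+ (K.:- t) K.:* p K.:= K.:- (a K.:+ t K.:* p)) refl _ t _)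

    ev-even≡0 : K.1# K.+ K.1# ≢ K.0# → ∀ t p → ev t p ≡ K.0# → ev (K.- t) p ≡ K.0# → ev (t K.* t) (evenCoeffs 𝔽 p) ≡ K.0#
    ev-even≡0 2≢0 t p p[t]≡0 p[-t]≡0 = K.x*y≡0⇒y≡0 2≢0 (begin
      (K.1# K.+ K.1#) K.* E
        ≡⟨ K.solve 3 (λ E O t → K.con (ℤ.+ 2) K.:* E K.:= (E K.:+ t K.:* O) K.:+ (E K.:+ (K.:- t) K.:* O)) refl E O t ⟩
      (E K.+ t K.* O) K.+ (E K.+ K.- t K.* O)      ≡⟨ cong₂ K._+_ (trans (sym (ev-parity t p)) p[t]≡0) at-neg ⟩
      K.0# K.+ K.0#                                ≡⟨ K.+-identityʳ K.0# ⟩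
      K.0#                                         ∎)
      where
      E = ev (t K.* t) (evenCoeffs 𝔽 p)
      O = ev (t K.* t) (oddCoeffs 𝔽 p)
      at-neg : E K.+ K.- t K.* O ≡ K.0#
      at-neg = begin
        E K.+ K.- t K.* O        ≡⟨ cong (λ s → ev s (evenCoeffs 𝔽 p) K.+ K.- t K.* ev s (oddCoeffs 𝔽 p)) (K.solve 1 (λ t → t K.:* t K.:= (K.:- t) K.:* (K.:- t)) refl t) ⟩
        _                        ≡⟨ ev-parity (K.- t) p ⟨
        ev (K.- t) p             ≡⟨ p[-t]≡0 ⟩
        K.0#                     ∎

-- Generators of a finite field

module Generation {𝔽 K : FiniteField} (φ : Hom 𝔽 K) where
  private
    module 𝔽 = FieldTheory 𝔽
    module K = FieldTheory K
    module φ = Hom φ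
    module At x = Evaluation φ x
  open At using (ev)
  open PolyTheory 𝔽
  open Truncation 𝔽

  _∈𝔽[_] : K.F → K.F → Set
  x ∈𝔽[ α ] = ∃ λ p → ev α p ≡ x

  module _ {α : K.F} where
    ∈-+ : ∀ {x y} → x ∈𝔽[ α ] → y ∈𝔽[ α ] → (x K.+ y) ∈𝔽[ α ]
    ∈-+ (p , refl) (q , refl) = p ⊕ q , At.ev-⊕ α p q

    ∈-* : ∀ {x y} → x ∈𝔽[ α ] → y ∈𝔽[ α ] → (x K.* y) ∈𝔽[ α ]
    ∈-* (p , refl) (q , refl) = p ⊗ q , At.ev-⊗ α p q

    ∈-const : ∀ c → φ.⟦ c ⟧ ∈𝔽[ α ]
    ∈-const c = constₚ 𝔽 c , At.ev-const α c

    ∈-1 : K.1# ∈𝔽[ α ]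
    ∈-1 = oneₚ 𝔽 , At.ev-one α

    ∈-self : α ∈𝔽[ α ]
    ∈-self = X 𝔽 , At.ev-X α

    ∈-neg : ∀ {x} → x ∈𝔽[ α ] → (K.- x) ∈𝔽[ α ]
    ∈-neg (p , refl) = ⊖ p , At.ev-⊖ α p

    ∈-^ : ∀ {x} n → x ∈𝔽[ α ] → (x K.^ n) ∈𝔽[ α ]
    ∈-^ zero _ = ∈-1
    ∈-^ (suc n) x∈ = ∈-* x∈ (∈-^ n x∈)

    -- By Fermat the inverse of x is a power of x.
    ∈-inv : ∀ {x} (x≢0 : x ≢ K.0#) → x ∈𝔽[ α ] → K.inv x x≢0 ∈𝔽[ α ]
    ∈-inv {x} x≢0 x∈ = subst _∈𝔽[ α ] (K.*-cancelˡ x≢0 (trans (lemma K.size (Counting.2≤size K) (Counting.fermat K x)) (sym (K.inv-inverseʳ x x≢0)))) (∈-^ (K.size ∸ 2) x∈)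
      where
      lemma : ∀ n → 2 ℕ.≤ n → x K.^ n ≡ x → x K.* x K.^ (n ∸ 2) ≡ K.1#
      lemma (suc (suc n)) _ eq = K.*-cancelˡ x≢0 (trans eq (sym (K.*-identityʳ x)))
      lemma (suc zero) (s≤s ())

    ∈-trans : ∀ {β} → β ∈𝔽[ α ] → ∀ {x} → x ∈𝔽[ β ] → x ∈𝔽[ α ]
    ∈-trans {β} β∈ (p , refl) = go p
      where
      go : ∀ p → ev β p ∈𝔽[ α ]
      go [] = [] , refl
      go (a ∷ p) = ∈-+ (∈-const a) (∈-* β∈ (go p))

  Generates : K.F → Set
  Generates α = ∀ x → x ∈𝔽[ α ]

  -- Reducing modulo `p` makes every element of `K` a value of a polynomial of degree below `d`;
  -- counting such polynomials gives q^n ≤ q^d, q the size of the base field.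
  generator-degree : ∀ {α p d n} → K.size ≡ 𝔽.size ℕ.^ n → Generates α → Degree p d → ev α p ≡ K.0# → n ℕ.≤ d
  generator-degree {α} {p} {d} {n} size≡ gen D p≡0 with n ℕ.≤? d
  ... | yes n≤d = n≤d
  ... | no n≰d = ⊥-elim (ℕ.<⇒≱ (ℕ.^-monoʳ-< 𝔽.size (Counting.2≤size 𝔽) (ℕ.≰⇒> n≰d)) (subst (ℕ._≤ 𝔽.size ℕ.^ d) size≡
      (injective⇒size≤ K.enum (Vec↔ 𝔽.enum d) code (λ {x} {y} eq → trans (sym (decode x)) (trans (cong (ev α ∘ toList) eq) (decode y))))))
    where
    code : K.F → Vec 𝔽.F d
    code x = truncate d (proj₁ (proj₂ (divide D (proj₁ (gen x)))))
    decode : ∀ x → ev α (toList (code x)) ≡ x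
    decode x = trans (At.ev-cong α (coef-truncate d r br)) (begin
      ev α r                       ≡⟨ K.+-identityˡ _ ⟨
      K.0# K.+ ev α r              ≡⟨ cong (K._+ ev α r) (trans (At.ev-⊗ α p k) (trans (cong (K._* ev α k) p≡0) (K.zeroˡ _))) ⟨
      ev α (p ⊗ k) K.+ ev α r      ≡⟨ At.ev-⊕ α (p ⊗ k) r ⟨
      ev α (p ⊗ k ⊕ r)             ≡⟨ At.ev-cong α e ⟨
      ev α q                       ≡⟨ proj₂ (gen x) ⟩
      x                            ∎)
      where
      q = proj₁ (gen x)
      qr = divide D q
      k = proj₁ qr
      r = proj₁ (proj₂ qr)
      e = proj₁ (proj₂ (proj₂ qr))
      br = proj₂ (proj₂ (proj₂ qr))

-- The substitution of 2t/(t + 1)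

module Möbius (𝔽 : FiniteField) (m : ℕ) where
  private module 𝔽 = FieldTheory 𝔽
  open PolyTheory 𝔽
  open LocalDefinitions 𝔽

  pow-<deg : ∀ {p} → p <deg 2 → ∀ n → powₚ 𝔽 p n <deg suc n
  pow-<deg b zero (suc k) _ = refl
  pow-<deg {p} b (suc n) = proj₂ (⊗-top p (powₚ 𝔽 p n) 1 n b (pow-<deg b n))

  scale-<deg : ∀ c {p n} → p <deg n → scale c p <deg n
  scale-<deg c {p} b k n≤k = trans (coef-scale c p k) (trans (cong (c 𝔽.*_) (b k n≤k)) (𝔽.zeroʳ c))

  ⊕-<deg : ∀ {p q n} → p <deg n → q <deg n → (p ⊕ q) <deg n
  ⊕-<deg {p} {q} bp bq k n≤k = trans (coef-⊕ p q k) (trans (cong₂ 𝔽._+_ (bp k n≤k) (bq k n≤k)) (𝔽.+-identityʳ 𝔽.0#))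

  -- The bound is stated from the moving index `i` of `homogenise`. Beyond 2m the exponent
  -- `2 ℕ.* m ∸ i` is truncated to 0, and only the vanishing of the coefficient makes such a term
  -- correct.
  Small : ℕ → Poly 𝔽 → Set
  Small i cs = ∀ k → 2 ℕ.* m ℕ.< i ℕ.+ k → coef cs k ≡ 𝔽.0#

  Small-tail : ∀ {i c cs} → Small i (c ∷ cs) → Small (suc i) cs
  Small-tail {i} small k lt = small (suc k) (subst (2 ℕ.* m ℕ.<_) (sym (ℕ.+-suc i k)) lt)

  scale-0-<deg : ∀ p n → scale 𝔽.0# p <deg n
  scale-0-<deg p n k _ = trans (coef-scale 𝔽.0# p k) (𝔽.zeroˡ _)

  homogenise-<deg : ∀ i cs → Small i cs → homogenise m i cs <deg suc (2 ℕ.* m)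
  homogenise-<deg i [] _ _ _ = refl
  homogenise-<deg i (c ∷ cs) small = ⊕-<deg {term m c i} {homogenise m (suc i) cs} (bound (i ℕ.≤? 2 ℕ.* m)) (homogenise-<deg (suc i) cs (Small-tail {i} small))
    where
    P = powₚ 𝔽 (scale (two 𝔽) (X 𝔽)) i
    Q = powₚ 𝔽 (𝔽.1# ∷ 𝔽.1# ∷ []) (2 ℕ.* m ∸ i)
    linear : ∀ a b → (a ∷ b ∷ []) <deg 2
    linear a b (suc (suc k)) _ = refl
    linear a b (suc zero) (s≤s ())
    bound : Dec (i ℕ.≤ 2 ℕ.* m) → term m c i <deg suc (2 ℕ.* m)
    bound (yes i≤) = scale-<deg c {P ⊗ Q} (subst (λ n → (P ⊗ Q) <deg suc n) (ℕ.m+[n∸m]≡n i≤)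
      (proj₂ (⊗-top P Q i (2 ℕ.* m ∸ i) (pow-<deg (linear _ _) i) (pow-<deg (linear _ _) (2 ℕ.* m ∸ i)))))
    bound (no i≰) = subst (λ c → scale c (P ⊗ Q) <deg suc (2 ℕ.* m)) (sym (small 0 (subst (2 ℕ.* m ℕ.<_) (sym (ℕ.+-identityʳ i)) (ℕ.≰⇒> i≰)))) (scale-0-<deg (P ⊗ Q) _)

  module _ {K : FiniteField} (φ : Hom 𝔽 K) (u t r : FiniteField.F K) where
    private
      module K = FieldTheory K
      module φ = Hom φ
      module At x = Evaluation φ x
    open At using (ev)

    module _ (r≡ : r ≡ t K.+ K.1#) (2t≡ur : (K.1# K.+ K.1#) K.* t ≡ u K.* r) where
      private
        ev-2X : ev t (scale (two 𝔽) (X 𝔽)) ≡ u K.* r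
        ev-2X = begin
          ev t (scale (two 𝔽) (X 𝔽))       ≡⟨ At.ev-scale t (two 𝔽) (X 𝔽) ⟩
          φ.⟦ two 𝔽 ⟧ K.* ev t (X 𝔽)       ≡⟨ cong₂ K._*_ (trans (φ.+-homo _ _) (cong₂ K._+_ φ.1-homo φ.1-homo)) (At.ev-X t) ⟩
          (K.1# K.+ K.1#) K.* t            ≡⟨ 2t≡ur ⟩
          u K.* r                          ∎

        ev-1+X : ev t (𝔽.1# ∷ 𝔽.1# ∷ []) ≡ r
        ev-1+X = begin
          φ.⟦ 𝔽.1# ⟧ K.+ t K.* ev t (oneₚ 𝔽)    ≡⟨ cong₂ (λ x y → x K.+ t K.* y) φ.1-homo (At.ev-one t) ⟩
          K.1# K.+ t K.* K.1#                   ≡⟨ K.solve 1 (λ t → K.con ℤ.1ℤ K.:+ t K.:* K.con ℤ.1ℤ K.:= t K.:+ K.con ℤ.1ℤ) refl t ⟩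
          t K.+ K.1#                            ≡⟨ r≡ ⟨
          r                                     ∎

        power : ∀ i n → i ℕ.≤ n → (u K.* r) K.^ i K.* r K.^ (n ∸ i) ≡ r K.^ n K.* u K.^ i
        power zero n _ = K.solve 1 (λ x → K.con ℤ.1ℤ K.:* x K.:= x K.:* K.con ℤ.1ℤ) refl _
        power (suc i) (suc n) (s≤s i≤n) = begin
          (u K.* r) K.* (u K.* r) K.^ i K.* r K.^ (n ∸ i)       ≡⟨ K.*-assoc (u K.* r) _ _ ⟩
          (u K.* r) K.* ((u K.* r) K.^ i K.* r K.^ (n ∸ i))     ≡⟨ cong ((u K.* r) K.*_) (power i n i≤n) ⟩
          (u K.* r) K.* (r K.^ n K.* u K.^ i)
            ≡⟨ K.solve 4 (λ u r x y → (u K.:* r) K.:* (x K.:* y) K.:= (r K.:* x) K.:* (u K.:* y)) refl u r (r K.^ n) (u K.^ i) ⟩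
          (r K.* r K.^ n) K.* (u K.* u K.^ i)                   ∎

        ev-term : ∀ c i → (2 ℕ.* m ℕ.< i → c ≡ 𝔽.0#) → ev t (term m c i) ≡ φ.⟦ c ⟧ K.* (r K.^ (2 ℕ.* m) K.* u K.^ i)
        ev-term c i small with i ℕ.≤? 2 ℕ.* m
        ... | yes i≤ = begin
          ev t (term m c i)                                       ≡⟨ At.ev-scale t c (P ⊗ Q) ⟩
          φ.⟦ c ⟧ K.* ev t (P ⊗ Q)
            ≡⟨ cong (φ.⟦ c ⟧ K.*_) (trans (At.ev-⊗ t P Q) (cong₂ K._*_
                 (trans (At.ev-pow t (scale (two 𝔽) (X 𝔽)) i) (K.^-congˡ i ev-2X))
                 (trans (At.ev-pow t (𝔽.1# ∷ 𝔽.1# ∷ []) (2 ℕ.* m ∸ i)) (K.^-congˡ (2 ℕ.* m ∸ i) ev-1+X)))) ⟩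
          φ.⟦ c ⟧ K.* ((u K.* r) K.^ i K.* r K.^ (2 ℕ.* m ∸ i))   ≡⟨ cong (φ.⟦ c ⟧ K.*_) (power i (2 ℕ.* m) i≤) ⟩
          φ.⟦ c ⟧ K.* (r K.^ (2 ℕ.* m) K.* u K.^ i)               ∎
          where
          P = powₚ 𝔽 (scale (two 𝔽) (X 𝔽)) i
          Q = powₚ 𝔽 (𝔽.1# ∷ 𝔽.1# ∷ []) (2 ℕ.* m ∸ i)
        ... | no i≰ = trans (At.ev-scale t c (powₚ 𝔽 (scale (two 𝔽) (X 𝔽)) i ⊗ powₚ 𝔽 (𝔽.1# ∷ 𝔽.1# ∷ []) (2 ℕ.* m ∸ i))) (trans (vanish _) (sym (vanish _)))
          where
          vanish : ∀ x → φ.⟦ c ⟧ K.* x ≡ K.0#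
          vanish x = trans (cong (K._* x) (trans (cong φ.⟦_⟧ (small (ℕ.≰⇒> i≰))) φ.0-homo)) (K.zeroˡ x)

      -- Clearing denominators: with r = t + 1 the hypothesis u r = 2t replaces u = 2t/(t + 1), and
      -- for `i` = 0 the value is r^(2m) g(u).
      ev-homogenise : ∀ i cs → Small i cs → ev t (homogenise m i cs) ≡ (r K.^ (2 ℕ.* m) K.* u K.^ i) K.* ev u cs
      ev-homogenise i [] _ = sym (K.zeroʳ _)
      ev-homogenise i (c ∷ cs) small = begin
        ev t (term m c i ⊕ homogenise m (suc i) cs)                  ≡⟨ At.ev-⊕ t (term m c i) (homogenise m (suc i) cs) ⟩
        ev t (term m c i) K.+ ev t (homogenise m (suc i) cs)
          ≡⟨ cong₂ K._+_ (ev-term c i (λ lt → small 0 (subst (2 ℕ.* m ℕ.<_) (sym (ℕ.+-identityʳ i)) lt)))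
                         (ev-homogenise (suc i) cs (Small-tail {i} small)) ⟩
        φ.⟦ c ⟧ K.* (R K.* U) K.+ (R K.* (u K.* U)) K.* ev u cs
          ≡⟨ K.solve 5 (λ c R U u p → c K.:* (R K.:* U) K.:+ (R K.:* (u K.:* U)) K.:* p K.:= (R K.:* U) K.:* (c K.:+ u K.:* p)) refl φ.⟦ c ⟧ R U u (ev u cs) ⟩
        (R K.* U) K.* (φ.⟦ c ⟧ K.+ u K.* ev u cs)                    ∎
        where R = r K.^ (2 ℕ.* m)
              U = u K.^ i

-- Rescaling of j

module Twist (K : FiniteField) (e j r : FiniteField.F K) where
  open FieldTheory K
  private module H = QuaternionAlgebra K e j
  open QuaternionCoordinates commutativeRing e j using (module Symbolic)

  -- Replacing the generator j by r times j carries the algebra in which j² is r² times `j` into the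
  -- one in which it is `j`. It is applied with `j` = u - 1 and r²(u - 1) = s - 1.
  ϑ : ℍ K → ℍ K
  ϑ (a ,ᵢ b ,ⱼ c ,ₖ d) = a ,ᵢ b ,ⱼ r * c ,ₖ r * d

  ϑ-• : ∀ {j′} → j′ ≡ r * r * j → ∀ x y → ϑ (QuaternionAlgebra._•_ K e j′ x y) ≡ ϑ x H.• ϑ y
  ϑ-• refl (a₁ ,ᵢ b₁ ,ⱼ c₁ ,ₖ d₁) (a₂ ,ᵢ b₂ ,ⱼ c₂ ,ₖ d₂) = H.ℍ-≡
    (solve 11 (λ e j r a₁ b₁ c₁ d₁ a₂ b₂ c₂ d₂ → let module S = Symbolic e (r :* r :* j) in let module U = Symbolic e j in
      S.*a a₁ b₁ c₁ d₁ a₂ b₂ c₂ d₂ := U.*a a₁ b₁ (r :* c₁) (r :* d₁) a₂ b₂ (r :* c₂) (r :* d₂)) refl e j r a₁ b₁ c₁ d₁ a₂ b₂ c₂ d₂)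
    (solve 11 (λ e j r a₁ b₁ c₁ d₁ a₂ b₂ c₂ d₂ → let module S = Symbolic e (r :* r :* j) in let module U = Symbolic e j in
      S.*b a₁ b₁ c₁ d₁ a₂ b₂ c₂ d₂ := U.*b a₁ b₁ (r :* c₁) (r :* d₁) a₂ b₂ (r :* c₂) (r :* d₂)) refl e j r a₁ b₁ c₁ d₁ a₂ b₂ c₂ d₂)
    (solve 11 (λ e j r a₁ b₁ c₁ d₁ a₂ b₂ c₂ d₂ → let module S = Symbolic e (r :* r :* j) in let module U = Symbolic e j in
      r :* S.*c a₁ b₁ c₁ d₁ a₂ b₂ c₂ d₂ := U.*c a₁ b₁ (r :* c₁) (r :* d₁) a₂ b₂ (r :* c₂) (r :* d₂)) refl e j r a₁ b₁ c₁ d₁ a₂ b₂ c₂ d₂)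
    (solve 11 (λ e j r a₁ b₁ c₁ d₁ a₂ b₂ c₂ d₂ → let module S = Symbolic e (r :* r :* j) in let module U = Symbolic e j in
      r :* S.*d a₁ b₁ c₁ d₁ a₂ b₂ c₂ d₂ := U.*d a₁ b₁ (r :* c₁) (r :* d₁) a₂ b₂ (r :* c₂) (r :* d₂)) refl e j r a₁ b₁ c₁ d₁ a₂ b₂ c₂ d₂)

  ϑ-conjugate : ∀ x → ϑ (H.conjugate x) ≡ H.conjugate (ϑ x)
  ϑ-conjugate (a ,ᵢ b ,ⱼ c ,ₖ d) = H.ℍ-≡ refl refl (sym (-‿distribʳ-* r c)) (sym (-‿distribʳ-* r d))

  ϑ-1 : ϑ (H.real 1#) ≡ H.real 1#
  ϑ-1 = H.ℍ-≡ refl refl (zeroʳ r) (zeroʳ r)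

-- A root u of g gives the root t = u / (2 − u) of h and the root s = t² of h̃.
module Correspondence (𝔽 : FiniteField) (2≢0 : Char≢2 𝔽)
    (ε : FiniteField.F 𝔽) (g : Poly 𝔽) (m : ℕ) (Dg : PolyTheory.Degree 𝔽 g (2 ℕ.* m)) (2≤2m : 2 ℕ.≤ 2 ℕ.* m)
    (h : Poly 𝔽) (monic-h : Monic 𝔽 h) (h~H : ScalarMultiple 𝔽 h (Hpoly 𝔽 g m))
    {M : FiniteField} (base : Hom 𝔽 M) (u : FiniteField.F M)
    (size-M : FiniteField.size M ≡ FiniteField.size 𝔽 ℕ.^ (2 ℕ.* m)) (u-generates : Generation.Generates base u)
    (ev-u≡0⇒∣ : ∀ p → Evaluation.ev base u p ≡ FiniteField.0# M → PolyTheory._∣_ 𝔽 g p)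
    (∣⇒ev-u≡0 : ∀ p → PolyTheory._∣_ 𝔽 g p → Evaluation.ev base u p ≡ FiniteField.0# M) where
  private
    module 𝔽 = FieldTheory 𝔽
    module M = FieldTheory M
    module φ = Hom base
    module At x = Evaluation base x
  open PolyTheory 𝔽
  open Parity 𝔽
  open LocalDefinitions 𝔽
  open Möbius 𝔽 m
  open At using (ev)
  open Generation base

  private
    2m≡m+m : 2 ℕ.* m ≡ m ℕ.+ m
    2m≡m+m = cong (m ℕ.+_) (ℕ.+-identityʳ m)

  2≢0ᴹ : M.1# M.+ M.1# ≢ M.0#
  2≢0ᴹ eq = φ.≢0-homo 2≢0 (trans (φ.+-homo _ _) (trans (cong₂ M._+_ φ.1-homo φ.1-homo) eq))

  private
    -- `g` divides whatever vanishes at `u` and has degree at least 2. This is what excludes u = 0,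
    -- 1 and 2.
    linear≢0 : ∀ a b → b ≢ 𝔽.0# → φ.⟦ a ⟧ M.+ u M.* φ.⟦ b ⟧ ≢ M.0#
    linear≢0 a b b≢0 eq = b≢0 (at (∣-small⇒≋[] Dg (λ { (suc (suc k)) _ → refl ; (suc zero) 2m≤1 → contradiction (ℕ.≤-trans 2≤2m 2m≤1) λ { (s≤s ()) }
                                                  ; zero 2m≤0 → contradiction (ℕ.≤-trans 2≤2m 2m≤0) λ () })
      (ev-u≡0⇒∣ (a ∷ b ∷ []) (trans (cong (λ z → φ.⟦ a ⟧ M.+ u M.* z) (At.ev-const u b)) eq))) 1)

  u≢0 : u ≢ M.0#
  u≢0 eq = linear≢0 𝔽.0# 𝔽.1# 𝔽.1≢0 (trans (cong₂ (λ x y → x M.+ y M.* φ.⟦ 𝔽.1# ⟧) φ.0-homo eq) (trans (M.+-identityˡ _) (M.zeroˡ _)))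

  private
    2-u≢0 : (M.1# M.+ M.1#) M.+ M.- u ≢ M.0#
    2-u≢0 eq = linear≢0 (two 𝔽) (𝔽.- 𝔽.1#) (λ -1≡0 → 𝔽.1≢0 (trans (sym (𝔽.-‿involutive 𝔽.1#)) (trans (cong 𝔽.-_ -1≡0) 𝔽.-0#≈0#))) (begin
      φ.⟦ two 𝔽 ⟧ M.+ u M.* φ.⟦ 𝔽.- 𝔽.1# ⟧      ≡⟨ cong₂ (λ x y → x M.+ u M.* y) (trans (φ.+-homo _ _) (cong₂ M._+_ φ.1-homo φ.1-homo)) (trans (φ.-‿homo _) (cong M.-_ φ.1-homo)) ⟩
      (M.1# M.+ M.1#) M.+ u M.* M.- M.1#        ≡⟨ M.solve 1 (λ u → M.con (ℤ.+ 2) M.:+ u M.:* (M.:- M.con ℤ.1ℤ) M.:= M.con (ℤ.+ 2) M.:- u) refl u ⟩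
      (M.1# M.+ M.1#) M.+ M.- u                 ≡⟨ eq ⟩
      M.0#                                      ∎)

    v = M.inv ((M.1# M.+ M.1#) M.+ M.- u) 2-u≢0

  -- `t` is the solution of 2t/(t + 1) = u, so `r` = 2/(2 - u). The scalar `μ` = 2 - u is the real
  -- part of the square of a generator, and `μ` times `r` is 2.
  μ t r s : M.F
  μ = (M.1# M.+ M.1#) M.+ M.- u
  t = u M.* v
  r = t M.+ M.1#
  s = t M.* t

  μr≡2 : μ M.* r ≡ M.1# M.+ M.1#
  μr≡2 = begin
    μ M.* (u M.* v M.+ M.1#)       ≡⟨ M.solve 3 (λ μ u v → μ M.:* (u M.:* v M.:+ M.con ℤ.1ℤ) M.:= u M.:* (μ M.:* v) M.:+ μ) refl μ u v ⟩
    u M.* (μ M.* v) M.+ μ          ≡⟨ cong (λ z → u M.* z M.+ μ) (M.inv-inverseʳ μ 2-u≢0) ⟩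
    u M.* M.1# M.+ μ               ≡⟨ M.solve 1 (λ u → u M.:* M.con ℤ.1ℤ M.:+ (M.con (ℤ.+ 2) M.:- u) M.:= M.con (ℤ.+ 2)) refl u ⟩
    M.1# M.+ M.1#                  ∎

  r≢0 : r ≢ M.0#
  r≢0 = M.x*y≢0⇒y≢0 {μ} (2≢0ᴹ ∘ trans (sym μr≡2))

  μ≢0 : μ ≢ M.0#
  μ≢0 = 2-u≢0

  2t≡ur : (M.1# M.+ M.1#) M.* t ≡ u M.* r
  2t≡ur = begin
    (M.1# M.+ M.1#) M.* t           ≡⟨ cong (M._* t) μr≡2 ⟨
    (μ M.* r) M.* (u M.* v)         ≡⟨ M.solve 4 (λ μ r u v → (μ M.:* r) M.:* (u M.:* v) M.:= u M.:* r M.:* (μ M.:* v)) refl μ r u v ⟩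
    u M.* r M.* (μ M.* v)           ≡⟨ cong (u M.* r M.*_) (M.inv-inverseʳ μ 2-u≢0) ⟩
    u M.* r M.* M.1#                ≡⟨ M.*-identityʳ _ ⟩
    u M.* r                         ∎

  -- Precisely the hypothesis of `ϑ-•`: rescaling j by `r` carries the algebra at `s` into the
  -- algebra at `u`.
  s-1≡r²[u-1] : s M.+ M.- M.1# ≡ r M.* r M.* (u M.+ M.- M.1#)
  s-1≡r²[u-1] = begin
    t M.* t M.+ M.- M.1#                     ≡⟨ M.solve 1 (λ t → t M.:* t M.:- M.con ℤ.1ℤ M.:= (t M.:+ M.con ℤ.1ℤ) M.:* (M.con (ℤ.+ 2) M.:* t M.:- (t M.:+ M.con ℤ.1ℤ))) refl t ⟩
    r M.* ((M.1# M.+ M.1#) M.* t M.+ M.- r)  ≡⟨ cong (λ z → r M.* (z M.+ M.- r)) 2t≡ur ⟩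
    r M.* (u M.* r M.+ M.- r)                ≡⟨ M.solve 2 (λ r u → r M.:* (u M.:* r M.:- r) M.:= r M.:* r M.:* (u M.:- M.con ℤ.1ℤ)) refl r u ⟩
    r M.* r M.* (u M.+ M.- M.1#)             ∎

  s-1≢0 : s M.+ M.- M.1# ≢ M.0#
  s-1≢0 eq = M.x*y≢0 (M.x*y≢0 r≢0 r≢0) (λ u-1≡0 → linear≢0 (𝔽.- 𝔽.1#) 𝔽.1# 𝔽.1≢0 (begin
    φ.⟦ 𝔽.- 𝔽.1# ⟧ M.+ u M.* φ.⟦ 𝔽.1# ⟧     ≡⟨ cong₂ (λ x y → x M.+ u M.* y) (trans (φ.-‿homo _) (cong M.-_ φ.1-homo)) φ.1-homo ⟩
    M.- M.1# M.+ u M.* M.1#                 ≡⟨ M.solve 1 (λ u → M.:- M.con ℤ.1ℤ M.:+ u M.:* M.con ℤ.1ℤ M.:= u M.:- M.con ℤ.1ℤ) refl u ⟩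
    u M.+ M.- M.1#                          ≡⟨ u-1≡0 ⟩
    M.0#                                    ∎)) (trans (sym s-1≡r²[u-1]) eq)

  t≢0 : t ≢ M.0#
  t≢0 = M.x*y≢0 u≢0 (M.inv≢0 μ 2-u≢0)

  s≢0 : s ≢ M.0#
  s≢0 = M.x*y≢0 t≢0 t≢0

  private
    t-generates : Generates t
    t-generates x = ∈-trans (subst _∈𝔽[ t ] u≡ (∈-* (∈-* (∈-+ ∈-1 ∈-1) ∈-self) (∈-inv r≢0 (∈-+ ∈-self ∈-1)))) (u-generates x)
      where
      u≡ : (M.1# M.+ M.1#) M.* t M.* M.inv r r≢0 ≡ u
      u≡ = begin
        (M.1# M.+ M.1#) M.* t M.* M.inv r r≢0     ≡⟨ cong (M._* M.inv r r≢0) 2t≡ur ⟩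
        u M.* r M.* M.inv r r≢0                   ≡⟨ M.*-assoc u r _ ⟩
        u M.* (r M.* M.inv r r≢0)                 ≡⟨ cong (u M.*_) (M.inv-inverseʳ r r≢0) ⟩
        u M.* M.1#                                ≡⟨ M.*-identityʳ u ⟩
        u                                         ∎

    g-small : Small 0 g
    g-small k lt = bounded Dg k lt

    h≋ : h ≋ scale (proj₁ h~H) (homogenise m 0 g)
    h≋ = subst (λ H → h ≋ scale (proj₁ h~H) H) (Hpoly≡ m g) (≈⇒≋ (proj₂ (proj₂ h~H)))

    h[t]≡0 : ev t h ≡ M.0#
    h[t]≡0 = begin
      ev t h                                              ≡⟨ At.ev-cong t h≋ ⟩
      ev t (scale (proj₁ h~H) (homogenise m 0 g))         ≡⟨ At.ev-scale t (proj₁ h~H) (homogenise m 0 g) ⟩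
      φ.⟦ proj₁ h~H ⟧ M.* ev t (homogenise m 0 g)         ≡⟨ cong (φ.⟦ proj₁ h~H ⟧ M.*_) (ev-homogenise base u t r refl 2t≡ur 0 g g-small) ⟩
      φ.⟦ proj₁ h~H ⟧ M.* ((r M.^ (2 ℕ.* m) M.* M.1#) M.* ev u g)   ≡⟨ cong (λ z → φ.⟦ proj₁ h~H ⟧ M.* ((r M.^ (2 ℕ.* m) M.* M.1#) M.* z)) (∣⇒ev-u≡0 g ∣-refl) ⟩
      φ.⟦ proj₁ h~H ⟧ M.* ((r M.^ (2 ℕ.* m) M.* M.1#) M.* M.0#)     ≡⟨ M.solve 2 (λ a b → a M.:* (b M.:* M.con ℤ.0ℤ) M.:= M.con ℤ.0ℤ) refl _ _ ⟩
      M.0#                                                ∎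

    h≢0 : ¬ h ≋ []
    h≢0 = Monic⇒≢[] monic-h

    h-<deg : h <deg suc (2 ℕ.* m)
    h-<deg k lt = trans (at h≋ k) (scale-<deg (proj₁ h~H) {homogenise m 0 g} (homogenise-<deg 0 g g-small) k lt)

    -- The substitution could have lowered the degree. It has not, because `h` vanishes at `t`,
    -- which generates a field of size q^(2m), q the size of the base field.
    Dh : Degree h (2 ℕ.* m)
    Dh = subst (Degree h) (ℕ.≤-antisym (ℕ.s≤s⁻¹ (<deg⇒Degree< h-<deg (proj₂ D))) (generator-degree size-M t-generates (proj₂ D) h[t]≡0)) (proj₂ D)
      where D = degree-of h≢0

    s-degree : ∀ {p n} → Degree p n → ev s p ≡ M.0# → m ℕ.≤ n
    s-degree {p} {n} D p≡0 = ℕ.*-cancelˡ-≤ 2 (subst (2 ℕ.* m ℕ.≤_) (cong (n ℕ.+_) (sym (ℕ.+-identityʳ n)))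
      (generator-degree size-M t-generates (Degree-double D) (trans (ev-double base t p) p≡0)))

    h-parity : ev s (evenCoeffs 𝔽 h) M.+ t M.* ev s (oddCoeffs 𝔽 h) ≡ M.0#
    h-parity = trans (sym (ev-parity base t h)) h[t]≡0

  private
    1≤m : 1 ℕ.≤ m
    1≤m = ℕ.*-cancelˡ-≤ {1} {m} 2 2≤2m

    none-smaller : ∀ {n} → (∀ {p k} → Degree p k → ev s p ≡ M.0# → n ℕ.≤ k) → ∀ p → p <deg n → ev s p ≡ M.0# → p ≋ []
    none-smaller big p b p≡0 = [ (λ (k , D) → ⊥-elim (ℕ.<⇒≱ (<deg⇒Degree< b D) (big D p≡0))) , id ]′ (degree⊎zero p)

  private
    minimal-even : IsZeroₚ 𝔽 (oddCoeffs 𝔽 h) → IsMinimalPolynomial base s (evenCoeffs 𝔽 h)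
    minimal-even z = record
      { d = m ; D = De ; 1≤d = 1≤m ; f[θ]≡0 = e[s]≡0
      ; minimal = no-smaller⇒minimal base s De e[s]≡0 (none-smaller s-degree) }
      where
      De : Degree (evenCoeffs 𝔽 h) m
      De = Degree-even (subst (Degree h) 2m≡m+m Dh)
      e[s]≡0 : ev s (evenCoeffs 𝔽 h) ≡ M.0#
      e[s]≡0 = begin
        ev s (evenCoeffs 𝔽 h)                                          ≡⟨ M.solve 2 (λ x t → x M.:= x M.:+ t M.:* M.con ℤ.0ℤ) refl _ t ⟩
        ev s (evenCoeffs 𝔽 h) M.+ t M.* M.0#                           ≡⟨ cong (λ z → ev s (evenCoeffs 𝔽 h) M.+ t M.* z) (At.ev-cong s {oddCoeffs 𝔽 h} {[]} (IsZero⇒≋[] z)) ⟨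
        ev s (evenCoeffs 𝔽 h) M.+ t M.* ev s (oddCoeffs 𝔽 h)           ≡⟨ h-parity ⟩
        M.0#                                                           ∎

    E O : M.F
    E = ev s (evenCoeffs 𝔽 h)
    O = ev s (oddCoeffs 𝔽 h)

    -- As a nonzero polynomial of degree below `m` the odd part is too small to annihilate `s`.
    O≢0 : ¬ IsZeroₚ 𝔽 (oddCoeffs 𝔽 h) → O ≢ M.0#
    O≢0 nz O≡0 = ℕ.<⇒≱ (<deg⇒Degree< odd-<deg (proj₂ Do)) (s-degree (proj₂ Do) O≡0)
      where
      Do : ∃ (Degree (oddCoeffs 𝔽 h))
      Do = degree-of {oddCoeffs 𝔽 h} (nz ∘ ≋[]⇒IsZero _)
      odd-<deg : oddCoeffs 𝔽 h <deg m
      odd-<deg n m≤n = trans (coef-odd h n) (h-<deg (suc (n ℕ.+ n)) (s≤s (subst (ℕ._≤ n ℕ.+ n) (sym 2m≡m+m) (ℕ.+-mono-≤ m≤n m≤n))))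

    s-generates : O ≢ M.0# → Generates s
    s-generates O≢0 x = ∈-trans (subst _∈𝔽[ s ] t≡ (∈-* (∈-neg (evenCoeffs 𝔽 h , refl)) (∈-inv O≢0 (oddCoeffs 𝔽 h , refl)))) (t-generates x)
      where
      t≡ : M.- E M.* M.inv O O≢0 ≡ t
      t≡ = begin
        M.- E M.* M.inv O O≢0                             ≡⟨ M.solve 4 (λ E O t i → M.:- E M.:* i M.:= t M.:* (O M.:* i) M.:- (E M.:+ t M.:* O) M.:* i) refl E O t (M.inv O O≢0) ⟩
        t M.* (O M.* M.inv O O≢0) M.+ M.- ((E M.+ t M.* O) M.* M.inv O O≢0)   ≡⟨ cong₂ (λ x y → t M.* x M.+ M.- (y M.* M.inv O O≢0)) (M.inv-inverseʳ O O≢0) h-parity ⟩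
        t M.* M.1# M.+ M.- (M.0# M.* M.inv O O≢0)         ≡⟨ M.solve 2 (λ t i → t M.:* M.con ℤ.1ℤ M.:- M.con ℤ.0ℤ M.:* i M.:= t) refl t _ ⟩
        t                                                 ∎

    hh⁻ : Poly 𝔽
    hh⁻ = h ⊗ negVar 𝔽 h

    hh⁻[s]≡0 : ev s (evenCoeffs 𝔽 hh⁻) ≡ M.0#
    hh⁻[s]≡0 = ev-even≡0 base 2≢0ᴹ t hh⁻
      (trans (At.ev-⊗ t h (negVar 𝔽 h)) (trans (cong (M._* ev t (negVar 𝔽 h)) h[t]≡0) (M.zeroˡ _)))
      (trans (At.ev-⊗ (M.- t) h (negVar 𝔽 h)) (trans (cong (ev (M.- t) h M.*_) (trans (ev-negVar base t h) h[t]≡0)) (M.zeroʳ _)))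

    Dhh⁻ : Degree (evenCoeffs 𝔽 hh⁻) (2 ℕ.* m)
    Dhh⁻ = Degree-even (Degree-⊗ Dh (Degree-negVar Dh))

    minimal-odd : ¬ IsZeroₚ 𝔽 (oddCoeffs 𝔽 h) → IsMinimalPolynomial base s (evenCoeffs 𝔽 hh⁻)
    minimal-odd nz = record
      { d = 2 ℕ.* m ; D = Dhh⁻ ; 1≤d = ℕ.<⇒≤ 2≤2m ; f[θ]≡0 = hh⁻[s]≡0
      ; minimal = no-smaller⇒minimal base s Dhh⁻ hh⁻[s]≡0 (none-smaller (generator-degree size-M (s-generates (O≢0 nz)))) }

  tilde-minimal : IsMinimalPolynomial base s (tilde 𝔽 h)
  tilde-minimal = tilde-elim h (IsMinimalPolynomial base s) minimal-even minimal-odd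

  private
    module Qu = QuatEvaluation 𝔽 ε base u
    module Qs = QuatEvaluation 𝔽 ε base s
    module Hu = QuaternionAlgebra M Qu.e Qu.j
    module Hs = QuaternionAlgebra M Qs.e Qs.j

    open Twist M Qu.e Qu.j r

    module Wu = WordValues 𝔽 ε M Qu.e Qu.j (Qu.evℍ ∘ δ 𝔽 ε)
    module Ws = WordValues 𝔽 ε M Qs.e Qs.j (Qs.evℍ ∘ γ 𝔽 ε)

    -- z = cj + dij has z² = 1 - u, hence (1 + z)² = (2 - u) + 2z; here 2 - u is `μ` and 2 is `μ`
    -- times `r`.
    γ²≡μϑγ : ∀ c d → Qu.e M.* (d M.* d) M.+ M.- (c M.* c) ≡ M.1# →
             let x = M.1# ,ᵢ M.0# ,ⱼ c ,ₖ d in x Hu.• x ≡ μ Hu.∙ ϑ x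
    γ²≡μϑγ c d eq = Hu.ℍ-≡
      (begin
        _ ≡⟨ M.solve 4 (λ e u c d → Symbolic.*a e (u M.:- M.con ℤ.1ℤ) (M.con ℤ.1ℤ) (M.con ℤ.0ℤ) c d (M.con ℤ.1ℤ) (M.con ℤ.0ℤ) c d
                           M.:= M.con ℤ.1ℤ M.:- (u M.:- M.con ℤ.1ℤ) M.:* (e M.:* (d M.:* d) M.:- c M.:* c)) refl Qu.e u c d ⟩
        M.1# M.+ M.- ((u M.+ M.- M.1#) M.* (Qu.e M.* (d M.* d) M.+ M.- (c M.* c)))   ≡⟨ cong (λ z → M.1# M.+ M.- ((u M.+ M.- M.1#) M.* z)) eq ⟩
        M.1# M.+ M.- ((u M.+ M.- M.1#) M.* M.1#)
          ≡⟨ M.solve 1 (λ u → M.con ℤ.1ℤ M.:- (u M.:- M.con ℤ.1ℤ) M.:* M.con ℤ.1ℤ M.:= (M.con (ℤ.+ 2) M.:- u) M.:* M.con ℤ.1ℤ) refl u ⟩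
        μ M.* M.1#                                                                  ∎)
      (M.solve 5 (λ e j μ c d → Symbolic.*b e j (M.con ℤ.1ℤ) (M.con ℤ.0ℤ) c d (M.con ℤ.1ℤ) (M.con ℤ.0ℤ) c d M.:= μ M.:* M.con ℤ.0ℤ) refl Qu.e Qu.j μ c d)
      (trans (M.solve 4 (λ e j c d → Symbolic.*c e j (M.con ℤ.1ℤ) (M.con ℤ.0ℤ) c d (M.con ℤ.1ℤ) (M.con ℤ.0ℤ) c d M.:= M.con (ℤ.+ 2) M.:* c) refl Qu.e Qu.j c d) (double-coordinate c))
      (trans (M.solve 4 (λ e j c d → Symbolic.*d e j (M.con ℤ.1ℤ) (M.con ℤ.0ℤ) c d (M.con ℤ.1ℤ) (M.con ℤ.0ℤ) c d M.:= M.con (ℤ.+ 2) M.:* d) refl Qu.e Qu.j c d) (double-coordinate d))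
      where
      open QuaternionCoordinates M.commutativeRing Qu.e Qu.j using (module Symbolic)
      double-coordinate : ∀ c → (M.1# M.+ M.1#) M.* c ≡ μ M.* (r M.* c)
      double-coordinate c = trans (cong (M._* c) (sym μr≡2)) (M.*-assoc μ r c)

    δ-value : ∀ σ → Qu.evℍ (δ 𝔽 ε σ) ≡ μ Hu.∙ ϑ (Qs.evℍ (γ 𝔽 ε σ))
    δ-value σ@((c , d) , eq) = begin
      Qu.evℍ (δ 𝔽 ε σ)                                  ≡⟨ Qu.evℍ-· (γ 𝔽 ε σ) (γ 𝔽 ε σ) ⟩
      Qu.evℍ (γ 𝔽 ε σ) Hu.• Qu.evℍ (γ 𝔽 ε σ)            ≡⟨ cong₂ Hu._•_ (Qu.evℍ-γ σ) (Qu.evℍ-γ σ) ⟩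
      Qu.γ̂ σ Hu.• Qu.γ̂ σ                               ≡⟨ γ²≡μϑγ φ.⟦ c ⟧ φ.⟦ d ⟧ (Qu.φ-Sol eq) ⟩
      μ Hu.∙ ϑ (Qs.γ̂ σ)                                ≡⟨ cong (λ x → μ Hu.∙ ϑ x) (Qs.evℍ-γ σ) ⟨
      μ Hu.∙ ϑ (Qs.evℍ (γ 𝔽 ε σ))                       ∎

    letter-twist : ∀ l → Wu.letterValue l ≡ μ Hu.∙ ϑ (Ws.letterValue l)
    letter-twist (false , σ) = δ-value σ
    letter-twist (true , σ) = begin
      Hu.conjugate (Qu.evℍ (δ 𝔽 ε σ))                            ≡⟨ cong Hu.conjugate (δ-value σ) ⟩
      Hu.conjugate (μ Hu.∙ ϑ (Qs.evℍ (γ 𝔽 ε σ)))                 ≡⟨ Hu.conjugate-∙ μ _ ⟩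
      μ Hu.∙ Hu.conjugate (ϑ (Qs.evℍ (γ 𝔽 ε σ)))                 ≡⟨ cong (μ Hu.∙_) (ϑ-conjugate _) ⟨
      μ Hu.∙ ϑ (Hs.conjugate (Qs.evℍ (γ 𝔽 ε σ)))                 ∎

    word-twist : ∀ w → ∃ λ k → k ≢ M.0# × Wu.wordValue w ≡ k Hu.∙ ϑ (Ws.wordValue w)
    word-twist [] = M.1# , M.1≢0 , sym (trans (Hu.1∙ _) ϑ-1)
    word-twist (l ∷ w) = μ M.* k , M.x*y≢0 μ≢0 (proj₁ (proj₂ (word-twist w))) , (begin
      Wu.letterValue l Hu.• Wu.wordValue w         ≡⟨ cong₂ Hu._•_ (letter-twist l) (proj₂ (proj₂ (word-twist w))) ⟩
      (μ Hu.∙ x) Hu.• (k Hu.∙ y)                   ≡⟨ Hu.∙-• μ x (k Hu.∙ y) ⟩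
      μ Hu.∙ (x Hu.• (k Hu.∙ y))                   ≡⟨ cong (μ Hu.∙_) (Hu.•-∙ k x y) ⟩
      μ Hu.∙ k Hu.∙ (x Hu.• y)                     ≡⟨ Hu.∙-∙ μ k (x Hu.• y) ⟩
      (μ M.* k) Hu.∙ (x Hu.• y)                    ≡⟨ cong ((μ M.* k) Hu.∙_) (ϑ-• s-1≡r²[u-1] (Ws.letterValue l) (Ws.wordValue w)) ⟨
      (μ M.* k) Hu.∙ ϑ (Ws.letterValue l Hs.• Ws.wordValue w)    ∎)
      where
      k = proj₁ (word-twist w)
      x = ϑ (Ws.letterValue l)
      y = ϑ (Ws.wordValue w)

    real-twist : ∀ {k} → k ≢ M.0# → ∀ x → Hu.IsReal (k Hu.∙ ϑ x) ⇔ Hs.IsReal x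
    real-twist {k} k≢0 (a ,ᵢ b ,ⱼ c ,ₖ d) = mk⇔
      (λ (b≡0 , c≡0 , d≡0) → M.x*y≡0⇒y≡0 k≢0 b≡0 , M.x*y≡0⇒y≡0 r≢0 (M.x*y≡0⇒y≡0 k≢0 c≡0) , M.x*y≡0⇒y≡0 r≢0 (M.x*y≡0⇒y≡0 k≢0 d≡0))
      (λ { (refl , refl , refl) → M.zeroʳ k , trans (cong (k M.*_) (M.zeroʳ r)) (M.zeroʳ k) , trans (cong (k M.*_) (M.zeroʳ r)) (M.zeroʳ k) })

    norm-δ : ∀ σ → Hu.norm (Qu.evℍ (δ 𝔽 ε σ)) ≡ u M.* u
    norm-δ σ = begin
      Hu.norm (Qu.evℍ (δ 𝔽 ε σ))                                     ≡⟨ cong Hu.norm (Qu.evℍ-· (γ 𝔽 ε σ) (γ 𝔽 ε σ)) ⟩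
      Hu.norm (Qu.evℍ (γ 𝔽 ε σ) Hu.• Qu.evℍ (γ 𝔽 ε σ))               ≡⟨ Hu.norm-• (Qu.evℍ (γ 𝔽 ε σ)) (Qu.evℍ (γ 𝔽 ε σ)) ⟩
      Hu.norm (Qu.evℍ (γ 𝔽 ε σ)) M.* Hu.norm (Qu.evℍ (γ 𝔽 ε σ))      ≡⟨ cong (λ x → Hu.norm x M.* Hu.norm x) (Qu.evℍ-γ σ) ⟩
      Hu.norm (Qu.γ̂ σ) M.* Hu.norm (Qu.γ̂ σ)                        ≡⟨ cong (λ x → x M.* x) (Qu.norm-γ̂ σ) ⟩
      u M.* u                                                        ∎

    norm-γ : ∀ σ → Hs.norm (Qs.evℍ (γ 𝔽 ε σ)) ≡ s
    norm-γ σ = trans (cong Hs.norm (Qs.evℍ-γ σ)) (Qs.norm-γ̂ σ)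

    ∣⇒ev-s≡0 : ∀ p → tilde 𝔽 h ∣ p → ev s p ≡ M.0#
    ∣⇒ev-s≡0 p = At.∣⇒ev≡0 s (IsMinimalPolynomial.f[θ]≡0 tilde-minimal)

  -- Both sides say that the value of the word is real, and neither the rescaling by `r` nor the
  -- nonzero scalar of `word-twist` affects realness.
  InΓ-correspondence : ∀ w → InΓ[_] 𝔽 ε g (evalWord 𝔽 ε (δ 𝔽 ε) w) ⇔ InΓ[_] 𝔽 ε (tilde 𝔽 h) (evalWord 𝔽 ε (γ 𝔽 ε) w)
  InΓ-correspondence w = mk⇔
    (S.from ∘ subst Hs.IsReal (sym evγ) ∘ Equivalence.to (real-twist k≢0 (Ws.wordValue w)) ∘ subst Hu.IsReal (trans evδ eq) ∘ U.to)
    (U.from ∘ subst Hu.IsReal (sym (trans evδ eq)) ∘ Equivalence.from (real-twist k≢0 (Ws.wordValue w)) ∘ subst Hs.IsReal evγ ∘ S.to)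
    where
    k≢0 = proj₁ (proj₂ (word-twist w))
    eq = proj₂ (proj₂ (word-twist w))
    evδ = Qu.evℍ-evalWord (δ 𝔽 ε) w
    evγ = Qs.evℍ-evalWord (γ 𝔽 ε) w
    module U = Equivalence (Qu.InΓ⇔IsReal ev-u≡0⇒∣ ∣⇒ev-u≡0 (evalWord 𝔽 ε (δ 𝔽 ε) w)
      (λ N≡0 → M.x^n≢0 (length w) (M.x*y≢0 u≢0 u≢0) (trans (sym (trans (cong Hu.norm evδ) (Wu.norm-wordValue norm-δ w))) N≡0)))
    module S = Equivalence (Qs.InΓ⇔IsReal (IsMinimalPolynomial.minimal tilde-minimal) ∣⇒ev-s≡0 (evalWord 𝔽 ε (γ 𝔽 ε) w)
      (λ N≡0 → M.x^n≢0 (length w) s≢0 (trans (sym (trans (cong Hs.norm evγ) (Ws.norm-wordValue norm-γ w))) N≡0)))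

  -- Surjectivity of the identity map on words comes down to this; the value of w⁻¹w is the norm of
  -- w, which is real.
  CosetEq-refl : ∀ w → CosetEq 𝔽 ε (γ 𝔽 ε) (tilde 𝔽 h) w w
  CosetEq-refl w = Equivalence.from (Qs.InΓ⇔IsReal (IsMinimalPolynomial.minimal tilde-minimal) ∣⇒ev-s≡0 (evalWord 𝔽 ε (γ 𝔽 ε) w⁻¹w)
      (λ N≡0 → M.x^n≢0 (length w⁻¹w) s≢0 (trans (sym (trans (cong Hs.norm value) (Ws.norm-wordValue norm-γ w⁻¹w))) N≡0)))
    (subst Hs.IsReal (sym (trans value (trans (Ws.wordValue-++ (invWord 𝔽 ε w) w) (trans (cong (Hs._• Ws.wordValue w) (Ws.wordValue-invWord w)) (Hs.conjugate-•-self (Ws.wordValue w)))))) (refl , refl , refl))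
    where
    w⁻¹w : Word 𝔽 ε
    w⁻¹w = invWord 𝔽 ε w ++ w
    value : Qs.evℍ (evalWord 𝔽 ε (γ 𝔽 ε) w⁻¹w) ≡ Ws.wordValue w⁻¹w
    value = Qs.evℍ-evalWord (γ 𝔽 ε) w⁻¹w

-- Splitting over a finite field

module Matrices (K : FiniteField) where
  open FieldTheory K

  infixl 7 _⊙_
  _⊙_ : Mat2 K → Mat2 K → Mat2 K
  _⊙_ = _·M_ K

  infixr 8 _*ₘ_
  _*ₘ_ : F → Mat2 K → Mat2 K
  _*ₘ_ = scaleM K

  Mat2-≡ : {a b c d a′ b′ c′ d′ : F} → a ≡ a′ → b ≡ b′ → c ≡ c′ → d ≡ d′ → mat {K = K} a b c d ≡ mat a′ b′ c′ d′
  Mat2-≡ refl refl refl refl = refl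

  1ₘ : Mat2 K
  1ₘ = mat 1# 0# 0# 1#

  adj : Mat2 K → Mat2 K
  adj (mat a b c d) = mat d (- b) (- c) a

  _+ₘ_ : Mat2 K → Mat2 K → Mat2 K
  mat a b c d +ₘ mat a′ b′ c′ d′ = mat (a + a′) (b + b′) (c + c′) (d + d′)

  upper lower : F → Mat2 K
  upper t = mat 1# t 0# 1#
  lower t = mat 1# 0# t 1#

  add-upper : ∀ a τ → (a *ₘ 1ₘ) +ₘ ((a * τ) *ₘ mat 0# 1# 0# 0#) ≡ a *ₘ upper τ
  add-upper a τ = Mat2-≡ diagonal (solve 2 (λ a t → a :* con ℤ.0ℤ :+ (a :* t) :* con ℤ.1ℤ := a :* t) refl a τ) off diagonal
    where
    diagonal : a * 1# + a * τ * 0# ≡ a * 1#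
    diagonal = solve 2 (λ a t → a :* con ℤ.1ℤ :+ (a :* t) :* con ℤ.0ℤ := a :* con ℤ.1ℤ) refl a τ
    off : a * 0# + a * τ * 0# ≡ a * 0#
    off = solve 2 (λ a t → a :* con ℤ.0ℤ :+ (a :* t) :* con ℤ.0ℤ := a :* con ℤ.0ℤ) refl a τ

  add-lower : ∀ a τ → (a *ₘ 1ₘ) +ₘ ((a * τ) *ₘ mat 0# 0# 1# 0#) ≡ a *ₘ lower τ
  add-lower a τ = cong (λ { (mat p q r t) → mat p r q t }) (add-upper a τ)

  det-⊙ : ∀ M N → det K (M ⊙ N) ≡ det K M * det K N
  det-⊙ (mat a b c d) (mat a′ b′ c′ d′) = solve 8 (λ a b c d a′ b′ c′ d′ →
    (a :* a′ :+ b :* c′) :* (c :* b′ :+ d :* d′) :- (a :* b′ :+ b :* d′) :* (c :* a′ :+ d :* c′)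
    := (a :* d :- b :* c) :* (a′ :* d′ :- b′ :* c′)) refl a b c d a′ b′ c′ d′

  det-*ₘ : ∀ k M → det K (k *ₘ M) ≡ k * k * det K M
  det-*ₘ k (mat a b c d) = solve 5 (λ k a b c d → (k :* a) :* (k :* d) :- (k :* b) :* (k :* c) := k :* k :* (a :* d :- b :* c)) refl k a b c d

  *ₘ-⊙ : ∀ k l M N → (k *ₘ M) ⊙ (l *ₘ N) ≡ (k * l) *ₘ (M ⊙ N)
  *ₘ-⊙ k l (mat a b c d) (mat a′ b′ c′ d′) = Mat2-≡ (entry a b a′ c′) (entry a b b′ d′) (entry c d a′ c′) (entry c d b′ d′)
    where
    entry : ∀ x y z w → (k * x) * (l * z) + (k * y) * (l * w) ≡ (k * l) * (x * z + y * w)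
    entry = solve 6 (λ k l x y z w → (k :* x) :* (l :* z) :+ (k :* y) :* (l :* w) := (k :* l) :* (x :* z :+ y :* w)) refl k l

  *ₘ-*ₘ : ∀ k l M → k *ₘ l *ₘ M ≡ (k * l) *ₘ M
  *ₘ-*ₘ k l (mat a b c d) = Mat2-≡ (sym (*-assoc k l a)) (sym (*-assoc k l b)) (sym (*-assoc k l c)) (sym (*-assoc k l d))

  1*ₘ : ∀ M → 1# *ₘ M ≡ M
  1*ₘ (mat a b c d) = Mat2-≡ (*-identityˡ a) (*-identityˡ b) (*-identityˡ c) (*-identityˡ d)

  upper-lower-upper : ∀ x y z → upper x ⊙ (lower y ⊙ upper z) ≡ mat (1# + x * y) ((1# + x * y) * z + x) y (1# + z * y)
  upper-lower-upper x y z = Mat2-≡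
    (solve 3 (λ x y z → l :* (l :* l :+ o :* o) :+ x :* (y :* l :+ l :* o) := l :+ x :* y) refl x y z)
    (solve 3 (λ x y z → l :* (l :* z :+ o :* l) :+ x :* (y :* z :+ l :* l) := (l :+ x :* y) :* z :+ x) refl x y z)
    (solve 3 (λ x y z → o :* (l :* l :+ o :* o) :+ l :* (y :* l :+ l :* o) := y) refl x y z)
    (solve 3 (λ x y z → o :* (l :* z :+ o :* l) :+ l :* (y :* z :+ l :* l) := l :+ z :* y) refl x y z)
    where
    o l : ∀ {n} → Polynomial n
    o = con ℤ.0ℤ
    l = con ℤ.1ℤ

  ⊙-lower : ∀ a b c d t → mat a b c d ⊙ lower t ≡ mat (a + b * t) b (c + d * t) d
  ⊙-lower a b c d t = Mat2-≡ (left a b) (right a b) (left c d) (right c d)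
    where
    left : ∀ a b → a * 1# + b * t ≡ a + b * t
    left a b = cong (_+ b * t) (*-identityʳ a)
    right : ∀ a b → a * 0# + b * 1# ≡ b
    right = solve 2 (λ a b → a :* con ℤ.0ℤ :+ b :* con ℤ.1ℤ := b) refl

  module _ (P : Mat2 K → Set) (P-upper : ∀ t → P (upper t)) (P-lower : ∀ t → P (lower t)) (P-⊙ : ∀ {M N} → P M → P N → P (M ⊙ N)) where
    private
      generic : ∀ a b c d → a * d + - (b * c) ≡ 1# → c ≢ 0# → P (mat a b c d)
      generic a b c d Δ c≢0 = subst P (trans (upper-lower-upper x c z) (Mat2-≡ (cancel a) b-eq refl (cancel d)))
        (P-⊙ (P-upper x) (P-⊙ (P-lower c) (P-upper z)))
        where
        i = inv c c≢0
        x = (a + - 1#) * i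
        z = (d + - 1#) * i
        cancel : ∀ p → 1# + (p + - 1#) * i * c ≡ p
        cancel p = begin
          1# + (p + - 1#) * i * c        ≡⟨ cong (1# +_) (*-assoc (p + - 1#) i c) ⟩
          1# + (p + - 1#) * (i * c)      ≡⟨ cong (λ q → 1# + (p + - 1#) * q) (inv-inverseˡ c c≢0) ⟩
          1# + (p + - 1#) * 1#           ≡⟨ solve 1 (λ p → con ℤ.1ℤ :+ (p :- con ℤ.1ℤ) :* con ℤ.1ℤ := p) refl p ⟩
          p                              ∎
        b-eq : (1# + x * c) * z + x ≡ b
        b-eq = *-cancelˡ c≢0 (begin
          c * ((1# + x * c) * z + x)             ≡⟨ solve 3 (λ x c z → c :* ((con ℤ.1ℤ :+ x :* c) :* z :+ x) := (con ℤ.1ℤ :+ x :* c) :* (con ℤ.1ℤ :+ z :* c) :- con ℤ.1ℤ) refl x c z ⟩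
          (1# + x * c) * (1# + z * c) + - 1#     ≡⟨ cong₂ (λ p q → p * q + - 1#) (cancel a) (cancel d) ⟩
          a * d + - 1#                           ≡⟨ cong (λ q → a * d + - q) Δ ⟨
          a * d + - (a * d + - (b * c))          ≡⟨ solve 3 (λ m b c → m :- (m :- b :* c) := c :* b) refl (a * d) b c ⟩
          c * b                                  ∎)

    -- With c ≠ 0 a matrix is a product upper, lower, upper. If c = 0 then d ≠ 0, and multiplying by
    -- `lower 1#` on the right leads to the first case.
    SL₂-induction : ∀ M → det K M ≡ 1# → P M
    SL₂-induction (mat a b c d) Δ with c ≟ 0#
    ... | no c≢0 = generic a b c d Δ c≢0
    ... | yes c≡0 = subst P (trans (⊙-lower (a + b * 1#) b (c + d * 1#) d (- 1#)) (Mat2-≡ (back a b) refl (back c d) refl))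
      (P-⊙ (generic (a + b * 1#) b (c + d * 1#) d
             (trans (solve 4 (λ a b c d → (a :+ b :* con ℤ.1ℤ) :* d :- b :* (c :+ d :* con ℤ.1ℤ) := a :* d :- b :* c) refl a b c d) Δ) c+d≢0)
           (P-lower (- 1#)))
      where
      back : ∀ a b → (a + b * 1#) + b * - 1# ≡ a
      back = solve 2 (λ a b → (a :+ b :* con ℤ.1ℤ) :+ b :* (:- con ℤ.1ℤ) := a) refl
      c+d≢0 : c + d * 1# ≢ 0#
      c+d≢0 eq = 1≢0 (begin
        1#                              ≡⟨ Δ ⟨
        a * d + - (b * c)               ≡⟨ solve 4 (λ a b c d → a :* d :- b :* c := a :* (c :+ d :* con ℤ.1ℤ) :- (a :+ b) :* c) refl a b c d ⟩
        a * (c + d * 1#) + - ((a + b) * c)   ≡⟨ cong₂ (λ x y → a * x + - ((a + b) * y)) eq c≡0 ⟩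
        a * 0# + - ((a + b) * 0#)       ≡⟨ solve 2 (λ a b → a :* con ℤ.0ℤ :- b :* con ℤ.0ℤ := con ℤ.0ℤ) refl a (a + b) ⟩
        0#                              ∎)

  -- For the rows w₁, w₂ of the matrix W the hypothesis reads w₁Z = ρw₂ and w₂Z = 0, that is WZ =
  -- ρE₁₂W. The adjugate serves as the inverse, at the price of the determinant.
  ⊙-adj-upper : ∀ {Z ρ} a b c d → mat a b c d ⊙ Z ≡ mat (ρ * c) (ρ * d) 0# 0# →
    (mat a b c d ⊙ Z) ⊙ adj (mat a b c d) ≡ (det K (mat a b c d) * ρ) *ₘ mat 0# 1# 0# 0#
  ⊙-adj-upper {ρ = ρ} a b c d eq = trans (cong (_⊙ adj (mat a b c d)) eq) (Mat2-≡
    (solve 5 (λ ρ a b c d → (ρ :* c) :* d :+ (ρ :* d) :* (:- c) := ((a :* d :- b :* c) :* ρ) :* con ℤ.0ℤ) refl ρ a b c d)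
    (solve 5 (λ ρ a b c d → (ρ :* c) :* (:- b) :+ (ρ :* d) :* a := ((a :* d :- b :* c) :* ρ) :* con ℤ.1ℤ) refl ρ a b c d)
    (solve 5 (λ ρ a b c d → con ℤ.0ℤ :* d :+ con ℤ.0ℤ :* (:- c) := ((a :* d :- b :* c) :* ρ) :* con ℤ.0ℤ) refl ρ a b c d)
    (solve 5 (λ ρ a b c d → con ℤ.0ℤ :* (:- b) :+ con ℤ.0ℤ :* a := ((a :* d :- b :* c) :* ρ) :* con ℤ.0ℤ) refl ρ a b c d))

  ⊙-adj-lower : ∀ {Z ρ} a b c d → mat a b c d ⊙ Z ≡ mat 0# 0# (ρ * a) (ρ * b) →
    (mat a b c d ⊙ Z) ⊙ adj (mat a b c d) ≡ (det K (mat a b c d) * ρ) *ₘ mat 0# 0# 1# 0#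
  ⊙-adj-lower {ρ = ρ} a b c d eq = trans (cong (_⊙ adj (mat a b c d)) eq) (Mat2-≡
    (solve 5 (λ ρ a b c d → con ℤ.0ℤ :* d :+ con ℤ.0ℤ :* (:- c) := ((a :* d :- b :* c) :* ρ) :* con ℤ.0ℤ) refl ρ a b c d)
    (solve 5 (λ ρ a b c d → con ℤ.0ℤ :* (:- b) :+ con ℤ.0ℤ :* a := ((a :* d :- b :* c) :* ρ) :* con ℤ.0ℤ) refl ρ a b c d)
    (solve 5 (λ ρ a b c d → (ρ :* a) :* d :+ (ρ :* b) :* (:- c) := ((a :* d :- b :* c) :* ρ) :* con ℤ.1ℤ) refl ρ a b c d)
    (solve 5 (λ ρ a b c d → (ρ :* a) :* (:- b) :+ (ρ :* b) :* a := ((a :* d :- b :* c) :* ρ) :* con ℤ.0ℤ) refl ρ a b c d))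

  -- The conjugating matrix has rows v and vZ/ρ (or the other way round), where v is any row with vZ ≠ 0.
  module _ (x y z : F) (nilpotent : x * x + y * z ≡ 0#) (nonzero : ¬ (x ≡ 0# × y ≡ 0# × z ≡ 0#)) {ρ : F} (ρ≢0 : ρ ≢ 0#) where
    private
      Z : Mat2 K
      Z = mat x y z (- x)

      i = inv ρ ρ≢0

      ρi : ∀ p → ρ * (p * i) ≡ p
      ρi p = begin
        ρ * (p * i)     ≡⟨ solve 3 (λ ρ p i → ρ :* (p :* i) := p :* (ρ :* i)) refl ρ p i ⟩
        p * (ρ * i)     ≡⟨ cong (p *_) (inv-inverseʳ ρ ρ≢0) ⟩
        p * 1#          ≡⟨ *-identityʳ p ⟩
        p               ∎

      row₁₀ : ∀ p q → 1# * p + 0# * q ≡ ρ * (p * i)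
      row₁₀ p q = trans (solve 2 (λ p q → con ℤ.1ℤ :* p :+ con ℤ.0ℤ :* q := p) refl p q) (sym (ρi p))

      row₀₁ : ∀ p q → 0# * p + 1# * q ≡ ρ * (q * i)
      row₀₁ p q = trans (solve 2 (λ p q → con ℤ.0ℤ :* p :+ con ℤ.1ℤ :* q := q) refl p q) (sym (ρi q))

      Z²-row₁ : x * i * x + y * i * z ≡ 0#
      Z²-row₁ = begin
        x * i * x + y * i * z     ≡⟨ solve 4 (λ x y z i → x :* i :* x :+ y :* i :* z := i :* (x :* x :+ y :* z)) refl x y z i ⟩
        i * (x * x + y * z)       ≡⟨ cong (i *_) nilpotent ⟩
        i * 0#                    ≡⟨ zeroʳ i ⟩
        0#                        ∎

      Z²-row₂ : x * i * y + y * i * - x ≡ 0#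
      Z²-row₂ = solve 3 (λ x y i → x :* i :* y :+ y :* i :* (:- x) := con ℤ.0ℤ) refl x y i

      module y≡0 (y≡0 : y ≡ 0#) where
        x≡0 : x ≡ 0#
        x≡0 = x²≡0⇒x≡0 (begin
          x * x               ≡⟨ solve 2 (λ x z → x :* x := x :* x :+ con ℤ.0ℤ :* z) refl x z ⟩
          x * x + 0# * z      ≡⟨ cong (λ q → x * x + q * z) y≡0 ⟨
          x * x + y * z       ≡⟨ nilpotent ⟩
          0#                  ∎)

        z≢0 : z ≢ 0#
        z≢0 z≡0 = nonzero (x≡0 , y≡0 , z≡0)

        -x≡ : - x ≡ ρ * (0# * i)
        -x≡ = trans (trans (cong -_ x≡0) -0#≈0#) (sym (ρi 0#))

        vanish : ∀ {p} → p ≡ 0# → ∀ q r → q * p + 0# * r ≡ 0#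
        vanish refl = solve 2 (λ q r → q :* con ℤ.0ℤ :+ con ℤ.0ℤ :* r := con ℤ.0ℤ) refl

        vanish′ : ∀ {p} → p ≡ 0# → ∀ r q → r * i * p + 0# * i * q ≡ 0#
        vanish′ refl r q = solve 3 (λ r i q → r :* i :* con ℤ.0ℤ :+ con ℤ.0ℤ :* i :* q := con ℤ.0ℤ) refl r i q

    conjugate-to-upper : ∃ λ W → det K W ≢ 0# × (W ⊙ Z) ⊙ adj W ≡ (det K W * ρ) *ₘ mat 0# 1# 0# 0#
    conjugate-to-upper with y ≟ 0#
    ... | no y≢0 = mat 1# 0# (x * i) (y * i)
      , (λ eq → x*y≢0 y≢0 (inv≢0 ρ ρ≢0) (trans (solve 3 (λ x y i → y :* i := con ℤ.1ℤ :* (y :* i) :- con ℤ.0ℤ :* (x :* i)) refl x y i) eq))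
      , ⊙-adj-upper 1# 0# (x * i) (y * i) (Mat2-≡ (row₁₀ x z) (row₁₀ y (- x)) Z²-row₁ Z²-row₂)
    ... | yes y≡0 = mat 0# 1# (z * i) (0# * i)
      , (λ eq → x*y≢0 z≢0 (inv≢0 ρ ρ≢0) (trans (solve 2 (λ z i → z :* i := :- (con ℤ.0ℤ :* (con ℤ.0ℤ :* i) :- con ℤ.1ℤ :* (z :* i))) refl z i) (trans (cong -_ eq) -0#≈0#)))
      , ⊙-adj-upper 0# 1# (z * i) (0# * i) (Mat2-≡ (row₀₁ x z) (trans (solve 2 (λ y w → con ℤ.0ℤ :* y :+ con ℤ.1ℤ :* w := w) refl y (- x)) -x≡) (vanish′ x≡0 z z) (vanish′ y≡0 z (- x)))
      where open y≡0 y≡0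

    conjugate-to-lower : ∃ λ W → det K W ≢ 0# × (W ⊙ Z) ⊙ adj W ≡ (det K W * ρ) *ₘ mat 0# 0# 1# 0#
    conjugate-to-lower with y ≟ 0#
    ... | no y≢0 = mat (x * i) (y * i) 1# 0#
      , (λ eq → x*y≢0 y≢0 (inv≢0 ρ ρ≢0) (trans (solve 3 (λ x y i → y :* i := :- ((x :* i) :* con ℤ.0ℤ :- (y :* i) :* con ℤ.1ℤ)) refl x y i) (trans (cong -_ eq) -0#≈0#)))
      , ⊙-adj-lower (x * i) (y * i) 1# 0# (Mat2-≡ Z²-row₁ Z²-row₂ (row₁₀ x z) (row₁₀ y (- x)))
    ... | yes y≡0 = mat (z * i) (0# * i) 0# 1#
      , (λ eq → x*y≢0 z≢0 (inv≢0 ρ ρ≢0) (trans (solve 2 (λ z i → z :* i := (z :* i) :* con ℤ.1ℤ :- (con ℤ.0ℤ :* i) :* con ℤ.0ℤ) refl z i) eq))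
      , ⊙-adj-lower (z * i) (0# * i) 0# 1# (Mat2-≡ (vanish′ x≡0 z z) (vanish′ y≡0 z (- x)) (row₀₁ x z) (trans (solve 2 (λ y w → con ℤ.0ℤ :* y :+ con ℤ.1ℤ :* w := w) refl y (- x)) -x≡))
      where open y≡0 y≡0

  0ₘ : Mat2 K
  0ₘ = mat 0# 0# 0# 0#

  apply : Mat2 K → F × F → F × F
  apply (mat p q r t) (v , w) = p * v + q * w , r * v + t * w

  det-singular : ∀ M v → v ≢ (0# , 0#) → apply M v ≡ (0# , 0#) → det K M ≡ 0#
  det-singular (mat p q r t) (v , w) v≢0 eq with v ≟ 0# | w ≟ 0#
  ... | yes refl | yes refl = ⊥-elim (v≢0 refl)
  ... | no v≢0′ | _ = x*y≡0⇒y≡0 v≢0′ (begin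
    v * (p * t + - (q * r))                        ≡⟨ solve 6 (λ p q r t v w → v :* (p :* t :- q :* r) := t :* (p :* v :+ q :* w) :- q :* (r :* v :+ t :* w)) refl p q r t v w ⟩
    t * (p * v + q * w) + - (q * (r * v + t * w))  ≡⟨ cong₂ (λ x y → t * x + - (q * y)) (cong proj₁ eq) (cong proj₂ eq) ⟩
    t * 0# + - (q * 0#)                            ≡⟨ solve 2 (λ t q → t :* con ℤ.0ℤ :- q :* con ℤ.0ℤ := con ℤ.0ℤ) refl t q ⟩
    0#                                             ∎)
  ... | yes _ | no w≢0 = x*y≡0⇒y≡0 w≢0 (begin
    w * (p * t + - (q * r))                        ≡⟨ solve 6 (λ p q r t v w → w :* (p :* t :- q :* r) := p :* (r :* v :+ t :* w) :- r :* (p :* v :+ q :* w)) refl p q r t v w ⟩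
    p * (r * v + t * w) + - (r * (p * v + q * w))  ≡⟨ cong₂ (λ x y → p * x + - (r * y)) (cong proj₂ eq) (cong proj₁ eq) ⟩
    p * 0# + - (r * 0#)                            ≡⟨ solve 2 (λ t q → t :* con ℤ.0ℤ :- q :* con ℤ.0ℤ := con ℤ.0ℤ) refl p r ⟩
    0#                                             ∎)

  -- If M kills v then M Z (adj M) is M's column vector times the number det (v , Zv).
  non-eigenvector : 1# + 1# ≢ 0# → ∀ x y z → ¬ (x ≡ 0# × y ≡ 0# × z ≡ 0#) →
    ∃ λ v → v ≢ (0# , 0#) × (∀ M → M ≢ 0ₘ → apply M v ≡ (0# , 0#) → (M ⊙ mat x y z (- x)) ⊙ adj M ≢ 0ₘ)
  non-eigenvector 2≢0 x y z nz = go (z ≟ 0#) (y ≟ 0#)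
    where
    vanish : ∀ {k q} → k ≢ 0# → k * (q * q) ≡ 0# → q ≡ 0#
    vanish k≢0 eq = x²≡0⇒x≡0 (x*y≡0⇒y≡0 k≢0 eq)
    left : ∀ p q → p * 1# + q * 0# ≡ 0# → p ≡ 0#
    left p q eq = trans (solve 2 (λ p q → p := p :* con ℤ.1ℤ :+ q :* con ℤ.0ℤ) refl p q) eq
    go : Dec (z ≡ 0#) → Dec (y ≡ 0#) → _
    go (no z≢0) _ = (1# , 0#) , (λ eq → 1≢0 (cong proj₁ eq)) , check
      where
      check : ∀ M → M ≢ 0ₘ → apply M (1# , 0#) ≡ (0# , 0#) → (M ⊙ mat x y z (- x)) ⊙ adj M ≢ 0ₘ
      check (mat p q r t) M≢0 Mv eq = M≢0 (Mat2-≡ p≡0 q≡0 r≡0 t≡0)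
        where
        p≡0 : p ≡ 0#
        p≡0 = left p q (cong proj₁ Mv)
        r≡0 : r ≡ 0#
        r≡0 = left r t (cong proj₂ Mv)
        q≡0 : q ≡ 0#
        q≡0 = vanish z≢0 (trans (solve 5 (λ x y z q t → let o = con ℤ.0ℤ in
          z :* (q :* q) := :- ((o :* x :+ q :* z) :* (:- q) :+ (o :* y :+ q :* (:- x)) :* o)) refl x y z q t)
          (trans (cong -_ (trans (cong (λ p → (p * x + q * z) * - q + (p * y + q * - x) * p) (sym p≡0)) (cong Mat2.m₁₂ eq))) -0#≈0#))
        t≡0 : t ≡ 0#
        t≡0 = vanish z≢0 (trans (solve 5 (λ x y z q t → let o = con ℤ.0ℤ in
          z :* (t :* t) := (o :* x :+ t :* z) :* t :+ (o :* y :+ t :* (:- x)) :* (:- o)) refl x y z q t)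
          (trans (cong (λ r → (r * x + t * z) * t + (r * y + t * - x) * - r) (sym r≡0)) (cong Mat2.m₂₁ eq)))
    go (yes z≡0) (no y≢0) = (0# , 1#) , (λ eq → 1≢0 (cong proj₂ eq)) , check
      where
      check : ∀ M → M ≢ 0ₘ → apply M (0# , 1#) ≡ (0# , 0#) → (M ⊙ mat x y z (- x)) ⊙ adj M ≢ 0ₘ
      check (mat p q r t) M≢0 Mv eq = M≢0 (Mat2-≡ p≡0 q≡0 r≡0 t≡0)
        where
        q≡0 : q ≡ 0#
        q≡0 = left q p (trans (+-comm _ _) (cong proj₁ Mv))
        t≡0 : t ≡ 0#
        t≡0 = left t r (trans (+-comm _ _) (cong proj₂ Mv))
        p≡0 : p ≡ 0#
        p≡0 = vanish y≢0 (trans (solve 5 (λ x y z p r → let o = con ℤ.0ℤ in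
          y :* (p :* p) := (p :* x :+ o :* z) :* (:- o) :+ (p :* y :+ o :* (:- x)) :* p) refl x y z p r)
          (trans (cong (λ q → (p * x + q * z) * - q + (p * y + q * - x) * p) (sym q≡0)) (cong Mat2.m₁₂ eq)))
        r≡0 : r ≡ 0#
        r≡0 = vanish y≢0 (trans (solve 5 (λ x y z p r → let o = con ℤ.0ℤ in
          y :* (r :* r) := :- ((r :* x :+ o :* z) :* o :+ (r :* y :+ o :* (:- x)) :* (:- r))) refl x y z p r)
          (trans (cong -_ (trans (cong (λ t → (r * x + t * z) * t + (r * y + t * - x) * - r) (sym t≡0)) (cong Mat2.m₂₁ eq))) -0#≈0#))
    -- The matrix is diagonal with entries x and -x, so both basis vectors are eigenvectors; their
    -- sum is not, because 2 ≠ 0.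
    go (yes z≡0) (yes y≡0) = (1# , 1#) , (λ eq → 1≢0 (cong proj₁ eq)) , check
      where
      2x≢0 : (1# + 1#) * x ≢ 0#
      2x≢0 = x*y≢0 2≢0 (λ x≡0 → nz (x≡0 , y≡0 , z≡0))
      check : ∀ M → M ≢ 0ₘ → apply M (1# , 1#) ≡ (0# , 0#) → (M ⊙ mat x y z (- x)) ⊙ adj M ≢ 0ₘ
      check (mat p q r t) M≢0 Mv eq = M≢0 (Mat2-≡ p≡0 (trans q≡-p (trans (cong -_ p≡0) -0#≈0#)) r≡0 (trans t≡-r (trans (cong -_ r≡0) -0#≈0#)))
        where
        opposite : ∀ p q → p * 1# + q * 1# ≡ 0# → q ≡ - p
        opposite p q e = trans (solve 2 (λ p q → q := (p :* con ℤ.1ℤ :+ q :* con ℤ.1ℤ) :- p) refl p q) (trans (cong (_+ - p) e) (+-identityˡ _))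
        q≡-p : q ≡ - p
        q≡-p = opposite p q (cong proj₁ Mv)
        t≡-r : t ≡ - r
        t≡-r = opposite r t (cong proj₂ Mv)
        p≡0 : p ≡ 0#
        p≡0 = vanish 2x≢0 (trans (solve 2 (λ x p → let o = con ℤ.0ℤ in
          (con (ℤ.+ 2) :* x) :* (p :* p) := (p :* x :+ (:- p) :* o) :* (:- (:- p)) :+ (p :* o :+ (:- p) :* (:- x)) :* p) refl x p)
          (trans (cong₂ (λ y z → (p * x + - p * z) * - - p + (p * y + - p * - x) * p) (sym y≡0) (sym z≡0))
            (trans (cong (λ q → (p * x + q * z) * - q + (p * y + q * - x) * p) (sym q≡-p)) (cong Mat2.m₁₂ eq))))
        r≡0 : r ≡ 0#
        r≡0 = vanish 2x≢0 (trans (solve 2 (λ x r → let o = con ℤ.0ℤ in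
          (con (ℤ.+ 2) :* x) :* (r :* r) := :- ((r :* x :+ (:- r) :* o) :* (:- r) :+ (r :* o :+ (:- r) :* (:- x)) :* (:- r))) refl x r)
          (trans (cong -_ (trans (cong₂ (λ y z → (r * x + - r * z) * - r + (r * y + - r * - x) * - r) (sym y≡0) (sym z≡0))
            (trans (cong (λ t → (r * x + t * z) * t + (r * y + t * - x) * - r) (sym t≡-r)) (cong Mat2.m₂₁ eq)))) -0#≈0#))

-- `j` is a value of the norm form of the extension by a square root of `e`: the classical condition
-- for the algebra (e, j) to be one of matrices.
Splits : (K : FiniteField) (e j α β : FiniteField.F K) → Set
Splits K e j α β = α * α + - (e * (β * β)) ≡ j
  where open FiniteField K

module Splitting (K : FiniteField) (2≢0 : Char≢2 K)
                 (e α β j : FiniteField.F K) (e≢0 : e ≢ FiniteField.0# K) (j≢0 : j ≢ FiniteField.0# K)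
                 (split : Splits K e j α β) where
  open FieldTheory K
  open QuaternionAlgebra K e j
  open Matrices K

  private
    module Φ′ (e α β : F) where
      Φ₁₁ Φ₁₂ Φ₂₁ Φ₂₂ : ℍ K → F
      Φ₁₁ (a ,ᵢ b ,ⱼ c ,ₖ d) = a + (c * α + d * (e * β))
      Φ₁₂ (a ,ᵢ b ,ⱼ c ,ₖ d) = e * (b + - (c * β + d * α))
      Φ₂₁ (a ,ᵢ b ,ⱼ c ,ₖ d) = b + (c * β + d * α)
      Φ₂₂ (a ,ᵢ b ,ⱼ c ,ₖ d) = a + - (c * α + d * (e * β))

  -- i goes to the matrix with rows (0, e), (1, 0) and j to the one with rows (α, -eβ), (β, -α),
  -- whose square is α² - eβ².
  Φ : ℍ K → Mat2 K
  Φ x = mat (Φ₁₁ x) (Φ₁₂ x) (Φ₂₁ x) (Φ₂₂ x)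
    where open Φ′ e α β

  private
    module Sym {n} (e α β : Polynomial n) where
      j′ : Polynomial n
      j′ = α :* α :- e :* (β :* β)
      Φ₁₁ Φ₁₂ Φ₂₁ Φ₂₂ : (a b c d : Polynomial n) → Polynomial n
      Φ₁₁ a b c d = a :+ (c :* α :+ d :* (e :* β))
      Φ₁₂ a b c d = e :* (b :- (c :* β :+ d :* α))
      Φ₂₁ a b c d = b :+ (c :* β :+ d :* α)
      Φ₂₂ a b c d = a :- (c :* α :+ d :* (e :* β))
      open QuaternionCoordinates.Symbolic commutativeRing 0# 0# e j′ public

  Φ-• : ∀ x y → Φ (x • y) ≡ Φ x ⊙ Φ y
  Φ-• = lemma split
    where
    -- Generalising `j` allows `refl` to replace it by α² - eβ², after which a polynomial identity
    -- remains.
    lemma : ∀ {j} → α * α + - (e * (β * β)) ≡ j → ∀ x y → Φ (QuaternionAlgebra._•_ K e j x y) ≡ Φ x ⊙ Φ y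
    lemma refl (a₁ ,ᵢ b₁ ,ⱼ c₁ ,ₖ d₁) (a₂ ,ᵢ b₂ ,ⱼ c₂ ,ₖ d₂) = Mat2-≡
      (solve 11 (λ e α β a₁ b₁ c₁ d₁ a₂ b₂ c₂ d₂ → let open Sym e α β in
        Φ₁₁ (*a a₁ b₁ c₁ d₁ a₂ b₂ c₂ d₂) (*b a₁ b₁ c₁ d₁ a₂ b₂ c₂ d₂) (*c a₁ b₁ c₁ d₁ a₂ b₂ c₂ d₂) (*d a₁ b₁ c₁ d₁ a₂ b₂ c₂ d₂)
        := Φ₁₁ a₁ b₁ c₁ d₁ :* Φ₁₁ a₂ b₂ c₂ d₂ :+ Φ₁₂ a₁ b₁ c₁ d₁ :* Φ₂₁ a₂ b₂ c₂ d₂) refl e α β a₁ b₁ c₁ d₁ a₂ b₂ c₂ d₂)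
      (solve 11 (λ e α β a₁ b₁ c₁ d₁ a₂ b₂ c₂ d₂ → let open Sym e α β in
        Φ₁₂ (*a a₁ b₁ c₁ d₁ a₂ b₂ c₂ d₂) (*b a₁ b₁ c₁ d₁ a₂ b₂ c₂ d₂) (*c a₁ b₁ c₁ d₁ a₂ b₂ c₂ d₂) (*d a₁ b₁ c₁ d₁ a₂ b₂ c₂ d₂)
        := Φ₁₁ a₁ b₁ c₁ d₁ :* Φ₁₂ a₂ b₂ c₂ d₂ :+ Φ₁₂ a₁ b₁ c₁ d₁ :* Φ₂₂ a₂ b₂ c₂ d₂) refl e α β a₁ b₁ c₁ d₁ a₂ b₂ c₂ d₂)
      (solve 11 (λ e α β a₁ b₁ c₁ d₁ a₂ b₂ c₂ d₂ → let open Sym e α β in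
        Φ₂₁ (*a a₁ b₁ c₁ d₁ a₂ b₂ c₂ d₂) (*b a₁ b₁ c₁ d₁ a₂ b₂ c₂ d₂) (*c a₁ b₁ c₁ d₁ a₂ b₂ c₂ d₂) (*d a₁ b₁ c₁ d₁ a₂ b₂ c₂ d₂)
        := Φ₂₁ a₁ b₁ c₁ d₁ :* Φ₁₁ a₂ b₂ c₂ d₂ :+ Φ₂₂ a₁ b₁ c₁ d₁ :* Φ₂₁ a₂ b₂ c₂ d₂) refl e α β a₁ b₁ c₁ d₁ a₂ b₂ c₂ d₂)
      (solve 11 (λ e α β a₁ b₁ c₁ d₁ a₂ b₂ c₂ d₂ → let open Sym e α β in
        Φ₂₂ (*a a₁ b₁ c₁ d₁ a₂ b₂ c₂ d₂) (*b a₁ b₁ c₁ d₁ a₂ b₂ c₂ d₂) (*c a₁ b₁ c₁ d₁ a₂ b₂ c₂ d₂) (*d a₁ b₁ c₁ d₁ a₂ b₂ c₂ d₂)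
        := Φ₂₁ a₁ b₁ c₁ d₁ :* Φ₁₂ a₂ b₂ c₂ d₂ :+ Φ₂₂ a₁ b₁ c₁ d₁ :* Φ₂₂ a₂ b₂ c₂ d₂) refl e α β a₁ b₁ c₁ d₁ a₂ b₂ c₂ d₂)

  det-Φ : ∀ x → det K (Φ x) ≡ norm x
  det-Φ = lemma split
    where
    lemma : ∀ {j} → α * α + - (e * (β * β)) ≡ j → ∀ x → det K (Φ x) ≡ QuaternionAlgebra.norm K e j x
    lemma refl (a ,ᵢ b ,ⱼ c ,ₖ d) = solve 7 (λ e α β a b c d → let open Sym e α β in
      Φ₁₁ a b c d :* Φ₂₂ a b c d :- Φ₁₂ a b c d :* Φ₂₁ a b c d := N a b c d) refl e α β a b c d

  Φ-∙ : ∀ k x → Φ (k ∙ x) ≡ k *ₘ Φ x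
  Φ-∙ k (a ,ᵢ b ,ⱼ c ,ₖ d) = Mat2-≡
    (solve 8 (λ e α β k a b c d → let open Sym e α β in Φ₁₁ (k :* a) (k :* b) (k :* c) (k :* d) := k :* Φ₁₁ a b c d) refl e α β k a b c d)
    (solve 8 (λ e α β k a b c d → let open Sym e α β in Φ₁₂ (k :* a) (k :* b) (k :* c) (k :* d) := k :* Φ₁₂ a b c d) refl e α β k a b c d)
    (solve 8 (λ e α β k a b c d → let open Sym e α β in Φ₂₁ (k :* a) (k :* b) (k :* c) (k :* d) := k :* Φ₂₁ a b c d) refl e α β k a b c d)
    (solve 8 (λ e α β k a b c d → let open Sym e α β in Φ₂₂ (k :* a) (k :* b) (k :* c) (k :* d) := k :* Φ₂₂ a b c d) refl e α β k a b c d)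

  Φ-affine : ∀ a y b c d → Φ (a ,ᵢ y * b ,ⱼ y * c ,ₖ y * d) ≡ (a *ₘ 1ₘ) +ₘ (y *ₘ Φ (0# ,ᵢ b ,ⱼ c ,ₖ d))
  Φ-affine a y b c d = Mat2-≡
    (solve 8 (λ e α β a y b c d → let open Sym e α β in Φ₁₁ a (y :* b) (y :* c) (y :* d) := a :* con ℤ.1ℤ :+ y :* Φ₁₁ (con ℤ.0ℤ) b c d) refl e α β a y b c d)
    (solve 8 (λ e α β a y b c d → let open Sym e α β in Φ₁₂ a (y :* b) (y :* c) (y :* d) := a :* con ℤ.0ℤ :+ y :* Φ₁₂ (con ℤ.0ℤ) b c d) refl e α β a y b c d)
    (solve 8 (λ e α β a y b c d → let open Sym e α β in Φ₂₁ a (y :* b) (y :* c) (y :* d) := a :* con ℤ.0ℤ :+ y :* Φ₂₁ (con ℤ.0ℤ) b c d) refl e α β a y b c d)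
    (solve 8 (λ e α β a y b c d → let open Sym e α β in Φ₂₂ a (y :* b) (y :* c) (y :* d) := a :* con ℤ.1ℤ :+ y :* Φ₂₂ (con ℤ.0ℤ) b c d) refl e α β a y b c d)

  Φ-conjugate : ∀ x → Φ (conjugate x) ≡ adj (Φ x)
  Φ-conjugate (a ,ᵢ b ,ⱼ c ,ₖ d) = Mat2-≡
    (solve 7 (λ e α β a b c d → let open Sym e α β in Φ₁₁ a (:- b) (:- c) (:- d) := Φ₂₂ a b c d) refl e α β a b c d)
    (solve 7 (λ e α β a b c d → let open Sym e α β in Φ₁₂ a (:- b) (:- c) (:- d) := :- (Φ₁₂ a b c d)) refl e α β a b c d)
    (solve 7 (λ e α β a b c d → let open Sym e α β in Φ₂₁ a (:- b) (:- c) (:- d) := :- (Φ₂₁ a b c d)) refl e α β a b c d)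
    (solve 7 (λ e α β a b c d → let open Sym e α β in Φ₂₂ a (:- b) (:- c) (:- d) := Φ₁₁ a b c d) refl e α β a b c d)

  Φ-real : Φ (real 1#) ≡ 1ₘ
  Φ-real = Mat2-≡
    (solve 3 (λ e α β → let open Sym e α β ; o = con ℤ.0ℤ in Φ₁₁ (con ℤ.1ℤ) o o o := con ℤ.1ℤ) refl e α β)
    (solve 3 (λ e α β → let open Sym e α β ; o = con ℤ.0ℤ in Φ₁₂ (con ℤ.1ℤ) o o o := o) refl e α β)
    (solve 3 (λ e α β → let open Sym e α β ; o = con ℤ.0ℤ in Φ₂₁ (con ℤ.1ℤ) o o o := o) refl e α β)
    (solve 3 (λ e α β → let open Sym e α β ; o = con ℤ.0ℤ in Φ₂₂ (con ℤ.1ℤ) o o o := con ℤ.1ℤ) refl e α β)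

  private
    κ κ⁻¹ : F
    κ = (1# + 1#) * (e * j)
    κ⁻¹ = inv κ (x*y≢0 2≢0 (x*y≢0 e≢0 j≢0))

    κ⁻¹κ : ∀ x → κ⁻¹ * (κ * x) ≡ x
    κ⁻¹κ x = trans (sym (*-assoc κ⁻¹ κ x)) (trans (cong (_* x) (inv-inverseˡ κ _)) (*-identityˡ x))

    -- The coordinates of the preimage under `Φ` before division by their common denominator `κ`.
    La Lb Lc Ld : Mat2 K → F
    La (mat p q r t) = (e * j) * (p + t)
    Lb (mat p q r t) = j * (e * r + q)
    Lc (mat p q r t) = α * (e * (p + - t)) + - (e * β * (e * r + - q))
    Ld (mat p q r t) = α * (e * r + - q) + - (e * β * (p + - t))

  Φ⁻¹ : Mat2 K → ℍ K
  Φ⁻¹ M = κ⁻¹ ∙ (La M ,ᵢ Lb M ,ⱼ Lc M ,ₖ Ld M)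

  private
    Φ-L : ∀ M → Φ (La M ,ᵢ Lb M ,ⱼ Lc M ,ₖ Ld M) ≡ κ *ₘ M
    Φ-L (mat p q r t) = lemma split
      where
      lemma : ∀ {j} → α * α + - (e * (β * β)) ≡ j →
        Φ ((e * j) * (p + t) ,ᵢ j * (e * r + q) ,ⱼ α * (e * (p + - t)) + - (e * β * (e * r + - q)) ,ₖ α * (e * r + - q) + - (e * β * (p + - t)))
        ≡ ((1# + 1#) * (e * j)) *ₘ mat p q r t
      lemma refl = Mat2-≡
        (solve 7 (λ e α β p q r t → let open Sym e α β in
          Φ₁₁ ((e :* j′) :* (p :+ t)) (j′ :* (e :* r :+ q)) (α :* (e :* (p :- t)) :- e :* β :* (e :* r :- q)) (α :* (e :* r :- q) :- e :* β :* (p :- t))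
          := (con (ℤ.+ 2) :* (e :* j′)) :* p) refl e α β p q r t)
        (solve 7 (λ e α β p q r t → let open Sym e α β in
          Φ₁₂ ((e :* j′) :* (p :+ t)) (j′ :* (e :* r :+ q)) (α :* (e :* (p :- t)) :- e :* β :* (e :* r :- q)) (α :* (e :* r :- q) :- e :* β :* (p :- t))
          := (con (ℤ.+ 2) :* (e :* j′)) :* q) refl e α β p q r t)
        (solve 7 (λ e α β p q r t → let open Sym e α β in
          Φ₂₁ ((e :* j′) :* (p :+ t)) (j′ :* (e :* r :+ q)) (α :* (e :* (p :- t)) :- e :* β :* (e :* r :- q)) (α :* (e :* r :- q) :- e :* β :* (p :- t))
          := (con (ℤ.+ 2) :* (e :* j′)) :* r) refl e α β p q r t)
        (solve 7 (λ e α β p q r t → let open Sym e α β in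
          Φ₂₂ ((e :* j′) :* (p :+ t)) (j′ :* (e :* r :+ q)) (α :* (e :* (p :- t)) :- e :* β :* (e :* r :- q)) (α :* (e :* r :- q) :- e :* β :* (p :- t))
          := (con (ℤ.+ 2) :* (e :* j′)) :* t) refl e α β p q r t)

    L-Φ : ∀ x → (La (Φ x) ,ᵢ Lb (Φ x) ,ⱼ Lc (Φ x) ,ₖ Ld (Φ x)) ≡ κ ∙ x
    L-Φ (a ,ᵢ b ,ⱼ c ,ₖ d) = lemma split
      where
      open Mat2 (Φ (a ,ᵢ b ,ⱼ c ,ₖ d))
      lemma : ∀ {j} → α * α + - (e * (β * β)) ≡ j →
        ((e * j) * (m₁₁ + m₂₂) ,ᵢ j * (e * m₂₁ + m₁₂) ,ⱼ α * (e * (m₁₁ + - m₂₂)) + - (e * β * (e * m₂₁ + - m₁₂)) ,ₖ α * (e * m₂₁ + - m₁₂) + - (e * β * (m₁₁ + - m₂₂)))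
        ≡ (((1# + 1#) * (e * j)) ∙ (a ,ᵢ b ,ⱼ c ,ₖ d))
      lemma refl = ℍ-≡
        (solve 7 (λ e α β a b c d → let open Sym e α β in (e :* j′) :* (Φ₁₁ a b c d :+ Φ₂₂ a b c d) := (con (ℤ.+ 2) :* (e :* j′)) :* a) refl e α β a b c d)
        (solve 7 (λ e α β a b c d → let open Sym e α β in j′ :* (e :* Φ₂₁ a b c d :+ Φ₁₂ a b c d) := (con (ℤ.+ 2) :* (e :* j′)) :* b) refl e α β a b c d)
        (solve 7 (λ e α β a b c d → let open Sym e α β in
          α :* (e :* (Φ₁₁ a b c d :- Φ₂₂ a b c d)) :- e :* β :* (e :* Φ₂₁ a b c d :- Φ₁₂ a b c d) := (con (ℤ.+ 2) :* (e :* j′)) :* c) refl e α β a b c d)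
        (solve 7 (λ e α β a b c d → let open Sym e α β in
          α :* (e :* Φ₂₁ a b c d :- Φ₁₂ a b c d) :- e :* β :* (Φ₁₁ a b c d :- Φ₂₂ a b c d) := (con (ℤ.+ 2) :* (e :* j′)) :* d) refl e α β a b c d)

  Φ-Φ⁻¹ : ∀ M → Φ (Φ⁻¹ M) ≡ M
  Φ-Φ⁻¹ M = begin
    Φ (κ⁻¹ ∙ (La M ,ᵢ Lb M ,ⱼ Lc M ,ₖ Ld M))       ≡⟨ Φ-∙ κ⁻¹ _ ⟩
    κ⁻¹ *ₘ Φ (La M ,ᵢ Lb M ,ⱼ Lc M ,ₖ Ld M)        ≡⟨ cong (κ⁻¹ *ₘ_) (Φ-L M) ⟩
    κ⁻¹ *ₘ κ *ₘ M                                  ≡⟨ Mat2-≡ (κ⁻¹κ _) (κ⁻¹κ _) (κ⁻¹κ _) (κ⁻¹κ _) ⟩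
    M                                              ∎

  Φ⁻¹-Φ : ∀ x → Φ⁻¹ (Φ x) ≡ x
  Φ⁻¹-Φ x = trans (cong (κ⁻¹ ∙_) (L-Φ x)) (ℍ-≡ (κ⁻¹κ _) (κ⁻¹κ _) (κ⁻¹κ _) (κ⁻¹κ _))

  Φ-injective : ∀ {x y} → Φ x ≡ Φ y → x ≡ y
  Φ-injective {x} {y} eq = trans (sym (Φ⁻¹-Φ x)) (trans (cong Φ⁻¹ eq) (Φ⁻¹-Φ y))

-- Quaternions over 𝔽[u]

module QuatNorm (𝔽 : FiniteField) (ε : FiniteField.F 𝔽) where
  private module 𝔽 = FieldTheory 𝔽
  open PolyTheory 𝔽

  Eₚ Jₚ : Poly 𝔽
  Eₚ = constₚ 𝔽 ε
  Jₚ = (𝔽.- 𝔽.1#) ∷ 𝔽.1# ∷ []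

  open QuaternionCoordinates polyRing Eₚ Jₚ public using () renaming (N to Nₚ; N-* to Nₚ-*; N-cong to Nₚ-cong; N-conj to Nₚ-conj; N-pure to Nₚ-pure; sandwich-pure to sandwich-pureₚ; N-1 to Nₚ-1; N-jk to Nₚ-jk; N-scale to Nₚ-scale)

  normₚ : Quat 𝔽 ε → Poly 𝔽
  normₚ (quat a b c d) = Nₚ a b c d

  normₚ-· : ∀ x y → normₚ (_·Q_ 𝔽 ε x y) ≋ normₚ x ⊗ normₚ y
  normₚ-· (quat a₁ b₁ c₁ d₁) (quat a₂ b₂ c₂ d₂) = Nₚ-* a₁ b₁ c₁ d₁ a₂ b₂ c₂ d₂

  normₚ-conj : ∀ x → normₚ (conj 𝔽 ε x) ≋ normₚ x
  normₚ-conj (quat a b c d) = Nₚ-conj a b c d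

  1+J : oneₚ 𝔽 ⊕ Jₚ ≋ X 𝔽
  1+J = pointwise λ { zero → 𝔽.-‿inverseʳ 𝔽.1# ; (suc zero) → refl ; (suc (suc _)) → refl }

  private
    const-⊗-const : ∀ a b → constₚ 𝔽 a ⊗ constₚ 𝔽 b ≋ constₚ 𝔽 (a 𝔽.* b)
    const-⊗-const a b = const-⊗ a (constₚ 𝔽 b)

  module _ (σ : Sol 𝔽 ε) where
    private
      C D : Poly 𝔽
      C = constₚ 𝔽 (proj₁ (proj₁ σ))
      D = constₚ 𝔽 (proj₂ (proj₁ σ))

      unit : Eₚ ⊗ (D ⊗ D) ⊕ ⊖ (C ⊗ C) ≋ oneₚ 𝔽
      unit = ≋-trans (⊕-cong (≋-trans (⊗-congˡ Eₚ (const-⊗-const _ _)) (const-⊗-const ε _)) (⊖-cong (const-⊗-const _ _)))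
        (pointwise λ { zero → proj₂ σ ; (suc _) → refl })

    normₚ-γ : normₚ (γ 𝔽 ε σ) ≋ X 𝔽
    normₚ-γ = ≋-trans (Nₚ-1 C D) (≋-trans (⊕-cong (≋-refl {oneₚ 𝔽}) (≋-trans (⊗-congˡ Jₚ unit) (⊗-identityʳ Jₚ))) 1+J)

    normₚ-cj+dk : normₚ (quat [] [] C D) ≋ Jₚ
    normₚ-cj+dk = ≋-trans (Nₚ-jk C D) (≋-trans (⊗-congˡ Jₚ unit) (⊗-identityʳ Jₚ))

  Degree-J : Degree Jₚ 1
  Degree-J = degree 𝔽.1≢0 λ { (suc (suc _)) _ → refl ; (suc zero) (s≤s ()) }

  ev-normₚ : ∀ {K} (φ : Hom 𝔽 K) α x → Evaluation.ev φ α (normₚ x) ≡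
    QuaternionAlgebra.norm K (QuatEvaluation.e 𝔽 ε φ α) (QuatEvaluation.j 𝔽 ε φ α) (QuatEvaluation.evℍ 𝔽 ε φ α x)
  ev-normₚ {K} φ α (quat a b c d) = begin
    ev (normₚ (quat a b c d))        ≡⟨ ev-⊕ (a ⊗ a ⊕ ⊖ (Eₚ ⊗ (b ⊗ b))) (⊖ (Jₚ ⊗ (c ⊗ c ⊕ ⊖ (Eₚ ⊗ (d ⊗ d))))) ⟩
    ev (a ⊗ a ⊕ ⊖ (Eₚ ⊗ (b ⊗ b))) K.+ ev (⊖ (Jₚ ⊗ (c ⊗ c ⊕ ⊖ (Eₚ ⊗ (d ⊗ d)))))
      ≡⟨ cong₂ K._+_ (pair a b) (trans (ev-⊖ (Jₚ ⊗ (c ⊗ c ⊕ ⊖ (Eₚ ⊗ (d ⊗ d))))) (cong K.-_ (trans (ev-⊗ Jₚ (c ⊗ c ⊕ ⊖ (Eₚ ⊗ (d ⊗ d)))) (cong₂ K._*_ Q.ev-Jₚ (pair c d))))) ⟩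
    _                                ∎
    where
    module K = FieldTheory K
    module Q = QuatEvaluation 𝔽 ε φ α
    open Evaluation φ α
    pair : ∀ p q → ev (p ⊗ p ⊕ ⊖ (Eₚ ⊗ (q ⊗ q))) ≡ ev p K.* ev p K.+ K.- (Q.e K.* (ev q K.* ev q))
    pair p q = trans (ev-⊕ (p ⊗ p) (⊖ (Eₚ ⊗ (q ⊗ q)))) (cong₂ K._+_ (ev-⊗ p p)
      (trans (ev-⊖ (Eₚ ⊗ (q ⊗ q))) (cong K.-_ (trans (ev-⊗ Eₚ (q ⊗ q)) (cong₂ K._*_ (ev-const ε) (ev-⊗ q q))))))

-- Degrees of norms

module Anisotropy (𝔽 : FiniteField) (ε : FiniteField.F 𝔽) (nonsquare : NonSquare 𝔽 ε) where
  private module 𝔽 = FieldTheory 𝔽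
  open 𝔽 using (F; _+_; _*_; -_; 0#; 1#)
  open PolyTheory 𝔽
  open QuatNorm 𝔽 ε

  anisotropic : ∀ {x y} → x * x + - (ε * (y * y)) ≡ 0# → x ≡ 0# × y ≡ 0#
  anisotropic {x} {y} eq with y 𝔽.≟ 0#
  ... | no y≢0 = ⊥-elim (nonsquare (x * i) (begin
    (x * i) * (x * i)            ≡⟨ 𝔽.solve 2 (λ x i → (x 𝔽.:* i) 𝔽.:* (x 𝔽.:* i) 𝔽.:= (x 𝔽.:* x) 𝔽.:* (i 𝔽.:* i)) refl x i ⟩
    (x * x) * (i * i)            ≡⟨ cong (_* (i * i)) (𝔽.x-y≡0⇒x≡y eq) ⟩
    (ε * (y * y)) * (i * i)      ≡⟨ 𝔽.solve 3 (λ e y i → (e 𝔽.:* (y 𝔽.:* y)) 𝔽.:* (i 𝔽.:* i) 𝔽.:= e 𝔽.:* ((y 𝔽.:* i) 𝔽.:* (y 𝔽.:* i))) refl ε y i ⟩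
    ε * ((y * i) * (y * i))      ≡⟨ cong (λ z → ε * (z * z)) (𝔽.inv-inverseʳ y y≢0) ⟩
    ε * (1# * 1#)                ≡⟨ 𝔽.solve 1 (λ e → e 𝔽.:* (𝔽.con ℤ.1ℤ 𝔽.:* 𝔽.con ℤ.1ℤ) 𝔽.:= e) refl ε ⟩
    ε                            ∎))
    where i = 𝔽.inv y y≢0
  ... | yes refl = 𝔽.x²≡0⇒x≡0 (trans (𝔽.solve 2 (λ x e → x 𝔽.:* x 𝔽.:= x 𝔽.:* x 𝔽.:- e 𝔽.:* (𝔽.con ℤ.0ℤ 𝔽.:* 𝔽.con ℤ.0ℤ)) refl x ε) eq) , refl

  pairNorm : Poly 𝔽 → Poly 𝔽 → Poly 𝔽
  pairNorm p q = p ⊗ p ⊕ ⊖ (Eₚ ⊗ (q ⊗ q))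

  private
    coef-pairNorm : ∀ p q n → coef (pairNorm p q) n ≡ coef (p ⊗ p) n + - (ε * coef (q ⊗ q) n)
    coef-pairNorm p q n = trans (coef-⊕ (p ⊗ p) (⊖ (Eₚ ⊗ (q ⊗ q))) n) (cong (coef (p ⊗ p) n +_)
      (trans (coef-⊖ (Eₚ ⊗ (q ⊗ q)) n) (cong -_ (trans (at (const-⊗ ε (q ⊗ q)) n) (coef-scale ε (q ⊗ q) n)))))

    x-ε0 : ∀ {x y} → x ≡ 0# → y ≡ 0# → x + - (ε * y) ≡ 0#
    x-ε0 refl refl = 𝔽.solve 1 (λ e → 𝔽.con ℤ.0ℤ 𝔽.:- e 𝔽.:* 𝔽.con ℤ.0ℤ 𝔽.:= 𝔽.con ℤ.0ℤ) refl ε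

  pairNorm-<deg : ∀ {p q k} → p <deg suc k → q <deg suc k → pairNorm p q <deg suc (k ℕ.+ k)
  pairNorm-<deg {p} {q} {k} bp bq m lt =
    trans (coef-pairNorm p q m) (x-ε0 (proj₂ (⊗-top p p k k bp bp) m lt) (proj₂ (⊗-top q q k k bq bq) m lt))

  -- The coefficient at 2k is the form x² - εy² taken at the two coefficients at k. The form being
  -- anisotropic, it survives as soon as one of them does; so nonzero pairs have norms of even
  -- degree.
  pairNorm-top : ∀ {p q k} → p <deg suc k → q <deg suc k → ¬ (coef p k ≡ 0# × coef q k ≡ 0#) → Degree (pairNorm p q) (k ℕ.+ k)
  pairNorm-top {p} {q} {k} bp bq nz = degree
    (λ eq → nz (anisotropic (trans (cong₂ (λ x y → x + - (ε * y)) (sym (proj₁ (⊗-top p p k k bp bp))) (sym (proj₁ (⊗-top q q k k bq bq)))) (trans (sym (coef-pairNorm p q (k ℕ.+ k))) eq))))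
    (pairNorm-<deg {p} {q} bp bq)

  pairNorm-degree : ∀ p q → (p ≋ [] × q ≋ []) ⊎ ∃ λ k → p <deg suc k × q <deg suc k × Degree (pairNorm p q) (k ℕ.+ k)
  pairNorm-degree p q with degree⊎zero p | degree⊎zero q
  ... | inj₂ p≋[] | inj₂ q≋[] = inj₁ (p≋[] , q≋[])
  ... | inj₁ (k , D) | inj₂ q≋[] = inj₂ (k , bounded D , b , pairNorm-top {p} {q} (bounded D) b (leading≢0 D ∘ proj₁))
    where b : q <deg suc k
          b n _ = at q≋[] n
  ... | inj₂ p≋[] | inj₁ (k , D) = inj₂ (k , b , bounded D , pairNorm-top {p} {q} b (bounded D) (leading≢0 D ∘ proj₂))
    where b : p <deg suc k
          b n _ = at p≋[] n
  ... | inj₁ (k , Dp) | inj₁ (l , Dq) with ℕ.≤-total k l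
  ...   | inj₁ k≤l = inj₂ (l , b , bounded Dq , pairNorm-top {p} {q} b (bounded Dq) (leading≢0 Dq ∘ proj₂))
    where b : p <deg suc l
          b n l<n = bounded Dp n (ℕ.≤-<-trans k≤l l<n)
  ...   | inj₂ l≤k = inj₂ (k , bounded Dp , b , pairNorm-top {p} {q} (bounded Dp) b (leading≢0 Dp ∘ proj₁))
    where b : q <deg suc k
          b n k<n = bounded Dq n (ℕ.≤-<-trans l≤k k<n)

  private
    odd≢even : ∀ l k → suc (l ℕ.+ l) ≢ k ℕ.+ k
    odd≢even l (suc k) eq = odd≢even k l (sym (ℕ.suc-injective (trans eq (cong suc (ℕ.+-suc k k)))))

    -- The two summands have degrees of different parity, so they cannot cancel.
    no-cancellation : ∀ {P Q p q} → Degree P p → Degree Q q → p ≢ q → ∃ λ n → (p ℕ.≤ n) × (q ℕ.≤ n) × coef (P ⊕ ⊖ Q) n ≢ 0#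
    no-cancellation {P} {Q} {p} {q} DP DQ p≢q with ℕ.<-cmp p q
    ... | tri< p<q _ _ = q , ℕ.<⇒≤ p<q , ℕ.≤-refl , λ eq → leading≢0 DQ (begin
      coef Q q                                ≡⟨ 𝔽.solve 1 (λ x → x 𝔽.:= 𝔽.:- (𝔽.con ℤ.0ℤ 𝔽.:- x)) refl _ ⟩
      - (0# + - coef Q q)                     ≡⟨ cong (λ z → - (z + - coef Q q)) (bounded DP q p<q) ⟨
      - (coef P q + - coef Q q)               ≡⟨ cong -_ (trans (coef-⊕ P (⊖ Q) q) (cong (coef P q +_) (coef-⊖ Q q))) ⟨
      - coef (P ⊕ ⊖ Q) q                      ≡⟨ trans (cong -_ eq) 𝔽.-0#≈0# ⟩
      0#                                      ∎)
    ... | tri≈ _ p≡q _ = ⊥-elim (p≢q p≡q)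
    ... | tri> _ _ q<p = p , ℕ.≤-refl , ℕ.<⇒≤ q<p , λ eq → leading≢0 DP (begin
      coef P p                                ≡⟨ 𝔽.solve 1 (λ x → x 𝔽.:= x 𝔽.:- 𝔽.con ℤ.0ℤ) refl _ ⟩
      coef P p + - 0#                         ≡⟨ cong (λ z → coef P p + - z) (bounded DQ p q<p) ⟨
      coef P p + - coef Q p                   ≡⟨ trans (coef-⊕ P (⊖ Q) p) (cong (coef P p +_) (coef-⊖ Q p)) ⟨
      coef (P ⊕ ⊖ Q) p                        ≡⟨ eq ⟩
      0#                                      ∎)

    one-high : ∀ n → 1 ℕ.≤ n → coef (oneₚ 𝔽) n ≡ 0#
    one-high (suc n) _ = refl

    pairNorm-[] : ∀ {p q} → p ≋ [] → q ≋ [] → pairNorm p q ≋ []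
    pairNorm-[] {p} {q} p≋[] q≋[] = pointwise λ n → trans (coef-pairNorm p q n)
      (x-ε0 (at (⊗-cong {q = p} p≋[] ≋-refl) n) (at (⊗-cong {q = q} q≋[] ≋-refl) n))

  normₚ≢[] : ∀ a b c d → ¬ (a ≋ [] × b ≋ [] × c ≋ [] × d ≋ []) → ¬ normₚ (quat a b c d) ≋ []
  normₚ≢[] a b c d nz e = go (pairNorm-degree a b) (pairNorm-degree c d)
    where
    go : _ → _ → ⊥
    go (inj₁ (a≋[] , b≋[])) (inj₁ (c≋[] , d≋[])) = nz (a≋[] , b≋[] , c≋[] , d≋[])
    go (inj₂ (k , _ , _ , DP)) (inj₂ (l , _ , _ , DQ)) =
      let (n , _ , _ , nz) = no-cancellation DP (Degree-⊗ Degree-J DQ) (odd≢even l k ∘ sym) in nz (at e n)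
    go (inj₂ (k , _ , _ , DP)) (inj₁ (c≋[] , d≋[])) = Degree⇒≢[] DP (≋-trans (≋-sym (≋-trans (⊕-cong (≋-refl {pairNorm a b})
      (⊖-cong (≋-trans (⊗-congˡ Jₚ (pairNorm-[] c≋[] d≋[])) (⊗-comm Jₚ [])))) (⊕-identityʳ _))) e)
    go (inj₁ (a≋[] , b≋[])) (inj₂ (l , _ , _ , DQ)) = Degree⇒≢[] (Degree-⊗ Degree-J DQ) (pointwise λ n → begin
      coef (Jₚ ⊗ pairNorm c d) n                  ≡⟨ 𝔽.solve 1 (λ x → x 𝔽.:= 𝔽.:- (𝔽.con ℤ.0ℤ 𝔽.:- x)) refl _ ⟩
      - (0# + - coef (Jₚ ⊗ pairNorm c d) n)       ≡⟨ cong -_ (trans (coef-⊕ (pairNorm a b) (⊖ (Jₚ ⊗ pairNorm c d)) n) (cong₂ _+_ (at (pairNorm-[] a≋[] b≋[]) n) (coef-⊖ (Jₚ ⊗ pairNorm c d) n))) ⟨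
      - coef (normₚ (quat a b c d)) n             ≡⟨ trans (cong -_ (at e n)) 𝔽.-0#≈0# ⟩
      0#                                          ∎)

  -- By parity of degrees a nonzero pair (c, d) would leave a nonzero coefficient in positive
  -- degree. What remains are the constants a + bi of norm 1, in which b may well be nonzero.
  norm-one : ∀ a b c d → normₚ (quat a b c d) ≋ oneₚ 𝔽 → b <deg 1 × c ≋ [] × d ≋ []
  norm-one a b c d e = go (pairNorm-degree a b) (pairNorm-degree c d)
    where
    high : ∀ {n} → 1 ℕ.≤ n → coef (normₚ (quat a b c d)) n ≢ 0# → ⊥
    high {n} 1≤n nz = nz (trans (at e n) (one-high n 1≤n))
    go : _ → _ → b <deg 1 × c ≋ [] × d ≋ []
    go (inj₁ (_ , b≋[])) (inj₁ (c≋[] , d≋[])) = (λ n _ → at b≋[] n) , c≋[] , d≋[]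
    go (inj₂ (k , _ , bb , DP)) (inj₁ (c≋[] , d≋[])) = subst (λ k → b <deg suc k) (k≡0 k DP) bb , c≋[] , d≋[]
      where
      P≋1 : pairNorm a b ≋ oneₚ 𝔽
      P≋1 = ≋-trans (≋-sym (≋-trans (⊕-cong (≋-refl {pairNorm a b}) (⊖-cong (≋-trans (⊗-congˡ Jₚ (pairNorm-[] c≋[] d≋[])) (⊗-comm Jₚ [])))) (⊕-identityʳ _))) e
      k≡0 : ∀ k → Degree (pairNorm a b) (k ℕ.+ k) → k ≡ 0
      k≡0 zero _ = refl
      k≡0 (suc k) DP = ⊥-elim (leading≢0 DP (trans (at P≋1 (suc k ℕ.+ suc k)) refl))
    go (inj₁ (a≋[] , b≋[])) (inj₂ (l , _ , _ , DQ)) = ⊥-elim (leading≢0 DJQ (begin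
      coef (Jₚ ⊗ pairNorm c d) n                  ≡⟨ 𝔽.solve 1 (λ x → x 𝔽.:= 𝔽.:- (𝔽.con ℤ.0ℤ 𝔽.:- x)) refl _ ⟩
      - (0# + - coef (Jₚ ⊗ pairNorm c d) n)       ≡⟨ cong -_ (trans (coef-⊕ (pairNorm a b) (⊖ (Jₚ ⊗ pairNorm c d)) n) (cong₂ _+_ (at (pairNorm-[] a≋[] b≋[]) n) (coef-⊖ (Jₚ ⊗ pairNorm c d) n))) ⟨
      - coef (normₚ (quat a b c d)) n             ≡⟨ trans (cong -_ (trans (at e n) refl)) 𝔽.-0#≈0# ⟩
      0#                                          ∎))
      where
      n = 1 ℕ.+ (l ℕ.+ l)
      DJQ = Degree-⊗ Degree-J DQ
    go (inj₂ (k , _ , _ , DP)) (inj₂ (l , _ , _ , DQ)) =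
      let (n , _ , q≤n , nz) = no-cancellation DP (Degree-⊗ Degree-J DQ) (odd≢even l k ∘ sym) in ⊥-elim (high (ℕ.≤-trans (s≤s z≤n) q≤n) nz)

-- Factorisation into generators

module Factorisation (𝔽 : FiniteField) (ε : FiniteField.F 𝔽) (nonsquare : NonSquare 𝔽 ε) (σ₀ : Sol 𝔽 ε) where
  private
    module 𝔽 = FieldTheory 𝔽
    module At₀ = QuatEvaluation 𝔽 ε (idHom 𝔽) (FiniteField.0# 𝔽)
    module At₁ = QuatEvaluation 𝔽 ε (idHom 𝔽) (FiniteField.1# 𝔽)
    module H₀ = QuaternionAlgebra 𝔽 At₀.e At₀.j
    module H₁ = QuaternionAlgebra 𝔽 At₁.e At₁.j
    module E₀ = Evaluation (idHom 𝔽) (FiniteField.0# 𝔽)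
    module E₁ = Evaluation (idHom 𝔽) (FiniteField.1# 𝔽)
  open 𝔽 using (F; _+_; _*_; -_; 0#; 1#)
  open PolyTheory 𝔽
  open QuatNorm 𝔽 ε
  open Anisotropy 𝔽 ε nonsquare

  private
    0ℍ : ℍ 𝔽
    0ℍ = 0# ,ᵢ 0# ,ⱼ 0# ,ₖ 0#

    module Kill (a b c d : F) (N≡0 : H₀.norm (a ,ᵢ b ,ⱼ c ,ₖ d) ≡ 0#) where
      -- Write x = z + w j with z = a + bi and w = c + di. At u = 0, where j² = -1, x = (1 + v j) z
      -- with v = w z / N(z), and `P`, `Q` are the coordinates of w z. Norm 0 of x gives N(v) = -1,
      -- so 1 + v j is the value of a generator; its conjugate kills x because the norm of a
      -- generator vanishes at u = 0.
      n P Q : F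
      n = a * a + - (ε * (b * b))
      P = c * a + ε * (d * b)
      Q = c * b + d * a

      n≡ : ε * (d * d) + - (c * c) ≡ n
      n≡ = begin
        ε * (d * d) + - (c * c)                          ≡⟨ 𝔽.solve 5 (λ e a b c d → e 𝔽.:* (d 𝔽.:* d) 𝔽.:- c 𝔽.:* c
             𝔽.:= (a 𝔽.:* a 𝔽.:- e 𝔽.:* (b 𝔽.:* b)) 𝔽.:- ((a 𝔽.:* a 𝔽.:- e 𝔽.:* (b 𝔽.:* b)) 𝔽.:- (𝔽.con ℤ.0ℤ 𝔽.:- 𝔽.con ℤ.1ℤ) 𝔽.:* (c 𝔽.:* c 𝔽.:- e 𝔽.:* (d 𝔽.:* d)))) refl ε a b c d ⟩
        n + - H₀.norm (a ,ᵢ b ,ⱼ c ,ₖ d)                 ≡⟨ cong (λ z → n + - z) N≡0 ⟩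
        n + - 0#                                         ≡⟨ 𝔽.solve 1 (λ n → n 𝔽.:- 𝔽.con ℤ.0ℤ 𝔽.:= n) refl n ⟩
        n                                                ∎

      module _ (n≢0 : n ≢ 0#) where
        i : F
        i = 𝔽.inv n n≢0

        σ : Sol 𝔽 ε
        σ = (P * i , Q * i) , (begin
          ε * ((Q * i) * (Q * i)) + - ((P * i) * (P * i))
            ≡⟨ 𝔽.solve 6 (λ e a b c d i → let P = c 𝔽.:* a 𝔽.:+ e 𝔽.:* (d 𝔽.:* b) ; Q = c 𝔽.:* b 𝔽.:+ d 𝔽.:* a in
                 e 𝔽.:* ((Q 𝔽.:* i) 𝔽.:* (Q 𝔽.:* i)) 𝔽.:- (P 𝔽.:* i) 𝔽.:* (P 𝔽.:* i)
                 𝔽.:= ((e 𝔽.:* (d 𝔽.:* d) 𝔽.:- c 𝔽.:* c) 𝔽.:* i) 𝔽.:* ((a 𝔽.:* a 𝔽.:- e 𝔽.:* (b 𝔽.:* b)) 𝔽.:* i)) refl ε a b c d i ⟩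
          ((ε * (d * d) + - (c * c)) * i) * (n * i)      ≡⟨ cong (λ z → (z * i) * (n * i)) n≡ ⟩
          (n * i) * (n * i)                              ≡⟨ cong₂ _*_ (𝔽.inv-inverseʳ n n≢0) (𝔽.inv-inverseʳ n n≢0) ⟩
          1# * 1#                                        ≡⟨ 𝔽.*-identityˡ 1# ⟩
          1#                                             ∎)

        annihilate : ∀ {v} p q → v ≡ p + i * q → n * p + q ≡ 0# → v ≡ 0#
        annihilate {v} p q eq z = 𝔽.x*y≡0⇒y≡0 n≢0 (begin
          n * v                     ≡⟨ cong (n *_) eq ⟩
          n * (p + i * q)           ≡⟨ 𝔽.solve 4 (λ n p i q → n 𝔽.:* (p 𝔽.:+ i 𝔽.:* q) 𝔽.:= n 𝔽.:* p 𝔽.:+ (n 𝔽.:* i) 𝔽.:* q) refl n p i q ⟩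
          n * p + (n * i) * q       ≡⟨ cong (λ z → n * p + z * q) (𝔽.inv-inverseʳ n n≢0) ⟩
          n * p + 1# * q            ≡⟨ cong (n * p +_) (𝔽.*-identityˡ q) ⟩
          n * p + q                 ≡⟨ z ⟩
          0#                        ∎)

        proportional : ∀ x q → q ≡ - (x * (ε * (d * d) + - (c * c))) → n * x + q ≡ 0#
        proportional x q eq = trans (cong (n * x +_) (trans eq (cong (λ z → - (x * z)) n≡))) (𝔽.solve 2 (λ n x → n 𝔽.:* x 𝔽.:- x 𝔽.:* n 𝔽.:= 𝔽.con ℤ.0ℤ) refl n x)

        killed : H₀.conjugate (At₀.γ̂ σ) H₀.• (a ,ᵢ b ,ⱼ c ,ₖ d) ≡ 0ℍ
        killed = H₀.ℍ-≡
          (annihilate a (P * c + - (ε * (Q * d)))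
            (𝔽.solve 8 (λ e a b c d P Q i → let open Symbolic e (𝔽.con ℤ.0ℤ 𝔽.:- 𝔽.con ℤ.1ℤ) in
              *a (𝔽.con ℤ.1ℤ) (𝔽.:- 𝔽.con ℤ.0ℤ) (𝔽.:- (P 𝔽.:* i)) (𝔽.:- (Q 𝔽.:* i)) a b c d 𝔽.:= a 𝔽.:+ i 𝔽.:* (P 𝔽.:* c 𝔽.:- e 𝔽.:* (Q 𝔽.:* d))) refl ε a b c d P Q i)
            (proportional a _ (𝔽.solve 5 (λ e a b c d → (c 𝔽.:* a 𝔽.:+ e 𝔽.:* (d 𝔽.:* b)) 𝔽.:* c 𝔽.:- e 𝔽.:* ((c 𝔽.:* b 𝔽.:+ d 𝔽.:* a) 𝔽.:* d)
              𝔽.:= 𝔽.:- (a 𝔽.:* (e 𝔽.:* (d 𝔽.:* d) 𝔽.:- c 𝔽.:* c))) refl ε a b c d)))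
          (annihilate b (Q * c + - (P * d))
            (𝔽.solve 8 (λ e a b c d P Q i → let open Symbolic e (𝔽.con ℤ.0ℤ 𝔽.:- 𝔽.con ℤ.1ℤ) in
              *b (𝔽.con ℤ.1ℤ) (𝔽.:- 𝔽.con ℤ.0ℤ) (𝔽.:- (P 𝔽.:* i)) (𝔽.:- (Q 𝔽.:* i)) a b c d 𝔽.:= b 𝔽.:+ i 𝔽.:* (Q 𝔽.:* c 𝔽.:- P 𝔽.:* d)) refl ε a b c d P Q i)
            (proportional b _ (𝔽.solve 5 (λ e a b c d → (c 𝔽.:* b 𝔽.:+ d 𝔽.:* a) 𝔽.:* c 𝔽.:- (c 𝔽.:* a 𝔽.:+ e 𝔽.:* (d 𝔽.:* b)) 𝔽.:* d
              𝔽.:= 𝔽.:- (b 𝔽.:* (e 𝔽.:* (d 𝔽.:* d) 𝔽.:- c 𝔽.:* c))) refl ε a b c d)))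
          (annihilate c (ε * (Q * b) + - (P * a))
            (𝔽.solve 8 (λ e a b c d P Q i → let open Symbolic e (𝔽.con ℤ.0ℤ 𝔽.:- 𝔽.con ℤ.1ℤ) in
              *c (𝔽.con ℤ.1ℤ) (𝔽.:- 𝔽.con ℤ.0ℤ) (𝔽.:- (P 𝔽.:* i)) (𝔽.:- (Q 𝔽.:* i)) a b c d 𝔽.:= c 𝔽.:+ i 𝔽.:* (e 𝔽.:* (Q 𝔽.:* b) 𝔽.:- P 𝔽.:* a)) refl ε a b c d P Q i)
            (𝔽.solve 5 (λ e a b c d → (a 𝔽.:* a 𝔽.:- e 𝔽.:* (b 𝔽.:* b)) 𝔽.:* c 𝔽.:+ (e 𝔽.:* ((c 𝔽.:* b 𝔽.:+ d 𝔽.:* a) 𝔽.:* b) 𝔽.:- (c 𝔽.:* a 𝔽.:+ e 𝔽.:* (d 𝔽.:* b)) 𝔽.:* a)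
              𝔽.:= 𝔽.con ℤ.0ℤ) refl ε a b c d))
          (annihilate d (P * b + - (Q * a))
            (𝔽.solve 8 (λ e a b c d P Q i → let open Symbolic e (𝔽.con ℤ.0ℤ 𝔽.:- 𝔽.con ℤ.1ℤ) in
              *d (𝔽.con ℤ.1ℤ) (𝔽.:- 𝔽.con ℤ.0ℤ) (𝔽.:- (P 𝔽.:* i)) (𝔽.:- (Q 𝔽.:* i)) a b c d 𝔽.:= d 𝔽.:+ i 𝔽.:* (P 𝔽.:* b 𝔽.:- Q 𝔽.:* a)) refl ε a b c d P Q i)
            (𝔽.solve 5 (λ e a b c d → (a 𝔽.:* a 𝔽.:- e 𝔽.:* (b 𝔽.:* b)) 𝔽.:* d 𝔽.:+ ((c 𝔽.:* a 𝔽.:+ e 𝔽.:* (d 𝔽.:* b)) 𝔽.:* b 𝔽.:- (c 𝔽.:* b 𝔽.:+ d 𝔽.:* a) 𝔽.:* a)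
              𝔽.:= 𝔽.con ℤ.0ℤ) refl ε a b c d))
          where open QuaternionCoordinates 𝔽.commutativeRing At₀.e At₀.j using (module Symbolic)

    kill-zero : ∀ {x} → x ≡ 0ℍ → ∃ λ σ → H₀.conjugate (At₀.γ̂ σ) H₀.• x ≡ 0ℍ
    kill-zero refl = σ₀ , trans (H₀.•-real 0# (H₀.conjugate (At₀.γ̂ σ₀))) (H₀.ℍ-≡ (𝔽.zeroˡ _) (𝔽.zeroˡ _) (𝔽.zeroˡ _) (𝔽.zeroˡ _))

    kill : ∀ x → H₀.norm x ≡ 0# → ∃ λ σ → H₀.conjugate (At₀.γ̂ σ) H₀.• x ≡ 0ℍ
    kill x@(a ,ᵢ b ,ⱼ c ,ₖ d) N≡0 = decide ((a * a + - (ε * (b * b))) 𝔽.≟ 0#)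
      where
      decide : Dec (a * a + - (ε * (b * b)) ≡ 0#) → ∃ λ σ → H₀.conjugate (At₀.γ̂ σ) H₀.• x ≡ 0ℍ
      decide (no n≢0) = Kill.σ a b c d N≡0 n≢0 , Kill.killed a b c d N≡0 n≢0
      -- By anisotropy a = b = 0, and then norm 0 forces c = d = 0 in the same way. The quaternion
      -- is zero and any generator will do.
      decide (yes n≡0) = kill-zero (H₀.ℍ-≡ (proj₁ ab≡0) (proj₂ ab≡0) (proj₁ cd≡0) (proj₂ cd≡0))
        where
        ab≡0 : a ≡ 0# × b ≡ 0#
        ab≡0 = anisotropic n≡0
        cd≡0 : c ≡ 0# × d ≡ 0#
        cd≡0 = anisotropic (trans (trans (𝔽.solve 3 (λ e c d → c 𝔽.:* c 𝔽.:- e 𝔽.:* (d 𝔽.:* d) 𝔽.:= 𝔽.:- (e 𝔽.:* (d 𝔽.:* d) 𝔽.:- c 𝔽.:* c)) refl ε c d)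
          (cong -_ (trans (Kill.n≡ a b c d N≡0) n≡0))) 𝔽.-0#≈0#)

  tailₚ : Poly 𝔽 → Poly 𝔽
  tailₚ [] = []
  tailₚ (_ ∷ p) = p

  shift : ∀ p → E₀.ev p ≡ 0# → p ≋ X 𝔽 ⊗ tailₚ p
  shift [] _ = ≋-sym (⊗-comm (X 𝔽) [])
  shift (a ∷ p) eq = ≋-sym (≋-trans (0∷-⊗ (oneₚ 𝔽) p) (∷-cong (sym a≡0) (⊗-identityˡ p)))
    where
    a≡0 : a ≡ 0#
    a≡0 = trans (sym (trans (cong (a +_) (𝔽.zeroˡ _)) (𝔽.+-identityʳ a))) eq

  private
    tailQ : Quat 𝔽 ε → Quat 𝔽 ε
    tailQ (quat a b c d) = quat (tailₚ a) (tailₚ b) (tailₚ c) (tailₚ d)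

    record _≋Q_ (x y : Quat 𝔽 ε) : Set where
      constructor coordinates
      field
        ≋a : qa x ≋ qa y
        ≋b : qb x ≋ qb y
        ≋c : qc x ≋ qc y
        ≋d : qd x ≋ qd y
    open _≋Q_

    shiftQ : ∀ x → At₀.evℍ x ≡ 0ℍ → x ≋Q scaleQ 𝔽 ε (X 𝔽) (tailQ x)
    shiftQ (quat a b c d) eq = coordinates (shift a (cong ℍ.a eq)) (shift b (cong ℍ.b eq)) (shift c (cong ℍ.c eq)) (shift d (cong ℍ.d eq))

    normₚ-scale : ∀ x → normₚ (scaleQ 𝔽 ε (X 𝔽) x) ≋ X 𝔽 ⊗ (X 𝔽 ⊗ normₚ x)
    normₚ-scale (quat a b c d) = Nₚ-scale (X 𝔽) a b c d

    normₚ-cong : ∀ {x y} → x ≋Q y → normₚ x ≋ normₚ y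
    normₚ-cong {quat _ _ _ _} {quat _ _ _ _} (coordinates a b c d) = Nₚ-cong a b c d

    X≢0 : ¬ X 𝔽 ≋ []
    X≢0 e = 𝔽.1≢0 (at e 1)

    b[1] : Quat 𝔽 ε → F
    b[1] x = E₁.ev (qb x)

  module _ {K : FiniteField} (φ : Hom 𝔽 K) (s : FiniteField.F K) (s≢0 : s ≢ FiniteField.0# K) where
    private
      module K = FieldTheory K
      module Q = QuatEvaluation 𝔽 ε φ s
      module H = QuaternionAlgebra K Q.e Q.j
      module E = Evaluation φ s
      open WordValues 𝔽 ε K Q.e Q.j (Q.evℍ ∘ γ 𝔽 ε)

      -- The norm vanishes at u = 0, so some conjugate generator times `x` vanishes there; dividing
      -- it by `X` leaves norm X^k. At u = 1 the algebra has j² = 0, and multiplication on the left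
      -- by 1 + cj + dij does not change the i-coordinate, so the condition on it is inherited.
      step : ∀ x k → normₚ x ≋ powₚ 𝔽 (X 𝔽) (suc k) → b[1] x ≡ 0# →
             ∃₂ λ σ y → normₚ y ≋ powₚ 𝔽 (X 𝔽) k × b[1] y ≡ 0# × Q.evℍ x ≡ Q.evℍ (γ 𝔽 ε σ) H.• Q.evℍ y
      step x k N≋ bx = σ , y , N-y , b-y , value
        where
        N₀≡0 : H₀.norm (At₀.evℍ x) ≡ 0#
        N₀≡0 = begin
          H₀.norm (At₀.evℍ x)                            ≡⟨ ev-normₚ (idHom 𝔽) 0# x ⟨
          E₀.ev (normₚ x)                                ≡⟨ E₀.ev-cong N≋ ⟩
          E₀.ev (X 𝔽 ⊗ powₚ 𝔽 (X 𝔽) k)                   ≡⟨ E₀.ev-⊗ (X 𝔽) (powₚ 𝔽 (X 𝔽) k) ⟩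
          E₀.ev (X 𝔽) * E₀.ev (powₚ 𝔽 (X 𝔽) k)           ≡⟨ cong (_* E₀.ev (powₚ 𝔽 (X 𝔽) k)) E₀.ev-X ⟩
          0# * E₀.ev (powₚ 𝔽 (X 𝔽) k)                    ≡⟨ 𝔽.zeroˡ _ ⟩
          0#                                             ∎
        killed = kill (At₀.evℍ x) N₀≡0
        σ = proj₁ killed
        g = γ 𝔽 ε σ
        z = _·Q_ 𝔽 ε (conj 𝔽 ε g) x
        y = tailQ z
        z₀≡0 : At₀.evℍ z ≡ 0ℍ
        z₀≡0 = begin
          At₀.evℍ z                                           ≡⟨ At₀.evℍ-· (conj 𝔽 ε g) x ⟩
          At₀.evℍ (conj 𝔽 ε g) H₀.• At₀.evℍ x                 ≡⟨ cong (H₀._• At₀.evℍ x) (trans (At₀.evℍ-conj g) (cong H₀.conjugate (At₀.evℍ-γ σ))) ⟩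
          H₀.conjugate (At₀.γ̂ σ) H₀.• At₀.evℍ x              ≡⟨ proj₂ killed ⟩
          0ℍ                                                  ∎
        z≋Xy : z ≋Q scaleQ 𝔽 ε (X 𝔽) y
        z≋Xy = shiftQ z z₀≡0
        N-y : normₚ y ≋ powₚ 𝔽 (X 𝔽) k
        N-y = ⊗-cancelˡ (X 𝔽) X≢0 (⊗-cancelˡ (X 𝔽) X≢0 (ℙ.begin
          X 𝔽 ⊗ (X 𝔽 ⊗ normₚ y)                ℙ.≈⟨ normₚ-scale y ⟨
          normₚ (scaleQ 𝔽 ε (X 𝔽) y)           ℙ.≈⟨ normₚ-cong z≋Xy ⟨
          normₚ z                              ℙ.≈⟨ normₚ-· (conj 𝔽 ε g) x ⟩
          normₚ (conj 𝔽 ε g) ⊗ normₚ x         ℙ.≈⟨ ⊗-cong (≋-trans (normₚ-conj g) (normₚ-γ σ)) N≋ ⟩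
          X 𝔽 ⊗ (X 𝔽 ⊗ powₚ 𝔽 (X 𝔽) k)         ℙ.∎))
        b-y : b[1] y ≡ 0#
        b-y = begin
          E₁.ev (qb y)                         ≡⟨ 𝔽.*-identityˡ _ ⟨
          1# * E₁.ev (qb y)                    ≡⟨ cong (_* E₁.ev (qb y)) E₁.ev-X ⟨
          E₁.ev (X 𝔽) * E₁.ev (qb y)           ≡⟨ E₁.ev-⊗ (X 𝔽) (qb y) ⟨
          E₁.ev (X 𝔽 ⊗ qb y)                   ≡⟨ E₁.ev-cong (≋b z≋Xy) ⟨
          E₁.ev (qb z)                         ≡⟨ cong ℍ.b z₁ ⟩
          ℍ.b (H₁.conjugate (At₁.γ̂ σ) H₁.• At₁.evℍ x)   ≡⟨ b-at-1 (At₁.evℍ x) _ _ ⟩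
          b[1] x                               ≡⟨ bx ⟩
          0#                                   ∎
          where
          z₁ : At₁.evℍ z ≡ H₁.conjugate (At₁.γ̂ σ) H₁.• At₁.evℍ x
          z₁ = trans (At₁.evℍ-· (conj 𝔽 ε g) x) (cong (H₁._• At₁.evℍ x) (trans (At₁.evℍ-conj g) (cong H₁.conjugate (At₁.evℍ-γ σ))))
          b-at-1 : ∀ x c d → ℍ.b ((1# ,ᵢ - 0# ,ⱼ c ,ₖ d) H₁.• x) ≡ ℍ.b x
          b-at-1 (a ,ᵢ b ,ⱼ c₂ ,ₖ d₂) c d = 𝔽.solve 7 (λ e a b c₂ d₂ c d → QuaternionCoordinates.Symbolic.*b 𝔽.commutativeRing 0# 0# e (𝔽.con ℤ.1ℤ 𝔽.:- 𝔽.con ℤ.1ℤ)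
            (𝔽.con ℤ.1ℤ) (𝔽.:- 𝔽.con ℤ.0ℤ) c d a b c₂ d₂ 𝔽.:= b) refl ε a b c₂ d₂ c d
        ĝ = Q.evℍ g
        value : Q.evℍ x ≡ ĝ H.• Q.evℍ y
        value = ∙-cancel (begin
          s H.∙ Q.evℍ x                               ≡⟨ H.real-• s (Q.evℍ x) ⟨
          H.real s H.• Q.evℍ x                        ≡⟨ cong (H._• Q.evℍ x) (trans (H.•-conjugate ĝ) (cong H.real (trans (cong H.norm (Q.evℍ-γ σ)) (Q.norm-γ̂ σ)))) ⟨
          (ĝ H.• H.conjugate ĝ) H.• Q.evℍ x           ≡⟨ H.•-assoc ĝ (H.conjugate ĝ) (Q.evℍ x) ⟩
          ĝ H.• (H.conjugate ĝ H.• Q.evℍ x)           ≡⟨ cong (λ w → ĝ H.• (w H.• Q.evℍ x)) (Q.evℍ-conj g) ⟨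
          ĝ H.• (Q.evℍ (conj 𝔽 ε g) H.• Q.evℍ x)      ≡⟨ cong (ĝ H.•_) (Q.evℍ-· (conj 𝔽 ε g) x) ⟨
          ĝ H.• Q.evℍ z                               ≡⟨ cong (ĝ H.•_) z-value ⟩
          ĝ H.• (s H.∙ Q.evℍ y)                       ≡⟨ H.•-∙ s ĝ (Q.evℍ y) ⟩
          s H.∙ (ĝ H.• Q.evℍ y)                       ∎)
          where
          coordinate : ∀ {p q} → p ≋ X 𝔽 ⊗ q → E.ev p ≡ s K.* E.ev q
          coordinate {p} {q} e = trans (E.ev-cong e) (trans (E.ev-⊗ (X 𝔽) q) (cong (K._* E.ev q) E.ev-X))
          z-value : Q.evℍ z ≡ s H.∙ Q.evℍ y
          z-value = H.ℍ-≡ (coordinate (≋a z≋Xy)) (coordinate (≋b z≋Xy)) (coordinate (≋c z≋Xy)) (coordinate (≋d z≋Xy))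
          ∙-cancel : ∀ {p q} → s H.∙ p ≡ s H.∙ q → p ≡ q
          ∙-cancel eq = H.ℍ-≡ (K.*-cancelˡ s≢0 (cong ℍ.a eq)) (K.*-cancelˡ s≢0 (cong ℍ.b eq)) (K.*-cancelˡ s≢0 (cong ℍ.c eq)) (K.*-cancelˡ s≢0 (cong ℍ.d eq))

      -- Here the condition at u = 1 is spent: in norm 1 the i-coordinate is a constant, so its
      -- vanishing at one point removes it.
      constant : ∀ x → normₚ x ≋ oneₚ 𝔽 → b[1] x ≡ 0# → ∃ λ k → k ≢ K.0# × Q.evℍ x ≡ H.real k
      constant (quat a b c d) N≋ bx = E.ev a , ev≢0 , real
        where
        small = norm-one a b c d N≋
        b≋[] : b ≋ []
        b≋[] = ≋-trans b≋const (pointwise λ { zero → trans (sym (E₁.ev-const (coef b 0))) (trans (sym (E₁.ev-cong b≋const)) bx) ; (suc _) → refl })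
          where
          b≋const : b ≋ constₚ 𝔽 (coef b 0)
          b≋const = pointwise λ { zero → refl ; (suc n) → proj₁ small (suc n) (s≤s z≤n) }
        real : Q.evℍ (quat a b c d) ≡ H.real (E.ev a)
        real = H.ℍ-≡ refl (E.ev-cong b≋[]) (E.ev-cong (proj₁ (proj₂ small))) (E.ev-cong (proj₂ (proj₂ small)))
        ev≢0 : E.ev a ≢ K.0#
        ev≢0 eq = K.1≢0 (begin
          K.1#                                ≡⟨ E.ev-one ⟨
          E.ev (oneₚ 𝔽)                       ≡⟨ E.ev-cong N≋ ⟨
          E.ev (normₚ (quat a b c d))         ≡⟨ ev-normₚ φ s (quat a b c d) ⟩
          H.norm (Q.evℍ (quat a b c d))       ≡⟨ cong H.norm real ⟩
          H.norm (H.real (E.ev a))            ≡⟨ H.norm-IsReal {H.real (E.ev a)} (refl , refl , refl) ⟩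
          E.ev a K.* E.ev a                   ≡⟨ cong (K._* E.ev a) eq ⟩
          K.0# K.* E.ev a                     ≡⟨ K.zeroˡ _ ⟩
          K.0#                                ∎)

    factorise : ∀ k x → normₚ x ≋ powₚ 𝔽 (X 𝔽) k → E₁.ev (qb x) ≡ 0# → ∃₂ λ w l → l ≢ K.0# × Q.evℍ x ≡ l H.∙ wordValue w
    factorise zero x N≋ bx = [] , l , proj₁ (proj₂ c) , trans (proj₂ (proj₂ c)) (H.ℍ-≡ (sym (K.*-identityʳ l)) (sym (K.zeroʳ l)) (sym (K.zeroʳ l)) (sym (K.zeroʳ l)))
      where
      c = constant x N≋ bx
      l = proj₁ c
    factorise (suc k) x N≋ bx = (false , σ) ∷ w , l , proj₁ (proj₂ (proj₂ rest)) , (begin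
      Q.evℍ x                                         ≡⟨ proj₂ (proj₂ (proj₂ (proj₂ st))) ⟩
      Q.evℍ (γ 𝔽 ε σ) H.• Q.evℍ y                     ≡⟨ cong (Q.evℍ (γ 𝔽 ε σ) H.•_) (proj₂ (proj₂ (proj₂ rest))) ⟩
      Q.evℍ (γ 𝔽 ε σ) H.• (l H.∙ wordValue w)         ≡⟨ H.•-∙ l _ (wordValue w) ⟩
      l H.∙ (Q.evℍ (γ 𝔽 ε σ) H.• wordValue w)         ∎)
      where
      st = step x k N≋ bx
      σ = proj₁ st
      y = proj₁ (proj₂ st)
      rest = factorise k y (proj₁ (proj₂ (proj₂ st))) (proj₁ (proj₂ (proj₂ (proj₂ st))))
      w = proj₁ rest
      l = proj₁ (proj₂ rest)

-- Approximation of unipotent matrices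

-- (a , b) stands for a + b √(-J); one step multiplies by 1 + √(-J), of norm 1 + J.
module PellIdentities {c ℓ} (R : CommutativeRing c ℓ) (J : CommutativeRing.Carrier R) where
  private module R = CommutativeRing R
  open R using (Carrier; _≈_; _+_; _*_; -_; 1#)
  open IntegerCoefficients R

  norm-step : ∀ a b → (a + - (J * b)) * (a + - (J * b)) + J * ((a + b) * (a + b)) ≈ (1# + J) * (a * a + J * (b * b))
  norm-step = solve 3 (λ J a b → (a :- J :* b) :* (a :- J :* b) :+ J :* ((a :+ b) :* (a :+ b)) := (con ℤ.1ℤ :+ J) :* (a :* a :+ J :* (b :* b))) R.refl J

  cross-step : ∀ a b c d → (a + - (J * b)) * (c + d) + - ((c + - (J * d)) * (a + b)) ≈ (1# + J) * (a * d + - (c * b))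
  cross-step = solve 5 (λ J a b c d → (a :- J :* b) :* (c :+ d) :- (c :- J :* d) :* (a :+ b) := (con ℤ.1ℤ :+ J) :* (a :* d :- c :* b)) R.refl J

  -- The norm of the conjugate of (a, b) times (c, d).
  norm-mix : ∀ a b c d → (a * c + J * (b * d)) * (a * c + J * (b * d)) + J * ((a * d + - (c * b)) * (a * d + - (c * b)))
             ≈ (a * a + J * (b * b)) * (c * c + J * (d * d))
  norm-mix = solve 5 (λ J a b c d → (a :* c :+ J :* (b :* d)) :* (a :* c :+ J :* (b :* d)) :+ J :* ((a :* d :- c :* b) :* (a :* d :- c :* b))
             := (a :* a :+ J :* (b :* b)) :* (c :* c :+ J :* (d :* d))) R.refl J

  cross-difference : ∀ a b c d → a * (d + - b) + (- b) * (c + - a) ≈ a * d + - (c * b)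
  cross-difference = solve 4 (λ a b c d → a :* (d :- b) :+ (:- b) :* (c :- a) := a :* d :- c :* b) R.refl

  norm-start : 1# * 1# + J * (R.0# * R.0#) ≈ 1#
  norm-start = solve 1 (λ J → con ℤ.1ℤ :* con ℤ.1ℤ :+ J :* (con ℤ.0ℤ :* con ℤ.0ℤ) := con ℤ.1ℤ) R.refl J

  cross-start : ∀ c d → 1# * d + - (c * R.0#) ≈ 1# * d
  cross-start = solve 2 (λ c d → con ℤ.1ℤ :* d :- c :* con ℤ.0ℤ := con ℤ.1ℤ :* d) R.refl

module Pell (𝔽 : FiniteField) (2≢0 : Char≢2 𝔽) (ε : FiniteField.F 𝔽) where
  private module 𝔽 = FieldTheory 𝔽
  open 𝔽 using (F; 0#; 1#)
  open PolyTheory 𝔽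
  open Truncation 𝔽
  open QuatNorm 𝔽 ε using (Jₚ; 1+J)
  open PellIdentities polyRing Jₚ
  private
    module E₀ = Evaluation (idHom 𝔽) 0#

    mutual
      α β : ℕ → Poly 𝔽
      α zero = oneₚ 𝔽
      α (suc n) = α n ⊕ ⊖ (Jₚ ⊗ β n)
      β zero = []
      β (suc n) = α n ⊕ β n

    X^ : ℕ → Poly 𝔽
    X^ = powₚ 𝔽 (X 𝔽)

  X^-+ : ∀ m n → powₚ 𝔽 (X 𝔽) m ⊗ powₚ 𝔽 (X 𝔽) n ≋ powₚ 𝔽 (X 𝔽) (m ℕ.+ n)
  X^-+ zero n = ⊗-identityˡ _
  X^-+ (suc m) n = ≋-trans (⊗-assoc (X 𝔽) (X^ m) (X^ n)) (⊗-congˡ (X 𝔽) (X^-+ m n))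

  private
    pell-norm : ∀ n → α n ⊗ α n ⊕ Jₚ ⊗ (β n ⊗ β n) ≋ X^ n
    pell-norm zero = norm-start
    pell-norm (suc n) = ≋-trans (norm-step (α n) (β n)) (⊗-cong 1+J (pell-norm n))

    -- The conjugate of the i-th power times the power with exponent i + n is X^i times the n-th
    -- power. This shows that the coefficient constructed in `pell` is nonzero.
    pell-cross : ∀ i n → α i ⊗ β (i ℕ.+ n) ⊕ ⊖ (α (i ℕ.+ n) ⊗ β i) ≋ X^ i ⊗ β n
    pell-cross zero n = cross-start (α n) (β n)
    pell-cross (suc i) n = ≋-trans (cross-step (α i) (β i) (α (i ℕ.+ n)) (β (i ℕ.+ n)))
      (≋-trans (⊗-cong 1+J (pell-cross i n)) (≋-sym (⊗-assoc (X 𝔽) (X^ i) (β n))))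

    J[0]≡-1 : E₀.ev Jₚ ≡ 𝔽.- 1#
    J[0]≡-1 = 𝔽.solve 1 (λ x → 𝔽.:- 𝔽.con ℤ.1ℤ 𝔽.:+ 𝔽.con ℤ.0ℤ 𝔽.:* x 𝔽.:= 𝔽.:- 𝔽.con ℤ.1ℤ) refl (E₀.ev (oneₚ 𝔽))

    α[0]-step : ∀ n → E₀.ev (α (suc n)) ≡ E₀.ev (α n) 𝔽.+ E₀.ev (β n)
    α[0]-step n = begin
      E₀.ev (α n ⊕ ⊖ (Jₚ ⊗ β n))                             ≡⟨ E₀.ev-⊕ (α n) (⊖ (Jₚ ⊗ β n)) ⟩
      E₀.ev (α n) 𝔽.+ E₀.ev (⊖ (Jₚ ⊗ β n))                   ≡⟨ cong (E₀.ev (α n) 𝔽.+_) (trans (E₀.ev-⊖ (Jₚ ⊗ β n)) (cong 𝔽.-_ (trans (E₀.ev-⊗ Jₚ (β n)) (cong (𝔽._* E₀.ev (β n)) J[0]≡-1)))) ⟩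
      E₀.ev (α n) 𝔽.+ 𝔽.- (𝔽.- 1# 𝔽.* E₀.ev (β n))           ≡⟨ 𝔽.solve 2 (λ a b → a 𝔽.:- (𝔽.:- 𝔽.con ℤ.1ℤ) 𝔽.:* b 𝔽.:= a 𝔽.:+ b) refl _ _ ⟩
      E₀.ev (α n) 𝔽.+ E₀.ev (β n)                            ∎

    α[0]≡β[0] : ∀ n → E₀.ev (α (suc n)) ≡ E₀.ev (β (suc n))
    α[0]≡β[0] n = trans (α[0]-step n) (sym (E₀.ev-⊕ (α n) (β n)))

    -- At u = 0 one has -J = 1, and after the first step both coordinates are equal and doubled each
    -- time: they are powers of 2.
    α[0]≢0 : ∀ n → E₀.ev (α (suc n)) ≢ 0#
    α[0]≢0 zero eq = 𝔽.1≢0 (trans (sym (trans (α[0]-step 0) (trans (𝔽.+-identityʳ _) E₀.ev-one))) eq)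
    α[0]≢0 (suc n) eq = 𝔽.x*y≢0 2≢0 (α[0]≢0 n) (begin
      (1# 𝔽.+ 1#) 𝔽.* E₀.ev (α (suc n))                      ≡⟨ 𝔽.solve 1 (λ x → 𝔽.con (ℤ.+ 2) 𝔽.:* x 𝔽.:= x 𝔽.:+ x) refl _ ⟩
      E₀.ev (α (suc n)) 𝔽.+ E₀.ev (α (suc n))                ≡⟨ cong (E₀.ev (α (suc n)) 𝔽.+_) (α[0]≡β[0] n) ⟩
      E₀.ev (α (suc n)) 𝔽.+ E₀.ev (β (suc n))                ≡⟨ α[0]-step (suc n) ⟨
      E₀.ev (α (suc (suc n)))                                ≡⟨ eq ⟩
      0#                                                     ∎)

    β≢[] : ∀ n → ¬ β (suc n) ≋ []
    β≢[] n e = α[0]≢0 n (trans (α[0]≡β[0] n) (E₀.ev-cong e))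

    X^≢[] : ∀ n → ¬ X^ n ≋ []
    X^≢[] zero e = 𝔽.1≢0 (at e 0)
    X^≢[] (suc n) = ⊗≢[] {X 𝔽} (λ e → 𝔽.1≢0 (at e 1)) (X^≢[] n)

  module _ {G : Poly 𝔽} {d : ℕ} (D : Degree G d) where
    private
      code : Poly 𝔽 → Vec F d
      code p = truncate d (proj₁ (proj₂ (divide D p)))

      open PrincipalQuotient.Modulo polyRing G

      code~ : ∀ p → toList (code p) ~ p
      code~ p = ~-trans (≈⇒~ (coef-truncate d (proj₁ (proj₂ (divide D p))) (proj₂ (proj₂ (proj₂ (divide D p))))))
        (~-sym (~-trans (≈⇒~ (proj₁ (proj₂ (proj₂ (divide D p))))) (~-+ (∣⇒~0 (multiple (proj₁ (divide D p)) ≋-refl)) (≈⇒~ (≋-refl {proj₁ (proj₂ (divide D p))})))))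

      code≡⇒∣ : ∀ {p q} → code p ≡ code q → G ∣ p ⊕ ⊖ q
      code≡⇒∣ {p} {q} eq = divides (~-trans (~-sym (code~ p)) (subst (λ v → toList v ~ q) (sym eq) (code~ q)))

      difference : ∀ {i j} → i ℕ.< j → code (α i) ≡ code (α j) → code (β i) ≡ code (β j) →
                   G ∣ α (i ℕ.+ suc (j ∸ suc i)) ⊕ ⊖ α i × G ∣ β (i ℕ.+ suc (j ∸ suc i)) ⊕ ⊖ β i
      difference {i} {j} i<j e e′ = subst (λ k → G ∣ α k ⊕ ⊖ α i × G ∣ β k ⊕ ⊖ β i) (sym (trans (ℕ.+-suc i _) (ℕ.m+[n∸m]≡n i<j)))
        (code≡⇒∣ {α j} {α i} (sym e) , code≡⇒∣ {β j} {β i} (sym e′))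

      period : ∃₂ λ i n → G ∣ α (i ℕ.+ suc n) ⊕ ⊖ α i × G ∣ β (i ℕ.+ suc n) ⊕ ⊖ β i
      period with collision (↔-id (Fin (suc (𝔽.size ℕ.^ d ℕ.* 𝔽.size ℕ.^ d)))) ((Vec↔ 𝔽.enum d ×-↔ Vec↔ 𝔽.enum d) ↔-∘ Fin.*↔×)
                            (ℕ.n<1+n _) (λ i → code (α (toℕ i)) , code (β (toℕ i)))
      ... | i , j , i≢j , eq with ℕ.<-cmp (toℕ i) (toℕ j)
      ...   | tri≈ _ i≡j _ = ⊥-elim (i≢j (Fin.toℕ-injective i≡j))
      ...   | tri< i<j _ _ = toℕ i , toℕ j ∸ suc (toℕ i) , difference i<j (cong proj₁ eq) (cong proj₂ eq)
      ...   | tri> _ _ j<i = toℕ j , toℕ i ∸ suc (toℕ j) , difference j<i (sym (cong proj₁ eq)) (sym (cong proj₂ eq))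

    -- Two powers, i < k, agree modulo `G` by pigeonhole. Dividing one by the other would leave the
    -- polynomials; the conjugate of the first times the second has the same effect, its second
    -- coordinate being divisible by `G`, and the norm is still a power of `X`.
    pell : ∃₂ λ A B → ∃ λ n → (A ⊗ A ⊕ Jₚ ⊗ (B ⊗ B) ≋ powₚ 𝔽 (X 𝔽) n) × (¬ B ≋ []) × G ∣ B
    pell = let i , n , Gα , Gβ = period ; k = i ℕ.+ suc n in
      α i ⊗ α k ⊕ Jₚ ⊗ (β i ⊗ β k) , α i ⊗ β k ⊕ ⊖ (α k ⊗ β i) , i ℕ.+ k
      , ≋-trans (norm-mix (α i) (β i) (α k) (β k)) (≋-trans (⊗-cong (pell-norm i) (pell-norm k)) (X^-+ i k))
      , (λ e → ⊗≢[] (X^≢[] i) (β≢[] n) (≋-trans (≋-sym (pell-cross i (suc n))) e))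
      , ∣-resp {G} (cross-difference (α i) (β i) (α k) (β k)) (∣-+ {G} (∣-* {G} (α i) Gβ) (∣-* {G} (⊖ β i) Gα))

module Valuation {𝔽 K : FiniteField} (φ : Hom 𝔽 K) (s : FiniteField.F K) {f : Poly 𝔽} {d : ℕ}
                 (D : PolyTheory.Degree 𝔽 f d) (1≤d : 1 ℕ.≤ d)
                 (minimal : ∀ p → Evaluation.ev φ s p ≡ FiniteField.0# K → PolyTheory._∣_ 𝔽 f p) where
  private module K = FieldTheory K
  open PolyTheory 𝔽
  open Evaluation φ s

  valuation : ∀ B → ¬ B ≋ [] → ∃₂ λ e C → B ≋ powₚ 𝔽 f e ⊗ C × ev C ≢ K.0#
  valuation B B≢[] = go (<-wellFounded _) B (proj₂ (degree-of B≢[]))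
    where
    go : ∀ {n} → Acc ℕ._<_ n → ∀ B → Degree B n → ∃₂ λ e C → B ≋ powₚ 𝔽 f e ⊗ C × ev C ≢ K.0#
    go {n} (acc rec) B DB = decide (ev B K.≟ K.0#)
      where
      decide : Dec (ev B ≡ K.0#) → ∃₂ λ e C → B ≋ powₚ 𝔽 f e ⊗ C × ev C ≢ K.0#
      decide (no B≢0) = 0 , B , ≋-sym (⊗-identityˡ B) , B≢0
      decide (yes B≡0) = descend (minimal B B≡0)
        where
        descend : f ∣ B → ∃₂ λ e C → B ≋ powₚ 𝔽 f e ⊗ C × ev C ≢ K.0#
        descend (multiple q B≋fq) = suc (proj₁ r) , proj₁ (proj₂ r) ,
          ≋-trans B≋fq (≋-trans (⊗-congˡ f (proj₁ (proj₂ (proj₂ r)))) (≋-sym (⊗-assoc f (powₚ 𝔽 f (proj₁ r)) (proj₁ (proj₂ r))))) , proj₂ (proj₂ (proj₂ r))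
          where
          Dq = degree-of {q} (λ q≋[] → Degree⇒≢[] DB (≋-trans B≋fq (≋-trans (⊗-congˡ f q≋[]) (⊗-comm f []))))
          smaller : proj₁ Dq ℕ.< n
          smaller = subst (proj₁ Dq ℕ.<_) (Degree-unique (Degree-⊗ D (proj₂ Dq)) (Degree-resp-≋ B≋fq DB)) (ℕ.+-monoˡ-≤ (proj₁ Dq) 1≤d)
          r = go (rec smaller) q (proj₂ Dq)

absorb : ∀ {c ℓ} (R : CommutativeRing c ℓ) → let open CommutativeRing R in ∀ n j k → (n * (j * (k * k))) * n ≈ j * ((k * n) * (k * n))
absorb R = solve 3 (λ n j k → (n :* (j :* (k :* k))) :* n := j :* ((k :* n) :* (k :* n))) (CommutativeRing.refl R)
  where open IntegerCoefficients R

-- Degree bounds for the counting argument: `h` for the coordinates a and b, `l` for c and d. With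
-- 2h ≤ d and 2l + 1 ≤ d both halves of the norm stay within degree d, as J contributes 1 to the
-- second, while h + l + 1 = d maximises the number of quaternions.
halves : ∀ d → 1 ℕ.≤ d → ∃₂ λ h l → h ℕ.+ h ℕ.≤ d × suc (l ℕ.+ l) ℕ.≤ d × suc (h ℕ.+ l) ≡ d
halves (suc zero) _ = 0 , 0 , z≤n , s≤s z≤n , refl
halves (suc (suc zero)) _ = 1 , 0 , s≤s (s≤s z≤n) , s≤s z≤n , refl
halves (suc (suc (suc d))) _ with halves (suc d) (s≤s z≤n)
... | h , l , h+h≤ , l+l< , eq = suc h , suc l
  , subst (ℕ._≤ suc (suc (suc d))) (cong suc (sym (ℕ.+-suc h h))) (s≤s (s≤s h+h≤))
  , subst (ℕ._≤ suc (suc (suc d))) (cong (2 ℕ.+_) (sym (ℕ.+-suc l l))) (s≤s (s≤s l+l<))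
  , cong suc (trans (cong suc (ℕ.+-suc h l)) (cong suc eq))

-- Small quaternions killing a vector

module Thue (𝔽 : FiniteField) (ε : FiniteField.F 𝔽) (nonsquare : NonSquare 𝔽 ε)
    {K : FiniteField} (2≢0 : Char≢2 K)
    (φ : Hom 𝔽 K) (s : FiniteField.F K)
    {f : Poly 𝔽} {d : ℕ} (D : PolyTheory.Degree 𝔽 f d) (1≤d : 1 ℕ.≤ d)
    (minimal : ∀ p → Evaluation.ev φ s p ≡ FiniteField.0# K → PolyTheory._∣_ 𝔽 f p)
    (size-K : FiniteField.size K ≡ FiniteField.size 𝔽 ℕ.^ d)
    (α β : FiniteField.F K)
    (e≢0 : QuatEvaluation.e 𝔽 ε φ s ≢ FiniteField.0# K) (j≢0 : QuatEvaluation.j 𝔽 ε φ s ≢ FiniteField.0# K)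
    (split : Splits K (QuatEvaluation.e 𝔽 ε φ s) (QuatEvaluation.j 𝔽 ε φ s) α β) where
  private
    module 𝔽 = FieldTheory 𝔽
    module K = FieldTheory K
    module Q = QuatEvaluation 𝔽 ε φ s
    module H = QuaternionAlgebra K Q.e Q.j
  open PolyTheory 𝔽
  open Truncation 𝔽
  open Evaluation φ s
  open QuatNorm 𝔽 ε
  open Anisotropy 𝔽 ε nonsquare
  open Matrices K
  open Splitting K 2≢0 Q.e α β Q.j e≢0 j≢0 split

  Φ̂ : Quat 𝔽 ε → Mat2 K
  Φ̂ x = Φ (Q.evℍ x)

  Φ̂-· : ∀ x y → Φ̂ (_·Q_ 𝔽 ε x y) ≡ Φ̂ x ⊙ Φ̂ y
  Φ̂-· x y = trans (cong Φ (Q.evℍ-· x y)) (Φ-• (Q.evℍ x) (Q.evℍ y))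

  Φ̂-conj : ∀ x → Φ̂ (conj 𝔽 ε x) ≡ adj (Φ̂ x)
  Φ̂-conj x = trans (cong Φ (Q.evℍ-conj x)) (Φ-conjugate (Q.evℍ x))

  ev-normₚ-det : ∀ x → ev (normₚ x) ≡ det K (Φ̂ x)
  ev-normₚ-det x = trans (ev-normₚ φ s x) (sym (det-Φ (Q.evℍ x)))

  private
    h l : ℕ
    h = proj₁ (halves d 1≤d)
    l = proj₁ (proj₂ (halves d 1≤d))

    h+h≤d : h ℕ.+ h ℕ.≤ d
    h+h≤d = proj₁ (proj₂ (proj₂ (halves d 1≤d)))

    l+l<d : suc (l ℕ.+ l) ℕ.≤ d
    l+l<d = proj₁ (proj₂ (proj₂ (proj₂ (halves d 1≤d))))

    1+h+l≡d : suc (h ℕ.+ l) ≡ d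
    1+h+l≡d = proj₂ (proj₂ (proj₂ (proj₂ (halves d 1≤d))))

    Small : Set
    Small = (Vec 𝔽.F (suc h) × Vec 𝔽.F (suc h)) × (Vec 𝔽.F (suc l) × Vec 𝔽.F (suc l))

    q = 𝔽.size

    small↔ : _ ↔ Small
    small↔ = ((((Vec↔ 𝔽.enum (suc h) ×-↔ Vec↔ 𝔽.enum (suc h)) ↔-∘ Fin.*↔×) ×-↔ ((Vec↔ 𝔽.enum (suc l) ×-↔ Vec↔ 𝔽.enum (suc l)) ↔-∘ Fin.*↔×)) ↔-∘ Fin.*↔×)

    more : K.size ℕ.* K.size ℕ.< (q ℕ.^ suc h ℕ.* q ℕ.^ suc h) ℕ.* (q ℕ.^ suc l ℕ.* q ℕ.^ suc l)
    more = subst₂′ (trans (ℕ.^-distribˡ-+-* q d d) (sym (cong₂ ℕ._*_ size-K size-K)))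
      (trans (ℕ.^-distribˡ-+-* q (suc h ℕ.+ suc h) (suc l ℕ.+ suc l)) (cong₂ ℕ._*_ (ℕ.^-distribˡ-+-* q (suc h) (suc h)) (ℕ.^-distribˡ-+-* q (suc l) (suc l))))
      (ℕ.^-monoʳ-< q (Counting.2≤size 𝔽) exponents)
      where
      subst₂′ : ∀ {a b c d} → a ≡ b → c ≡ d → a ℕ.< c → b ℕ.< d
      subst₂′ refl refl lt = lt
      exponents : d ℕ.+ d ℕ.< (suc h ℕ.+ suc h) ℕ.+ (suc l ℕ.+ suc l)
      exponents = subst (d ℕ.+ d ℕ.<_) sum (ℕ.≤-trans (ℕ.n<1+n _) (ℕ.n≤1+n _))
        where
        open +-*-Solver
        sum : suc (suc (d ℕ.+ d)) ≡ (suc h ℕ.+ suc h) ℕ.+ (suc l ℕ.+ suc l)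
        sum = trans (cong (λ d → suc (suc (d ℕ.+ d))) (sym 1+h+l≡d))
          (solve 2 (λ h l → con 2 :+ ((con 1 :+ (h :+ l)) :+ (con 1 :+ (h :+ l))) := ((con 1 :+ h) :+ (con 1 :+ h)) :+ ((con 1 :+ l) :+ (con 1 :+ l))) refl h l)

    diff : ∀ {n} → Vec 𝔽.F n → Vec 𝔽.F n → Poly 𝔽
    diff v w = toList v ⊕ ⊖ toList w

    diff-<deg : ∀ {n} (v w : Vec 𝔽.F n) → diff v w <deg n
    diff-<deg v w = ⊖-<deg {toList v} {toList w} (toList-<deg v) (toList-<deg w)

    diff≋[]⇒≡ : ∀ {n} {v w : Vec 𝔽.F n} → diff v w ≋ [] → v ≡ w
    diff≋[]⇒≡ e = toList-injective-≋ (≈⇒≋ (≋[]⇒IsZero _ e))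

    ev-diff : ∀ {n} (v w : Vec 𝔽.F n) → ev (diff v w) ≡ ev (toList v) K.+ K.- ev (toList w)
    ev-diff v w = trans (ev-⊕ (toList v) (⊖ toList w)) (cong (ev (toList v) K.+_) (ev-⊖ (toList w)))

    toℍ : Small → ℍ K
    toℍ ((a , b) , (c , d)) = ev (toList a) ,ᵢ ev (toList b) ,ⱼ ev (toList c) ,ₖ ev (toList d)

    toQ : Small → Small → Quat 𝔽 ε
    toQ ((a , b) , (c , d)) ((a′ , b′) , (c′ , d′)) = quat (diff a a′) (diff b b′) (diff c c′) (diff d d′)

    apply-difference : ∀ a b c d a′ b′ c′ d′ v →
      let x = a ,ᵢ b ,ⱼ c ,ₖ d ; y = a′ ,ᵢ b′ ,ⱼ c′ ,ₖ d′
          z = (a K.+ K.- a′) ,ᵢ (b K.+ K.- b′) ,ⱼ (c K.+ K.- c′) ,ₖ (d K.+ K.- d′)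
      in apply (Φ x) v ≡ apply (Φ y) v → apply (Φ z) v ≡ (K.0# , K.0#)
    apply-difference a b c d a′ b′ c′ d′ (v , w) eq = cong₂ _,_
      (trans (K.solve 13 (λ e α β v w a b c d a′ b′ c′ d′ → let
            Φ₁₁ = λ a b c d → a K.:+ (c K.:* α K.:+ d K.:* (e K.:* β))
            Φ₁₂ = λ a b c d → e K.:* (b K.:- (c K.:* β K.:+ d K.:* α))
          in Φ₁₁ (a K.:- a′) (b K.:- b′) (c K.:- c′) (d K.:- d′) K.:* v K.:+ Φ₁₂ (a K.:- a′) (b K.:- b′) (c K.:- c′) (d K.:- d′) K.:* w
             K.:= (Φ₁₁ a b c d K.:* v K.:+ Φ₁₂ a b c d K.:* w) K.:- (Φ₁₁ a′ b′ c′ d′ K.:* v K.:+ Φ₁₂ a′ b′ c′ d′ K.:* w))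
          refl Q.e α β v w a b c d a′ b′ c′ d′) (K.x≡y⇒x-y≡0 (cong proj₁ eq)))
      (trans (K.solve 13 (λ e α β v w a b c d a′ b′ c′ d′ → let
            Φ₂₁ = λ a b c d → b K.:+ (c K.:* β K.:+ d K.:* α)
            Φ₂₂ = λ a b c d → a K.:- (c K.:* α K.:+ d K.:* (e K.:* β))
          in Φ₂₁ (a K.:- a′) (b K.:- b′) (c K.:- c′) (d K.:- d′) K.:* v K.:+ Φ₂₂ (a K.:- a′) (b K.:- b′) (c K.:- c′) (d K.:- d′) K.:* w
             K.:= (Φ₂₁ a b c d K.:* v K.:+ Φ₂₂ a b c d K.:* w) K.:- (Φ₂₁ a′ b′ c′ d′ K.:* v K.:+ Φ₂₂ a′ b′ c′ d′ K.:* w))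
          refl Q.e α β v w a b c d a′ b′ c′ d′) (K.x≡y⇒x-y≡0 (cong proj₂ eq)))

    toQ-<deg : ∀ x y → normₚ (toQ x y) <deg suc d
    toQ-<deg ((a , b) , (c , e)) ((a′ , b′) , (c′ , e′)) m d<m = begin
      coef (normₚ (quat A B C E)) m                            ≡⟨ coef-⊕ (pairNorm A B) (⊖ (Jₚ ⊗ pairNorm C E)) m ⟩
      coef (pairNorm A B) m 𝔽.+ coef (⊖ (Jₚ ⊗ pairNorm C E)) m   ≡⟨ cong₂ 𝔽._+_ first (trans (coef-⊖ (Jₚ ⊗ pairNorm C E) m) (trans (cong 𝔽.-_ second) 𝔽.-0#≈0#)) ⟩
      𝔽.0# 𝔽.+ 𝔽.0#                                            ≡⟨ 𝔽.+-identityʳ 𝔽.0# ⟩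
      𝔽.0#                                                     ∎
      where
      A = diff a a′
      B = diff b b′
      C = diff c c′
      E = diff e e′
      first : coef (pairNorm A B) m ≡ 𝔽.0#
      first = pairNorm-<deg {A} {B} (diff-<deg a a′) (diff-<deg b b′) m (ℕ.≤-trans (s≤s h+h≤d) d<m)
      second : coef (Jₚ ⊗ pairNorm C E) m ≡ 𝔽.0#
      second = proj₂ (⊗-top Jₚ (pairNorm C E) 1 (l ℕ.+ l) (bounded Degree-J) (pairNorm-<deg {C} {E} (diff-<deg c c′) (diff-<deg e e′))) m (ℕ.≤-trans (s≤s l+l<d) d<m)

    suc-h≤d : suc h ℕ.≤ d
    suc-h≤d = subst (suc h ℕ.≤_) 1+h+l≡d (s≤s (ℕ.m≤m+n h l))

    suc-l≤d : suc l ℕ.≤ d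
    suc-l≤d = subst (suc l ℕ.≤_) 1+h+l≡d (s≤s (ℕ.m≤n+m l h))

    ev-small≡0 : ∀ {n p} → n ℕ.≤ d → p <deg n → ev p ≡ K.0# → p ≋ []
    ev-small≡0 {n} {p} n≤d b eq = ∣-small⇒≋[] D (λ m d≤m → b m (ℕ.≤-trans n≤d d≤m)) (minimal p eq)

    Φ-0 : Φ (K.0# ,ᵢ K.0# ,ⱼ K.0# ,ₖ K.0#) ≡ 0ₘ
    Φ-0 = trans (cong Φ (H.ℍ-≡ (sym (K.zeroˡ K.1#)) (sym (K.zeroˡ K.0#)) (sym (K.zeroˡ K.0#)) (sym (K.zeroˡ K.0#))))
      (trans (Φ-∙ K.0# (H.real K.1#)) (Mat2-≡ (K.zeroˡ _) (K.zeroˡ _) (K.zeroˡ _) (K.zeroˡ _)))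

    toQ≢0 : ∀ x y → x ≢ y → Φ̂ (toQ x y) ≢ 0ₘ
    toQ≢0 ((a , b) , (c , e)) ((a′ , b′) , (c′ , e′)) x≢y eq = x≢y (cong₂ _,_
      (cong₂ _,_ (diff≋[]⇒≡ (ev-small≡0 suc-h≤d (diff-<deg a a′) (cong ℍ.a zero-quat))) (diff≋[]⇒≡ (ev-small≡0 suc-h≤d (diff-<deg b b′) (cong ℍ.b zero-quat))))
      (cong₂ _,_ (diff≋[]⇒≡ (ev-small≡0 suc-l≤d (diff-<deg c c′) (cong ℍ.c zero-quat))) (diff≋[]⇒≡ (ev-small≡0 suc-l≤d (diff-<deg e e′) (cong ℍ.d zero-quat)))))
      where
      zero-quat : Q.evℍ (quat (diff a a′) (diff b b′) (diff c c′) (diff e e′)) ≡ (K.0# ,ᵢ K.0# ,ⱼ K.0# ,ₖ K.0#)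
      zero-quat = Φ-injective (trans eq (sym Φ-0))

    toQ-norm≢[] : ∀ x y → x ≢ y → ¬ normₚ (toQ x y) ≋ []
    toQ-norm≢[] ((a , b) , (c , e)) ((a′ , b′) , (c′ , e′)) x≢y = normₚ≢[] (diff a a′) (diff b b′) (diff c c′) (diff e e′)
      (λ (ea , eb , ec , ee) → x≢y (cong₂ _,_ (cong₂ _,_ (diff≋[]⇒≡ ea) (diff≋[]⇒≡ eb)) (cong₂ _,_ (diff≋[]⇒≡ ec) (diff≋[]⇒≡ ee))))

    apply-toQ : ∀ x y v → apply (Φ (toℍ x)) v ≡ apply (Φ (toℍ y)) v → apply (Φ̂ (toQ x y)) v ≡ (K.0# , K.0#)
    apply-toQ ((a , b) , (c , e)) ((a′ , b′) , (c′ , e′)) v eq =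
      trans (cong (λ x → apply (Φ x) v) (H.ℍ-≡ (ev-diff a a′) (ev-diff b b′) (ev-diff c c′) (ev-diff e e′)))
        (apply-difference (ev (toList a)) (ev (toList b)) (ev (toList c)) (ev (toList e)) (ev (toList a′)) (ev (toList b′)) (ev (toList c′)) (ev (toList e′)) v eq)

    multiple-of-f : ∀ {p} → p <deg suc d → ¬ p ≋ [] → f ∣ p → ∃ λ c → c ≢ 𝔽.0# × p ≋ scale c f
    multiple-of-f {p} b p≢[] (multiple k p≋fk) = coef k 0 , leading≢0 Dk₀ , ≋-trans p≋fk (≋-trans (⊗-comm f k) (≋-trans (⊗-cong k≋const (≋-refl {f})) (const-⊗ (coef k 0) f)))
      where
      Dk = degree-of {k} (λ k≋[] → p≢[] (≋-trans p≋fk (≋-trans (⊗-congˡ f k≋[]) (⊗-comm f []))))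
      n≡0 : proj₁ Dk ≡ 0
      n≡0 = ℕ.n≤0⇒n≡0 (ℕ.+-cancelˡ-≤ d (proj₁ Dk) 0 (subst (d ℕ.+ proj₁ Dk ℕ.≤_) (sym (ℕ.+-identityʳ d)) (ℕ.s≤s⁻¹ (<deg⇒Degree< b (Degree-resp-≋ (≋-sym p≋fk) (Degree-⊗ D (proj₂ Dk)))))))
      Dk₀ : Degree k 0
      Dk₀ = subst (Degree k) n≡0 (proj₂ Dk)
      k≋const : k ≋ constₚ 𝔽 (coef k 0)
      k≋const = pointwise λ { zero → refl ; (suc n) → bounded Dk₀ (suc n) (s≤s z≤n) }

  Killer : K.F × K.F → Set
  Killer v = ∃ λ m → (∃ λ c → c ≢ 𝔽.0# × normₚ m ≋ scale c f) × apply (Φ̂ m) v ≡ (K.0# , K.0#) × Φ̂ m ≢ 0ₘ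

  private
    -- The matrix is singular, so `f` divides the norm. The norm has degree at most `d` and is
    -- nonzero by anisotropy, which leaves a nonzero constant as cofactor.
    killer : ∀ v → v ≢ (K.0# , K.0#) → ∀ x y → x ≢ y → apply (Φ (toℍ x)) v ≡ apply (Φ (toℍ y)) v → Killer v
    killer v v≢0 x y x≢y eq = m , multiple-of-f (toQ-<deg x y) (toQ-norm≢[] x y x≢y) (minimal (normₚ m) norm≡0) , kills , toQ≢0 x y x≢y
      where
      m : Quat 𝔽 ε
      m = toQ x y
      kills : apply (Φ̂ m) v ≡ (K.0# , K.0#)
      kills = apply-toQ x y v eq
      norm≡0 : ev (normₚ m) ≡ K.0#
      norm≡0 = trans (ev-normₚ-det m) (det-singular (Φ̂ m) v v≢0 kills)

  -- Quaternions of degree ≤ d form a space of dimension 2d + 2, and killing v imposes 2d conditions.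
  thue : ∀ v → v ≢ (K.0# , K.0#) → Killer v
  thue v v≢0 = killer v v≢0 (proj₁ c) (proj₁ (proj₂ c)) (proj₁ (proj₂ (proj₂ c))) (proj₂ (proj₂ (proj₂ c)))
    where
    c : ∃₂ λ x y → x ≢ y × apply (Φ (toℍ x)) v ≡ apply (Φ (toℍ y)) v
    c = collision small↔ ((K.enum ×-↔ K.enum) ↔-∘ Fin.*↔×) more (λ x → apply (Φ (toℍ x)) v)

  pure : (b c d : Poly 𝔽) → Quat 𝔽 ε
  pure b c d = quat [] b c d

  -- m z m̄, with its real part, which is zero only up to `_≋_`, replaced by the literal zero. The
  -- construction can thus be iterated on elements of the form `pure`.
  sandwich : Quat 𝔽 ε → Quat 𝔽 ε → Quat 𝔽 ε
  sandwich m (quat _ b c d) = let x = _·Q_ 𝔽 ε (_·Q_ 𝔽 ε m (pure b c d)) (conj 𝔽 ε m) in pure (qb x) (qc x) (qd x)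

  private
    sandwich-≋ : ∀ m b c d → qa (_·Q_ 𝔽 ε (_·Q_ 𝔽 ε m (pure b c d)) (conj 𝔽 ε m)) ≋ []
    sandwich-≋ (quat a₁ b₁ c₁ d₁) b c d = sandwich-pureₚ a₁ b₁ c₁ d₁ b c d

  Φ̂-sandwich : ∀ m b c d → Φ̂ (sandwich m (pure b c d)) ≡ (Φ̂ m ⊙ Φ̂ (pure b c d)) ⊙ adj (Φ̂ m)
  Φ̂-sandwich m b c d = begin
    Φ̂ (sandwich m (pure b c d))                                       ≡⟨ cong Φ (H.ℍ-≡ (sym (ev-cong (sandwich-≋ m b c d))) refl refl refl) ⟩
    Φ̂ (_·Q_ 𝔽 ε (_·Q_ 𝔽 ε m (pure b c d)) (conj 𝔽 ε m))               ≡⟨ Φ̂-· (_·Q_ 𝔽 ε m (pure b c d)) (conj 𝔽 ε m) ⟩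
    Φ̂ (_·Q_ 𝔽 ε m (pure b c d)) ⊙ Φ̂ (conj 𝔽 ε m)                      ≡⟨ cong₂ _⊙_ (Φ̂-· m (pure b c d)) (Φ̂-conj m) ⟩
    (Φ̂ m ⊙ Φ̂ (pure b c d)) ⊙ adj (Φ̂ m)                                ∎

  normₚ-sandwich : ∀ m b c d → normₚ (sandwich m (pure b c d)) ≋ (normₚ m ⊗ normₚ (pure b c d)) ⊗ normₚ m
  normₚ-sandwich m b c d = ≋-trans (Nₚ-cong {a′ = qa x} {qb x} {qc x} {qd x} (≋-sym (sandwich-≋ m b c d)) ≋-refl ≋-refl ≋-refl)
    (≋-trans (normₚ-· y (conj 𝔽 ε m)) (⊗-cong (normₚ-· m (pure b c d)) (normₚ-conj m)))
    where
    y = _·Q_ 𝔽 ε m (pure b c d)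
    x = _·Q_ 𝔽 ε y (conj 𝔽 ε m)

  Φ̂-pure : ∀ b c d → let M = Φ̂ (pure b c d) in M ≡ mat (Mat2.m₁₁ M) (Mat2.m₁₂ M) (Mat2.m₂₁ M) (K.- Mat2.m₁₁ M)
  Φ̂-pure b c d = Mat2-≡ refl refl refl (K.solve 1 (λ x → K.con ℤ.0ℤ K.:- x K.:= K.:- (K.con ℤ.0ℤ K.:+ x)) refl _)

  -- An element of norm J times a square, ready for being divided out of a multiple of κ fⁿ.
  record Reduced (n : ℕ) : Set where
    constructor reduced
    field
      ζb ζc ζd : Poly 𝔽
      κ        : 𝔽.F
      κ≢0      : κ ≢ 𝔽.0#
      norm≋    : normₚ (pure ζb ζc ζd) ≋ Jₚ ⊗ (scale κ (powₚ 𝔽 f n) ⊗ scale κ (powₚ 𝔽 f n))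
      Φ≢0      : Φ̂ (pure ζb ζc ζd) ≢ 0ₘ

  private
    start : Sol 𝔽 ε → Reduced 0
    start σ@((c , d) , eq) = reduced [] (constₚ 𝔽 c) (constₚ 𝔽 d) 𝔽.1# 𝔽.1≢0
      (≋-trans (normₚ-cj+dk σ) (≋-trans (≋-sym (⊗-identityʳ Jₚ)) (⊗-congˡ Jₚ (≋-sym 1·1≋1))))
      (λ Φ≡0 → 𝔽.1≢0 (trans (sym eq) (c≡d≡0 (ev-const≡0 (cong ℍ.c (Φ-injective (trans Φ≡0 (sym Φ-0))))) (ev-const≡0 (cong ℍ.d (Φ-injective (trans Φ≡0 (sym Φ-0))))))))
      where
      1·1≋1 : scale 𝔽.1# (oneₚ 𝔽) ⊗ scale 𝔽.1# (oneₚ 𝔽) ≋ oneₚ 𝔽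
      1·1≋1 = pointwise λ { zero → 𝔽.solve 0 ((𝔽.con ℤ.1ℤ 𝔽.:* 𝔽.con ℤ.1ℤ) 𝔽.:* (𝔽.con ℤ.1ℤ 𝔽.:* 𝔽.con ℤ.1ℤ) 𝔽.:+ 𝔽.con ℤ.0ℤ 𝔽.:= 𝔽.con ℤ.1ℤ) refl ; (suc _) → refl }
      ev-const≡0 : ∀ {c} → ev (constₚ 𝔽 c) ≡ K.0# → c ≡ 𝔽.0#
      ev-const≡0 {c} e = Hom.injective φ (trans (sym (ev-const c)) (trans e (sym (Hom.0-homo φ))))
      c≡d≡0 : c ≡ 𝔽.0# → d ≡ 𝔽.0# → ε 𝔽.* (d 𝔽.* d) 𝔽.+ (𝔽.- (c 𝔽.* c)) ≡ 𝔽.0#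
      c≡d≡0 refl refl = 𝔽.solve 1 (λ e → e 𝔽.:* (𝔽.con ℤ.0ℤ 𝔽.:* 𝔽.con ℤ.0ℤ) 𝔽.:- 𝔽.con ℤ.0ℤ 𝔽.:* 𝔽.con ℤ.0ℤ 𝔽.:= 𝔽.con ℤ.0ℤ) refl ε

    scale-merge : ∀ κ c p → scale κ p ⊗ scale c f ≋ scale (κ 𝔽.* c) (f ⊗ p)
    scale-merge κ c p = ℙ.begin
      scale κ p ⊗ scale c f           ℙ.≈⟨ scale-⊗ κ p (scale c f) ⟩
      scale κ (p ⊗ scale c f)         ℙ.≈⟨ scale-cong κ (≋-trans (⊗-comm p (scale c f)) (scale-⊗ c f p)) ⟩
      scale κ (scale c (f ⊗ p))       ℙ.≈⟨ pointwise (λ n → trans (coef-scale κ (scale c (f ⊗ p)) n) (trans (cong (κ 𝔽.*_) (coef-scale c (f ⊗ p) n)) (trans (sym (𝔽.*-assoc κ c _)) (sym (coef-scale (κ 𝔽.* c) (f ⊗ p) n))))) ⟩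
      scale (κ 𝔽.* c) (f ⊗ p)         ℙ.∎
      where
      scale-cong : ∀ κ {p q} → p ≋ q → scale κ p ≋ scale κ q
      scale-cong κ {p} {q} e = pointwise λ n → trans (coef-scale κ p n) (trans (cong (κ 𝔽.*_) (at e n)) (sym (coef-scale κ q n)))

    extend-by : ∀ {n} b c d κ → κ ≢ 𝔽.0# → normₚ (pure b c d) ≋ Jₚ ⊗ (scale κ (powₚ 𝔽 f n) ⊗ scale κ (powₚ 𝔽 f n)) →
                ∀ m μ → μ ≢ 𝔽.0# → normₚ m ≋ scale μ f → (Φ̂ m ⊙ Φ̂ (pure b c d)) ⊙ adj (Φ̂ m) ≢ 0ₘ → Reduced (suc n)
    extend-by {n} b c d κ κ≢0 norm≋ m μ μ≢0 Nm nz = reduced (qb ζ′) (qc ζ′) (qd ζ′) (κ 𝔽.* μ) (𝔽.x*y≢0 κ≢0 μ≢0) norm′ (λ Φ≡0 → nz (trans (sym (Φ̂-sandwich m b c d)) Φ≡0))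
      where
      k ζk : Poly 𝔽
      k = scale κ (powₚ 𝔽 f n)
      ζk = scale (κ 𝔽.* μ) (powₚ 𝔽 f (suc n))
      ζ′ : Quat 𝔽 ε
      ζ′ = sandwich m (pure b c d)
      norm′ : normₚ ζ′ ≋ Jₚ ⊗ (ζk ⊗ ζk)
      norm′ = ≋-trans (normₚ-sandwich m b c d) (≋-trans (⊗-cong (⊗-cong Nm norm≋) Nm) (≋-trans (absorb polyRing (scale μ f) Jₚ k)
        (⊗-congˡ Jₚ (⊗-cong (scale-merge κ μ (powₚ 𝔽 f n)) (scale-merge κ μ (powₚ 𝔽 f n))))))

    NonEigenvector : Mat2 K → K.F × K.F → Set
    NonEigenvector Z v = ∀ M → M ≢ 0ₘ → apply M v ≡ (K.0# , K.0#) → (M ⊙ Z) ⊙ adj M ≢ 0ₘ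

    escape : ∀ b c d → Φ̂ (pure b c d) ≢ 0ₘ → ∃ λ v → v ≢ (K.0# , K.0#) × NonEigenvector (Φ̂ (pure b c d)) v
    escape b c d Φ≢0 = subst (λ Z → ∃ λ v → v ≢ (K.0# , K.0#) × NonEigenvector Z v) (sym (Φ̂-pure b c d))
      (non-eigenvector 2≢0 _ _ _ (λ (x , y , z) → Φ≢0 (trans (Φ̂-pure b c d) (Mat2-≡ x y z (trans (cong K.-_ x) K.-0#≈0#)))))

    extend-killer : ∀ {n} (R : Reduced n) v → NonEigenvector (Φ̂ (pure (Reduced.ζb R) (Reduced.ζc R) (Reduced.ζd R))) v → Killer v → Reduced (suc n)
    extend-killer (reduced b c d κ κ≢0 norm≋ Φ≢0) v nev (m , (μ , μ≢0 , Nm) , kills , Φm≢0) =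
      extend-by b c d κ κ≢0 norm≋ m μ μ≢0 Nm (nev (Φ̂ m) Φm≢0 kills)

    -- Conjugating by an element of norm `f` up to a constant could give zero modulo `f`. This is
    -- avoided by letting it kill a vector that is not an eigenvector of the current matrix.
    extend : ∀ {n} → Reduced n → Reduced (suc n)
    extend R = next (escape (Reduced.ζb R) (Reduced.ζc R) (Reduced.ζd R) (Reduced.Φ≢0 R))
      where
      next : (∃ λ v → v ≢ (K.0# , K.0#) × NonEigenvector (Φ̂ (pure (Reduced.ζb R) (Reduced.ζc R) (Reduced.ζd R))) v) → Reduced (suc _)
      next (v , v≢0 , nev) = extend-killer R v nev (thue v v≢0)

  reduced-element : Sol 𝔽 ε → ∀ n → Reduced n
  reduced-element σ zero = start σ
  reduced-element σ (suc n) = extend (reduced-element σ n)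

module Rearrangements {c ℓ} (R : CommutativeRing c ℓ) where
  private module R = CommutativeRing R
  open R using (_≈_; _+_; _*_)
  open IntegerCoefficients R

  collect : ∀ i j r c n k f g → (i * (j * (r * c))) * (n * (k * (f * g))) ≈ (i * k) * ((j * (f * (n * r))) * (g * c))
  collect = solve 8 (λ i j r c n k f g → (i :* (j :* (r :* c))) :* (n :* (k :* (f :* g))) := (i :* k) :* ((j :* (f :* (n :* r))) :* (g :* c))) R.refl

  square-out : ∀ y n j k → (y * y) * ((n * (j * (k * k))) * n) ≈ j * ((y * (n * k)) * (y * (n * k)))
  square-out = solve 4 (λ y n j k → (y :* y) :* ((n :* (j :* (k :* k))) :* n) := j :* ((y :* (n :* k)) :* (y :* (n :* k)))) R.refl

-- Elementary matrices as images of words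

module Unipotents (𝔽 : FiniteField) (2≢0𝔽 : Char≢2 𝔽)
    (ε : FiniteField.F 𝔽) (nonsquare : NonSquare 𝔽 ε) (σ₀ : Sol 𝔽 ε)
    {K : FiniteField} (2≢0 : Char≢2 K)
    (φ : Hom 𝔽 K) (s : FiniteField.F K) (s≢0 : s ≢ FiniteField.0# K)
    {f : Poly 𝔽} {d : ℕ} (D : PolyTheory.Degree 𝔽 f d) (1≤d : 1 ℕ.≤ d)
    (f[s]≡0 : Evaluation.ev φ s f ≡ FiniteField.0# K)
    (minimal : ∀ p → Evaluation.ev φ s p ≡ FiniteField.0# K → PolyTheory._∣_ 𝔽 f p)
    (size-K : FiniteField.size K ≡ FiniteField.size 𝔽 ℕ.^ d)
    (generates : ∀ x → ∃ λ p → Evaluation.ev φ s p ≡ x)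
    (α β : FiniteField.F K)
    (e≢0 : QuatEvaluation.e 𝔽 ε φ s ≢ FiniteField.0# K) (j≢0 : QuatEvaluation.j 𝔽 ε φ s ≢ FiniteField.0# K)
    (split : Splits K (QuatEvaluation.e 𝔽 ε φ s) (QuatEvaluation.j 𝔽 ε φ s) α β) where
  private
    module 𝔽 = FieldTheory 𝔽
    module K = FieldTheory K
    module Q = QuatEvaluation 𝔽 ε φ s
    module H = QuaternionAlgebra K Q.e Q.j
    module E₁ = Evaluation (idHom 𝔽) (FiniteField.1# 𝔽)
  open PolyTheory 𝔽
  open Evaluation φ s
  open QuatNorm 𝔽 ε
  open Matrices K
  open Splitting K 2≢0 Q.e α β Q.j e≢0 j≢0 split
  open Thue 𝔽 ε nonsquare 2≢0 φ s D 1≤d minimal size-K α β e≢0 j≢0 split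
  open WordValues 𝔽 ε K Q.e Q.j (Q.evℍ ∘ γ 𝔽 ε)
  open Rearrangements polyRing

  private
    lift : K.F → Poly 𝔽
    lift x = proj₁ (generates x)

    lifts : List (Poly 𝔽)
    lifts = map (lift ∘ Inverse.to K.enum) (allFin K.size)

    lift∈ : ∀ x → lift x ∈ lifts
    lift∈ x = subst (λ y → lift y ∈ lifts) (Inverse.strictlyInverseˡ K.enum x) (∈-map⁺ (lift ∘ Inverse.to K.enum) (∈-allFin (Inverse.from K.enum x)))

    fromPairs : Poly 𝔽 × Poly 𝔽 → Poly 𝔽 × Poly 𝔽 → Quat 𝔽 ε
    fromPairs ab cd = quat (proj₁ ab) (proj₂ ab) (proj₁ cd) (proj₂ cd)

    quats : List (Quat 𝔽 ε)
    quats = cartesianProductWith fromPairs (cartesianProduct lifts lifts) (cartesianProduct lifts lifts)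

    liftQ : ℍ K → Quat 𝔽 ε
    liftQ (a ,ᵢ b ,ⱼ c ,ₖ d) = quat (lift a) (lift b) (lift c) (lift d)

    liftQ∈ : ∀ x → liftQ x ∈ quats
    liftQ∈ (a ,ᵢ b ,ⱼ c ,ₖ d) = ∈-cartesianProductWith⁺ fromPairs (∈-cartesianProduct⁺ (lift∈ a) (lift∈ b)) (∈-cartesianProduct⁺ (lift∈ c) (lift∈ d))

    evℍ-liftQ : ∀ x → Q.evℍ (liftQ x) ≡ x
    evℍ-liftQ (a ,ᵢ b ,ⱼ c ,ₖ d) = H.ℍ-≡ (proj₂ (generates a)) (proj₂ (generates b)) (proj₂ (generates c)) (proj₂ (generates d))

    -- A quaternion whose norm vanishes at `s` is no conjugator; replacing its norm by 1 keeps the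
    -- common multiple nonzero at `s`.
    unit : (p : Poly 𝔽) → Dec (ev p ≡ K.0#) → Poly 𝔽
    unit p (yes _) = oneₚ 𝔽
    unit p (no _) = p

    unit≢0 : ∀ p p? → ev (unit p p?) ≢ K.0#
    unit≢0 p (yes _) = K.1≢0 ∘ trans (sym ev-one)
    unit≢0 p (no p≢0) = p≢0

    commonNorm : List (Quat 𝔽 ε) → Poly 𝔽
    commonNorm [] = oneₚ 𝔽
    commonNorm (w ∷ ws) = unit (normₚ w) (ev (normₚ w) K.≟ K.0#) ⊗ commonNorm ws

    commonNorm≢0 : ∀ ws → ev (commonNorm ws) ≢ K.0#
    commonNorm≢0 [] = K.1≢0 ∘ trans (sym ev-one)
    commonNorm≢0 (w ∷ ws) eq = K.x*y≢0 (unit≢0 (normₚ w) (ev (normₚ w) K.≟ K.0#)) (commonNorm≢0 ws)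
      (trans (sym (ev-⊗ (unit (normₚ w) (ev (normₚ w) K.≟ K.0#)) (commonNorm ws))) eq)

    norm∣commonNorm : ∀ {w ws} → w ∈ ws → ev (normₚ w) ≢ K.0# → normₚ w ∣ commonNorm ws
    norm∣commonNorm {w} {_ ∷ ws} (here refl) w≢0 = head (ev (normₚ w) K.≟ K.0#)
      where
      head : ∀ p? → normₚ w ∣ unit (normₚ w) p? ⊗ commonNorm ws
      head (yes w≡0) = ⊥-elim (w≢0 w≡0)
      head (no _) = multiple (commonNorm ws) ≋-refl
    norm∣commonNorm {w} {v ∷ ws} (there w∈ws) w≢0 = ∣-* {normₚ w} (unit (normₚ v) (ev (normₚ v) K.≟ K.0#)) (norm∣commonNorm w∈ws w≢0)

    -- One multiple of the norms of all possible conjugators at once: the Pell element, the exponent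
    -- `e` and the reduced element can be fixed before the conjugator is chosen.
    ν : Poly 𝔽
    ν = commonNorm quats

    ev≢0⇒≢[] : ∀ {p} → ev p ≢ K.0# → ¬ p ≋ []
    ev≢0⇒≢[] p≢0 e = p≢0 (ev-cong e)

    record Unit : Set where
      field
        A C : Poly 𝔽
        n e : ℕ
        norm≋ : A ⊗ A ⊕ Jₚ ⊗ (((Jₚ ⊗ (f ⊗ ν)) ⊗ (powₚ 𝔽 f e ⊗ C)) ⊗ ((Jₚ ⊗ (f ⊗ ν)) ⊗ (powₚ 𝔽 f e ⊗ C))) ≋ powₚ 𝔽 (X 𝔽) n
        C≢0 : ev C ≢ K.0#

    -- `Jₚ` makes the i-coordinate vanish at u = 1. `f` guarantees the total exponent `suc e`,
    -- without which the reduced element need not be nilpotent at `s`. `ν` leaves room for dividing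
    -- by the norm of a conjugator.
    G : Poly 𝔽
    G = Jₚ ⊗ (f ⊗ ν)

    G≢[] : ¬ G ≋ []
    G≢[] = ⊗≢[] (Degree⇒≢[] Degree-J) (⊗≢[] (Degree⇒≢[] D) (ev≢0⇒≢[] (commonNorm≢0 quats)))

    toUnit : (∃₂ λ A B → ∃ λ n → (A ⊗ A ⊕ Jₚ ⊗ (B ⊗ B) ≋ powₚ 𝔽 (X 𝔽) n) × (¬ B ≋ []) × G ∣ B) → Unit
    toUnit (A , B , n , norm≋ , B≢[] , multiple B′ B≋) = finish (Valuation.valuation φ s D 1≤d minimal B′ B′≢[])
      where
      B′≢[] : ¬ B′ ≋ []
      B′≢[] e = B≢[] (≋-trans B≋ (≋-trans (⊗-congˡ G e) (⊗-comm G [])))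
      finish : (∃₂ λ e C → B′ ≋ powₚ 𝔽 f e ⊗ C × ev C ≢ K.0#) → Unit
      finish (e , C , B′≋ , C≢0) = record { A = A ; C = C ; n = n ; e = e ; C≢0 = C≢0
        ; norm≋ = ≋-trans (⊕-cong (≋-refl {A ⊗ A}) (⊗-congˡ Jₚ (⊗-cong B≋′ B≋′))) norm≋ }
        where
        B≋′ : G ⊗ (powₚ 𝔽 f e ⊗ C) ≋ B
        B≋′ = ≋-sym (≋-trans B≋ (⊗-congˡ G B′≋))

    pellUnit : Unit
    pellUnit = toUnit (Pell.pell 𝔽 2≢0𝔽 ε (proj₂ (degree-of G≢[])))

  InImage : Mat2 K → Set
  InImage M = ∃₂ λ w l → l ≢ K.0# × Φ (wordValue w) ≡ l *ₘ M

  private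
    module Element (U : Unit) (R : Reduced (suc (Unit.e U))) where
      open Unit U
      open Reduced R renaming (norm≋ to ζ-norm≋)

      κ⁻¹ : 𝔽.F
      κ⁻¹ = 𝔽.inv κ κ≢0

      ζ : Quat 𝔽 ε
      ζ = pure ζb ζc ζd

      Z : Mat2 K
      Z = Φ̂ ζ

      -- `y₀` is the factor `y` of the nilpotent part times the determinant of the conjugator, by
      -- `y·det`, and depends on no conjugator.
      a y₀ : K.F
      a = ev A
      y₀ = Hom.⟦ φ ⟧ κ⁻¹ K.* (Q.j K.* (ev ν K.* ev C))

      y₀≢0 : y₀ ≢ K.0#
      y₀≢0 = K.x*y≢0 (Hom.≢0-homo φ (𝔽.inv≢0 κ κ≢0)) (K.x*y≢0 j≢0 (K.x*y≢0 (commonNorm≢0 quats) C≢0))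

      module _ (w : Quat 𝔽 ε) (ρ : Poly 𝔽) (ν≋ : ν ≋ normₚ w ⊗ ρ) where
        -- The Pell coefficient `G ⊗ (powₚ 𝔽 f e ⊗ C)` divided by `normₚ w ⊗ k`, with the quotient
        -- written out; `YNk` verifies it. Since the norm of `ξ` is J times the square of that
        -- divisor, the norm of `x` is the Pell norm again.
        Y : Poly 𝔽
        Y = constₚ 𝔽 κ⁻¹ ⊗ (Jₚ ⊗ (ρ ⊗ C))

        ξ : Quat 𝔽 ε
        ξ = sandwich w ζ

        x : Quat 𝔽 ε
        x = quat A (Y ⊗ qb ξ) (Y ⊗ qc ξ) (Y ⊗ qd ξ)

        k : Poly 𝔽
        k = scale κ (powₚ 𝔽 f (suc e))

        YNk : Y ⊗ (normₚ w ⊗ k) ≋ G ⊗ (powₚ 𝔽 f e ⊗ C)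
        YNk = ≋-trans (⊗-congˡ Y (⊗-congˡ (normₚ w) (≋-sym (const-⊗ κ (powₚ 𝔽 f (suc e))))))
          (≋-trans (collect (constₚ 𝔽 κ⁻¹) Jₚ ρ C (normₚ w) (constₚ 𝔽 κ) f (powₚ 𝔽 f e))
          (≋-trans (⊗-cong κκ (≋-refl {(Jₚ ⊗ (f ⊗ (normₚ w ⊗ ρ))) ⊗ (powₚ 𝔽 f e ⊗ C)}))
          (≋-trans (⊗-identityˡ _)
            (⊗-cong (⊗-congˡ Jₚ (⊗-congˡ f (≋-sym ν≋))) (≋-refl {powₚ 𝔽 f e ⊗ C})))))
          where
          κκ : constₚ 𝔽 κ⁻¹ ⊗ constₚ 𝔽 κ ≋ oneₚ 𝔽
          κκ = ≋-trans (const-⊗ κ⁻¹ (constₚ 𝔽 κ)) (∷-cong (𝔽.inv-inverseˡ κ κ≢0) ≋-refl)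

        x-norm : normₚ x ≋ powₚ 𝔽 (X 𝔽) n
        x-norm = ≋-trans (Nₚ-pure A Y (qb ξ) (qc ξ) (qd ξ)) (≋-trans (⊕-cong (≋-refl {A ⊗ A})
          (≋-trans (⊗-congˡ (Y ⊗ Y) (≋-trans (normₚ-sandwich w ζb ζc ζd) (⊗-cong (⊗-congˡ (normₚ w) ζ-norm≋) (≋-refl {normₚ w}))))
          (≋-trans (square-out Y (normₚ w) Jₚ k) (⊗-congˡ Jₚ (⊗-cong YNk YNk))))) norm≋)

        x-b[1] : E₁.ev (qb x) ≡ 𝔽.0#
        x-b[1] = begin
          E₁.ev (Y ⊗ qb ξ)                        ≡⟨ E₁.ev-⊗ Y (qb ξ) ⟩
          E₁.ev Y 𝔽.* E₁.ev (qb ξ)                ≡⟨ cong (𝔽._* E₁.ev (qb ξ)) Y[1]≡0 ⟩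
          𝔽.0# 𝔽.* E₁.ev (qb ξ)                   ≡⟨ 𝔽.zeroˡ _ ⟩
          𝔽.0#                                    ∎
          where
          J[1]≡0 : E₁.ev Jₚ ≡ 𝔽.0#
          J[1]≡0 = trans (cong (λ z → 𝔽.- 𝔽.1# 𝔽.+ 𝔽.1# 𝔽.* z) E₁.ev-one) (𝔽.solve 0 (𝔽.:- 𝔽.con ℤ.1ℤ 𝔽.:+ 𝔽.con ℤ.1ℤ 𝔽.:* 𝔽.con ℤ.1ℤ 𝔽.:= 𝔽.con ℤ.0ℤ) refl)
          Y[1]≡0 : E₁.ev Y ≡ 𝔽.0#
          Y[1]≡0 = begin
            E₁.ev Y                                                     ≡⟨ E₁.ev-⊗ (constₚ 𝔽 κ⁻¹) (Jₚ ⊗ (ρ ⊗ C)) ⟩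
            E₁.ev (constₚ 𝔽 κ⁻¹) 𝔽.* E₁.ev (Jₚ ⊗ (ρ ⊗ C))               ≡⟨ cong (E₁.ev (constₚ 𝔽 κ⁻¹) 𝔽.*_) (trans (E₁.ev-⊗ Jₚ (ρ ⊗ C)) (cong (𝔽._* E₁.ev (ρ ⊗ C)) J[1]≡0)) ⟩
            E₁.ev (constₚ 𝔽 κ⁻¹) 𝔽.* (𝔽.0# 𝔽.* E₁.ev (ρ ⊗ C))           ≡⟨ trans (cong (E₁.ev (constₚ 𝔽 κ⁻¹) 𝔽.*_) (𝔽.zeroˡ _)) (𝔽.zeroʳ _) ⟩
            𝔽.0#                                                        ∎

        y : K.F
        y = ev Y

        y·det : y K.* det K (Φ̂ w) ≡ y₀
        y·det = begin
          ev Y K.* det K (Φ̂ w)                    ≡⟨ cong₂ K._*_ (trans (ev-⊗ (constₚ 𝔽 κ⁻¹) (Jₚ ⊗ (ρ ⊗ C))) (cong₂ K._*_ (ev-const κ⁻¹) (trans (ev-⊗ Jₚ (ρ ⊗ C)) (cong₂ K._*_ Q.ev-Jₚ (ev-⊗ ρ C))))) (sym (ev-normₚ-det w)) ⟩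
          (Hom.⟦ φ ⟧ κ⁻¹ K.* (Q.j K.* (ev ρ K.* ev C))) K.* ev (normₚ w)
            ≡⟨ K.solve 5 (λ i j r c n → (i K.:* (j K.:* (r K.:* c))) K.:* n K.:= i K.:* (j K.:* ((n K.:* r) K.:* c))) refl (Hom.⟦ φ ⟧ κ⁻¹) Q.j (ev ρ) (ev C) (ev (normₚ w)) ⟩
          Hom.⟦ φ ⟧ κ⁻¹ K.* (Q.j K.* ((ev (normₚ w) K.* ev ρ) K.* ev C))
            ≡⟨ cong (λ z → Hom.⟦ φ ⟧ κ⁻¹ K.* (Q.j K.* (z K.* ev C))) (trans (ev-cong ν≋) (ev-⊗ (normₚ w) ρ)) ⟨
          y₀                                      ∎

        Φ̂-x : Φ̂ x ≡ (a *ₘ 1ₘ) +ₘ (y *ₘ ((Φ̂ w ⊙ Z) ⊙ adj (Φ̂ w)))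
        Φ̂-x = begin
          Φ̂ x                                                                  ≡⟨ cong Φ (H.ℍ-≡ refl (ev-⊗ Y (qb ξ)) (ev-⊗ Y (qc ξ)) (ev-⊗ Y (qd ξ))) ⟩
          Φ (a ,ᵢ y K.* ev (qb ξ) ,ⱼ y K.* ev (qc ξ) ,ₖ y K.* ev (qd ξ))       ≡⟨ Φ-affine a y (ev (qb ξ)) (ev (qc ξ)) (ev (qd ξ)) ⟩
          (a *ₘ 1ₘ) +ₘ (y *ₘ Φ̂ ξ)                                              ≡⟨ cong (λ M → (a *ₘ 1ₘ) +ₘ (y *ₘ M)) (Φ̂-sandwich w ζb ζc ζd) ⟩
          (a *ₘ 1ₘ) +ₘ (y *ₘ ((Φ̂ w ⊙ Z) ⊙ adj (Φ̂ w)))                          ∎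

      k[s]≡0 : ev (scale κ (powₚ 𝔽 f (suc e))) ≡ K.0#
      k[s]≡0 = trans (ev-scale κ (powₚ 𝔽 f (suc e))) (trans (cong (Hom.⟦ φ ⟧ κ K.*_) (trans (ev-⊗ f (powₚ 𝔽 f e)) (trans (cong (K._* ev (powₚ 𝔽 f e)) f[s]≡0) (K.zeroˡ _)))) (K.zeroʳ _))

      -- The trace is zero, and the determinant is the norm, a multiple of `f` because the exponent
      -- `suc e` is positive.
      nilpotent : Mat2.m₁₁ Z K.* Mat2.m₁₁ Z K.+ Mat2.m₁₂ Z K.* Mat2.m₂₁ Z ≡ K.0#
      nilpotent = begin
        p K.* p K.+ q K.* r                          ≡⟨ K.solve 3 (λ x y z → x K.:* x K.:+ y K.:* z K.:= K.:- (x K.:* (K.:- x) K.:- y K.:* z)) refl p q r ⟩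
        K.- det K (mat p q r (K.- p))                ≡⟨ cong (λ M → K.- det K M) (Φ̂-pure ζb ζc ζd) ⟨
        K.- det K Z                                  ≡⟨ cong K.-_ (ev-normₚ-det ζ) ⟨
        K.- ev (normₚ ζ)                             ≡⟨ cong K.-_ (trans (ev-cong ζ-norm≋) (trans (ev-⊗ Jₚ (kk ⊗ kk)) (cong (ev Jₚ K.*_) (trans (ev-⊗ kk kk) (cong₂ K._*_ k[s]≡0 k[s]≡0))))) ⟩
        K.- (ev Jₚ K.* (K.0# K.* K.0#))              ≡⟨ K.solve 1 (λ j → K.:- (j K.:* (K.con ℤ.0ℤ K.:* K.con ℤ.0ℤ)) K.:= K.con ℤ.0ℤ) refl (ev Jₚ) ⟩
        K.0#                                         ∎
        where
        p q r : K.F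
        p = Mat2.m₁₁ Z
        q = Mat2.m₁₂ Z
        r = Mat2.m₂₁ Z
        kk : Poly 𝔽
        kk = scale κ (powₚ 𝔽 f (suc e))

      Z-nonzero : ¬ (Mat2.m₁₁ Z ≡ K.0# × Mat2.m₁₂ Z ≡ K.0# × Mat2.m₂₁ Z ≡ K.0#)
      Z-nonzero (x≡0 , y≡0 , z≡0) = Φ≢0 (trans (Φ̂-pure ζb ζc ζd) (Mat2-≡ x≡0 y≡0 z≡0 (trans (cong K.-_ x≡0) K.-0#≈0#)))

      a²≡sⁿ : a K.* a ≡ s K.^ n
      a²≡sⁿ = begin
        a K.* a                                      ≡⟨ K.solve 2 (λ a j → a K.:* a K.:= a K.:* a K.:+ j K.:* (K.con ℤ.0ℤ K.:* K.con ℤ.0ℤ)) refl a (ev Jₚ) ⟩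
        a K.* a K.+ ev Jₚ K.* (K.0# K.* K.0#)        ≡⟨ cong (λ z → a K.* a K.+ ev Jₚ K.* (z K.* z)) B≡0 ⟨
        a K.* a K.+ ev Jₚ K.* (ev B K.* ev B)        ≡⟨ trans (ev-⊕ (A ⊗ A) (Jₚ ⊗ (B ⊗ B))) (cong₂ K._+_ (ev-⊗ A A) (trans (ev-⊗ Jₚ (B ⊗ B)) (cong (ev Jₚ K.*_) (ev-⊗ B B)))) ⟨
        ev (A ⊗ A ⊕ Jₚ ⊗ (B ⊗ B))                    ≡⟨ ev-cong norm≋ ⟩
        ev (powₚ 𝔽 (X 𝔽) n)                          ≡⟨ trans (ev-pow (X 𝔽) n) (K.^-congˡ n ev-X) ⟩
        s K.^ n                                      ∎
        where
        B : Poly 𝔽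
        B = G ⊗ (powₚ 𝔽 f e ⊗ C)
        B≡0 : ev B ≡ K.0#
        B≡0 = begin
          ev B                                                              ≡⟨ ev-⊗ G (powₚ 𝔽 f e ⊗ C) ⟩
          ev G K.* ev (powₚ 𝔽 f e ⊗ C)                                      ≡⟨ cong (K._* ev (powₚ 𝔽 f e ⊗ C)) (trans (ev-⊗ Jₚ (f ⊗ ν)) (cong (ev Jₚ K.*_) (trans (ev-⊗ f ν) (cong (K._* ev ν) f[s]≡0)))) ⟩
          (ev Jₚ K.* (K.0# K.* ev ν)) K.* ev (powₚ 𝔽 f e ⊗ C)               ≡⟨ K.solve 3 (λ j v c → (j K.:* (K.con ℤ.0ℤ K.:* v)) K.:* c K.:= K.con ℤ.0ℤ) refl (ev Jₚ) (ev ν) _ ⟩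
          K.0#                                                              ∎

      a≢0 : a ≢ K.0#
      a≢0 a≡0 = K.x^n≢0 n s≢0 (trans (sym a²≡sⁿ) (trans (cong (K._* a) a≡0) (K.zeroˡ a)))

      module Target (τ : K.F) (τ≢0 : τ ≢ K.0#) where
        y₀⁻¹ ρ : K.F
        y₀⁻¹ = K.inv y₀ y₀≢0
        -- Chosen so that `y` times the factor det W · ρ produced by the conjugation is aτ for every
        -- W.
        ρ = a K.* τ K.* y₀⁻¹

        ρ≢0 : ρ ≢ K.0#
        ρ≢0 = K.x*y≢0 (K.x*y≢0 a≢0 τ≢0) (K.inv≢0 y₀ y₀≢0)

        y₀ρ : y₀ K.* ρ ≡ a K.* τ
        y₀ρ = begin
          y₀ K.* (a K.* τ K.* y₀⁻¹)       ≡⟨ K.solve 3 (λ y b i → y K.:* (b K.:* i) K.:= b K.:* (y K.:* i)) refl y₀ (a K.* τ) y₀⁻¹ ⟩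
          a K.* τ K.* (y₀ K.* y₀⁻¹)       ≡⟨ cong (a K.* τ K.*_) (K.inv-inverseʳ y₀ y₀≢0) ⟩
          a K.* τ K.* K.1#                ≡⟨ K.*-identityʳ _ ⟩
          a K.* τ                         ∎

        -- `W` is the matrix of a lift taken from the finite list `quats`, and its determinant is
        -- nonzero; so the norm of the lift is one of the factors collected in `ν`.
        realise : ∀ T N → (a *ₘ 1ₘ) +ₘ ((a K.* τ) *ₘ N) ≡ a *ₘ T →
                  (∃ λ W → det K W ≢ K.0# × (W ⊙ Z) ⊙ adj W ≡ (det K W K.* ρ) *ₘ N) → InImage T
        realise T N combine (W , detW≢0 , WZW) = conclude (norm∣commonNorm (liftQ∈ (Φ⁻¹ W)) norm≢0)
          where
          w : Quat 𝔽 ε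
          w = liftQ (Φ⁻¹ W)
          Φ̂-w : Φ̂ w ≡ W
          Φ̂-w = trans (cong Φ (evℍ-liftQ (Φ⁻¹ W))) (Φ-Φ⁻¹ W)
          norm≢0 : ev (normₚ w) ≢ K.0#
          norm≢0 eq = detW≢0 (trans (cong (det K) (sym Φ̂-w)) (trans (sym (ev-normₚ-det w)) eq))
          conclude : normₚ w ∣ ν → InImage T
          conclude (multiple r ν≋) = finish (Factorisation.factorise 𝔽 ε nonsquare σ₀ φ s s≢0 n (x w r ν≋) (x-norm w r ν≋) (x-b[1] w r ν≋))
            where
            value : Φ̂ (x w r ν≋) ≡ a *ₘ T
            value = begin
              Φ̂ (x w r ν≋)                                                          ≡⟨ Φ̂-x w r ν≋ ⟩
              (a *ₘ 1ₘ) +ₘ (y w r ν≋ *ₘ ((Φ̂ w ⊙ Z) ⊙ adj (Φ̂ w)))                    ≡⟨ cong (λ M → (a *ₘ 1ₘ) +ₘ (y w r ν≋ *ₘ ((M ⊙ Z) ⊙ adj M))) Φ̂-w ⟩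
              (a *ₘ 1ₘ) +ₘ (y w r ν≋ *ₘ ((W ⊙ Z) ⊙ adj W))                          ≡⟨ cong (λ M → (a *ₘ 1ₘ) +ₘ (y w r ν≋ *ₘ M)) WZW ⟩
              (a *ₘ 1ₘ) +ₘ (y w r ν≋ *ₘ (det K W K.* ρ) *ₘ N)                       ≡⟨ cong ((a *ₘ 1ₘ) +ₘ_) (trans (*ₘ-*ₘ (y w r ν≋) (det K W K.* ρ) N) (cong (_*ₘ N) scalar)) ⟩
              (a *ₘ 1ₘ) +ₘ ((a K.* τ) *ₘ N)                                         ≡⟨ combine ⟩
              a *ₘ T                                                                ∎
              where
              scalar : y w r ν≋ K.* (det K W K.* ρ) ≡ a K.* τ
              scalar = begin
                y w r ν≋ K.* (det K W K.* ρ)        ≡⟨ K.*-assoc (y w r ν≋) (det K W) ρ ⟨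
                y w r ν≋ K.* det K W K.* ρ          ≡⟨ cong (λ M → y w r ν≋ K.* det K M K.* ρ) Φ̂-w ⟨
                y w r ν≋ K.* det K (Φ̂ w) K.* ρ      ≡⟨ cong (K._* ρ) (y·det w r ν≋) ⟩
                y₀ K.* ρ                            ≡⟨ y₀ρ ⟩
                a K.* τ                             ∎
            finish : (∃₂ λ v l → l ≢ K.0# × Q.evℍ (x w r ν≋) ≡ l H.∙ wordValue v) → InImage T
            finish (v , l , l≢0 , eq) = v , K.inv l l≢0 K.* a , K.x*y≢0 (K.inv≢0 l l≢0) a≢0 , (begin
              Φ (wordValue v)                                     ≡⟨ 1*ₘ _ ⟨
              K.1# *ₘ Φ (wordValue v)                             ≡⟨ cong (_*ₘ Φ (wordValue v)) (K.inv-inverseˡ l l≢0) ⟨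
              (K.inv l l≢0 K.* l) *ₘ Φ (wordValue v)              ≡⟨ *ₘ-*ₘ (K.inv l l≢0) l (Φ (wordValue v)) ⟨
              K.inv l l≢0 *ₘ l *ₘ Φ (wordValue v)                 ≡⟨ cong (K.inv l l≢0 *ₘ_) (trans (cong Φ eq) (Φ-∙ l (wordValue v))) ⟨
              K.inv l l≢0 *ₘ Φ̂ (x w r ν≋)                         ≡⟨ cong (K.inv l l≢0 *ₘ_) value ⟩
              K.inv l l≢0 *ₘ a *ₘ T                               ≡⟨ *ₘ-*ₘ (K.inv l l≢0) a T ⟩
              (K.inv l l≢0 K.* a) *ₘ T                            ∎)

        Z≡ : mat (Mat2.m₁₁ Z) (Mat2.m₁₂ Z) (Mat2.m₂₁ Z) (K.- Mat2.m₁₁ Z) ≡ Z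
        Z≡ = sym (Φ̂-pure ζb ζc ζd)

        upper-image : InImage (upper τ)
        upper-image = realise (upper τ) (mat K.0# K.1# K.0# K.0#) (add-upper a τ)
          (subst (λ Z → ∃ λ W → det K W ≢ K.0# × (W ⊙ Z) ⊙ adj W ≡ (det K W K.* ρ) *ₘ mat K.0# K.1# K.0# K.0#) Z≡
            (conjugate-to-upper (Mat2.m₁₁ Z) (Mat2.m₁₂ Z) (Mat2.m₂₁ Z) nilpotent Z-nonzero ρ≢0))

        lower-image : InImage (lower τ)
        lower-image = realise (lower τ) (mat K.0# K.0# K.1# K.0#) (add-lower a τ)
          (subst (λ Z → ∃ λ W → det K W ≢ K.0# × (W ⊙ Z) ⊙ adj W ≡ (det K W K.* ρ) *ₘ mat K.0# K.0# K.1# K.0#) Z≡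
            (conjugate-to-lower (Mat2.m₁₁ Z) (Mat2.m₁₂ Z) (Mat2.m₂₁ Z) nilpotent Z-nonzero ρ≢0))

    module The = Element pellUnit (reduced-element σ₀ (suc (Unit.e pellUnit)))

    one-image : InImage 1ₘ
    one-image = [] , K.1# , K.1≢0 , trans Φ-real (sym (1*ₘ 1ₘ))

    upper-in : ∀ t → InImage (upper t)
    upper-in t = decide (t K.≟ K.0#)
      where
      decide : Dec (t ≡ K.0#) → InImage (upper t)
      decide (yes t≡0) = subst (λ t → InImage (upper t)) (sym t≡0) one-image
      decide (no t≢0) = The.Target.upper-image t t≢0

    lower-in : ∀ t → InImage (lower t)
    lower-in t = decide (t K.≟ K.0#)
      where
      decide : Dec (t ≡ K.0#) → InImage (lower t)
      decide (yes t≡0) = subst (λ t → InImage (lower t)) (sym t≡0) one-image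
      decide (no t≢0) = The.Target.lower-image t t≢0

  image-⊙ : ∀ {M N} → InImage M → InImage N → InImage (M ⊙ N)
  image-⊙ {M} {N} (v , l , l≢0 , eq) (w , l′ , l′≢0 , eq′) = v ++ w , l K.* l′ , K.x*y≢0 l≢0 l′≢0 , (begin
    Φ (wordValue (v ++ w))                       ≡⟨ cong Φ (wordValue-++ v w) ⟩
    Φ (wordValue v H.• wordValue w)              ≡⟨ Φ-• (wordValue v) (wordValue w) ⟩
    Φ (wordValue v) ⊙ Φ (wordValue w)            ≡⟨ cong₂ _⊙_ eq eq′ ⟩
    (l *ₘ M) ⊙ (l′ *ₘ N)                         ≡⟨ *ₘ-⊙ l l′ M N ⟩
    (l K.* l′) *ₘ (M ⊙ N)                        ∎)

  SL₂⊆image : ∀ M → det K M ≡ K.1# → InImage M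
  SL₂⊆image = SL₂-induction InImage upper-in lower-in image-⊙

-- The projective groups

module ProjectiveGroup (𝔽 : FiniteField) (ε : FiniteField.F 𝔽) (σ₀ : Sol 𝔽 ε)
    (K : FiniteField) (2≢0 : Char≢2 K)
    (e α β j : FiniteField.F K) (e≢0 : e ≢ FiniteField.0# K) (j≢0 : j ≢ FiniteField.0# K)
    (split : Splits K e j α β)
    (value : Sol 𝔽 ε → ℍ K) (s : FiniteField.F K) (s≢0 : s ≢ FiniteField.0# K)
    (norm-value : ∀ σ → QuaternionAlgebra.norm K e j (value σ) ≡ s)
    (_≈_ : Word 𝔽 ε → Word 𝔽 ε → Set)
    (coset : ∀ x y → (x ≈ y) ⇔ QuaternionAlgebra.IsReal K e j (WordValues.wordValue 𝔽 ε K e j value (invWord 𝔽 ε x ++ y)))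
  where
  private
    module K = FieldTheory K
  open QuaternionAlgebra K e j
  open Matrices K
  open Splitting K 2≢0 e α β j e≢0 j≢0 split
  open WordValues 𝔽 ε K e j value

  InImage : Mat2 K → Set
  InImage M = ∃₂ λ w l → l ≢ K.0# × Φ (wordValue w) ≡ l *ₘ M

  -- The relation is a parameter because the cosets are those of the δ modulo g, whereas the values
  -- of words are taken from the γ at a root of h̃.
  wordGroup : GroupData
  wordGroup = record { G = Word 𝔽 ε ; _≈G_ = _≈_ ; Mul = λ x y z → z ≈ (x ++ y) }

  ψ : Word 𝔽 ε → Mat2 K
  ψ w = Φ (wordValue w)

  private
    norm-word : ∀ w → norm (wordValue w) ≡ s K.^ length w
    norm-word = norm-wordValue norm-value

    norm≢0 : ∀ w → norm (wordValue w) ≢ K.0#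
    norm≢0 w eq = K.x^n≢0 (length w) s≢0 (trans (sym (norm-word w)) eq)

    det-ψ : ∀ w → det K (ψ w) ≡ s K.^ length w
    det-ψ w = trans (det-Φ (wordValue w)) (norm-word w)

    det-ψ≢0 : ∀ w → det K (ψ w) ≢ K.0#
    det-ψ≢0 w eq = K.x^n≢0 (length w) s≢0 (trans (sym (det-ψ w)) eq)

    ψ-++ : ∀ v w → ψ (v ++ w) ≡ ψ v ⊙ ψ w
    ψ-++ v w = trans (cong Φ (wordValue-++ v w)) (Φ-• (wordValue v) (wordValue w))

    Proportional : Mat2 K → Mat2 K → Set
    Proportional M N = ∃ λ k → k ≢ K.0# × N ≡ k *ₘ M

    *ₘ-inverse : ∀ {M N k} (k≢0 : k ≢ K.0#) → N ≡ k *ₘ M → M ≡ K.inv k k≢0 *ₘ N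
    *ₘ-inverse {M} {N} {k} k≢0 eq = begin
      M                              ≡⟨ 1*ₘ M ⟨
      K.1# *ₘ M                      ≡⟨ cong (_*ₘ M) (K.inv-inverseˡ k k≢0) ⟨
      (K.inv k k≢0 K.* k) *ₘ M       ≡⟨ *ₘ-*ₘ (K.inv k k≢0) k M ⟨
      K.inv k k≢0 *ₘ k *ₘ M          ≡⟨ cong (K.inv k k≢0 *ₘ_) eq ⟨
      K.inv k k≢0 *ₘ N               ∎

    Proportional-sym : ∀ {M N} → Proportional M N → Proportional N M
    Proportional-sym (k , k≢0 , eq) = K.inv k k≢0 , K.inv≢0 k k≢0 , *ₘ-inverse k≢0 eq

    real-quotient⇔ : ∀ x y → norm x ≢ K.0# → norm y ≢ K.0# → IsReal (conjugate x • y) ⇔ (∃ λ k → k ≢ K.0# × y ≡ k ∙ x)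
    real-quotient⇔ x y Nx Ny = mk⇔ to from
      where
      i : K.F
      i = K.inv (norm x) Nx
      to : IsReal (conjugate x • y) → ∃ λ k → k ≢ K.0# × y ≡ k ∙ x
      to real′ = i K.* c , K.x*y≢0 (K.inv≢0 (norm x) Nx) c≢0 , (begin
        y                                ≡⟨ 1∙ y ⟨
        K.1# ∙ y                         ≡⟨ cong (_∙ y) (K.inv-inverseˡ (norm x) Nx) ⟨
        (i K.* norm x) ∙ y               ≡⟨ ∙-∙ i (norm x) y ⟨
        i ∙ norm x ∙ y                   ≡⟨ cong (i ∙_) (real-• (norm x) y) ⟨
        i ∙ (real (norm x) • y)          ≡⟨ cong (λ z → i ∙ (z • y)) (•-conjugate x) ⟨
        i ∙ ((x • conjugate x) • y)      ≡⟨ cong (i ∙_) (•-assoc x (conjugate x) y) ⟩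
        i ∙ (x • (conjugate x • y))      ≡⟨ cong (λ z → i ∙ (x • z)) (IsReal⇒real real′) ⟩
        i ∙ (x • real c)                 ≡⟨ cong (i ∙_) (•-real c x) ⟩
        i ∙ c ∙ x                        ≡⟨ ∙-∙ i c x ⟩
        (i K.* c) ∙ x                    ∎)
        where
        c : K.F
        c = ℍ.a (conjugate x • y)
        c≢0 : c ≢ K.0#
        c≢0 c≡0 = K.x*y≢0 Nx Ny (begin
          norm x K.* norm y                    ≡⟨ cong (K._* norm y) (norm-conjugate x) ⟨
          norm (conjugate x) K.* norm y        ≡⟨ norm-• (conjugate x) y ⟨
          norm (conjugate x • y)               ≡⟨ norm-IsReal real′ ⟩
          c K.* c                              ≡⟨ cong (K._* c) c≡0 ⟩
          K.0# K.* c                           ≡⟨ K.zeroˡ c ⟩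
          K.0#                                 ∎)
      from : (∃ λ k → k ≢ K.0# × y ≡ k ∙ x) → IsReal (conjugate x • y)
      from (k , k≢0 , y≡) = subst IsReal (sym (begin
        conjugate x • y            ≡⟨ cong (conjugate x •_) y≡ ⟩
        conjugate x • (k ∙ x)      ≡⟨ •-∙ k (conjugate x) x ⟩
        k ∙ (conjugate x • x)      ≡⟨ cong (k ∙_) (conjugate-•-self x) ⟩
        k ∙ real (norm x)          ∎)) (K.zeroʳ k , K.zeroʳ k , K.zeroʳ k)

    ≈⇔ : ∀ x y → (x ≈ y) ⇔ Proportional (ψ x) (ψ y)
    ≈⇔ x y = mk⇔
      (λ x≈y → let (k , k≢0 , eq) = Equivalence.to rq (subst IsReal split-word (Equivalence.to (coset x y) x≈y)) in k , k≢0 , trans (cong Φ eq) (Φ-∙ k (wordValue x)))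
      (λ (k , k≢0 , eq) → Equivalence.from (coset x y) (subst IsReal (sym split-word) (Equivalence.from rq (k , k≢0 , Φ-injective (trans eq (sym (Φ-∙ k (wordValue x))))))))
      where
      rq : IsReal (conjugate (wordValue x) • wordValue y) ⇔ (∃ λ k → k ≢ K.0# × wordValue y ≡ k ∙ wordValue x)
      rq = real-quotient⇔ (wordValue x) (wordValue y) (norm≢0 x) (norm≢0 y)
      split-word : wordValue (invWord 𝔽 ε x ++ y) ≡ conjugate (wordValue x) • wordValue y
      split-word = trans (wordValue-++ (invWord 𝔽 ε x) y) (cong (_• wordValue y) (wordValue-invWord x))

    image-unscale : ∀ {k M} → k ≢ K.0# → InImage (k *ₘ M) → InImage M
    image-unscale {k} {M} k≢0 (w , l , l≢0 , eq) = w , l K.* k , K.x*y≢0 l≢0 k≢0 , trans eq (*ₘ-*ₘ l k M)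

    ⊙-adj-cancel : ∀ g M → g ⊙ (adj g ⊙ M) ≡ det K g *ₘ M
    ⊙-adj-cancel (mat a b c d) (mat p q r t) = Mat2-≡ (top p r) (top q t) (bottom p r) (bottom q t)
      where
      top : ∀ p r → a K.* (d K.* p K.+ (K.- b) K.* r) K.+ b K.* ((K.- c) K.* p K.+ a K.* r) ≡ (a K.* d K.+ K.- (b K.* c)) K.* p
      top = K.solve 6 (λ a b c d p r → a K.:* (d K.:* p K.:+ (K.:- b) K.:* r) K.:+ b K.:* ((K.:- c) K.:* p K.:+ a K.:* r) K.:= (a K.:* d K.:- b K.:* c) K.:* p) refl a b c d
      bottom : ∀ p r → c K.* (d K.* p K.+ (K.- b) K.* r) K.+ d K.* ((K.- c) K.* p K.+ a K.* r) ≡ (a K.* d K.+ K.- (b K.* c)) K.* r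
      bottom = K.solve 6 (λ a b c d p r → c K.:* (d K.:* p K.:+ (K.:- b) K.:* r) K.:+ d K.:* ((K.:- c) K.:* p K.:+ a K.:* r) K.:= (a K.:* d K.:- b K.:* c) K.:* r) refl a b c d

    det-adj : ∀ g → det K (adj g) ≡ det K g
    det-adj (mat a b c d) = K.solve 4 (λ a b c d → d K.:* a K.:- (K.:- b) K.:* (K.:- c) K.:= a K.:* d K.:- b K.:* c) refl a b c d

  module _ (SL₂⊆image : ∀ M → det K M ≡ K.1# → InImage M) (image-⊙ : ∀ {M N} → InImage M → InImage N → InImage (M ⊙ N)) where
    private
      square-det⇒image : ∀ {r} M → r K.* r ≡ det K M → det K M ≢ K.0# → InImage M
      square-det⇒image {r} M r²≡ det≢0 = image-unscale i≢0 (SL₂⊆image (i *ₘ M) (begin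
        det K (i *ₘ M)               ≡⟨ det-*ₘ i M ⟩
        i K.* i K.* det K M          ≡⟨ cong (i K.* i K.*_) r²≡ ⟨
        i K.* i K.* (r K.* r)        ≡⟨ K.solve 2 (λ i r → i K.:* i K.:* (r K.:* r) K.:= (i K.:* r) K.:* (i K.:* r)) refl i r ⟩
        (i K.* r) K.* (i K.* r)      ≡⟨ cong₂ K._*_ (K.inv-inverseˡ r r≢0) (K.inv-inverseˡ r r≢0) ⟩
        K.1# K.* K.1#                ≡⟨ K.*-identityˡ K.1# ⟩
        K.1#                         ∎))
        where
        r≢0 : r ≢ K.0#
        r≢0 r≡0 = det≢0 (trans (sym r²≡) (trans (cong (K._* r) r≡0) (K.zeroˡ r)))
        i : K.F
        i = K.inv r r≢0
        i≢0 : i ≢ K.0#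
        i≢0 = K.inv≢0 r r≢0

      image⇒Proportional : ∀ {M} → InImage M → ∃ λ w → Proportional (ψ w) M
      image⇒Proportional (w , l , l≢0 , eq) = w , Proportional-sym (l , l≢0 , eq)

      module Nonsquare (¬□s : ¬ ∃ λ r → r K.* r ≡ s) where
        -- Scalars change a determinant by squares, so a square determinant reduces to SL₂. A
        -- generator has the nonsquare determinant `s`, and splitting it off reaches the other
        -- class.
        GL₂⊆image : ∀ M → det K M ≢ K.0# → InImage M
        GL₂⊆image M det≢0 = [ (λ (r , r²≡) → square-det⇒image M r²≡ det≢0) , twisted ]′ (Squares.nonsquare-index-2 K 2≢0 ¬□s det≢0)
          where
          g : Mat2 K
          g = ψ [ false , σ₀ ]
          det-g : det K g ≡ s
          det-g = trans (det-ψ [ false , σ₀ ]) (K.*-identityʳ s)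
          twisted : (∃ λ r → r K.* r ≡ s K.* det K M) → InImage M
          twisted (r , r²≡) = image-unscale s≢0 (subst InImage (trans (⊙-adj-cancel g M) (cong (_*ₘ M) det-g))
            (image-⊙ ([ false , σ₀ ] , K.1# , K.1≢0 , sym (1*ₘ g)) (square-det⇒image (adj g ⊙ M) (trans r²≡ (sym det≡)) (λ eq → K.x*y≢0 s≢0 det≢0 (trans (sym det≡) eq)))))
            where
            det≡ : det K (adj g ⊙ M) ≡ s K.* det K M
            det≡ = trans (det-⊙ (adj g) M) (cong (K._* det K M) (trans (det-adj g) det-g))

        pgl : GroupIso wordGroup (PGL2 K)
        pgl = record
          { φ = λ w → ψ w , det-ψ≢0 w
          ; φ-≈ = ≈⇔
          ; φ-surj = λ (M , det≢0) → image⇒Proportional (GL₂⊆image M det≢0)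
          ; φ-hom = λ x y z z≈xy → subst (λ M → Proportional M (ψ z)) (ψ-++ x y) (Proportional-sym (Equivalence.to (≈⇔ z (x ++ y)) z≈xy)) }

      module Square (ρ : K.F) (ρ²≡s : ρ K.* ρ ≡ s) where
        ρ≢0 : ρ ≢ K.0#
        ρ≢0 ρ≡0 = s≢0 (trans (sym ρ²≡s) (trans (cong (K._* ρ) ρ≡0) (K.zeroˡ ρ)))

        i : K.F
        i = K.inv ρ ρ≢0

        n : Word 𝔽 ε → K.F
        n w = i K.^ length w

        n≢0 : ∀ w → n w ≢ K.0#
        n≢0 w = K.x^n≢0 (length w) (K.inv≢0 ρ ρ≢0)

        -- A letter and its inverse both have norm `s`, so dividing by the square root of `s` once
        -- for each letter brings every word into SL₂.
        χ : Word 𝔽 ε → Mat2 K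
        χ w = n w *ₘ ψ w

        n²sⁿ≡1 : ∀ k → i K.^ k K.* i K.^ k K.* s K.^ k ≡ K.1#
        n²sⁿ≡1 ℕ.zero = K.solve 0 (K.con ℤ.1ℤ K.:* K.con ℤ.1ℤ K.:* K.con ℤ.1ℤ K.:= K.con ℤ.1ℤ) refl
        n²sⁿ≡1 (ℕ.suc k) = begin
          (i K.* p) K.* (i K.* p) K.* (s K.* q)                ≡⟨ cong (λ z → (i K.* p) K.* (i K.* p) K.* (z K.* q)) ρ²≡s ⟨
          (i K.* p) K.* (i K.* p) K.* ((ρ K.* ρ) K.* q)        ≡⟨ K.solve 4 (λ i p r q → (i K.:* p) K.:* (i K.:* p) K.:* ((r K.:* r) K.:* q) K.:= ((i K.:* r) K.:* (i K.:* r)) K.:* (p K.:* p K.:* q)) refl i p ρ q ⟩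
          ((i K.* ρ) K.* (i K.* ρ)) K.* (p K.* p K.* q)        ≡⟨ cong₂ K._*_ (cong₂ K._*_ (K.inv-inverseˡ ρ ρ≢0) (K.inv-inverseˡ ρ ρ≢0)) (n²sⁿ≡1 k) ⟩
          (K.1# K.* K.1#) K.* K.1#                             ≡⟨ K.solve 0 ((K.con ℤ.1ℤ K.:* K.con ℤ.1ℤ) K.:* K.con ℤ.1ℤ K.:= K.con ℤ.1ℤ) refl ⟩
          K.1#                                                 ∎
          where
          p q : K.F
          p = i K.^ k
          q = s K.^ k

        det-χ : ∀ w → det K (χ w) ≡ K.1#
        det-χ w = trans (det-*ₘ (n w) (ψ w)) (trans (cong (n w K.* n w K.*_) (det-ψ w)) (n²sⁿ≡1 (length w)))

        χ-++ : ∀ v w → χ (v ++ w) ≡ χ v ⊙ χ w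
        χ-++ v w = begin
          n (v ++ w) *ₘ ψ (v ++ w)               ≡⟨ cong₂ _*ₘ_ (trans (cong (i K.^_) (List.length-++ v)) (K.^-homo-* i (length v) (length w))) (ψ-++ v w) ⟩
          (n v K.* n w) *ₘ (ψ v ⊙ ψ w)           ≡⟨ *ₘ-⊙ (n v) (n w) (ψ v) (ψ w) ⟨
          χ v ⊙ χ w                              ∎

        Sign : Mat2 K → Mat2 K → Set
        Sign M N = N ≡ M ⊎ N ≡ (K.- K.1#) *ₘ M

        Proportional⇒Sign : ∀ {M N} → det K M ≡ K.1# → det K N ≡ K.1# → Proportional M N → Sign M N
        Proportional⇒Sign {M} {N} detM detN (k , _ , eq) = Sum.map (λ k≡ → trans eq (trans (cong (_*ₘ M) k≡) (1*ₘ M))) (λ k≡ → trans eq (cong (_*ₘ M) k≡)) (K.x²≡y²⇒x≡±y (begin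
          k K.* k                   ≡⟨ K.*-identityʳ _ ⟨
          k K.* k K.* K.1#          ≡⟨ cong (k K.* k K.*_) detM ⟨
          k K.* k K.* det K M       ≡⟨ det-*ₘ k M ⟨
          det K (k *ₘ M)            ≡⟨ cong (det K) eq ⟨
          det K N                   ≡⟨ detN ⟩
          K.1#                      ≡⟨ K.*-identityˡ K.1# ⟨
          K.1# K.* K.1#             ∎))

        -1≢0 : K.- K.1# ≢ K.0#
        -1≢0 eq = K.1≢0 (trans (sym (K.-‿involutive K.1#)) (trans (cong K.-_ eq) K.-0#≈0#))

        Sign⇒Proportional : ∀ {M N} → Sign M N → Proportional M N
        Sign⇒Proportional {M} (inj₁ eq) = K.1# , K.1≢0 , trans eq (sym (1*ₘ M))
        Sign⇒Proportional (inj₂ eq) = K.- K.1# , -1≢0 , eq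

        Proportional-trans : ∀ {L M N} → Proportional L M → Proportional M N → Proportional L N
        Proportional-trans {L} (k , k≢0 , eq) (l , l≢0 , eq′) = l K.* k , K.x*y≢0 l≢0 k≢0 , trans eq′ (trans (cong (l *ₘ_) eq) (*ₘ-*ₘ l k L))

        χ∝ψ : ∀ w → Proportional (ψ w) (χ w)
        χ∝ψ w = n w , n≢0 w , refl

        ≈⇔Sign : ∀ x y → (x ≈ y) ⇔ Sign (χ x) (χ y)
        ≈⇔Sign x y = mk⇔
          (λ x≈y → Proportional⇒Sign (det-χ x) (det-χ y) (Proportional-trans (Proportional-sym (χ∝ψ x)) (Proportional-trans (Equivalence.to (≈⇔ x y) x≈y) (χ∝ψ y))))
          (λ sg → Equivalence.from (≈⇔ x y) (Proportional-trans (χ∝ψ x) (Proportional-trans (Sign⇒Proportional sg) (Proportional-sym (χ∝ψ y)))))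

        Sign-sym : ∀ {M N} → det K M ≡ K.1# → det K N ≡ K.1# → Sign M N → Sign N M
        Sign-sym detM detN sg = Proportional⇒Sign detN detM (Proportional-sym (Sign⇒Proportional sg))

        surjective : ∀ (M : Σ (Mat2 K) λ M → det K M ≡ K.1#) → ∃ λ w → Sign (χ w) (proj₁ M)
        surjective (M , detM) = let (w , p) = image⇒Proportional (SL₂⊆image M detM) in
          w , Proportional⇒Sign (det-χ w) detM (Proportional-trans (Proportional-sym (χ∝ψ w)) p)

        psl : GroupIso wordGroup (PSL2 K)
        psl = record
          { φ = λ w → χ w , det-χ w
          ; φ-≈ = ≈⇔Sign
          ; φ-surj = surjective
          ; φ-hom = λ x y z z≈xy → subst (λ M → Sign M (χ z)) (χ-++ x y) (Sign-sym (det-χ z) (det-χ (x ++ y)) (Equivalence.to (≈⇔Sign z (x ++ y)) z≈xy)) }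

    PSL₂⊎PGL₂ : GroupIso wordGroup (PSL2 K) ⊎ GroupIso wordGroup (PGL2 K)
    PSL₂⊎PGL₂ = decide (Squares.square? K 2≢0 s)
      where
      decide : Dec (∃ λ r → r K.* r ≡ s) → GroupIso wordGroup (PSL2 K) ⊎ GroupIso wordGroup (PGL2 K)
      decide (yes (ρ , ρ²≡s)) = inj₁ (Square.psl ρ ρ²≡s)
      decide (no ¬□s) = inj₂ (Nonsquare.pgl ¬□s)

-- Transport to a field given by its size

ev-∘ : ∀ {D E K} (η : Hom E K) (φ : Hom D E) α p → Evaluation.ev (η ∘ₕ φ) (Hom.⟦ η ⟧ α) p ≡ Hom.⟦ η ⟧ (Evaluation.ev φ α p)
ev-∘ η φ α [] = sym (Hom.0-homo η)
ev-∘ {K = K} η φ α (a ∷ p) = begin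
  η.⟦ φ.⟦ a ⟧ ⟧ K.+ η.⟦ α ⟧ K.* Evaluation.ev (η ∘ₕ φ) η.⟦ α ⟧ p     ≡⟨ cong (λ z → η.⟦ φ.⟦ a ⟧ ⟧ K.+ η.⟦ α ⟧ K.* z) (ev-∘ η φ α p) ⟩
  η.⟦ φ.⟦ a ⟧ ⟧ K.+ η.⟦ α ⟧ K.* η.⟦ Evaluation.ev φ α p ⟧            ≡⟨ cong (η.⟦ φ.⟦ a ⟧ ⟧ K.+_) (η.*-homo _ _) ⟨
  η.⟦ φ.⟦ a ⟧ ⟧ K.+ η.⟦ _ ⟧                                          ≡⟨ η.+-homo _ _ ⟨
  η.⟦ Evaluation.ev φ α (a ∷ p) ⟧                                    ∎
  where
  module K = FieldTheory K
  module η = Hom η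
  module φ = Hom φ

2≢0-hom : ∀ {E K} → Hom E K → Char≢2 E → Char≢2 K
2≢0-hom {E} {K} φ 2≢0 eq = Hom.≢0-homo φ 2≢0 (trans (Hom.+-homo φ _ _) (trans (cong₂ (FieldTheory._+_ K) (Hom.1-homo φ) (Hom.1-homo φ)) eq))

nonsquare⇒≢0 : ∀ 𝔽 {ε} → NonSquare 𝔽 ε → ε ≢ FiniteField.0# 𝔽
nonsquare⇒≢0 𝔽 nonsquare refl = nonsquare 0# (zeroˡ 0#)
  where open FieldTheory 𝔽

module GroupAtRoot (𝔽 : FiniteField) (2≢0 : Char≢2 𝔽)
    (ε : FiniteField.F 𝔽) (nonsquare : NonSquare 𝔽 ε) (σ₀ : Sol 𝔽 ε)
    {K : FiniteField} (φ : Hom 𝔽 K) (s : FiniteField.F K) (s≢0 : s ≢ FiniteField.0# K)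
    (j≢0 : QuatEvaluation.j 𝔽 ε φ s ≢ FiniteField.0# K)
    {f : Poly 𝔽} (f-minimal : IsMinimalPolynomial φ s f)
    (size-K : FiniteField.size K ≡ FiniteField.size 𝔽 ℕ.^ IsMinimalPolynomial.d f-minimal)
    (_≈_ : Word 𝔽 ε → Word 𝔽 ε → Set)
    (coset : ∀ x y → (x ≈ y) ⇔ InΓ[_] 𝔽 ε f (evalWord 𝔽 ε (γ 𝔽 ε) (invWord 𝔽 ε x ++ y))) where
  private
    module 𝔽 = FieldTheory 𝔽
    module K = FieldTheory K
    module Q = QuatEvaluation 𝔽 ε φ s
    module H = QuaternionAlgebra K Q.e Q.j
  open PolyTheory 𝔽
  open Truncation 𝔽
  open Evaluation φ s
  open IsMinimalPolynomial f-minimal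
  open WordValues 𝔽 ε K Q.e Q.j (Q.evℍ ∘ γ 𝔽 ε)

  private
    2≢0ᴷ = 2≢0-hom φ 2≢0

    e≢0 : Q.e ≢ K.0#
    e≢0 = Hom.≢0-homo φ (nonsquare⇒≢0 𝔽 nonsquare)

    norm-γ : ∀ σ → H.norm (Q.evℍ (γ 𝔽 ε σ)) ≡ s
    norm-γ σ = trans (cong H.norm (Q.evℍ-γ σ)) (Q.norm-γ̂ σ)

    generates : ∀ x → ∃ λ p → ev p ≡ x
    generates x = let (v , eq) = injective⇒bijective (Vec↔ 𝔽.enum d) K.enum (sym size-K) (ev ∘ toList) injective x in toList v , eq
      where
      injective : ∀ {v w : Vec 𝔽.F d} → ev (toList v) ≡ ev (toList w) → v ≡ w
      injective {v} {w} eq = toList-injective-≋ (≈⇒≋ (≋[]⇒IsZero _ (∣-small⇒≋[] D (⊖-<deg {toList v} {toList w} (toList-<deg v) (toList-<deg w))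
        (minimal (toList v ⊕ ⊖ toList w) (trans (ev-⊕ (toList v) (⊖ toList w)) (trans (cong (ev (toList v) K.+_) (ev-⊖ (toList w))) (K.x≡y⇒x-y≡0 eq)))))))

    coset′ : ∀ x y → (x ≈ y) ⇔ H.IsReal (wordValue (invWord 𝔽 ε x ++ y))
    coset′ x y = ⇔-trans (coset x y) (subst (λ z → InΓ[_] 𝔽 ε f (evalWord 𝔽 ε (γ 𝔽 ε) w) ⇔ H.IsReal z) ev≡
      (Q.InΓ⇔IsReal minimal (λ p → ∣⇒ev≡0 {f} {p} f[θ]≡0) (evalWord 𝔽 ε (γ 𝔽 ε) w)
        (λ N≡0 → K.x^n≢0 (length w) s≢0 (trans (sym (trans (cong H.norm ev≡) (norm-wordValue norm-γ w))) N≡0))))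
      where
      w : Word 𝔽 ε
      w = invWord 𝔽 ε x ++ y
      ev≡ : Q.evℍ (evalWord 𝔽 ε (γ 𝔽 ε) w) ≡ wordValue w
      ev≡ = Q.evℍ-evalWord (γ 𝔽 ε) w

    module Split (α β : K.F) (split : Splits K Q.e Q.j α β) where
      module U = Unipotents 𝔽 2≢0 ε nonsquare σ₀ 2≢0ᴷ φ s s≢0 D 1≤d f[θ]≡0 minimal size-K generates α β e≢0 j≢0 split
      open ProjectiveGroup 𝔽 ε σ₀ K 2≢0ᴷ Q.e α β Q.j e≢0 j≢0 split (Q.evℍ ∘ γ 𝔽 ε) s s≢0 norm-γ _≈_ coset′ public using (wordGroup; PSL₂⊎PGL₂)

      result : GroupIso wordGroup (PSL2 K) ⊎ GroupIso wordGroup (PGL2 K)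
      result = PSL₂⊎PGL₂ U.SL₂⊆image U.image-⊙

  cosets≅PSL₂⊎PGL₂ : let A = record { G = Word 𝔽 ε ; _≈G_ = _≈_ ; Mul = λ x y z → z ≈ (x ++ y) } in GroupIso A (PSL2 K) ⊎ GroupIso A (PGL2 K)
  cosets≅PSL₂⊎PGL₂ = use (Squares.norm-surjective K 2≢0ᴷ Q.e e≢0 Q.j)
    where
    use : (∃₂ λ x y → x K.* x K.+ K.- (Q.e K.* (y K.* y)) ≡ Q.j) → _
    use (α , β , split) = Split.result α β split

module GroupOfSize (𝔽 : FiniteField) (2≢0 : Char≢2 𝔽)
    (ε : FiniteField.F 𝔽) (nonsquare : NonSquare 𝔽 ε) (σ₀ : Sol 𝔽 ε)
    {M : FiniteField} (ψ : Hom 𝔽 M) (s : FiniteField.F M) (s≢0 : s ≢ FiniteField.0# M)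
    (s-1≢0 : FieldTheory._+_ M s (FieldTheory.-_ M (FieldTheory.1# M)) ≢ FiniteField.0# M)
    {f : Poly 𝔽} (f-minimal : IsMinimalPolynomial ψ s f)
    (_≈_ : Word 𝔽 ε → Word 𝔽 ε → Set)
    (coset : ∀ x y → (x ≈ y) ⇔ InΓ[_] 𝔽 ε f (evalWord 𝔽 ε (γ 𝔽 ε) (invWord 𝔽 ε x ++ y)))
    (K : FiniteField) (size-K : FiniteField.size K ≡ FiniteField.size 𝔽 ℕ.^ deg 𝔽 f) where
  private
    module 𝔽 = FieldTheory 𝔽
    module M = FieldTheory M
    module K = FieldTheory K
  open PolyTheory 𝔽
  open IsMinimalPolynomial f-minimal

  private
    module L = Residue 𝔽 D 1≤d (minimal⇒prime ψ s f[θ]≡0 minimal)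

    deg≡d : deg 𝔽 f ≡ d
    deg≡d = Degree⇒deg D

    size-K′ : K.size ≡ 𝔽.size ℕ.^ d
    size-K′ = trans size-K (cong (𝔽.size ℕ.^_) deg≡d)

    -- `M` may be too large for the group: when h is even it has size q^(2m) while h̃ has degree m,
    -- q being the size of the base field. The arithmetic is therefore done at a root of `f` inside
    -- `K`, the image of the residue class of the variable.
    η : Hom L.residueField K
    η = SameSize.sameSize⇒hom L.residueField K (sym size-K′)

    φ : Hom 𝔽 K
    φ = η ∘ₕ L.base

    t : K.F
    t = Hom.⟦ η ⟧ L.root

    module E = Evaluation φ t

    ev≡0⇒∣ : ∀ p → E.ev p ≡ K.0# → f ∣ p
    ev≡0⇒∣ p eq = proj₁ (L.ev-root≡0⇔∣ p) (Hom.injective η (trans (sym (ev-∘ η L.base L.root p)) (trans eq (sym (Hom.0-homo η)))))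

    f[t]≡0 : E.ev f ≡ K.0#
    f[t]≡0 = trans (ev-∘ η L.base L.root f) (trans (cong (Hom.⟦ η ⟧) (proj₂ (L.ev-root≡0⇔∣ f) ∣-refl)) (Hom.0-homo η))

    -- Whatever vanishes at `t` is divisible by `f` and so vanishes at `s`; in this way s ≠ 0 and s
    -- ≠ 1 are inherited by `t`.
    transfer : ∀ p → E.ev p ≡ K.0# → Evaluation.ev ψ s p ≡ M.0#
    transfer p eq = Evaluation.∣⇒ev≡0 ψ s f[θ]≡0 (ev≡0⇒∣ p eq)

    t≢0 : t ≢ K.0#
    t≢0 eq = s≢0 (trans (sym (Evaluation.ev-X ψ s)) (transfer (X 𝔽) (trans E.ev-X eq)))

    j≢0 : QuatEvaluation.j 𝔽 ε φ t ≢ K.0#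
    j≢0 eq = s-1≢0 (trans (sym (QuatEvaluation.ev-Jₚ 𝔽 ε ψ s)) (transfer (QuatNorm.Jₚ 𝔽 ε) (trans (QuatEvaluation.ev-Jₚ 𝔽 ε φ t) eq)))

  groupIso : let A = record { G = Word 𝔽 ε ; _≈G_ = _≈_ ; Mul = λ x y z → z ≈ (x ++ y) } in GroupIso A (PSL2 K) ⊎ GroupIso A (PGL2 K)
  groupIso = GroupAtRoot.cosets≅PSL₂⊎PGL₂ 𝔽 2≢0 ε nonsquare σ₀ φ t t≢0 j≢0
    (record { d = d ; D = D ; 1≤d = 1≤d ; f[θ]≡0 = f[t]≡0 ; minimal = ev≡0⇒∣ }) size-K′ _≈_ coset

-- Application to the residue field of g

open import Data.Nat using (_*_; _^_)
open import Data.Nat.Divisibility using (_∤_)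

module Main (𝔽 : FiniteField) (odd : 2 ∤ FiniteField.size 𝔽) (ε : FiniteField.F 𝔽) (nonsquare : NonSquare 𝔽 ε)
    (g : Poly 𝔽) (m : ℕ) (irr : Irreducible 𝔽 g) (deg-g : deg 𝔽 g ≡ 2 * m)
    (h : Poly 𝔽) (monic-h : Monic 𝔽 h) (h~H : ScalarMultiple 𝔽 h (Hpoly 𝔽 g m)) where
  private
    module 𝔽 = FieldTheory 𝔽
  open PolyTheory 𝔽

  private
    2≢0 : 𝔽.1# 𝔽.+ 𝔽.1# ≢ 𝔽.0#
    2≢0 = odd⇒2≢0 𝔽 odd

    Dg : Degree g (2 * m)
    Dg = subst (Degree g) deg-g (Degree-deg (1≤deg⇒≢[] {g} (proj₁ irr)))

    2≤2m : 2 ℕ.≤ 2 * m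
    2≤2m = go m (subst (1 ℕ.≤_) deg-g (proj₁ irr))
      where
      go : ∀ m → 1 ℕ.≤ 2 * m → 2 ℕ.≤ 2 * m
      go (ℕ.suc m) _ = subst (2 ℕ.≤_) (sym (ℕ.*-suc 2 m)) (ℕ.m≤m+n 2 (2 * m))

    module G = Residue 𝔽 Dg (ℕ.<⇒≤ 2≤2m) (irreducible⇒prime irr)

    module C = Correspondence 𝔽 2≢0 ε g m Dg 2≤2m h monic-h h~H G.base G.root refl
      (λ x → toList x , trans (G.ev-root (toList x)) (G.reduce-toList x)) (λ p → proj₁ (G.ev-root≡0⇔∣ p)) (λ p → proj₂ (G.ev-root≡0⇔∣ p))

    σ₀ : Sol 𝔽 ε
    σ₀ = use (Squares.norm-surjective 𝔽 2≢0 ε (nonsquare⇒≢0 𝔽 nonsquare) (𝔽.- 𝔽.1#))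
      where
      use : (∃₂ λ x y → x 𝔽.* x 𝔽.+ 𝔽.- (ε 𝔽.* (y 𝔽.* y)) ≡ 𝔽.- 𝔽.1#) → Sol 𝔽 ε
      use (x , y , eq) = (x , y) , (begin
        ε 𝔽.* (y 𝔽.* y) 𝔽.+ (𝔽.- (x 𝔽.* x))              ≡⟨ 𝔽.solve 3 (λ e x y → e 𝔽.:* (y 𝔽.:* y) 𝔽.:- x 𝔽.:* x 𝔽.:= 𝔽.:- (x 𝔽.:* x 𝔽.:- e 𝔽.:* (y 𝔽.:* y))) refl ε x y ⟩
        𝔽.- (x 𝔽.* x 𝔽.+ 𝔽.- (ε 𝔽.* (y 𝔽.* y)))          ≡⟨ cong 𝔽.-_ eq ⟩
        𝔽.- (𝔽.- 𝔽.1#)                                   ≡⟨ 𝔽.-‿involutive 𝔽.1# ⟩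
        𝔽.1#                                             ∎)

  coset⇔ : ∀ x y → CosetEq 𝔽 ε (δ 𝔽 ε) g x y ⇔ CosetEq 𝔽 ε (γ 𝔽 ε) (tilde 𝔽 h) x y
  coset⇔ x y = C.InΓ-correspondence (invWord 𝔽 ε x ++ y)

  graphIso : GraphIso (Ygraph 𝔽 ε g) (Xgraph 𝔽 ε (tilde 𝔽 h))
  graphIso = record
    { f = id
    ; f-≈ = coset⇔
    ; f-surj = λ y → y , C.CosetEq-refl y
    ; f-adj = λ x y → mk⇔ (λ (σ , e) → σ , Equivalence.to (coset⇔ y _) e) (λ (σ , e) → σ , Equivalence.from (coset⇔ y _) e) }

  groupIso : (K : FiniteField) → FiniteField.size K ≡ FiniteField.size 𝔽 ^ deg 𝔽 (tilde 𝔽 h) →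
             GroupIso (YGroup 𝔽 ε g) (PSL2 K) ⊎ GroupIso (YGroup 𝔽 ε g) (PGL2 K)
  groupIso = GroupOfSize.groupIso 𝔽 2≢0 ε nonsquare σ₀ G.base C.s C.s≢0 C.s-1≢0 C.tilde-minimal (CosetEq 𝔽 ε (δ 𝔽 ε) g) coset⇔

theorem2p6 : (𝔽 : FiniteField) → 2 ∤ FiniteField.size 𝔽
    → (ε : FiniteField.F 𝔽) → NonSquare 𝔽 ε
    → (g : Poly 𝔽) (m : ℕ) → Monic 𝔽 g → Irreducible 𝔽 g → deg 𝔽 g ≡ 2 * m
    → (h : Poly 𝔽) → Monic 𝔽 h → ScalarMultiple 𝔽 h (Hpoly 𝔽 g m)
    → GraphIso (Ygraph 𝔽 ε g) (Xgraph 𝔽 ε (tilde 𝔽 h))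
    × ((K : FiniteField) → FiniteField.size K ≡ FiniteField.size 𝔽 ^ deg 𝔽 (tilde 𝔽 h)
    → GroupIso (YGroup 𝔽 ε g) (PSL2 K) ⊎ GroupIso (YGroup 𝔽 ε g) (PGL2 K))
theorem2p6 𝔽 odd ε nonsquare g m _ irr deg-g h monic-h h~H = graphIso , groupIso
  where open Main 𝔽 odd ε nonsquare g m irr deg-g h monic-h h~H
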